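{- Let $F=K_1\nabla F^{\bullet}$, where each connected component of $F^{\bullet}$ is either a tree with at least two vertices or an even cycle, and let $F^{o}$ be an odd-ballooning of $F$ in which every substituted odd cycle has length at least five. Then for all sufficiently large $n$: (1) if each component of $F^{\bullet}$ is an even cycle, then ${\rm EX}(n,F^{o})=\{(M_{\frac{1}{2}|F^{\bullet}|-1}\cup K_1)\nabla T_{n-|F^{\bullet}|+1,2}\}$; (2) if each component of $F^{\bullet}$ is a single edge, then ${\rm EX}(n,F^{o})=\{K_{e(F^{\bullet})}\nabla T_{n-e(F^{\bullet}),2}\}$; (3) otherwise, ${\rm EX}(n,F^{o})=\{E_{e(F^{\bullet})}\nabla T_{n-e(F^{\bullet}),2}\}$.
   Context: For a graph $H$, $|H|$ is its number of vertices and $e(H)$ its number of edges. $K_k$, $E_k$ denote the complete and the empty (edgeless) graph on $k$ vertices; $M_t$ is a matching consisting of $t$ vertex-disjoint edges ($2t$ vertices); $T_{m,2}$ is the complete bipartite graph on $m$ vertices with part sizes $\lfloor m/2\rfloor,\lceil m/2\rceil$. $G\nabla H$ is the join (disjoint union plus all edges between them) and $G\cup H$ the disjoint union. A graph is $F^{o}$-free if it has no subgraph isomorphic to $F^{o}$; ${\rm EX}(n,F^{o})$ is the set of $n$-vertex $F^{o}$-free graphs with the maximum possible number of edges. The odd-ballooning $F^{o}$ of $F$ is obtained by replacing each edge $uv$ of $F$ with an odd cycle through the edge $uv$ (adding a new $u$–$v$ path of even length with new internal vertices), all new vertices of different cycles being distinct; different edges may receive odd cycles of different lengths, all here of length at least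 $5$. -}

module Defs where

open import Data.Bool using (Bool; true; false; _∧_; _∨_; not; if_then_else_)
open import Data.Bool.Properties using (∨-comm; ∧-zeroʳ)
open import Data.Nat using (ℕ; zero; suc; _+_; _*_; _∸_; _≤_; _<_; _<ᵇ_; _≡ᵇ_; _/_)
open import Data.Fin using (Fin; toℕ; splitAt; _≟_)

open import Data.List using (List; []; _∷_; map; foldr)
open import Data.Nat.ListAction using (sum)
open import Data.List.Relation.Unary.All using (All)
open import Data.Sum using (_⊎_; inj₁; inj₂)
open import Data.Product using (Σ; Σ-syntax; _×_; _,_; proj₁; proj₂)
open import Data.Empty using (⊥)
open import Relation.Nullary using (¬_; Dec; yes; no)
open import Relation.Nullary.Decidable using (⌊_⌋)
open import Relation.Binary.PropositionalEquality using (_≡_; refl; cong)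
open import Relation.Binary.Construct.Closure.ReflexiveTransitive using (Star)
open import Function.Bundles using (_↔_; Inverse)
open import Function.Definitions using (Injective)

record SimpleGraph (n : ℕ) : Set where
  field
    adj    : Fin n → Fin n → Bool
    sym    : ∀ i j → adj i j ≡ adj j i
    irrefl : ∀ i → adj i i ≡ false
open SimpleGraph public

private
  notEq : ∀ {n} (i j : Fin n) → Bool
  notEq i j = not ⌊ i ≟ j ⌋

  notEq-sym : ∀ {n} (i j : Fin n) → notEq i j ≡ notEq j i
  notEq-sym i j with i ≟ j | j ≟ i
  ... | yes _ | yes _ = refl
  ... | no _  | no _  = refl
  ... | yes p | no ¬q = Data.Empty.⊥-elim (¬q (Relation.Binary.PropositionalEquality.sym p))
    where import Data.Empty
  ... | no ¬p | yes q = Data.Empty.⊥-elim (¬p (Relation.Binary.PropositionalEquality.sym q))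
    where import Data.Empty

  notEq-refl : ∀ {n} (i : Fin n) → notEq i i ≡ false
  notEq-refl i with i ≟ i
  ... | yes _ = refl
  ... | no ¬p = Data.Empty.⊥-elim (¬p refl)
    where import Data.Empty

mkGraph : ∀ {n} → (Fin n → Fin n → Bool) → SimpleGraph n
mkGraph f = record
  { adj    = λ i j → (f i j ∨ f j i) ∧ notEq i j
  ; sym    = λ i j → Relation.Binary.PropositionalEquality.cong₂ _∧_ (∨-comm (f i j) (f j i)) (notEq-sym i j)
  ; irrefl = λ i → Relation.Binary.PropositionalEquality.trans
                     (cong ((f i i ∨ f i i) ∧_) (notEq-refl i)) (∧-zeroʳ (f i i ∨ f i i))
  }

edges : ∀ {n} → SimpleGraph n → ℕ
edges {n} G = sum (map (λ i → sum (map (λ j → if (toℕ i <ᵇ toℕ j) ∧ adj G i j then 1 else 0)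
                                         (Data.List.allFin n)))
                       (Data.List.allFin n))
  where import Data.List

_≅_ : ∀ {a b} → SimpleGraph a → SimpleGraph b → Set
_≅_ {a} {b} G H = Σ[ σ ∈ (Fin a ↔ Fin b) ] (∀ i j → adj G i j ≡ adj H (Inverse.to σ i) (Inverse.to σ j))

complete : (k : ℕ) → SimpleGraph k
complete k = mkGraph (λ _ _ → true)

emptyG : (k : ℕ) → SimpleGraph k
emptyG k = mkGraph (λ _ _ → false)

-- M_t ∪ K_1 on 2t+1 vertices: vertices 2s and 2s+1 (s < t) adjacent, vertex 2t isolated
matchingPlusK1 : (t : ℕ) → SimpleGraph (suc (2 * t))
matchingPlusK1 t = mkGraph (λ i j → (toℕ i / 2) ≡ᵇ (toℕ j / 2))

turan2 : (m : ℕ) → SimpleGraph m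
turan2 m = mkGraph (λ i j → (toℕ i <ᵇ m / 2) ∧ not (toℕ j <ᵇ m / 2))

-- cycle C_k on vertices 0,…,k-1 (used for k ≥ 3)
cycleGraph : (k : ℕ) → SimpleGraph k
cycleGraph k = mkGraph (λ i j → (suc (toℕ i) ≡ᵇ toℕ j) ∨ ((toℕ i ≡ᵇ 0) ∧ (suc (toℕ j) ≡ᵇ k)))

join : ∀ {a b} → SimpleGraph a → SimpleGraph b → SimpleGraph (a + b)
join {a} G H = mkGraph f
  where
  f : _ → _ → Bool
  f i j with splitAt a i | splitAt a j
  ... | inj₁ x | inj₁ y = adj G x y
  ... | inj₂ x | inj₂ y = adj H x y
  ... | _      | _      = true

union : ∀ {a b} → SimpleGraph a → SimpleGraph b → SimpleGraph (a + b)
union {a} G H = mkGraph f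
  where
  f : _ → _ → Bool
  f i j with splitAt a i | splitAt a j
  ... | inj₁ x | inj₁ y = adj G x y
  ... | inj₂ x | inj₂ y = adj H x y
  ... | _      | _      = false

unionList : List (Σ ℕ SimpleGraph) → Σ ℕ SimpleGraph
unionList [] = 0 , emptyG 0
unionList ((a , G) ∷ gs) = (a + proj₁ (unionList gs)) , union G (proj₂ (unionList gs))

record PGraph : Set₁ where
  field
    V   : Set
    Adj : V → V → Set
open PGraph public

toP : ∀ {n} → SimpleGraph n → PGraph
toP {n} G = record { V = Fin n ; Adj = λ i j → adj G i j ≡ true }

_⊆_ : ∀ {n} → PGraph → SimpleGraph n → Set
_⊆_ {n} H G = Σ[ f ∈ (V H → Fin n) ] (Injective _≡_ _≡_ f × (∀ x y → Adj H x y → adj G (f x) (f y) ≡ true))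

Free : ∀ {n} → PGraph → SimpleGraph n → Set
Free H G = ¬ (H ⊆ G)

Connected : ∀ {n} → SimpleGraph n → Set
Connected G = ∀ u v → Star (λ i j → adj G i j ≡ true) u v

Acyclic : ∀ {n} → SimpleGraph n → Set
Acyclic G = ∀ k → 3 ≤ k → ¬ (toP (cycleGraph k) ⊆ G)

IsTree : ∀ {n} → SimpleGraph n → Set
IsTree {n} G = 2 ≤ n × Connected G × Acyclic G

IsEvenCycle : ∀ {n} → SimpleGraph n → Set
IsEvenCycle G = Σ[ t ∈ ℕ ] (2 ≤ t × G ≅ cycleGraph (2 * t))

IsSingleEdge : ∀ {n} → SimpleGraph n → Set
IsSingleEdge G = G ≅ complete 2

-- Odd-ballooning.  F on Fin k; ℓ u v is the length of the odd cycle
-- substituted for the edge {u , v} (u < v).  The new u–v path has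
-- ℓ u v ∸ 2 new internal vertices w₀,…,w_{ℓ-3}:  u – w₀ – … – w_{ℓ-3} – v.

IsEdge : ∀ {k} → SimpleGraph k → Fin k → Fin k → Set
IsEdge F u v = toℕ u < toℕ v × adj F u v ≡ true

module _ {k : ℕ} (F : SimpleGraph k) (ℓ : Fin k → Fin k → ℕ) where

  Inner : Set
  Inner = Σ[ u ∈ Fin k ] Σ[ v ∈ Fin k ] (IsEdge F u v × Fin (ℓ u v ∸ 2))

  BV : Set
  BV = Fin k ⊎ Inner

  attach : Fin k → Inner → Set
  attach a (u , v , _ , i) = (a ≡ u × toℕ i ≡ 0) ⊎ (a ≡ v × suc (toℕ i) ≡ ℓ u v ∸ 2)

  BAdj : BV → BV → Set
  BAdj (inj₁ a) (inj₁ b) = adj F a b ≡ true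
  BAdj (inj₁ a) (inj₂ w) = attach a w
  BAdj (inj₂ w) (inj₁ a) = attach a w
  BAdj (inj₂ (u , v , _ , i)) (inj₂ (u' , v' , _ , j)) =
    u ≡ u' × v ≡ v' × (suc (toℕ i) ≡ toℕ j ⊎ suc (toℕ j) ≡ toℕ i)

  oddBalloon : PGraph
  oddBalloon = record { V = BV ; Adj = BAdj }

ValidLengths : ∀ {k} → SimpleGraph k → (Fin k → Fin k → ℕ) → Set
ValidLengths F ℓ = ∀ u v → IsEdge F u v → 5 ≤ ℓ u v × Σ[ s ∈ ℕ ] ℓ u v ≡ suc (2 * s)

UniqueExtremal : (n : ℕ) → PGraph → ∀ {N} → SimpleGraph N → Set
UniqueExtremal n H {N} G₀ =
  N ≡ n × Free H G₀ ×
  (∀ (G : SimpleGraph n) → Free H G → edges G Data.Nat.≤ edges G₀ × (edges G ≡ edges G₀ → G ≅ G₀))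

{-# OPTIONS --safe #-}

-- Write Q = F•, with a proper 2-colouring, and let U be the joined part of the extremal graph.
--
-- No copy in U ∇ T: T is bipartite, so every substituted odd cycle meets U.  If the apex of F is
-- not sent into U, the |Q| > |U| spokes need distinct vertices of U; otherwise every edge of Q
-- outside U needs a vertex of its own, and the few edges of U force too many of them.
--
-- Upper bound: deleting vertices of degree below n/2 gains on the extremal numbers, so G may be
-- assumed to have minimum degree n/2.  Only boundedly many vertices have dense neighbourhoods,
-- since otherwise G contains a large complete tripartite graph.  Hence the neighbourhood of a
-- suitable vertex and its complement form an almost complete bipartition.  Let W be the set of
-- vertices with linearly many neighbours on both sides.  Copies of the ballooning are found
-- greedily: a cycle over an edge crossing the bipartition gets its odd length from a vertex of W
-- or from an edge inside a side.  This bounds |W|, and shows that either the edges inside the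
-- sides are few or all vertices have few neighbours on their own side.  Counting edges gives
-- |W| = |U| with every vertex of W almost full; then any edge inside a side, and any edge of
-- G[W] absent from U up to isomorphism, yields a copy, so G ⊆ U ∇ T.

module Submission where

open import Defs
open import Data.Bool using (Bool; true; false; _∧_; _∨_; not; if_then_else_)
import Data.Bool as Bool
import Data.Bool.Properties as Boolₚ
open import Data.Nat using (ℕ; zero; suc; _+_; _*_; _∸_; _^_; _≤_; _<_; z≤n; s≤s; _<ᵇ_; _≡ᵇ_; _/_; _%_; _≤?_; _<?_; NonZero)
open import Data.Nat.Properties hiding (_≟_; ≡-irrelevant; suc-injective)
import Data.Nat as ℕ
import Data.Nat.Properties as ℕₚ
import Data.Nat.DivMod as DivMod
open import Data.Nat.Tactic.RingSolver using (solve; solve-∀)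
open import Data.Nat.ListAction using (sum)
open import Data.Fin using (Fin; zero; suc; toℕ; fromℕ<; _↑ˡ_; _↑ʳ_; splitAt; punchIn; punchOut; inject≤)
import Data.Fin as Fin
import Data.Fin.Properties as Finₚ
open import Data.List using (List; []; _∷_; _++_; length; map; lookup; concatMap; allFin; tabulate)
import Data.List.Properties as Listₚ
import Data.List.Relation.Unary.All as All
open All using (All)
open import Data.List.Relation.Unary.Any using (Any; here; there; index)
import Data.List.Relation.Unary.Any.Properties as Anyₚ
open import Data.List.Membership.Propositional using (_∈_)
open import Data.List.Membership.Propositional.Properties using (∈-lookup; ∈-++⁺ˡ; ∈-++⁺ʳ; ∈-++⁻; ∈-map⁺; ∈-allFin; ∈-concatMap⁺)
open import Data.Maybe using (Maybe; just; nothing; is-nothing)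
import Data.Maybe.Properties as Maybeₚ
open import Data.Product using (Σ; Σ-syntax; ∃; _×_; _,_; proj₁; proj₂)
open import Data.Sum using (_⊎_; inj₁; inj₂; [_,_]′)
open import Data.Empty using (⊥; ⊥-elim)
open import Data.Unit using (⊤; tt)
open import Relation.Nullary using (¬_; Dec; yes; no)
open import Relation.Nullary.Decidable using (⌊_⌋)
open import Relation.Binary.PropositionalEquality using (_≡_; _≢_; refl; cong; cong₂; trans; subst; module ≡-Reasoning) renaming (sym to ≡sym)
open import Relation.Binary.Construct.Closure.ReflexiveTransitive using (Star; ε; _◅_)
open import Function using (_∘_; id; Injective; _↔_; Inverse; mk↔ₛ′)
import Algebra.Properties.CommutativeMonoid.Sum +-0-commutativeMonoid as Sumₚ
open import Data.Fin.Permutation using (Permutation; _⟨$⟩ʳ_; ↔⇒≡)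
open import Relation.Binary using (tri<; tri≈; tri>)
open import Data.List.Relation.Unary.Unique.Propositional using (Unique)
import Data.List.Relation.Unary.AllPairs as AllPairs
import Data.List.Relation.Unary.Unique.Propositional.Properties as Uniqueₚ

-- Call a vertex of W a hub. With e = e(Q) and N = |Q|, two embeddings fix |U|. With the apex of F
-- on a hub the spokes cost nothing and every edge of Q needs a hub of its own: e + 1 hubs suffice.
-- With the apex inside a side, one colour class of Q on hubs and a hub for each spoke to the other
-- class, N hubs suffice. A tree component gives e < N and |U| = e; for even cycles e = N and the
-- second embedding lowers this to |U| = e - 1.
--
-- Inside U, sending a vertex c of Q to a hub adjacent to the apex uses one hub and settles deg c
-- edges. This gains nothing for single edges, so U is complete; for cycles, one hub short, two such
-- vertices are needed, so U has maximum degree one; otherwise some vertex gains a hub at once, so U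
-- is empty.
--
-- The obstacle is a cycle of length five run through an edge inside a side: one end of that edge
-- must be adjacent to an end of the edge of F. The neighbours guaranteed to a vertex of W may be
-- exhausted by the non-neighbours of such ends, so the edge count must first yield one vertex of
-- degree n/2 + n/(4e), which then serves as apex.

infixl 6 _⊕_
infixl 7 _⊛_
_⊕_ : ∀ {a b c d} → a ≤ b → c ≤ d → a + c ≤ b + d
_⊕_ = +-mono-≤

_⊛_ : ∀ k {a b} → a ≤ b → k * a ≤ k * b
k ⊛ p = *-monoʳ-≤ k p

-- Certificates for linear arithmetic: the slack s and a nonnegative combination A ≤ B of the
-- hypotheses reduce an inequality to a semiring identity.
lin : ∀ {c d A B} s → A ≤ B → c + B + s ≡ d + A → c ≤ d
lin {c} {d} {A} {B} s p q = +-cancelʳ-≤ A c d (≤-trans (+-monoʳ-≤ c p) (≤-trans (m≤m+n (c + B) s) (≤-reflexive q)))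

-- Booleans, comparisons and membership in lists

1≰0 : ¬ (1 ≤ 0)
1≰0 ()

∧⁻ : ∀ {a b} → a ∧ b ≡ true → a ≡ true × b ≡ true
∧⁻ {true} {true} _ = refl , refl

∧⁺ : ∀ {a b} → a ≡ true → b ≡ true → a ∧ b ≡ true
∧⁺ refl refl = refl

not⁻ : ∀ {a} → not a ≡ true → a ≡ false
not⁻ {false} _ = refl

t≢f : ∀ {a} {X : Set} → a ≡ true → a ≡ false → X
t≢f refl ()

bool : ∀ b → (b ≡ true) ⊎ (b ≡ false)
bool true  = inj₁ refl
bool false = inj₂ refl

≢⇒not : ∀ {a b} → a ≢ b → b ≡ not a
≢⇒not {true}  {true}  p = ⊥-elim (p refl)
≢⇒not {true}  {false} p = refl
≢⇒not {false} {true}  p = refl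
≢⇒not {false} {false} p = ⊥-elim (p refl)

<ᵇ⁺ : ∀ {a b} → a < b → (a <ᵇ b) ≡ true
<ᵇ⁺ {zero}  {suc b} (s≤s p) = refl
<ᵇ⁺ {suc a} {suc b} (s≤s p) = <ᵇ⁺ p

<ᵇ⁻ : ∀ {a b} → (a <ᵇ b) ≡ true → a < b
<ᵇ⁻ {zero}  {suc b} _ = s≤s z≤n
<ᵇ⁻ {suc a} {suc b} p = s≤s (<ᵇ⁻ p)

<ᵇ-f⁻ : ∀ {a b} → (a <ᵇ b) ≡ false → b ≤ a
<ᵇ-f⁻ {a} {b} p = ≮⇒≥ (λ q → t≢f (<ᵇ⁺ q) p)

<ᵇ-f⁺ : ∀ {a b} → b ≤ a → (a <ᵇ b) ≡ false
<ᵇ-f⁺ {a} {b} p with bool (a <ᵇ b)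
... | inj₂ q = q
... | inj₁ q = ⊥-elim (<⇒≱ (<ᵇ⁻ q) p)

≡ᵇ⁻ : ∀ {a b} → (a ≡ᵇ b) ≡ true → a ≡ b
≡ᵇ⁻ {zero}  {zero}  _ = refl
≡ᵇ⁻ {suc a} {suc b} p = cong suc (≡ᵇ⁻ p)

≡ᵇ⁺ : ∀ {a b} → a ≡ b → (a ≡ᵇ b) ≡ true
≡ᵇ⁺ {zero}  refl = refl
≡ᵇ⁺ {suc a} refl = ≡ᵇ⁺ {a} refl

infix 4 _==_
_==_ : ∀ {n} → Fin n → Fin n → Bool
x == y = ⌊ x Fin.≟ y ⌋

==⁻ : ∀ {n} {x y : Fin n} → (x == y) ≡ true → x ≡ y
==⁻ {x = x} {y} p with x Fin.≟ y
... | yes q = q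

==-refl : ∀ {n} (x : Fin n) → (x == x) ≡ true
==-refl x with x Fin.≟ x
... | yes _ = refl
... | no q  = ⊥-elim (q refl)

==-f⁻ : ∀ {n} {x y : Fin n} → (x == y) ≡ false → x ≢ y
==-f⁻ {x = x} p refl = t≢f (==-refl x) p

==-f⁺ : ∀ {n} {x y : Fin n} → x ≢ y → (x == y) ≡ false
==-f⁺ {x = x} {y} p with bool (x == y)
... | inj₂ q = q
... | inj₁ q = ⊥-elim (p (==⁻ q))

b2n : Bool → ℕ
b2n b = if b then 1 else 0

b2n≤1 : ∀ b → b2n b ≤ 1
b2n≤1 true  = ≤-refl
b2n≤1 false = z≤n

memb : ∀ {n} → List (Fin n) → Fin n → Bool
memb []      z = false
memb (x ∷ L) z = (x == z) ∨ memb L z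

memb⁺ : ∀ {n} {L : List (Fin n)} {z} → z ∈ L → memb L z ≡ true
memb⁺ {z = z} (here refl) rewrite ==-refl z = refl
memb⁺ {L = x ∷ L} {z} (there p) rewrite memb⁺ p = Boolₚ.∨-zeroʳ (x == z)

memb⁻ : ∀ {n} {L : List (Fin n)} {z} → memb L z ≡ true → z ∈ L
memb⁻ {L = x ∷ L} {z} e with bool (x == z)
... | inj₁ q = here (≡sym (==⁻ q))
... | inj₂ q rewrite q = there (memb⁻ e)

private
  nth′ : ∀ {m n} b → (Fin m → Fin n) → Fin (b2n b + m) → Fin (suc n)
  nth′ true  g zero    = zero
  nth′ true  g (suc i) = suc (g i)
  nth′ false g i       = suc (g i)

↑ˡ≢↑ʳ : ∀ {a b} (i : Fin a) (j : Fin b) → i ↑ˡ b ≢ a ↑ʳ j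
↑ˡ≢↑ʳ {a} {b} i j e = <⇒≱ (Finₚ.toℕ<n i)
  (≤-trans (m≤m+n a (toℕ j)) (≤-reflexive (trans (≡sym (Finₚ.toℕ-↑ʳ a j)) (trans (cong toℕ (≡sym e)) (Finₚ.toℕ-↑ˡ i b)))))

-- Sums and counting over Fin n; opaque, so that unification sees them as rigid

opaque

  ∑ : ∀ {n} → (Fin n → ℕ) → ℕ
  ∑ {zero}  f = 0
  ∑ {suc n} f = f zero + ∑ (f ∘ suc)

  ∑≡sum : ∀ {n} (f : Fin n → ℕ) → ∑ f ≡ Sumₚ.sum f
  ∑≡sum {zero}  f = refl
  ∑≡sum {suc n} f = cong (f zero +_) (∑≡sum (f ∘ suc))

  ∑-cong : ∀ {n} {f g : Fin n → ℕ} → (∀ i → f i ≡ g i) → ∑ f ≡ ∑ g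
  ∑-cong {zero}  p = refl
  ∑-cong {suc n} p = cong₂ _+_ (p zero) (∑-cong (p ∘ suc))

  ∑-+ : ∀ {n} (f g : Fin n → ℕ) → ∑ (λ i → f i + g i) ≡ ∑ f + ∑ g
  ∑-+ f g = trans (∑≡sum (λ i → f i + g i)) (trans (Sumₚ.∑-distrib-+ f g) (cong₂ _+_ (≡sym (∑≡sum f)) (≡sym (∑≡sum g))))

  ∑-swap : ∀ {m n} (f : Fin m → Fin n → ℕ) → ∑ (λ i → ∑ (λ j → f i j)) ≡ ∑ (λ j → ∑ (λ i → f i j))
  ∑-swap f = trans (∑∑≡ f) (trans (Sumₚ.∑-comm f) (≡sym (∑∑≡ (λ j i → f i j))))
    where
    ∑∑≡ : ∀ {m n} (f : Fin m → Fin n → ℕ) → ∑ (λ i → ∑ (f i)) ≡ Sumₚ.sum (λ i → Sumₚ.sum (f i))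
    ∑∑≡ f = trans (∑≡sum (λ i → ∑ (f i))) (Sumₚ.sum-cong-≗ (λ i → ∑≡sum (f i)))

  ∑-permute : ∀ {m n} (f : Fin n → ℕ) (π : Permutation m n) → ∑ f ≡ ∑ (λ i → f (π ⟨$⟩ʳ i))
  ∑-permute f π = trans (∑≡sum f) (trans (Sumₚ.sum-permute f π) (≡sym (∑≡sum (λ i → f (π ⟨$⟩ʳ i)))))

  ∑-remove : ∀ {n} (f : Fin (suc n) → ℕ) v → ∑ f ≡ f v + ∑ (λ i → f (punchIn v i))
  ∑-remove f v = trans (∑≡sum f) (trans (Sumₚ.sum-remove {i = v} f) (cong (f v +_) (≡sym (∑≡sum (λ i → f (punchIn v i))))))

  ∑-mono : ∀ {n} {f g : Fin n → ℕ} → (∀ i → f i ≤ g i) → ∑ f ≤ ∑ g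
  ∑-mono {zero}  p = z≤n
  ∑-mono {suc n} p = +-mono-≤ (p zero) (∑-mono (p ∘ suc))

  ∑-const : ∀ n c → ∑ {n} (λ _ → c) ≡ n * c
  ∑-const zero    c = refl
  ∑-const (suc n) c = cong (c +_) (∑-const n c)

  ∑-*ˡ : ∀ {n} c (f : Fin n → ℕ) → ∑ (λ i → c * f i) ≡ c * ∑ f
  ∑-*ˡ {zero}  c f = ≡sym (*-zeroʳ c)
  ∑-*ˡ {suc n} c f = trans (cong (c * f zero +_) (∑-*ˡ c (f ∘ suc))) (≡sym (*-distribˡ-+ c (f zero) _))

  ∑-zero : ∀ {n} {f : Fin n → ℕ} → (∀ i → f i ≡ 0) → ∑ f ≡ 0
  ∑-zero {n} p = trans (∑-cong p) (trans (∑-const n 0) (*-zeroʳ n))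

  ∑-≤const : ∀ {n} {f : Fin n → ℕ} c → (∀ i → f i ≤ c) → ∑ f ≤ n * c
  ∑-≤const {n} c p = ≤-trans (∑-mono p) (≤-reflexive (∑-const n c))

  ≤∑ : ∀ {n} (f : Fin n → ℕ) i → f i ≤ ∑ f
  ≤∑ f zero    = m≤m+n _ _
  ≤∑ f (suc i) = ≤-trans (≤∑ (f ∘ suc) i) (m≤n+m _ _)

  ∑-++ : ∀ a {b} (f : Fin (a + b) → ℕ) → ∑ f ≡ ∑ (λ i → f (i ↑ˡ b)) + ∑ (λ j → f (a ↑ʳ j))
  ∑-++ zero    f = refl
  ∑-++ (suc a) f = trans (cong (f zero +_) (∑-++ a (f ∘ suc))) (≡sym (+-assoc (f zero) _ _))

  -- No term has any slack left. Applied to rows and then to entries, this turns equality of edge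
  -- numbers into equality of graphs.
  ∑-pinch : ∀ {n} {f g : Fin n → ℕ} → (∀ i → f i ≤ g i) → ∑ g ≤ ∑ f → ∀ i → f i ≡ g i
  ∑-pinch {suc n} {f} {g} p q zero = ≤-antisym (p zero)
    (+-cancelʳ-≤ _ _ _ (≤-trans (+-monoʳ-≤ (g zero) (∑-mono (p ∘ suc))) q))
  ∑-pinch {suc n} {f} {g} p q (suc i) = ∑-pinch (p ∘ suc)
    (+-cancelˡ-≤ (f zero) _ _ (≤-trans (+-monoˡ-≤ _ (p zero)) q)) i

  count : ∀ {n} → (Fin n → Bool) → ℕ
  count p = ∑ (λ i → b2n (p i))

  count≡∑ : ∀ {n} (p : Fin n → Bool) → count p ≡ ∑ (λ i → b2n (p i))
  count≡∑ p = refl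

  ∑-suc : ∀ {n} (f : Fin (suc n) → ℕ) → ∑ f ≡ f zero + ∑ (f ∘ suc)
  ∑-suc f = refl

  ∑-nil : (f : Fin 0 → ℕ) → ∑ f ≡ 0
  ∑-nil f = refl

  count-suc : ∀ {n} (p : Fin (suc n) → Bool) → count p ≡ b2n (p zero) + count (p ∘ suc)
  count-suc p = refl

  count-cong : ∀ {n} {p q : Fin n → Bool} → (∀ i → p i ≡ q i) → count p ≡ count q
  count-cong e = ∑-cong (λ i → cong b2n (e i))

  b2n-mono : ∀ {a b} → (a ≡ true → b ≡ true) → b2n a ≤ b2n b
  b2n-mono {true}  {b} f rewrite f refl = ≤-refl
  b2n-mono {false} f = z≤n

  count-mono : ∀ {n} {p q : Fin n → Bool} → (∀ i → p i ≡ true → q i ≡ true) → count p ≤ count q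
  count-mono f = ∑-mono (λ i → b2n-mono (f i))

  count-split : ∀ {n} → (p q : Fin n → Bool) →
    count p ≡ count (λ i → p i ∧ q i) + count (λ i → p i ∧ not (q i))
  count-split p q = trans (∑-cong (λ i → pt (p i) (q i))) (∑-+ (λ i → b2n (p i ∧ q i)) (λ i → b2n (p i ∧ not (q i))))
    where
    pt : ∀ a b → b2n a ≡ b2n (a ∧ b) + b2n (a ∧ not b)
    pt false b     = refl
    pt true  true  = refl
    pt true  false = refl

  count-∨ : ∀ {n} → (p q : Fin n → Bool) → count (λ i → p i ∨ q i) ≤ count p + count q
  count-∨ p q = ≤-trans (∑-mono (λ i → pt (p i) (q i))) (≤-reflexive (∑-+ (λ i → b2n (p i)) (λ i → b2n (q i))))
    where
    pt : ∀ a b → b2n (a ∨ b) ≤ b2n a + b2n b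
    pt true  b = s≤s z≤n
    pt false b = ≤-refl

  count≤n : ∀ {n} (p : Fin n → Bool) → count p ≤ n
  count≤n {n} p = ≤-trans (∑-≤const 1 (λ i → b2n≤1 (p i))) (≤-reflexive (*-identityʳ n))

  count-not : ∀ {n} (p : Fin n → Bool) → count p + count (λ i → not (p i)) ≡ n
  count-not {n} p = trans (≡sym (count-split (λ _ → true) p)) (trans (∑-const n 1) (*-identityʳ n))

  count-none : ∀ {n} (p : Fin n → Bool) → (∀ i → p i ≡ false) → count p ≡ 0
  count-none p f = ∑-zero (λ i → cong b2n (f i))

  count-pos : ∀ {n} (p : Fin n → Bool) (i : Fin n) → p i ≡ true → 1 ≤ count p
  count-pos p i e = ≤-trans (≤-reflexive (≡sym (cong b2n e))) (≤∑ (λ j → b2n (p j)) i)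

  find? : ∀ {n} (p : Fin n → Bool) → (∃ λ i → p i ≡ true) ⊎ (∀ i → p i ≡ false)
  find? {zero}  p = inj₂ (λ ())
  find? {suc n} p with bool (p zero)
  ... | inj₁ e = inj₁ (zero , e)
  ... | inj₂ e with find? (p ∘ suc)
  ...   | inj₁ (i , e') = inj₁ (suc i , e')
  ...   | inj₂ f = inj₂ λ { zero → e ; (suc i) → f i }

  find : ∀ {n} (p : Fin n → Bool) → 1 ≤ count p → ∃ λ i → p i ≡ true
  find p h with find? p
  ... | inj₁ r = r
  ... | inj₂ f = ⊥-elim (1≰0 (≤-trans h (≤-reflexive (count-none p f))))

  count-== : ∀ {n} (x : Fin n) → count (λ y → x == y) ≡ 1
  count-== {suc n} zero    = cong suc (count-none (λ (i : Fin n) → zero == suc i) (λ i → ==-f⁺ {x = zero} {y = suc i} (λ ())))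
  count-== {suc n} (suc x) = trans (count-cong lem) (count-== x)
    where
    lem : ∀ i → (suc x == suc i) ≡ (x == i)
    lem i with bool (x == i)
    ... | inj₁ e = trans (cong (λ z → suc x == suc z) (≡sym (==⁻ e))) (trans (==-refl (suc x)) (≡sym e))
    ... | inj₂ e = trans (==-f⁺ (λ q → ==-f⁻ e (Finₚ.suc-injective q))) (≡sym e)

  count-≤1 : ∀ {n} (p : Fin n → Bool) → (∀ x y → p x ≡ true → p y ≡ true → x ≡ y) → count p ≤ 1
  count-≤1 p f with find? p
  ... | inj₂ g = ≤-trans (≤-reflexive (count-none p g)) z≤n
  ... | inj₁ (x , e) = ≤-trans (count-mono (λ i e' → trans (cong (x ==_) (≡sym (f x i e e'))) (==-refl x)))
                        (≤-reflexive (count-== x))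

  count-two : ∀ {n} (p : Fin n → Bool) x y → x ≢ y → p x ≡ true → p y ≡ true →
    (∀ z → p z ≡ true → z ≡ x ⊎ z ≡ y) → count p ≡ 2
  count-two p x y ne px py only = trans (∑-cong pt) (trans (∑-+ (λ z → b2n (x == z)) (λ z → b2n (y == z))) (cong₂ _+_ (count-== x) (count-== y)))
    where
    pt : ∀ z → b2n (p z) ≡ b2n (x == z) + b2n (y == z)
    pt z with bool (p z)
    ... | inj₂ e rewrite e | ==-f⁺ {x = x} {z} (λ { refl → t≢f px e }) | ==-f⁺ {x = y} {z} (λ { refl → t≢f py e }) = refl
    ... | inj₁ e with only z e
    ...   | inj₁ refl rewrite e | ==-refl z | ==-f⁺ {x = y} {z} (λ q → ne (≡sym q)) = refl
    ...   | inj₂ refl rewrite e | ==-refl z | ==-f⁺ ne = refl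

  other : ∀ {n} (p : Fin n → Bool) (x : Fin n) → 2 ≤ count p → ∃ λ y → p y ≡ true × y ≢ x
  other p x h with find? (λ y → p y ∧ not (x == y))
  ... | inj₁ (y , e) = y , proj₁ (∧⁻ e) , λ { refl → t≢f (==-refl y) (not⁻ (proj₂ (∧⁻ {p y} e))) }
  ... | inj₂ f = ⊥-elim (<⇒≱ (≤-refl {2}) (≤-trans h (count-≤1 p (λ a b pa pb → trans (≡sym (is a pa)) (is b pb)))))
    where
    is : ∀ a → p a ≡ true → x ≡ a
    is a pa with bool (x == a)
    ... | inj₁ e = ==⁻ e
    ... | inj₂ e = t≢f (∧⁺ pa (cong not e)) (f a)

  count-memb : ∀ {n} (L : List (Fin n)) → count (memb L) ≤ length L
  count-memb {n} []      = ≤-reflexive (count-none {n} (memb []) (λ _ → refl))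
  count-memb (x ∷ L) = ≤-trans (count-∨ (x ==_) (memb L)) (+-mono-≤ (≤-reflexive (count-== x)) (count-memb L))

  count-minus : ∀ {n} (p q : Fin n → Bool) → count p ≤ count (λ z → p z ∧ not (q z)) + count q
  count-minus p q = ≤-trans (≤-reflexive (trans (count-split p q) (+-comm _ (count (λ z → p z ∧ not (q z))))))
    (+-monoʳ-≤ _ (count-mono (λ i e → proj₂ (∧⁻ {p i} e))))

  -- Lays the blocks `Fin (f x)` one after another; the inverse is `Σnth`.
  Σidx : ∀ {n} (f : Fin n → ℕ) (x : Fin n) → Fin (f x) → Fin (∑ f)
  Σidx f zero    i = i ↑ˡ _
  Σidx f (suc x) i = f zero ↑ʳ Σidx (f ∘ suc) x i

  Σidx-inj : ∀ {n} (f : Fin n → ℕ) x y i j → Σidx f x i ≡ Σidx f y j →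
    _≡_ {A = Σ (Fin n) (λ z → Fin (f z))} (x , i) (y , j)
  Σidx-inj f zero    zero    i j e = cong (zero ,_) (Finₚ.↑ˡ-injective _ i j e)
  Σidx-inj f zero    (suc y) i j e = ⊥-elim (↑ˡ≢↑ʳ i _ e)
  Σidx-inj f (suc x) zero    i j e = ⊥-elim (↑ˡ≢↑ʳ j _ (≡sym e))
  Σidx-inj f (suc x) (suc y) i j e with Σidx-inj (f ∘ suc) x y i j (Finₚ.↑ʳ-injective (f zero) _ _ e)
  ... | refl = refl

  nth : ∀ {n} (p : Fin n → Bool) → Fin (count p) → Fin n
  nth {suc n} p = nth′ (p zero) (nth (p ∘ suc))

  nth-true : ∀ {n} (p : Fin n → Bool) i → p (nth p i) ≡ true
  nth-true {suc n} p = lem (p zero) refl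
    where
    lem : ∀ b → p zero ≡ b → ∀ i → p (nth′ b (nth (p ∘ suc)) i) ≡ true
    lem true  e zero    = e
    lem true  e (suc i) = nth-true (p ∘ suc) i
    lem false e i       = nth-true (p ∘ suc) i

  nth-inj : ∀ {n} (p : Fin n → Bool) i j → nth p i ≡ nth p j → i ≡ j
  nth-inj {suc n} p = lem (p zero)
    where
    lem : ∀ b i j → nth′ b (nth (p ∘ suc)) i ≡ nth′ b (nth (p ∘ suc)) j → i ≡ j
    lem true  zero    zero    e = refl
    lem true  (suc i) (suc j) e = cong suc (nth-inj (p ∘ suc) i j (Finₚ.suc-injective e))
    lem false i       j       e = nth-inj (p ∘ suc) i j (Finₚ.suc-injective e)

  nth-surj : ∀ {n} (p : Fin n → Bool) x → p x ≡ true → ∃ λ i → nth p i ≡ x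
  nth-surj {suc n} p zero e = lem (p zero) e
    where
    lem : ∀ b → b ≡ true → ∃ λ i → nth′ b (nth (p ∘ suc)) i ≡ zero
    lem true _ = zero , refl
  nth-surj {suc n} p (suc x) e = lem (p zero)
    where
    lem : ∀ b → ∃ λ i → nth′ b (nth (p ∘ suc)) i ≡ suc x
    lem true  = let i , q = nth-surj (p ∘ suc) x e in suc i , cong suc q
    lem false = let i , q = nth-surj (p ∘ suc) x e in i , cong suc q

choose : ∀ {n} (p : Fin n → Bool) M → M ≤ count p →
  Σ[ g ∈ (Fin M → Fin n) ] (∀ i → p (g i) ≡ true) × (∀ i j → g i ≡ g j → i ≡ j)
choose p M h = nth p ∘ (λ i → inject≤ i h) , (λ i → nth-true p _) ,
  (λ i j e → Finₚ.inject≤-injective h h i j (nth-inj p _ _ e))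

count-inj : ∀ {n} (p : Fin n → Bool) M (g : Fin M → Fin n) → (∀ i → p (g i) ≡ true) →
  (∀ i j → g i ≡ g j → i ≡ j) → M ≤ count p
count-inj p M g t inj = Finₚ.injective⇒≤ {f = λ i → proj₁ (nth-surj p (g i) (t i))}
  (λ {i} {j} e → inj i j (trans (≡sym (proj₂ (nth-surj p (g i) (t i))))
     (trans (cong (nth p) e) (proj₂ (nth-surj p (g j) (t j))))))

-- Numbers the related pairs, so that every edge of F needing a parity correction can be given a
-- private one.
pairIdx : ∀ {m n} (b : Fin m → Fin n → Bool) u v → b u v ≡ true → Fin (∑ (λ u → count (b u)))
pairIdx b u v e = Σidx (λ u → count (b u)) u (proj₁ (nth-surj (b u) v e))

pairIdx-inj : ∀ {m n} (b : Fin m → Fin n → Bool) u v u′ v′ e e′ →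
  pairIdx b u v e ≡ pairIdx b u′ v′ e′ → u ≡ u′ × v ≡ v′
pairIdx-inj b u v u′ v′ e e′ q = lem (nth-surj (b u) v e) (nth-surj (b u′) v′ e′)
    (Σidx-inj (λ u → count (b u)) u u′ _ _ q)
  where
  lem : (r : ∃ λ i → nth (b u) i ≡ v) (r′ : ∃ λ i → nth (b u′) i ≡ v′) →
    _≡_ {A = Σ _ (λ z → Fin (count (b z)))} (u , proj₁ r) (u′ , proj₁ r′) → u ≡ u′ × v ≡ v′
  lem (i , p) (.i , p′) refl = refl , trans (≡sym p) p′

-- Degrees, degree sums and edge counts

pairs : ∀ {m n} → (Fin m → Fin n → Bool) → ℕ
pairs R = ∑ (λ i → count (R i))

pairs-cong : ∀ {m n} {R Q : Fin m → Fin n → Bool} → (∀ i j → R i j ≡ Q i j) → pairs R ≡ pairs Q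
pairs-cong e = ∑-cong (λ i → count-cong (e i))

pairs-mono : ∀ {m n} {R Q : Fin m → Fin n → Bool} → (∀ i j → R i j ≡ true → Q i j ≡ true) → pairs R ≤ pairs Q
pairs-mono e = ∑-mono (λ i → count-mono (e i))

pairs≡∑∑ : ∀ {m n} (R : Fin m → Fin n → Bool) → pairs R ≡ ∑ (λ i → ∑ (λ j → b2n (R i j)))
pairs≡∑∑ R = ∑-cong (λ i → count≡∑ (R i))

pairs-swap : ∀ {m n} (R : Fin m → Fin n → Bool) → pairs R ≡ pairs (λ j i → R i j)
pairs-swap R = trans (pairs≡∑∑ R) (trans (∑-swap (λ i j → b2n (R i j))) (≡sym (pairs≡∑∑ (λ j i → R i j))))

pairs-split : ∀ {m n} (R Q : Fin m → Fin n → Bool) →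
  pairs R ≡ pairs (λ i j → R i j ∧ Q i j) + pairs (λ i j → R i j ∧ not (Q i j))
pairs-split R Q = trans (∑-cong (λ i → count-split (R i) (Q i)))
  (∑-+ (λ i → count (λ j → R i j ∧ Q i j)) (λ i → count (λ j → R i j ∧ not (Q i j))))

∑∑-+ : ∀ {m n} (f g : Fin m → Fin n → ℕ) →
  ∑ (λ i → ∑ (λ j → f i j + g i j)) ≡ ∑ (λ i → ∑ (f i)) + ∑ (λ i → ∑ (g i))
∑∑-+ f g = trans (∑-cong (λ i → ∑-+ (f i) (g i))) (∑-+ (λ i → ∑ (f i)) (λ i → ∑ (g i)))

count-guard : ∀ {n} b (p : Fin n → Bool) → count (λ j → b ∧ p j) ≡ b2n b * count p
count-guard true  p = ≡sym (+-identityʳ _)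
count-guard {n} false p = count-none {n} (λ _ → false) (λ _ → refl)

pairs-row : ∀ {m n} (P : Fin m → Bool) (R : Fin m → Fin n → Bool) →
  pairs (λ i j → P i ∧ R i j) ≡ ∑ (λ i → b2n (P i) * count (R i))
pairs-row P R = ∑-cong (λ i → count-guard (P i) (R i))

∑-== : ∀ {n} (x : Fin n) (f : Fin n → ℕ) → ∑ (λ u → b2n (x == u) * f u) ≡ f x
∑-== x f = trans (∑-cong pt) (trans (∑-*ˡ (f x) (λ u → b2n (x == u)))
  (trans (cong (f x *_) (trans (≡sym (count≡∑ (x ==_))) (count-== x))) (*-identityʳ (f x))))
  where
  pt : ∀ u → b2n (x == u) * f u ≡ f x * b2n (x == u)
  pt u with bool (x == u)
  ... | inj₁ e rewrite e | ==⁻ e = *-comm 1 (f u)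
  ... | inj₂ e rewrite e = ≡sym (*-zeroʳ (f x))

∑-P≤ : ∀ {n} (P : Fin n → Bool) (f : Fin n → ℕ) c → (∀ x → P x ≡ true → f x ≤ c) →
  ∑ (λ u → b2n (P u) * f u) ≤ count P * c
∑-P≤ P f c h = ≤-trans (∑-mono pt) (≤-reflexive (trans (∑-*ˡ c (λ u → b2n (P u))) (trans (*-comm c _) (cong (_* c) (≡sym (count≡∑ P))))))
  where
  pt : ∀ u → b2n (P u) * f u ≤ c * b2n (P u)
  pt u with bool (P u)
  ... | inj₁ e rewrite e = ≤-trans (≤-reflexive (+-identityʳ _)) (≤-trans (h u e) (≤-reflexive (≡sym (*-identityʳ c))))
  ... | inj₂ e rewrite e = z≤n

∑-P≥ : ∀ {n} (P : Fin n → Bool) (f : Fin n → ℕ) c → (∀ x → P x ≡ true → c ≤ f x) →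
  count P * c ≤ ∑ (λ u → b2n (P u) * f u)
∑-P≥ P f c h = ≤-trans (≤-reflexive (trans (cong (_* c) (count≡∑ P)) (trans (*-comm _ c) (≡sym (∑-*ˡ c (λ u → b2n (P u))))))) (∑-mono pt)
  where
  pt : ∀ u → c * b2n (P u) ≤ b2n (P u) * f u
  pt u with bool (P u)
  ... | inj₁ e rewrite e = ≤-trans (≤-reflexive (*-identityʳ c)) (≤-trans (h u e) (≤-reflexive (≡sym (+-identityʳ _))))
  ... | inj₂ e rewrite e = ≤-reflexive (*-zeroʳ c)

deg : ∀ {n} → SimpleGraph n → Fin n → ℕ
deg G x = count (adj G x)

-- Twice the number of edges. All extremal counts use it, since ordered pairs carry no trace of the
-- vertex order built into `edges`.
dsum : ∀ {n} → SimpleGraph n → ℕ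
dsum G = ∑ (deg G)

sum-allFin : ∀ n (f : Fin n → ℕ) → sum (map f (allFin n)) ≡ ∑ f
sum-allFin n f = trans (cong sum (Listₚ.map-tabulate id f)) (lem n f)
  where
  lem : ∀ n (f : Fin n → ℕ) → sum (tabulate f) ≡ ∑ f
  lem zero    f = ≡sym (∑-nil f)
  lem (suc n) f = trans (cong (f zero +_) (lem n (f ∘ suc))) (≡sym (∑-suc f))

upper : ∀ {n} → (Fin n → Fin n → Bool) → Fin n → Fin n → Bool
upper R i j = (toℕ i <ᵇ toℕ j) ∧ R i j

edges≡ : ∀ {n} (G : SimpleGraph n) → edges G ≡ pairs (upper (adj G))
edges≡ {n} G = trans (sum-allFin n _)
  (∑-cong (λ i → trans (sum-allFin n (λ j → b2n (upper (adj G) i j))) (≡sym (count≡∑ (upper (adj G) i)))))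

pairs-upper : ∀ {n} (R : Fin n → Fin n → Bool) → (∀ i j → R i j ≡ R j i) → (∀ i → R i i ≡ false) →
  pairs R ≡ 2 * pairs (upper R)
pairs-upper R s irr = begin
  pairs R ≡⟨ pairs≡∑∑ R ⟩
  ∑ (λ i → ∑ (λ j → b2n (R i j))) ≡⟨ ∑-cong (λ i → ∑-cong (λ j → pt i j)) ⟩
  ∑ (λ i → ∑ (λ j → b2n (upper R i j) + b2n (upper R j i))) ≡⟨ ∑∑-+ (λ i j → b2n (upper R i j)) (λ i j → b2n (upper R j i)) ⟩
  ∑ (λ i → ∑ (λ j → b2n (upper R i j))) + ∑ (λ i → ∑ (λ j → b2n (upper R j i)))
    ≡⟨ cong₂ _+_ (≡sym (pairs≡∑∑ (upper R))) (trans (∑-swap (λ i j → b2n (upper R j i))) (≡sym (pairs≡∑∑ (upper R)))) ⟩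
  pairs (upper R) + pairs (upper R) ≡⟨ cong (pairs (upper R) +_) (≡sym (+-identityʳ _)) ⟩
  2 * pairs (upper R) ∎
  where
  open ≡-Reasoning
  pt : ∀ i j → b2n (R i j) ≡ b2n (upper R i j) + b2n (upper R j i)
  pt i j with <-cmp (toℕ i) (toℕ j)
  ... | tri< p _ _ rewrite <ᵇ⁺ p | <ᵇ-f⁺ (<⇒≤ p) = ≡sym (+-identityʳ _)
  ... | tri> _ _ p rewrite <ᵇ⁺ p | <ᵇ-f⁺ (<⇒≤ p) = cong b2n (s i j)
  ... | tri≈ _ p _ rewrite Finₚ.toℕ-injective p | <ᵇ-f⁺ {toℕ j} ≤-refl = cong b2n (irr j)

dsum≡2edges : ∀ {n} (G : SimpleGraph n) → dsum G ≡ 2 * edges G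
dsum≡2edges G = trans (pairs-upper (adj G) (sym G) (irrefl G)) (cong (2 *_) (≡sym (edges≡ G)))

dsum-cong : ∀ {n} (G H : SimpleGraph n) → (∀ i j → adj G i j ≡ adj H i j) → dsum G ≡ dsum H
dsum-cong G H = pairs-cong

count-permute : ∀ {m n} (p : Fin n → Bool) (π : Permutation m n) → count p ≡ count (λ i → p (π ⟨$⟩ʳ i))
count-permute p π = trans (count≡∑ p) (trans (∑-permute (λ i → b2n (p i)) π) (≡sym (count≡∑ (λ i → p (π ⟨$⟩ʳ i)))))

deg-iso : ∀ {a b} (G : SimpleGraph a) (H : SimpleGraph b) (σ : G ≅ H) x → deg G x ≡ deg H (Inverse.to (proj₁ σ) x)
deg-iso G H (σ , e) x = trans (count-cong (e x)) (≡sym (count-permute (adj H (Inverse.to σ x)) σ))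

dsum-iso : ∀ {a b} (G : SimpleGraph a) (H : SimpleGraph b) → G ≅ H → dsum G ≡ dsum H
dsum-iso G H (σ , e) = trans (∑-cong (deg-iso G H (σ , e))) (≡sym (∑-permute (deg H) σ))

≅-trans : ∀ {a b c} {G : SimpleGraph a} {H : SimpleGraph b} {K : SimpleGraph c} → G ≅ H → H ≅ K → G ≅ K
≅-trans (σ , p) (τ , q) = mk↔ₛ′ (Inverse.to τ ∘ Inverse.to σ) (Inverse.from σ ∘ Inverse.from τ)
  (λ z → trans (cong (Inverse.to τ) (Inverse.strictlyInverseˡ σ _)) (Inverse.strictlyInverseˡ τ z))
  (λ z → trans (cong (Inverse.from σ) (Inverse.strictlyInverseʳ τ _)) (Inverse.strictlyInverseʳ σ z))
  , λ i j → trans (p i j) (q _ _)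

-- Pullback along any map: `punchIn v` deletes a vertex, a listing of W gives G[W], a bijection
-- relabels.
induce : ∀ {m n} → SimpleGraph n → (Fin m → Fin n) → SimpleGraph m
induce G f = record { adj = λ i j → adj G (f i) (f j) ; sym = λ i j → sym G (f i) (f j) ; irrefl = λ i → irrefl G (f i) }

dsum-delete : ∀ {n} (G : SimpleGraph (suc n)) v → dsum G ≡ dsum (induce G (punchIn v)) + 2 * deg G v
dsum-delete G v = begin
  dsum G ≡⟨ ∑-remove (deg G) v ⟩
  d + ∑ (λ i → deg G (punchIn v i)) ≡⟨ cong (d +_) (trans (∑-cong row) (∑-+ (λ i → b2n (adj G v (punchIn v i))) (deg D))) ⟩
  d + (∑ (λ i → b2n (adj G v (punchIn v i))) + dsum D) ≡⟨ cong (λ z → d + (z + dsum D)) (≡sym degv) ⟩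
  d + (d + dsum D) ≡⟨ arith d (dsum D) ⟩
  dsum D + 2 * d ∎
  where
  open ≡-Reasoning
  d = deg G v
  D = induce G (punchIn v)
  rem : ∀ u → deg G u ≡ b2n (adj G u v) + ∑ (λ i → b2n (adj G u (punchIn v i)))
  rem u = trans (count≡∑ (adj G u)) (∑-remove (λ j → b2n (adj G u j)) v)
  row : ∀ i → deg G (punchIn v i) ≡ b2n (adj G v (punchIn v i)) + deg D i
  row i = trans (rem (punchIn v i)) (cong₂ _+_ (cong b2n (sym G (punchIn v i) v)) (≡sym (count≡∑ (adj D i))))
  degv : d ≡ ∑ (λ i → b2n (adj G v (punchIn v i)))
  degv = trans (rem v) (cong (λ b → b2n b + ∑ (λ i → b2n (adj G v (punchIn v i)))) (irrefl G v))
  arith : ∀ a b → a + (a + b) ≡ b + 2 * a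
  arith = solve-∀

-- Joins, unions and the balanced complete bipartite graph

==-inj : ∀ {m n} (f : Fin m → Fin n) → (∀ x y → f x ≡ f y → x ≡ y) → ∀ x y → (f x == f y) ≡ (x == y)
==-inj f inj x y with bool (x == y)
... | inj₁ e rewrite e | ==⁻ e = ==-refl (f y)
... | inj₂ e rewrite e = ==-f⁺ (λ q → ==-f⁻ e (inj x y q))

-- The clean-up done by `mkGraph` leaves a relation unchanged that is already symmetric and
-- loopless; hence joins and unions restrict to their parts.
symmetrise : ∀ {n} (G : SimpleGraph n) i j → (adj G i j ∨ adj G j i) ∧ not (i == j) ≡ adj G i j
symmetrise G i j with bool (i == j)
... | inj₁ e rewrite e | ==⁻ e = trans (Boolₚ.∧-zeroʳ _) (≡sym (irrefl G j))
... | inj₂ e rewrite e | sym G j i = trans (Boolₚ.∧-identityʳ _) (Boolₚ.∨-idem _)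

module _ {a b : ℕ} (G : SimpleGraph a) (H : SimpleGraph b) where

  private
    ll≡ : ∀ (i j : Fin a) → (i ↑ˡ b == j ↑ˡ b) ≡ (i == j)
    ll≡ = ==-inj (λ (i : Fin a) → i ↑ˡ b) (λ i j → Finₚ.↑ˡ-injective b i j)
    rr≡ : ∀ (i j : Fin b) → (a ↑ʳ i == a ↑ʳ j) ≡ (i == j)
    rr≡ = ==-inj (λ (i : Fin b) → a ↑ʳ i) (λ i j → Finₚ.↑ʳ-injective a i j)
    lr≢ : ∀ (i : Fin a) (j : Fin b) → (i ↑ˡ b == a ↑ʳ j) ≡ false
    lr≢ i j = ==-f⁺ (↑ˡ≢↑ʳ i j)

  join-ll : ∀ i j → adj (join G H) (i ↑ˡ b) (j ↑ˡ b) ≡ adj G i j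
  join-ll i j rewrite Finₚ.splitAt-↑ˡ a i b | Finₚ.splitAt-↑ˡ a j b =
    trans (cong (λ z → (adj G i j ∨ adj G j i) ∧ not z) (ll≡ i j)) (symmetrise G i j)

  join-rr : ∀ i j → adj (join G H) (a ↑ʳ i) (a ↑ʳ j) ≡ adj H i j
  join-rr i j rewrite Finₚ.splitAt-↑ʳ a b i | Finₚ.splitAt-↑ʳ a b j =
    trans (cong (λ z → (adj H i j ∨ adj H j i) ∧ not z) (rr≡ i j)) (symmetrise H i j)

  join-lr : ∀ i j → adj (join G H) (i ↑ˡ b) (a ↑ʳ j) ≡ true
  join-lr i j rewrite Finₚ.splitAt-↑ˡ a i b | Finₚ.splitAt-↑ʳ a b j = cong not (lr≢ i j)

  union-ll : ∀ i j → adj (union G H) (i ↑ˡ b) (j ↑ˡ b) ≡ adj G i j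
  union-ll i j rewrite Finₚ.splitAt-↑ˡ a i b | Finₚ.splitAt-↑ˡ a j b =
    trans (cong (λ z → (adj G i j ∨ adj G j i) ∧ not z) (ll≡ i j)) (symmetrise G i j)

  union-rr : ∀ i j → adj (union G H) (a ↑ʳ i) (a ↑ʳ j) ≡ adj H i j
  union-rr i j rewrite Finₚ.splitAt-↑ʳ a b i | Finₚ.splitAt-↑ʳ a b j =
    trans (cong (λ z → (adj H i j ∨ adj H j i) ∧ not z) (rr≡ i j)) (symmetrise H i j)

  union-lr : ∀ i j → adj (union G H) (i ↑ˡ b) (a ↑ʳ j) ≡ false
  union-lr i j rewrite Finₚ.splitAt-↑ˡ a i b | Finₚ.splitAt-↑ʳ a b j = refl

  private
    split-deg : (J : SimpleGraph (a + b)) → ∀ v → deg J v ≡ count (λ i → adj J v (i ↑ˡ b)) + count (λ j → adj J v (a ↑ʳ j))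
    split-deg J v = trans (count≡∑ (adj J v)) (trans (∑-++ a (λ i → b2n (adj J v i)))
      (cong₂ _+_ (≡sym (count≡∑ (λ i → adj J v (i ↑ˡ b)))) (≡sym (count≡∑ (λ j → adj J v (a ↑ʳ j))))))
    full : ∀ n → count {n} (λ _ → true) ≡ n
    full n = trans (count≡∑ {n} (λ _ → true)) (trans (∑-const n 1) (*-identityʳ n))

  deg-join-l : ∀ i → deg (join G H) (i ↑ˡ b) ≡ deg G i + b
  deg-join-l i = trans (split-deg (join G H) (i ↑ˡ b)) (cong₂ _+_ (count-cong (join-ll i)) (trans (count-cong (join-lr i)) (full b)))

  deg-join-r : ∀ j → deg (join G H) (a ↑ʳ j) ≡ a + deg H j
  deg-join-r j = trans (split-deg (join G H) (a ↑ʳ j))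
    (cong₂ _+_ (trans (count-cong (λ i → trans (sym (join G H) (a ↑ʳ j) (i ↑ˡ b)) (join-lr i j))) (full a)) (count-cong (join-rr j)))

  deg-union-l : ∀ i → deg (union G H) (i ↑ˡ b) ≡ deg G i
  deg-union-l i = trans (split-deg (union G H) (i ↑ˡ b))
    (trans (cong₂ _+_ (count-cong (union-ll i)) (trans (count-cong (union-lr i)) (count-none {b} (λ _ → false) (λ _ → refl)))) (+-identityʳ _))

  deg-union-r : ∀ j → deg (union G H) (a ↑ʳ j) ≡ deg H j
  deg-union-r j = trans (split-deg (union G H) (a ↑ʳ j))
    (cong₂ _+_ (trans (count-cong (λ i → trans (sym (union G H) (a ↑ʳ j) (i ↑ˡ b)) (union-lr i j))) (count-none {a} (λ _ → false) (λ _ → refl))) (count-cong (union-rr j)))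

  dsum-union : dsum (union G H) ≡ dsum G + dsum H
  dsum-union = trans (∑-++ a (deg (union G H))) (cong₂ _+_ (∑-cong deg-union-l) (∑-cong deg-union-r))

  dsum-join : dsum (join G H) ≡ dsum G + dsum H + 2 * (a * b)
  dsum-join = trans (∑-++ a (deg (join G H)))
    (trans (cong₂ _+_ (trans (∑-cong deg-join-l) (trans (∑-+ (deg G) (λ _ → b)) (cong (dsum G +_) (∑-const a b))))
                      (trans (∑-cong deg-join-r) (trans (∑-+ (λ _ → a) (deg H)) (cong (_+ dsum H) (∑-const b a)))))
           (arith (dsum G) (dsum H) a b))
    where
    arith : ∀ g h a b → (g + a * b) + (b * a + h) ≡ g + h + 2 * (a * b)
    arith = solve-∀

↑-cases : ∀ a {b} (v : Fin (a + b)) → (∃ λ i → v ≡ i ↑ˡ b) ⊎ (∃ λ j → v ≡ a ↑ʳ j)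
↑-cases a {b} v with splitAt a v in e
... | inj₁ i = inj₁ (i , ≡sym (Finₚ.splitAt⁻¹-↑ˡ e))
... | inj₂ j = inj₂ (j , ≡sym (Finₚ.splitAt⁻¹-↑ʳ e))

half : ∀ m → m ≡ 2 * (m / 2) ⊎ m ≡ 1 + 2 * (m / 2)
half m = go (m % 2) (DivMod.m%n<n m 2) (DivMod.m≡m%n+[m/n]*n m 2)
  where
  go : ∀ r → r < 2 → m ≡ r + (m / 2) * 2 → m ≡ 2 * (m / 2) ⊎ m ≡ 1 + 2 * (m / 2)
  go 0 _ e = inj₁ (trans e (*-comm (m / 2) 2))
  go 1 _ e = inj₂ (trans e (cong suc (*-comm (m / 2) 2)))
  go (suc (suc r)) (s≤s (s≤s ())) e

half-even : ∀ h → (2 * h) / 2 ≡ h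
half-even h with half (2 * h)
... | inj₁ e = ≡sym (*-cancelˡ-≡ h _ 2 e)
... | inj₂ e = ⊥-elim (even≢odd h ((2 * h) / 2) e)

half-odd : ∀ h → (1 + 2 * h) / 2 ≡ h
half-odd h with half (1 + 2 * h)
... | inj₂ e = ≡sym (*-cancelˡ-≡ h _ 2 (ℕₚ.suc-injective e))
... | inj₁ e = ⊥-elim (even≢odd ((1 + 2 * h) / 2) h (≡sym e))

turanEdges : ℕ → ℕ
turanEdges m = (m / 2) * (m ∸ m / 2)

private
  te-even : ∀ h → turanEdges (2 * h) ≡ h * h
  te-even h rewrite half-even h = cong (h *_) (trans (cong (_∸ h) (arith h)) (m+n∸n≡m h h))
    where
    arith : ∀ h → 2 * h ≡ h + h
    arith = solve-∀
  te-odd : ∀ h → turanEdges (1 + 2 * h) ≡ h * (1 + h)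
  te-odd h rewrite half-odd h = cong (h *_) (trans (cong (_∸ h) (arith h)) (m+n∸n≡m (1 + h) h))
    where
    arith : ∀ h → 1 + 2 * h ≡ (1 + h) + h
    arith = solve-∀

parity : ∀ m → ∃ λ h → m ≡ 2 * h ⊎ m ≡ 1 + 2 * h
parity m with half m
... | inj₁ e = m / 2 , inj₁ e
... | inj₂ e = m / 2 , inj₂ e

-- The increment is m/2 rounded up. Only the rate m/2 matters: it is what the deletion of low-degree
-- vertices is compared with.
turanEdges-suc : ∀ m → ∃ λ c → turanEdges (suc m) ≡ turanEdges m + c × m ≤ 2 * c
turanEdges-suc m with parity m
... | h , inj₁ refl = h , trans (te-odd h) (trans (arith h) (cong (_+ h) (≡sym (te-even h)))) , ≤-refl
  where
  arith : ∀ h → h * (1 + h) ≡ h * h + h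
  arith = solve-∀
... | h , inj₂ refl = 1 + h , trans (cong turanEdges (a1 h)) (trans (te-even (1 + h)) (trans (a2 h) (cong (_+ (1 + h)) (≡sym (te-odd h))))) , ≤-trans (n≤1+n _) (≤-reflexive (a1 h))
  where
  a1 : ∀ h → 2 + 2 * h ≡ 2 * (1 + h)
  a1 = solve-∀
  a2 : ∀ h → (1 + h) * (1 + h) ≡ h * (1 + h) + (1 + h)
  a2 = solve-∀

turanEdges-lower : ∀ m → m * m ≤ 4 * turanEdges m + 1
turanEdges-lower m with parity m
... | h , inj₁ refl rewrite te-even h = ≤-trans (≤-reflexive (arith h)) (m≤m+n _ 1)
  where
  arith : ∀ h → (2 * h) * (2 * h) ≡ 4 * (h * h)
  arith = solve-∀
... | h , inj₂ refl rewrite te-odd h = ≤-reflexive (arith h)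
  where
  arith : ∀ h → (1 + 2 * h) * (1 + 2 * h) ≡ 4 * (h * (1 + h)) + 1
  arith = solve-∀

-- With b = a + d, the balanced product exceeds a * b by k² if d = 2k and by k(k + 1) if d = 2k + 1;
-- either excess vanishes only for k = 0.
turanEdges-upper : ∀ a b → a ≤ b → a * b ≤ turanEdges (a + b) × (turanEdges (a + b) ≤ a * b → (a + b) / 2 ≡ a)
turanEdges-upper a b a≤b with m≤n⇒∃[o]m+o≡n a≤b
... | d , refl with parity d
...   | k , inj₁ refl = le , eq
  where
  sz : ∀ a k → a + (a + 2 * k) ≡ 2 * (a + k)
  sz = solve-∀
  te : turanEdges (a + (a + 2 * k)) ≡ a * (a + 2 * k) + k * k
  te = trans (cong turanEdges (sz a k)) (trans (te-even (a + k)) (arith a k))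
    where
    arith : ∀ a k → (a + k) * (a + k) ≡ a * (a + 2 * k) + k * k
    arith = solve-∀
  le = ≤-trans (m≤m+n _ (k * k)) (≤-reflexive (≡sym te))
  z : ∀ k → k * k ≤ 0 → k ≡ 0
  z zero _ = refl
  eq : turanEdges (a + (a + 2 * k)) ≤ a * (a + 2 * k) → (a + (a + 2 * k)) / 2 ≡ a
  eq p = trans (cong (_/ 2) (sz a k)) (trans (half-even (a + k)) (trans (cong (a +_) k0) (+-identityʳ a)))
    where
    k0 : k ≡ 0
    k0 = z k (+-cancelˡ-≤ (a * (a + 2 * k)) _ _ (≤-trans (≤-reflexive (≡sym te)) (≤-trans p (≤-reflexive (≡sym (+-identityʳ _))))))
...   | k , inj₂ refl = le , eq
  where
  sz : ∀ a k → a + (a + (1 + 2 * k)) ≡ 1 + 2 * (a + k)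
  sz = solve-∀
  te : turanEdges (a + (a + (1 + 2 * k))) ≡ a * (a + (1 + 2 * k)) + k * (1 + k)
  te = trans (cong turanEdges (sz a k)) (trans (te-odd (a + k)) (arith a k))
    where
    arith : ∀ a k → (a + k) * (1 + (a + k)) ≡ a * (a + (1 + 2 * k)) + k * (1 + k)
    arith = solve-∀
  le = ≤-trans (m≤m+n _ (k * (1 + k))) (≤-reflexive (≡sym te))
  z : ∀ k → k * (1 + k) ≤ 0 → k ≡ 0
  z zero _ = refl
  eq : turanEdges (a + (a + (1 + 2 * k))) ≤ a * (a + (1 + 2 * k)) → (a + (a + (1 + 2 * k))) / 2 ≡ a
  eq p = trans (cong (_/ 2) (sz a k)) (trans (half-odd (a + k)) (trans (cong (a +_) k0) (+-identityʳ a)))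
    where
    k0 : k ≡ 0
    k0 = z k (+-cancelˡ-≤ (a * (a + (1 + 2 * k))) _ _ (≤-trans (≤-reflexive (≡sym te)) (≤-trans p (≤-reflexive (≡sym (+-identityʳ _))))))

side< : ∀ {m} → ℕ → Fin m → Bool
side< h i = toℕ i <ᵇ h

turan2-adj : ∀ m i j → adj (turan2 m) i j ≡ (side< (m / 2) i ∧ not (side< (m / 2) j)) ∨ (side< (m / 2) j ∧ not (side< (m / 2) i))
turan2-adj m i j with bool (i == j)
... | inj₂ e rewrite e = Boolₚ.∧-identityʳ _
... | inj₁ e with ==⁻ e
...   | refl rewrite e = trans (Boolₚ.∧-zeroʳ _) (≡sym (lem (toℕ i <ᵇ m / 2)))
  where
  lem : ∀ s → (s ∧ not s) ∨ (s ∧ not s) ≡ false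
  lem true = refl
  lem false = refl

bip : ∀ a b → SimpleGraph (a + b)
bip a b = join (emptyG a) (emptyG b)

turan2-bip : ∀ a b → (a + b) / 2 ≡ a → ∀ i j → adj (turan2 (a + b)) i j ≡ adj (bip a b) i j
turan2-bip a b e i j = trans (turan2-adj (a + b) i j) (lem (↑-cases a i) (↑-cases a j))
  where
  L : ∀ (i : Fin a) → side< ((a + b) / 2) (i ↑ˡ b) ≡ true
  L i = trans (cong₂ _<ᵇ_ (Finₚ.toℕ-↑ˡ i b) e) (<ᵇ⁺ (Finₚ.toℕ<n i))
  R : ∀ (j : Fin b) → side< ((a + b) / 2) (a ↑ʳ j) ≡ false
  R j = trans (cong₂ _<ᵇ_ (Finₚ.toℕ-↑ʳ a j) e) (<ᵇ-f⁺ (m≤m+n a (toℕ j)))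
  lem : (∃ λ k → i ≡ k ↑ˡ b) ⊎ (∃ λ k → i ≡ a ↑ʳ k) → (∃ λ k → j ≡ k ↑ˡ b) ⊎ (∃ λ k → j ≡ a ↑ʳ k) →
    (side< ((a + b) / 2) i ∧ not (side< ((a + b) / 2) j)) ∨ (side< ((a + b) / 2) j ∧ not (side< ((a + b) / 2) i)) ≡ adj (bip a b) i j
  lem (inj₁ (x , refl)) (inj₁ (y , refl)) rewrite L x | L y = ≡sym (join-ll (emptyG a) (emptyG b) x y)
  lem (inj₁ (x , refl)) (inj₂ (y , refl)) rewrite L x | R y = ≡sym (join-lr (emptyG a) (emptyG b) x y)
  lem (inj₂ (x , refl)) (inj₁ (y , refl)) rewrite R x | L y = ≡sym (trans (sym (bip a b) (a ↑ʳ x) (y ↑ˡ b)) (join-lr (emptyG a) (emptyG b) y x))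
  lem (inj₂ (x , refl)) (inj₂ (y , refl)) rewrite R x | R y = ≡sym (join-rr (emptyG a) (emptyG b) x y)

dsum-empty : ∀ n → dsum (emptyG n) ≡ 0
dsum-empty n = ∑-zero (λ i → count-none {n} (λ _ → false) (λ _ → refl))

dsum-bip : ∀ a b → dsum (bip a b) ≡ 2 * (a * b)
dsum-bip a b = trans (dsum-join (emptyG a) (emptyG b)) (cong₂ (λ x y → x + y + 2 * (a * b)) (dsum-empty a) (dsum-empty b))

dsum-turan2 : ∀ m → dsum (turan2 m) ≡ 2 * turanEdges m
dsum-turan2 m = lem (m / 2) (m ∸ m / 2) (m+[n∸m]≡n (DivMod.m/n≤m m 2)) refl
  where
  lem : ∀ a b → a + b ≡ m → m / 2 ≡ a → dsum (turan2 m) ≡ 2 * (a * b)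
  lem a b refl e = trans (dsum-cong (turan2 (a + b)) (bip a b) (turan2-bip a b e)) (dsum-bip a b)

-- Matchings inside a vertex set

-- The variables say whether u or v equals x or y. A pair is charged once for each such incidence,
-- so a pair meeting the edge xy is charged at least once and the two orientations of xy itself
-- twice.
edgeEnds≤ : ∀ xu yu xv yv → (xu ∨ yu) ∨ (xv ∨ yv) ≡ true →
  1 + b2n (xu ∧ yv) + b2n (yu ∧ xv) ≤ b2n xu + b2n yu + b2n xv + b2n yv
edgeEnds≤ false false false true  _ = s≤s z≤n
edgeEnds≤ false false true  false _ = s≤s z≤n
edgeEnds≤ false false true  true  _ = s≤s z≤n
edgeEnds≤ false true  false false _ = s≤s z≤n
edgeEnds≤ false true  false true  _ = s≤s z≤n
edgeEnds≤ false true  true  false _ = s≤s (s≤s z≤n)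
edgeEnds≤ false true  true  true  _ = s≤s (s≤s z≤n)
edgeEnds≤ true  false false false _ = s≤s z≤n
edgeEnds≤ true  false false true  _ = s≤s (s≤s z≤n)
edgeEnds≤ true  false true  false _ = s≤s z≤n
edgeEnds≤ true  false true  true  _ = s≤s (s≤s z≤n)
edgeEnds≤ true  true  false false _ = s≤s z≤n
edgeEnds≤ true  true  false true  _ = s≤s (s≤s z≤n)
edgeEnds≤ true  true  true  false _ = s≤s (s≤s z≤n)
edgeEnds≤ true  true  true  true  _ = s≤s (s≤s (s≤s z≤n))

record Matching {n} (G : SimpleGraph n) (P : Fin n → Bool) (s : ℕ) : Set where
  field
    w a   : Fin s → Fin n
    w∈    : ∀ i → P (w i) ≡ true
    a∈    : ∀ i → P (a i) ≡ true
    w~a   : ∀ i → adj G (w i) (a i) ≡ true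
    w-inj : ∀ i j → w i ≡ w j → i ≡ j
    a-inj : ∀ i j → a i ≡ a j → i ≡ j
    w≢a   : ∀ i j → w i ≢ a j

within : ∀ {n} (G : SimpleGraph n) (P : Fin n → Bool) → Fin n → Fin n → Bool
within G P x y = P x ∧ (P y ∧ adj G x y)

module _ {n} (G : SimpleGraph n) (Δ : ℕ) where

  private
    remove2 : (Fin n → Bool) → Fin n → Fin n → Fin n → Bool
    remove2 P x y z = P z ∧ not ((x == z) ∨ (y == z))

    cons : ∀ {P s} x y → P x ≡ true → P y ≡ true → adj G x y ≡ true → Matching G (remove2 P x y) s → Matching G P (suc s)
    cons {P} x y px py xy M = record
      { w = λ { zero → x ; (suc i) → w i } ; a = λ { zero → y ; (suc i) → a i }
      ; w∈ = λ { zero → px ; (suc i) → proj₁ (∧⁻ {P (w i)} (w∈ i)) } ; a∈ = λ { zero → py ; (suc i) → proj₁ (∧⁻ {P (a i)} (a∈ i)) }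
      ; w~a = λ { zero → xy ; (suc i) → w~a i }
      ; w-inj = λ { zero zero _ → refl ; zero (suc j) e → ⊥-elim (x≢ (w∈ j) e) ; (suc i) zero e → ⊥-elim (x≢ (w∈ i) (≡sym e)) ; (suc i) (suc j) e → cong suc (w-inj i j e) }
      ; a-inj = λ { zero zero _ → refl ; zero (suc j) e → ⊥-elim (y≢ (a∈ j) e) ; (suc i) zero e → ⊥-elim (y≢ (a∈ i) (≡sym e)) ; (suc i) (suc j) e → cong suc (a-inj i j e) }
      ; w≢a = λ { zero zero refl → t≢f xy (irrefl G x) ; zero (suc j) e → x≢ (a∈ j) e ; (suc i) zero e → y≢ (w∈ i) (≡sym e) ; (suc i) (suc j) e → w≢a i j e }
      }
      where
      open Matching M
      x≢ : ∀ {z} → remove2 P x y z ≡ true → x ≢ z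
      x≢ {z} r refl = t≢f (cong (_∨ (y == z)) (==-refl z)) (not⁻ (proj₂ (∧⁻ {P z} r)))
      y≢ : ∀ {z} → remove2 P x y z ≡ true → y ≢ z
      y≢ {z} r refl = t≢f (trans (cong ((x == z) ∨_) (==-refl z)) (Boolₚ.∨-zeroʳ _)) (not⁻ (proj₂ (∧⁻ {P z} r)))

    -- Only pairs in the rows and columns of x and y disappear, at most 4Δ of them with
    -- multiplicity; (x , y) and (y , x) lie in a row and in a column, which saves 2.
    step : ∀ P x y → within G P x y ≡ true → (∀ z → P z ≡ true → count (λ v → P v ∧ adj G z v) ≤ Δ) →
      pairs (within G P) + 2 ≤ pairs (within G (remove2 P x y)) + 4 * Δ
    step P x y r bound = begin
      pairs R + 2
        ≡⟨ cong₂ _+_ (pairs≡∑∑ R) (cong₂ _+_ (≡sym (one x y)) (≡sym (one y x))) ⟩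
      ∑∑ (λ u v → b2n (R u v)) + (∑∑ (λ u v → b2n ((x == u) ∧ (y == v))) + ∑∑ (λ u v → b2n ((y == u) ∧ (x == v))))
        ≡⟨ cong (∑∑ (λ u v → b2n (R u v)) +_) (≡sym (∑∑-+ (λ u v → b2n ((x == u) ∧ (y == v))) (λ u v → b2n ((y == u) ∧ (x == v))))) ⟩
      ∑∑ (λ u v → b2n (R u v)) + ∑∑ (λ u v → b2n ((x == u) ∧ (y == v)) + b2n ((y == u) ∧ (x == v)))
        ≡⟨ ≡sym (∑∑-+ (λ u v → b2n (R u v)) (λ u v → b2n ((x == u) ∧ (y == v)) + b2n ((y == u) ∧ (x == v)))) ⟩
      ∑∑ (λ u v → b2n (R u v) + (b2n ((x == u) ∧ (y == v)) + b2n ((y == u) ∧ (x == v))))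
        ≤⟨ ∑-mono (λ u → ∑-mono (λ v → pt u v)) ⟩
      ∑∑ (λ u v → b2n (R′ u v) + ((b2n (x == u) * b2n (R u v) + b2n (y == u) * b2n (R u v)) + (b2n (x == v) * b2n (R u v) + b2n (y == v) * b2n (R u v))))
        ≡⟨ trans (∑∑-+ (λ u v → b2n (R′ u v)) _) (cong₂ _+_ (≡sym (pairs≡∑∑ R′)) (trans (∑∑-+ (λ u v → b2n (x == u) * b2n (R u v) + b2n (y == u) * b2n (R u v)) _)
            (cong₂ _+_ (∑∑-+ (λ u v → b2n (x == u) * b2n (R u v)) (λ u v → b2n (y == u) * b2n (R u v)))
                       (∑∑-+ (λ u v → b2n (x == v) * b2n (R u v)) (λ u v → b2n (y == v) * b2n (R u v)))))) ⟩
      pairs R′ + ((rowsum x + rowsum y) + (colsum x + colsum y))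
        ≤⟨ +-monoʳ-≤ (pairs R′) (+-mono-≤ (+-mono-≤ (row≤ x px) (row≤ y py)) (+-mono-≤ (col≤ x px) (col≤ y py))) ⟩
      pairs R′ + ((Δ + Δ) + (Δ + Δ)) ≡⟨ cong (pairs R′ +_) (arith Δ) ⟩
      pairs R′ + 4 * Δ ∎
      where
      open ≤-Reasoning
      R = within G P
      R′ = within G (remove2 P x y)
      ∑∑ : (Fin n → Fin n → ℕ) → ℕ
      ∑∑ f = ∑ (λ u → ∑ (f u))
      px = proj₁ (∧⁻ {P x} r)
      py = proj₁ (∧⁻ {P y} (proj₂ (∧⁻ {P x} r)))
      arith : ∀ d → (d + d) + (d + d) ≡ 4 * d
      arith = solve-∀
      one : ∀ x y → ∑∑ (λ u v → b2n ((x == u) ∧ (y == v))) ≡ 1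
      one x y = trans (≡sym (pairs≡∑∑ (λ u v → (x == u) ∧ (y == v)))) (trans (pairs-row (x ==_) (λ _ → y ==_))
        (trans (∑-== x (λ _ → count (y ==_))) (count-== y)))
      R-sym : ∀ u v → R u v ≡ true → R v u ≡ true
      R-sym u v e = let p , q = ∧⁻ {P u} e ; q₁ , q₂ = ∧⁻ {P v} q in ∧⁺ q₁ (∧⁺ p (trans (sym G v u) q₂))
      rowsum colsum : Fin n → ℕ
      rowsum z = ∑∑ (λ u v → b2n (z == u) * b2n (R u v))
      colsum z = ∑∑ (λ u v → b2n (z == v) * b2n (R u v))
      rowR : ∀ z → P z ≡ true → count (R z) ≤ Δ
      rowR z pz = ≤-trans (count-mono (λ v e → proj₂ (∧⁻ {P z} e))) (bound z pz)
      row≤ : ∀ z → P z ≡ true → rowsum z ≤ Δ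
      row≤ z pz = ≤-trans (≤-reflexive (trans (∑-cong (λ u → trans (∑-*ˡ (b2n (z == u)) (λ v → b2n (R u v))) (cong (b2n (z == u) *_) (≡sym (count≡∑ (R u)))))) (∑-== z (λ u → count (R u))))) (rowR z pz)
      col≤ : ∀ z → P z ≡ true → colsum z ≤ Δ
      col≤ z pz = ≤-trans (≤-reflexive (trans (∑-swap (λ u v → b2n (z == v) * b2n (R u v)))
        (trans (∑-cong (λ v → trans (∑-*ˡ (b2n (z == v)) (λ u → b2n (R u v))) (cong (b2n (z == v) *_) (≡sym (count≡∑ (λ u → R u v))))))
          (∑-== z (λ v → count (λ u → R u v)))))) (≤-trans (count-mono (λ u e → R-sym u z e)) (rowR z pz))
      none : ∀ x y → R x y ≡ true → ∀ u v → R u v ≡ false → (x == u) ∧ (y == v) ≡ false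
      none x y r u v e with bool ((x == u) ∧ (y == v))
      ... | inj₂ q = q
      ... | inj₁ q with ∧⁻ {x == u} q
      ...   | q₁ , q₂ rewrite ==⁻ q₁ | ==⁻ q₂ = t≢f r e
      pt : ∀ u v → b2n (R u v) + (b2n ((x == u) ∧ (y == v)) + b2n ((y == u) ∧ (x == v))) ≤
        b2n (R′ u v) + ((b2n (x == u) * b2n (R u v) + b2n (y == u) * b2n (R u v)) + (b2n (x == v) * b2n (R u v) + b2n (y == v) * b2n (R u v)))
      pt u v with bool (R u v)
      ... | inj₂ e rewrite e | none x y r u v e | none y x (R-sym x y r) u v e = z≤n
      ... | inj₁ e with bool (((x == u) ∨ (y == u)) ∨ ((x == v) ∨ (y == v)))
      ...   | inj₁ q rewrite e | *-identityʳ (b2n (x == u)) | *-identityʳ (b2n (y == u)) | *-identityʳ (b2n (x == v)) | *-identityʳ (b2n (y == v)) =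
            ≤-trans (edgeEnds≤ (x == u) (y == u) (x == v) (y == v) q) (≤-trans (≤-reflexive (+-assoc (b2n (x == u) + b2n (y == u)) _ _)) (m≤n+m _ (b2n (R′ u v))))
      ...   | inj₂ q rewrite e = fin (x == u) (y == u) (x == v) (y == v) q refl refl refl refl
        where
        fin : ∀ a b c d → (a ∨ b) ∨ (c ∨ d) ≡ false → (x == u) ≡ a → (y == u) ≡ b → (x == v) ≡ c → (y == v) ≡ d →
          1 + (b2n (a ∧ d) + b2n (b ∧ c)) ≤ b2n (R′ u v) + ((b2n a * 1 + b2n b * 1) + (b2n c * 1 + b2n d * 1))
        fin false false false false _ ea eb ec ed rewrite ea | eb | ec | ed | proj₁ (∧⁻ {P u} e) | proj₁ (∧⁻ {P v} (proj₂ (∧⁻ {P u} e))) | proj₂ (∧⁻ {P v} (proj₂ (∧⁻ {P u} e))) = ≤-refl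

  matchArith : ∀ S S1 k D → S + 2 ≤ S1 + 4 * D → S1 + 2 * k ≤ 4 * (k * D) → S + 2 * (1 + k) ≤ 4 * ((1 + k) * D)
  matchArith S S1 k D h1 h2 = lin (0) (h1 ⊕ h2) (solve (S ∷ S1 ∷ k ∷ D ∷ []))

  -- Greedy removal of edges. The saving `2 * k` makes the bound sharp for Δ = 1, where it reads
  -- pairs ≤ 2k; recognising the extremal matching relies on this.
  matching? : ∀ s P → (∀ z → P z ≡ true → count (λ v → P v ∧ adj G z v) ≤ Δ) →
    Matching G P s ⊎ (∃ λ k → k < s × pairs (within G P) + 2 * k ≤ 4 * (k * Δ))
  matching? zero P _ = inj₁ (record { w = λ () ; a = λ () ; w∈ = λ () ; a∈ = λ () ; w~a = λ () ; w-inj = λ () ; a-inj = λ () ; w≢a = λ () })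
  matching? (suc s) P bound with find? (λ x → P x ∧ (0 <ᵇ count (λ y → P y ∧ adj G x y)))
  ... | inj₂ none = inj₂ (0 , s≤s z≤n , ≤-reflexive (cong (_+ 0) (∑-zero zero-row)))
    where
    zero-row : ∀ x → count (within G P x) ≡ 0
    zero-row x with bool (P x)
    ... | inj₂ e rewrite e = count-none {n} (λ _ → false) (λ _ → refl)
    ... | inj₁ e = n≤0⇒n≡0 (≤-trans (count-mono (λ y r → proj₂ (∧⁻ {P x} r))) (<ᵇ-f⁻ (trans (cong (_∧ (0 <ᵇ count (λ y → P y ∧ adj G x y))) (≡sym e)) (none x))))
  ... | inj₁ (x , e) with find (λ y → P y ∧ adj G x y) (<ᵇ⁻ (proj₂ (∧⁻ {P x} e)))
  ...   | y , e′ with matching? s (remove2 P x y) (λ z pz → ≤-trans (count-mono (λ v r → ∧⁺ (proj₁ (∧⁻ {P v} (proj₁ (∧⁻ {remove2 P x y v} r)))) (proj₂ (∧⁻ {remove2 P x y v} r)))) (bound z (proj₁ (∧⁻ {P z} pz))))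
  ...     | inj₁ M = inj₁ (cons x y (proj₁ (∧⁻ {P x} e)) (proj₁ (∧⁻ {P y} e′)) (proj₂ (∧⁻ {P y} e′)) M)
  ...     | inj₂ (k , k<s , h) = inj₂ (suc k , s≤s k<s , matchArith (pairs (within G P)) (pairs (within G (remove2 P x y))) k Δ (step P x y (∧⁺ (proj₁ (∧⁻ {P x} e)) e′) bound) h)

-- A finite list of all vertices of an odd-ballooning

uip : ∀ {A : Set} {x y : A} (p q : x ≡ y) → p ≡ q
uip refl refl = refl

-- Inner vertices carry a proof that their edge exists; uniqueness of this proof makes the edge and
-- the position determine the vertex.
edge-irrelevant : ∀ {k} (F : SimpleGraph k) {u v} (p q : IsEdge F u v) → p ≡ q
edge-irrelevant F (a , b) (c , d) = cong₂ _,_ (≤-irrelevant a c) (uip b d)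

edge? : ∀ {k} (F : SimpleGraph k) u v → Dec (IsEdge F u v)
edge? F u v with toℕ u <? toℕ v | bool (adj F u v)
... | yes p | inj₁ q = yes (p , q)
... | yes p | inj₂ q = no λ r → t≢f (proj₂ r) q
... | no p  | _      = no λ r → p (proj₁ r)

module _ {k : ℕ} (F : SimpleGraph k) (ℓ : Fin k → Fin k → ℕ) where

  private
    innerOn : ∀ u v → Dec (IsEdge F u v) → List (Inner F ℓ)
    innerOn u v (yes e) = map (λ i → u , v , e , i) (allFin (ℓ u v ∸ 2))
    innerOn u v (no _)  = []

    innerOn-∈ : ∀ u v (d : Dec (IsEdge F u v)) e i → (u , v , e , i) ∈ innerOn u v d
    innerOn-∈ u v (yes e′) e i rewrite edge-irrelevant F e e′ = ∈-map⁺ (λ i → u , v , e′ , i) (∈-allFin i)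
    innerOn-∈ u v (no ¬e) e i = ⊥-elim (¬e e)

  balloonVertices : List (BV F ℓ)
  balloonVertices = map inj₁ (allFin k) ++
    map inj₂ (concatMap (λ u → concatMap (λ v → innerOn u v (edge? F u v)) (allFin k)) (allFin k))

  balloonVertices-complete : ∀ x → x ∈ balloonVertices
  balloonVertices-complete (inj₁ u) = ∈-++⁺ˡ (∈-map⁺ inj₁ (∈-allFin u))
  balloonVertices-complete (inj₂ (u , v , e , i)) = ∈-++⁺ʳ (map inj₁ (allFin k)) (∈-map⁺ inj₂
    (∈-concatMap⁺ (λ u → concatMap (λ v → innerOn u v (edge? F u v)) (allFin k)) (Anyₚ.tabulate⁺ u
      (∈-concatMap⁺ (λ v → innerOn u v (edge? F u v)) (Anyₚ.tabulate⁺ v (innerOn-∈ u v (edge? F u v) e i))))))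

-- Greedy embedding of odd-balloonings

avoid : ∀ {n} k (Q : Fin k → Fin n → Bool) c (P : Fin n → Bool) → (∀ j → count (λ z → P z ∧ Q j z) ≤ c) →
  k * c < count P → ∃ λ z → P z ≡ true × (∀ j → Q j z ≡ false)
avoid zero Q c P _ h = let z , e = find P h in z , e , λ ()
avoid (suc k) Q c P b h with avoid k (Q ∘ suc) c (λ z → P z ∧ not (Q zero z))
  (λ j → ≤-trans (count-mono (λ z e → ∧⁺ (proj₁ (∧⁻ {P z} (proj₁ (∧⁻ {P z ∧ not (Q zero z)} e)))) (proj₂ (∧⁻ {P z ∧ not (Q zero z)} e)))) (b (suc j)))
  (+-cancelˡ-< c _ _ (≤-trans h (≤-trans (≤-reflexive (count-split P (Q zero))) (+-monoˡ-≤ _ (b zero)))))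
... | z , e , f = z , proj₁ (∧⁻ {P z} e) , λ { zero → not⁻ (proj₂ (∧⁻ {P z} e)) ; (suc j) → f j }

b≢not : ∀ b {X : Set} → b ≡ not b → X
b≢not true ()
b≢not false ()

ev : ℕ → Bool
ev zero    = true
ev (suc i) = not (ev i)

ev-2* : ∀ k → ev (2 * k) ≡ true
ev-2* zero = refl
ev-2* (suc k) rewrite +-suc k (k + 0) = trans (Boolₚ.not-involutive _) (ev-2* k)

-- What makes a cycle through x y odd although x and y lie on opposite sides: a vertex seeing
-- both sides, or an edge inside one side.
data Breaker (n : ℕ) : Set where
  hub  : Fin n → Breaker n
  edge : Fin n → Fin n → Breaker n

verts : ∀ {n} → Breaker n → List (Fin n)
verts (hub w)    = w ∷ []
verts (edge w a) = w ∷ a ∷ []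

private
  roomArith : ∀ h m c D F → h * (2 + m) < c → c ≤ D + F → F ≤ h → h * (1 + m) < D
  roomArith h m c D F h1 h2 h3 = lin (0) (h1 ⊕ h2 ⊕ h3) (solve (h ∷ m ∷ c ∷ D ∷ F ∷ []))

module Embed {n : ℕ} (G : SimpleGraph n) (side : Bool → Fin n → Bool) (m h : ℕ)
  (cross : ∀ s z → side s z ≡ true → count (λ y → side (not s) y ∧ not (adj G z y)) ≤ m) where

  allAdj : List (Fin n) → Fin n → Bool
  allAdj []      z = true
  allAdj (x ∷ d) z = adj G x z ∧ allAdj d z

  allAdj⁻ : ∀ {d z x} → allAdj d z ≡ true → x ∈ d → adj G x z ≡ true
  allAdj⁻ {y ∷ d} {z} e (here refl) = proj₁ (∧⁻ {adj G y z} e)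
  allAdj⁻ {y ∷ d} {z} e (there p) = allAdj⁻ {d} (proj₂ (∧⁻ {adj G y z} e)) p

  allAdj⁺ : ∀ {d z} → (∀ x → x ∈ d → adj G x z ≡ true) → allAdj d z ≡ true
  allAdj⁺ {[]}    f = refl
  allAdj⁺ {x ∷ d} f = ∧⁺ (f x (here refl)) (allAdj⁺ (λ y p → f y (there p)))

  -- Room for the greedy choice of at most h vertices: each vertex chosen before excludes itself and
  -- at most m non-neighbours, h * (1 + m) altogether, and up to h fixed vertices are excluded as
  -- well.
  record Good (s : Bool) (d : List (Fin n)) : Set where
    constructor good
    field room : h * (2 + m) < count (λ z → side s z ∧ allAdj d z)
  open Good

  Good-⊆ : ∀ {s d d′} → (∀ x → x ∈ d′ → x ∈ d) → Good s d → Good s d′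
  Good-⊆ {s} {d} {d′} f g = good (≤-trans (room g) (count-mono (λ z e → ∧⁺ (proj₁ (∧⁻ {side s z} e))
    (allAdj⁺ (λ x p → allAdj⁻ {d} (proj₂ (∧⁻ {side s z} e)) (f x p))))))

  Good₀ : ∀ {s d} → Good s d → Good s []
  Good₀ = Good-⊆ (λ x ())

  Good₁ : ∀ {s d x} → x ∈ d → Good s d → Good s (x ∷ [])
  Good₁ p = Good-⊆ (λ { z (here refl) → p ; z (there ()) })

  Good₂ : ∀ {s d x y} → x ∈ d → y ∈ d → Good s d → Good s (x ∷ y ∷ [])
  Good₂ p q = Good-⊆ (λ { z (here refl) → p ; z (there (here refl)) → q ; z (there (there ())) })

  -- A vertex of the ballooning is either sent to a given vertex or chosen greedily inside one
  -- side of the bipartition, adjacent to the given vertices in the list.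
  data Role : Set where
    fixed : Fin n → Role
    free  : Bool → List (Fin n) → Role

  -- The reason why the images of two roles will be adjacent: a free vertex sees all of its list,
  -- and free vertices on opposite sides are always chosen adjacent.
  Compat : Role → Role → Set
  Compat (fixed x)  (fixed y)    = adj G x y ≡ true
  Compat (fixed x)  (free s d)   = x ∈ d
  Compat (free s d) (fixed x)    = x ∈ d
  Compat (free s d) (free s′ d′) = s′ ≡ not s

  not-swap : ∀ {a b} → a ≡ not b → b ≡ not a
  not-swap {b = b} refl = ≡sym (Boolₚ.not-involutive b)

  Compat-sym : ∀ p q → Compat p q → Compat q p
  Compat-sym (fixed x)  (fixed y)    c = trans (sym G y x) c
  Compat-sym (fixed x)  (free s d)   c = c
  Compat-sym (free s d) (fixed x)    c = c
  Compat-sym (free s d) (free s′ d′) c = not-swap c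

  RoleGood : Role → Set
  RoleGood (fixed x)  = ⊤
  RoleGood (free s d) = Good s d

  -- Every two chosen vertices on opposite sides are made adjacent, whether or not an edge is
  -- wanted, so the choice is independent of the graph to be embedded.
  greedy : ∀ k (Dom : Fin k → Fin n → Bool) (σ : Fin k → Bool) → (∀ i z → Dom i z ≡ true → side (σ i) z ≡ true) →
    (∀ i → k * (1 + m) < count (Dom i)) →
    Σ[ g ∈ (Fin k → Fin n) ] (∀ i → Dom i (g i) ≡ true) × (∀ i j → g i ≡ g j → i ≡ j) ×
      (∀ i j → σ j ≡ not (σ i) → adj G (g i) (g j) ≡ true)
  greedy zero Dom σ _ _ = (λ ()) , (λ ()) , (λ ()) , (λ ())
  greedy (suc k) Dom σ D⊆ big with greedy k (Dom ∘ suc) (σ ∘ suc) (D⊆ ∘ suc) (λ i → ≤-trans (s≤s (m≤n+m _ (1 + m))) (big (suc i)))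
  ... | g , g∈ , g-inj , g-adj = g′ , g′∈ , inj′ , adj′
    where
    Q : Fin k → Fin n → Bool
    Q j z = (g j == z) ∨ ((σ (suc j) Bool.xor σ zero) ∧ not (adj G (g j) z))
    xor⇒ : ∀ {a b} → a Bool.xor b ≡ true → b ≡ not a
    xor⇒ {true} {false} _ = refl
    xor⇒ {false} {true} _ = refl
    ⇒xor : ∀ {a b} → b ≡ not a → a Bool.xor b ≡ true
    ⇒xor {true} refl = refl
    ⇒xor {false} refl = refl
    second : ∀ j → count (λ z → Dom zero z ∧ ((σ (suc j) Bool.xor σ zero) ∧ not (adj G (g j) z))) ≤ m
    second j with bool (σ (suc j) Bool.xor σ zero)
    ... | inj₂ e = ≤-trans (≤-reflexive (count-none (λ z → Dom zero z ∧ ((σ (suc j) Bool.xor σ zero) ∧ not (adj G (g j) z)))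
                    (λ z → trans (cong (λ b → Dom zero z ∧ (b ∧ not (adj G (g j) z))) e) (Boolₚ.∧-zeroʳ (Dom zero z))))) z≤n
    ... | inj₁ e = ≤-trans (count-mono (λ z q → ∧⁺ (trans (cong (λ s → side s z) (≡sym (xor⇒ {σ (suc j)} e))) (D⊆ zero z (proj₁ (∧⁻ {Dom zero z} q))))
                    (proj₂ (∧⁻ {σ (suc j) Bool.xor σ zero} (proj₂ (∧⁻ {Dom zero z} q)))))) (cross (σ (suc j)) (g j) (D⊆ (suc j) (g j) (g∈ j)))
    bad : ∀ j → count (λ z → Dom zero z ∧ Q j z) ≤ 1 + m
    bad j = ≤-trans (≤-reflexive (count-cong (λ z → Boolₚ.∧-distribˡ-∨ (Dom zero z) (g j == z) _)))
      (≤-trans (count-∨ (λ z → Dom zero z ∧ (g j == z)) (λ z → Dom zero z ∧ ((σ (suc j) Bool.xor σ zero) ∧ not (adj G (g j) z))))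
        (+-mono-≤ (≤-trans (count-mono (λ z e → proj₂ (∧⁻ {Dom zero z} e))) (≤-reflexive (count-== (g j)))) (second j)))
    new = avoid k Q (1 + m) (Dom zero) bad (≤-trans (s≤s (m≤n+m _ (1 + m))) (big zero))
    z₀ = proj₁ new
    ok : ∀ j → Q j z₀ ≡ false
    ok = proj₂ (proj₂ new)
    ∨⁻ : ∀ {a b} → a ∨ b ≡ false → a ≡ false × b ≡ false
    ∨⁻ {false} {false} _ = refl , refl
    g′ : Fin (suc k) → Fin n
    g′ zero = z₀
    g′ (suc j) = g j
    g′∈ : ∀ i → Dom i (g′ i) ≡ true
    g′∈ zero = proj₁ (proj₂ new)
    g′∈ (suc j) = g∈ j
    inj′ : ∀ i j → g′ i ≡ g′ j → i ≡ j
    inj′ zero zero _ = refl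
    inj′ zero (suc j) e = ⊥-elim (==-f⁻ (proj₁ (∨⁻ {g j == z₀} (ok j))) (≡sym e))
    inj′ (suc i) zero e = ⊥-elim (==-f⁻ (proj₁ (∨⁻ {g i == z₀} (ok i))) e)
    inj′ (suc i) (suc j) e = cong suc (g-inj i j e)
    new-adj : ∀ j → σ zero ≡ not (σ (suc j)) → adj G (g j) z₀ ≡ true
    new-adj j e with bool (adj G (g j) z₀)
    ... | inj₁ q = q
    ... | inj₂ q = t≢f (∧⁺ (⇒xor {σ (suc j)} e) (cong not q)) (proj₂ (∨⁻ {g j == z₀} (ok j)))
    adj′ : ∀ i j → σ j ≡ not (σ i) → adj G (g′ i) (g′ j) ≡ true
    adj′ zero zero e = b≢not (σ zero) e
    adj′ zero (suc j) e = trans (sym G z₀ (g j)) (new-adj j (not-swap e))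
    adj′ (suc i) zero e = new-adj i e
    adj′ (suc i) (suc j) e = g-adj i j e

  embedRoles : {X : Set} (xs : List X) → length xs ≤ h → (∀ x → x ∈ xs) → (Adj′ : X → X → Set) (ρ : X → Role) →
    (∀ x → RoleGood (ρ x)) → Good true [] → (∀ x y → Adj′ x y → Compat (ρ x) (ρ y)) →
    (∀ x y v → ρ x ≡ fixed v → ρ y ≡ fixed v → x ≡ y) →
    Σ[ f ∈ (X → Fin n) ] Injective _≡_ _≡_ f × (∀ x y → Adj′ x y → adj G (f x) (f y) ≡ true)
  embedRoles {X} xs len complete′ Adj′ ρ ρ-good good₀ compat inj = assemble (greedy (length xs) Dom σ
      (λ i z e → proj₁ (∧⁻ {side (σ i) z} (proj₁ (∧⁻ {side (σ i) z ∧ allAdj (proj₂ (sd (ρ (lookup xs i)))) z} e)))) big)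
    where
    enc : X → Fin (length xs)
    enc x = index (complete′ x)
    dec-enc : ∀ x → x ≡ lookup xs (enc x)
    dec-enc x = Anyₚ.lookup-index (complete′ x)
    sd : Role → Bool × List (Fin n)
    -- A fixed vertex draws a dummy vertex from side `true`, which `place` discards; thus all of
    -- `xs` is treated uniformly.
    sd (fixed _)  = true , []
    sd (free s d) = s , d
    fixes : List X → List (Fin n)
    add : Role → List (Fin n) → List (Fin n)
    add (fixed v)  L = v ∷ L
    add (free _ _) L = L
    fixes []       = []
    fixes (x ∷ ys) = add (ρ x) (fixes ys)
    add-len : ∀ r L → length (add r L) ≤ suc (length L)
    add-len (fixed v)  L = ≤-refl
    add-len (free _ _) L = n≤1+n _
    fixes-len : ∀ ys → length (fixes ys) ≤ length ys
    fixes-len []       = z≤n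
    fixes-len (x ∷ ys) = ≤-trans (add-len (ρ x) (fixes ys)) (s≤s (fixes-len ys))
    add-there : ∀ r {L v} → v ∈ L → v ∈ add r L
    add-there (fixed _)  p = there p
    add-there (free _ _) p = p
    fixes-∈ : ∀ {ys x v} → x ∈ ys → ρ x ≡ fixed v → v ∈ fixes ys
    fixes-∈ {y ∷ ys} (here refl) e rewrite e = here refl
    fixes-∈ {y ∷ ys} (there p)   e = add-there (ρ y) (fixes-∈ p e)
    Fx = fixes xs
    σ : Fin (length xs) → Bool
    σ i = proj₁ (sd (ρ (lookup xs i)))
    Dom : Fin (length xs) → Fin n → Bool
    Dom i z = (side (σ i) z ∧ allAdj (proj₂ (sd (ρ (lookup xs i)))) z) ∧ not (memb Fx z)
    sdGood : ∀ r → RoleGood r → Good (proj₁ (sd r)) (proj₂ (sd r))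
    sdGood (fixed _)  _ = good₀
    sdGood (free s d) g = g
    big : ∀ i → length xs * (1 + m) < count (Dom i)
    big i = ≤-trans (s≤s (*-monoˡ-≤ (1 + m) len))
      (roomArith h m _ (count (Dom i)) (length Fx) (room (sdGood (ρ (lookup xs i)) (ρ-good (lookup xs i))))
        (≤-trans (count-minus (λ z → side (σ i) z ∧ allAdj (proj₂ (sd (ρ (lookup xs i)))) z) (memb Fx)) (+-monoʳ-≤ _ (count-memb Fx)))
        (≤-trans (fixes-len xs) len))
    assemble : Σ[ g ∈ (Fin (length xs) → Fin n) ] (∀ i → Dom i (g i) ≡ true) × (∀ i j → g i ≡ g j → i ≡ j) ×
        (∀ i j → σ j ≡ not (σ i) → adj G (g i) (g j) ≡ true) →
      Σ[ f ∈ (X → Fin n) ] Injective _≡_ _≡_ f × (∀ x y → Adj′ x y → adj G (f x) (f y) ≡ true)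
    assemble (g , g∈ , g-inj , g-adj) = f , f-inj , f-adj
      where
      place : Role → Fin n → Fin n
      place (fixed v)  _ = v
      place (free _ _) z = z
      f : X → Fin n
      f x = place (ρ x) (g (enc x))
      inDom : ∀ x s d → ρ x ≡ free s d → side s (g (enc x)) ≡ true × allAdj d (g (enc x)) ≡ true × memb Fx (g (enc x)) ≡ false
      inDom x s d e with g∈ (enc x)
      ... | r rewrite ≡sym (dec-enc x) | e = let p , q = ∧⁻ {side s (g (enc x)) ∧ allAdj d (g (enc x))} r in
            proj₁ (∧⁻ {side s (g (enc x))} p) , proj₂ (∧⁻ {side s (g (enc x))} p) , not⁻ q
      σ-enc : ∀ x s d → ρ x ≡ free s d → σ (enc x) ≡ s
      σ-enc x s d e rewrite ≡sym (dec-enc x) | e = refl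
      f-inj : Injective _≡_ _≡_ f
      f-inj {x} {y} e with ρ x in ex | ρ y in ey
      ... | fixed v  | fixed w  = inj x y v ex (trans ey (cong fixed (≡sym e)))
      ... | fixed v  | free s d = t≢f (memb⁺ (subst (_∈ Fx) e (fixes-∈ (complete′ x) ex))) (proj₂ (proj₂ (inDom y s d ey)))
      ... | free s d | fixed v  = t≢f (memb⁺ (subst (_∈ Fx) (≡sym e) (fixes-∈ (complete′ y) ey))) (proj₂ (proj₂ (inDom x s d ex)))
      ... | free _ _ | free _ _ = trans (dec-enc x) (trans (cong (lookup xs) (g-inj (enc x) (enc y) e)) (≡sym (dec-enc y)))
      f-adj : ∀ x y → Adj′ x y → adj G (f x) (f y) ≡ true
      f-adj x y a with ρ x in ex | ρ y in ey | compat x y a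
      ... | fixed v  | fixed w    | c = c
      ... | fixed v  | free s d   | c = allAdj⁻ {d} (proj₁ (proj₂ (inDom y s d ey))) c
      ... | free s d | fixed w    | c = trans (sym G (g (enc x)) w) (allAdj⁻ {d} (proj₁ (proj₂ (inDom x s d ex))) c)
      ... | free s d | free s′ d′ | c = g-adj (enc x) (enc y)
            (trans (σ-enc y s′ d′ ey) (trans c (cong not (≡sym (σ-enc x s d ex)))))

  -- Roles of the L inner vertices of a new path from p to q; `fx` contains the given vertices it
  -- uses, which keeps different paths disjoint. `r` is total on ℕ to avoid bounds proofs, and only
  -- its values below L become vertices.
  record Path (p q : Role) (L : ℕ) (fx : List (Fin n)) : Set where
    field
      r     : ℕ → Role
      good′ : ∀ i → RoleGood (r i)
      start : Compat p (r 0)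
      end   : Compat (r (L ∸ 1)) q
      chain : ∀ i → suc i < L → Compat (r i) (r (suc i))
      fix   : ∀ i x → r i ≡ fixed x → x ∈ fx
      inj   : ∀ i j x → i < L → j < L → r i ≡ fixed x → r j ≡ fixed x → i ≡ j

  reversePath : ∀ {p q L fx} → 1 ≤ L → Path p q L fx → Path q p L fx
  reversePath {p} {q} {suc L} {fx} _ P = record
    { r = λ i → r (L ∸ i) ; good′ = λ i → good′ (L ∸ i)
    ; start = Compat-sym (r L) q end
    ; end = subst (λ z → Compat (r z) p) (≡sym (n∸n≡0 L)) (Compat-sym p (r 0) start)
    ; chain = λ { i (s≤s i<L) → Compat-sym (r (L ∸ suc i)) (r (L ∸ i))
        (subst (λ z → Compat (r (L ∸ suc i)) (r z)) (≡sym (+-∸-assoc 1 i<L))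
          (chain (L ∸ suc i) (s≤s (≤-trans (≤-reflexive (≡sym (+-∸-assoc 1 i<L))) (m∸n≤m L i))))) }
    ; fix = λ i → fix (L ∸ i)
    ; inj = λ { i j x (s≤s a) (s≤s b) e e′ → ∸-cancelˡ-≡ a b (inj (L ∸ i) (L ∸ j) x (s≤s (m∸n≤m L i)) (s≤s (m∸n≤m L j)) e e′) }
    }
    where open Path P

  ends : Role → List (Fin n)
  ends (fixed x)  = x ∷ []
  ends (free _ _) = []

  -- The end may be followed by a free vertex on side s.
  EndOK : Role → Bool → Set
  EndOK (fixed _)  s = ⊤
  EndOK (free t _) s = t ≡ not s

  compat-end : ∀ p s d → EndOK p s → (∀ x → x ∈ ends p → x ∈ d) → Compat p (free s d)
  compat-end (fixed x)  s d _  h = h x (here refl)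
  compat-end (free t _) s d ok h = not-swap ok

  private
    alt : Bool → List (Fin n) → List (Fin n) → Bool → Role
    alt s d d′ b = if b then free s d else free (not s) d′

    alt-good : ∀ s d d′ b → Good s d → Good (not s) d′ → RoleGood (alt s d d′ b)
    alt-good s d d′ true  g g′ = g
    alt-good s d d′ false g g′ = g′

    alt-chain : ∀ s d d′ b → Compat (alt s d d′ b) (alt s d d′ (not b))
    alt-chain s d d′ true  = refl
    alt-chain s d d′ false = ≡sym (Boolₚ.not-involutive s)

    alt-free : ∀ s d d′ b x {X : Set} → alt s d d′ b ≡ fixed x → X
    alt-free s d d′ true  x ()
    alt-free s d d′ false x ()

  -- An odd number of inner vertices alternating between the sides starts and ends on side s, so
  -- this serves ends that both lie opposite to s or are fixed neighbours of it.
  plainPath : ∀ {p q fx} k s → EndOK p s → EndOK q s → Good s (ends p ++ ends q) → Good (not s) [] → Path p q (suc (2 * k)) fx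
  plainPath {p} {q} k s okp okq g g′ = record
    { r = λ i → alt s D [] (ev i)
    ; good′ = λ i → alt-good s D [] (ev i) g g′
    ; start = compat-end p s D okp (λ x → ∈-++⁺ˡ)
    ; end = subst (λ b → Compat (alt s D [] b) q) (≡sym (ev-2* k)) (Compat-sym q (free s D) (compat-end q s D okq (λ x → ∈-++⁺ʳ (ends p))))
    ; chain = λ i _ → alt-chain s D [] (ev i)
    ; fix = λ i x e → alt-free s D [] (ev i) x e
    ; inj = λ i j x _ _ e _ → alt-free s D [] (ev i) x e
    }
    where D = ends p ++ ends q

  private
    2*suc : ∀ k → 2 * suc k ≡ 2 + 2 * k
    2*suc = solve-∀

  -- The hub is placed between free vertices of opposite sides, which shifts the alternation by one,
  -- so the ends may lie on opposite sides. At least three inner vertices are used, which is where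
  -- cycles have length at least five.
  hubPath : ∀ {p q} k s w → 1 ≤ k → EndOK p s → EndOK q (not s) → Good s (w ∷ ends p) → Good (not s) (w ∷ ends q) →
    Path p q (suc (2 * k)) (w ∷ [])
  hubPath {p} {q} (suc k) s w _ okp okq g g′ = record
    { r = r ; good′ = λ { 0 → g ; 1 → tt ; (suc (suc i)) → alt-good (not s) D [] (ev i) g′ (Good₀ (subst (λ z → Good z (w ∷ ends p)) (≡sym (Boolₚ.not-involutive s)) g)) }
    ; start = compat-end p s (w ∷ ends p) okp (λ x → there)
    ; end = subst (λ z → Compat (r z) q) (≡sym (2*suc k)) (subst (λ b → Compat (alt (not s) D [] b) q) (≡sym (ev-2* k))
        (Compat-sym q (free (not s) D) (compat-end q (not s) D okq (λ x → there))))
    ; chain = λ { 0 _ → here refl ; 1 _ → here refl ; (suc (suc i)) _ → alt-chain (not s) D [] (ev i) }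
    ; fix = λ { 0 x () ; 1 x refl → here refl ; (suc (suc i)) x e → alt-free (not s) D [] (ev i) x e }
    ; inj = λ { 1 1 x _ _ _ _ → refl ; 0 j x _ _ () _ ; 1 0 x _ _ _ () ; 1 (suc (suc j)) x _ _ _ e → alt-free (not s) D [] (ev j) x e
              ; (suc (suc i)) j x _ _ e _ → alt-free (not s) D [] (ev i) x e }
    }
    where
    D = w ∷ ends q
    r : ℕ → Role
    r 0 = free s (w ∷ ends p)
    r 1 = fixed w
    r (suc (suc i)) = alt (not s) D [] (ev i)

  -- The new path runs through an edge w a inside side t, which corrects the parity.
  edgePath : ∀ {p d} k t w a → 1 ≤ k → EndOK p (not t) → adj G w a ≡ true → a ∈ d → Good (not t) (w ∷ ends p) → Good (not t) (a ∷ []) → Good t [] →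
    Path p (free (not t) d) (suc (2 * k)) (w ∷ a ∷ [])
  edgePath {p} {d} (suc k) t w a _ okp wa a∈d g g′ g″ = record
    { r = r ; good′ = λ { 0 → g ; 1 → tt ; 2 → tt ; (suc (suc (suc i))) → alt-good (not t) (a ∷ []) [] (ev i) g′ (subst (λ z → Good z []) (≡sym (Boolₚ.not-involutive t)) g″) }
    ; start = compat-end p (not t) (w ∷ ends p) okp (λ x → there)
    ; end = subst (λ z → Compat (r z) (free (not t) d)) (≡sym (2*suc k)) (last k)
    ; chain = λ { 0 _ → here refl ; 1 _ → wa ; 2 _ → here refl ; (suc (suc (suc i))) _ → alt-chain (not t) (a ∷ []) [] (ev i) }
    ; fix = λ { 0 x () ; 1 x refl → here refl ; 2 x refl → there (here refl) ; (suc (suc (suc i))) x e → alt-free (not t) (a ∷ []) [] (ev i) x e }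
    ; inj = λ { 0 j x _ _ () _ ; 1 0 x _ _ _ () ; 1 1 x _ _ _ _ → refl
              ; 1 2 x _ _ refl refl → ⊥-elim (t≢f wa (irrefl G w)) ; 2 1 x _ _ refl refl → ⊥-elim (t≢f wa (irrefl G w))
              ; 2 0 x _ _ _ () ; 2 2 x _ _ _ _ → refl
              ; 1 (suc (suc (suc j))) x _ _ _ e → alt-free (not t) (a ∷ []) [] (ev j) x e
              ; 2 (suc (suc (suc j))) x _ _ _ e → alt-free (not t) (a ∷ []) [] (ev j) x e
              ; (suc (suc (suc i))) j x _ _ e _ → alt-free (not t) (a ∷ []) [] (ev i) x e }
    }
    where
    r : ℕ → Role
    r 0 = free (not t) (w ∷ ends p)
    r 1 = fixed w
    r 2 = fixed a
    r (suc (suc (suc i))) = alt (not t) (a ∷ []) [] (ev i)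
    last : ∀ k → Compat (r (2 + 2 * k)) (free (not t) d)
    -- In a cycle of length five there is no free vertex after `a`: it is itself adjacent to the far
    -- end, whose list must therefore contain it.
    last zero = a∈d
    last (suc k) = subst (λ z → Compat (r (2 + z)) (free (not t) d)) (≡sym (2*suc k))
      (subst (λ b → Compat (alt (not t) (a ∷ []) [] (not b)) (free (not t) d)) (≡sym (ev-2* k)) (≡sym (cong not (Boolₚ.not-involutive t))))

  module Balloon {k : ℕ} (F : SimpleGraph k) (ℓ : Fin k → Fin k → ℕ) (valid : ValidLengths F ℓ)
    (len : length (balloonVertices F ℓ) ≤ h) (good₀ : Good true []) where

    inner-length : ∀ u v → IsEdge F u v → ∃ λ j → ℓ u v ∸ 2 ≡ suc (2 * j) × 1 ≤ j
    inner-length u v e with valid u v e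
    ... | 5≤ , s , eq = lem s (ℓ u v) 5≤ eq
      where
      lem : ∀ s l → 5 ≤ l → l ≡ suc (2 * s) → ∃ λ j → l ∸ 2 ≡ suc (2 * j) × 1 ≤ j
      lem 0 _ (s≤s ()) refl
      lem 1 _ (s≤s (s≤s (s≤s ()))) refl
      lem (suc (suc j)) _ _ refl = suc j , cong (_∸ 1) (2*suc (suc j)) , s≤s z≤n

    embed : (ρ : Fin k → Role) → (∀ u → RoleGood (ρ u)) → (∀ u v → adj F u v ≡ true → Compat (ρ u) (ρ v)) →
      (∀ u v x → ρ u ≡ fixed x → ρ v ≡ fixed x → u ≡ v) →
      (fx : Fin k → Fin k → List (Fin n)) → (∀ u v → IsEdge F u v → Path (ρ u) (ρ v) (ℓ u v ∸ 2) (fx u v)) →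
      (∀ u v a x → x ∈ fx u v → ρ a ≢ fixed x) →
      (∀ u v u′ v′ x → x ∈ fx u v → x ∈ fx u′ v′ → u ≡ u′ × v ≡ v′) →
      oddBalloon F ℓ ⊆ G
    embed ρ ρ-good ρ-compat ρ-inj fx path fx-ρ fx-fx =
      embedRoles (balloonVertices F ℓ) len (balloonVertices-complete F ℓ) (BAdj F ℓ) role role-good good₀ role-compat role-inj
      where
      role : BV F ℓ → Role
      role (inj₁ u) = ρ u
      role (inj₂ (u , v , e , i)) = Path.r (path u v e) (toℕ i)
      role-good : ∀ x → RoleGood (role x)
      role-good (inj₁ u) = ρ-good u
      role-good (inj₂ (u , v , e , i)) = Path.good′ (path u v e) (toℕ i)
      attach-compat : ∀ a w → attach F ℓ a w → Compat (role (inj₁ a)) (role (inj₂ w))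
      attach-compat a (.a , v , e , i) (inj₁ (refl , i0)) = subst (λ z → Compat (ρ a) (Path.r (path a v e) z)) (≡sym i0) (Path.start (path a v e))
      attach-compat a (u , .a , e , i) (inj₂ (refl , il)) = Compat-sym _ (ρ a)
        (subst (λ z → Compat (Path.r (path u a e) z) (ρ a)) (cong (_∸ 1) (≡sym il)) (Path.end (path u a e)))
      role-compat : ∀ x y → BAdj F ℓ x y → Compat (role x) (role y)
      role-compat (inj₁ a) (inj₁ b) e = ρ-compat a b e
      role-compat (inj₁ a) (inj₂ w) e = attach-compat a w e
      role-compat (inj₂ w) (inj₁ a) e = Compat-sym (ρ a) _ (attach-compat a w e)
      role-compat (inj₂ (u , v , e , i)) (inj₂ (.u , .v , e′ , j)) (refl , refl , nx) with edge-irrelevant F e e′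
      role-compat (inj₂ (u , v , e , i)) (inj₂ (.u , .v , e′ , j)) (refl , refl , inj₁ ij) | refl =
        subst (λ z → Compat (Path.r (path u v e) (toℕ i)) (Path.r (path u v e) z)) ij
          (Path.chain (path u v e) (toℕ i) (subst (_< ℓ u v ∸ 2) (≡sym ij) (Finₚ.toℕ<n j)))
      role-compat (inj₂ (u , v , e , i)) (inj₂ (.u , .v , e′ , j)) (refl , refl , inj₂ ji) | refl =
        subst (λ z → Compat (Path.r (path u v e) z) (Path.r (path u v e) (toℕ j))) ji
          (Compat-sym (Path.r (path u v e) (toℕ j)) (Path.r (path u v e) (suc (toℕ j)))
            (Path.chain (path u v e) (toℕ j) (subst (_< ℓ u v ∸ 2) (≡sym ji) (Finₚ.toℕ<n i))))
      role-inj : ∀ x y v → role x ≡ fixed v → role y ≡ fixed v → x ≡ y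
      role-inj (inj₁ a) (inj₁ b) x p q = cong inj₁ (ρ-inj a b x p q)
      role-inj (inj₁ a) (inj₂ (u , v , e , i)) x p q = ⊥-elim (fx-ρ u v a x (Path.fix (path u v e) (toℕ i) x q) p)
      role-inj (inj₂ (u , v , e , i)) (inj₁ a) x p q = ⊥-elim (fx-ρ u v a x (Path.fix (path u v e) (toℕ i) x p) q)
      role-inj (inj₂ (u , v , e , i)) (inj₂ (u′ , v′ , e′ , j)) x p q
        with fx-fx u v u′ v′ x (Path.fix (path u v e) (toℕ i) x p) (Path.fix (path u′ v′ e′) (toℕ j) x q)
      ... | refl , refl with edge-irrelevant F e e′
      ...   | refl = cong (λ z → inj₂ (u , v , e , z)) (Finₚ.toℕ-injective (Path.inj (path u v e) (toℕ i) (toℕ j) x (Finₚ.toℕ<n i) (Finₚ.toℕ<n j) p q))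

    record Breakers (at : Fin k → Maybe (Fin n)) (broken : Fin k → Fin k → Bool) : Set where
      field
        M : ℕ
        br : Fin M → Breaker n
        br-disj : ∀ i j x → x ∈ verts (br i) → x ∈ verts (br j) → i ≡ j
        br-at : ∀ i x u → x ∈ verts (br i) → at u ≢ just x
        enough : pairs broken ≤ M

    module WithBreakers {at broken} (B : Breakers at broken) (at-inj : ∀ u v x → at u ≡ just x → at v ≡ just x → u ≡ v)
      (dl : Bool → List (Fin n)) (col : Fin k → Bool) where
      open Breakers B

      brk : ∀ u v → broken u v ≡ true → Breaker n
      brk u v e = br (inject≤ (pairIdx broken u v e) enough)

      fx′ : ∀ u v → (broken u v ≡ true) ⊎ (broken u v ≡ false) → List (Fin n)
      fx′ u v (inj₁ e) = verts (brk u v e)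
      fx′ u v (inj₂ _) = []

      roleOf : Maybe (Fin n) → Bool → Role
      roleOf (just x) c = fixed x
      roleOf nothing  c = free c (dl c)

      ρ : Fin k → Role
      ρ u = roleOf (at u) (col u)

      roleOf-fixed : ∀ m c x → roleOf m c ≡ fixed x → m ≡ just x
      roleOf-fixed (just x) c .x refl = refl

      finish : (∀ c → Good c (dl c)) → (∀ u v → adj F u v ≡ true → Compat (ρ u) (ρ v)) →
        (∀ u v → IsEdge F u v → ∀ j → 1 ≤ j → (b : (broken u v ≡ true) ⊎ (broken u v ≡ false)) → Path (ρ u) (ρ v) (suc (2 * j)) (fx′ u v b)) →
        oddBalloon F ℓ ⊆ G
      finish dl-good compat paths = embed ρ (λ u → rg (at u) (col u)) compat
        (λ u v x p q → at-inj u v x (roleOf-fixed (at u) _ x p) (roleOf-fixed (at v) _ x q))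
        (λ u v → fx′ u v (bool (broken u v)))
        (λ u v e → let j , eq , 1≤j = inner-length u v e in subst (λ L → Path (ρ u) (ρ v) L (fx′ u v (bool (broken u v)))) (≡sym eq) (paths u v e j 1≤j (bool (broken u v))))
        (λ u v a x x∈ e → fx-at u v (bool (broken u v)) a x x∈ (roleOf-fixed (at a) _ x e))
        (λ u v u′ v′ x p q → disj u v u′ v′ x (bool (broken u v)) (bool (broken u′ v′)) p q)
        where
        rg : ∀ m c → RoleGood (roleOf m c)
        rg (just x) c = tt
        rg nothing  c = dl-good c
        fx-at : ∀ u v b a x → x ∈ fx′ u v b → at a ≢ just x
        fx-at u v (inj₁ e) a x p = br-at _ x a p
        disj : ∀ u v u′ v′ x b b′ → x ∈ fx′ u v b → x ∈ fx′ u′ v′ b′ → u ≡ u′ × v ≡ v′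
        disj u v u′ v′ x (inj₁ e) (inj₁ e′) p q = pairIdx-inj broken u v u′ v′ e e′
          (Finₚ.inject≤-injective enough enough _ _ (br-disj _ _ x p q))

    lt : ∀ {u v} → IsEdge F u v → (toℕ u <ᵇ toℕ v) ≡ true
    lt e = <ᵇ⁺ (proj₁ e)

    -- Vertices in "at" act as hubs; an edge between two other vertices needs a breaker.
    hubBroken : (Fin k → Maybe (Fin n)) → Fin k → Fin k → Bool
    hubBroken at = upper (λ u v → adj F u v ∧ (is-nothing (at u) ∧ is-nothing (at v)))

    -- `t` is the side that contains all breaking edges. `dl c` lists what every free vertex of F on
    -- side c has to see: the vertices in `at` and, on side `not t`, the second ends of the breaking
    -- edges, in view of cycles of length five.
    embedHubs : ∀ (at : Fin k → Maybe (Fin n)) (B : Breakers at (hubBroken at)) (t : Bool) (dl : Bool → List (Fin n)) (col : Fin k → Bool) →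
      (∀ u v x → at u ≡ just x → at v ≡ just x → u ≡ v) →
      (∀ u v x y → adj F u v ≡ true → at u ≡ just x → at v ≡ just y → adj G x y ≡ true) →
      (∀ u v → adj F u v ≡ true → at u ≡ nothing → at v ≡ nothing → col v ≡ not (col u)) →
      (∀ u x c → at u ≡ just x → x ∈ dl c) → (∀ c → Good c (dl c)) →
      (∀ i w → Breakers.br B i ≡ hub w → ∀ s → Good s (w ∷ [])) →
      (∀ i w a → Breakers.br B i ≡ edge w a → adj G w a ≡ true × Good (not t) (w ∷ []) × Good (not t) (a ∷ []) × a ∈ dl (not t)) →
      oddBalloon F ℓ ⊆ G
    embedHubs at B t dl col at-inj at-adj proper at-dl dl-good hub-good edge-good =
      finish dl-good (λ u v a → compat u v a (at u) (at v) refl refl) (λ u v e j 1≤j b → path u v e j 1≤j b (at u) (at v) refl refl)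
      where
      open Breakers B
      open WithBreakers B at-inj dl col
      compat : ∀ u v → adj F u v ≡ true → ∀ mu mv → at u ≡ mu → at v ≡ mv → Compat (roleOf mu (col u)) (roleOf mv (col v))
      compat u v a (just x) (just y) p q = at-adj u v x y a p q
      compat u v a (just x) nothing  p q = at-dl u x _ p
      compat u v a nothing  (just y) p q = at-dl v y _ q
      compat u v a nothing  nothing  p q = proper u v a p q
      nil : ∀ s → Good s []
      nil s = Good₀ (dl-good s)
      break : ∀ u v j → 1 ≤ j → col v ≡ not (col u) → (b : Breaker n) → (∀ w → b ≡ hub w → ∀ s → Good s (w ∷ [])) →
        (∀ w a → b ≡ edge w a → adj G w a ≡ true × Good (not t) (w ∷ []) × Good (not t) (a ∷ []) × a ∈ dl (not t)) →
        Path (roleOf nothing (col u)) (roleOf nothing (col v)) (suc (2 * j)) (verts b)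
      break u v j 1≤j c (hub w) hg _ = hubPath j (not (col u)) w 1≤j (≡sym (Boolₚ.not-involutive (col u))) (trans c (≡sym (Boolₚ.not-involutive (not (col u))))) (hg w refl _) (hg w refl _)
      -- `edgePath` starts at the end on side `t`; if u lies on the other side, it is traversed from
      -- v.
      break u v j 1≤j c (edge w a) _ eg with eg w a refl | col u Bool.≟ t
      ... | wa , gw , ga , a∈ | yes refl rewrite c = edgePath j (col u) w a 1≤j (≡sym (Boolₚ.not-involutive (col u))) wa a∈ gw ga (nil _)
      ... | wa , gw , ga , a∈ | no ne with ≢⇒not (λ q → ne (≡sym q))
      ...   | cu rewrite c | cu | Boolₚ.not-involutive t = reversePath (s≤s z≤n) (edgePath j t w a 1≤j (≡sym (Boolₚ.not-involutive t)) wa a∈ gw ga (nil _))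
      path : ∀ u v → IsEdge F u v → ∀ j → 1 ≤ j → (b : (hubBroken at u v ≡ true) ⊎ (hubBroken at u v ≡ false)) → ∀ mu mv → at u ≡ mu → at v ≡ mv →
        Path (roleOf mu (col u)) (roleOf mv (col v)) (suc (2 * j)) (fx′ u v b)
      path u v e j 1≤j b (just x) (just y) p q = plainPath j true tt tt
        (Good₂ (at-dl u x true p) (at-dl v y true q) (dl-good true)) (nil _)
      path u v e j 1≤j b (just x) nothing p q = plainPath j (not (col v)) tt (≡sym (Boolₚ.not-involutive (col v)))
        (Good₁ (at-dl u x _ p) (dl-good _)) (nil _)
      path u v e j 1≤j b nothing (just y) p q = plainPath j (not (col u)) (≡sym (Boolₚ.not-involutive (col u))) tt
        (Good₁ (at-dl v y _ q) (dl-good _)) (nil _)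
      path u v e j 1≤j (inj₂ nb) nothing nothing p q = t≢f (∧⁺ (lt e) (∧⁺ (proj₂ e) (∧⁺ (cong is-nothing p) (cong is-nothing q)))) nb
      path u v e j 1≤j (inj₁ eb) nothing nothing p q = break u v j 1≤j (proper u v (proj₂ e) p q) (brk u v eb) (λ w → hub-good _ w) (λ w a → edge-good _ w a)

    -- All vertices in "at" lie on side t, all others on side not t: only edges inside "at" are
    -- parity-correct, the others need an edge inside side t.
    starBroken : (Fin k → Maybe (Fin n)) → Fin k → Fin k → Bool
    starBroken at = upper (λ u v → adj F u v ∧ not (not (is-nothing (at u)) ∧ not (is-nothing (at v))))

    embedStar : ∀ (at : Fin k → Maybe (Fin n)) (B : Breakers at (starBroken at)) (t : Bool) (d : List (Fin n)) →
      (∀ u v x → at u ≡ just x → at v ≡ just x → u ≡ v) →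
      (∀ u v x y → adj F u v ≡ true → at u ≡ just x → at v ≡ just y → adj G x y ≡ true) →
      (∀ u v → adj F u v ≡ true → at u ≡ nothing → at v ≡ nothing → ⊥) →
      (∀ u x → at u ≡ just x → x ∈ d) → Good (not t) d → Good t [] →
      (∀ i → ∃ λ w → ∃ λ a → Breakers.br B i ≡ edge w a × adj G w a ≡ true × w ∈ d × a ∈ d) →
      oddBalloon F ℓ ⊆ G
    embedStar at B t d at-inj at-adj proper at-d d-good nil edges′ =
      finish dlg (λ u v a → compat u v a (at u) (at v) refl refl) (λ u v e j 1≤j b → path u v e j 1≤j b (at u) (at v) refl refl)
      where
      open Breakers B
      dl : Bool → List (Fin n)
      dl c = if c Bool.xor t then d else []
      dl-not : dl (not t) ≡ d
      dl-not = lem t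
        where
        lem : ∀ t → (if not t Bool.xor t then d else []) ≡ d
        lem true = refl
        lem false = refl
      dlg : ∀ c → Good c (dl c)
      dlg c = lem c t nil d-good
        where
        lem : ∀ c t → Good t [] → Good (not t) d → Good c (if c Bool.xor t then d else [])
        lem true  true  g g′ = g
        lem true  false g g′ = g′
        lem false true  g g′ = g′
        lem false false g g′ = g
      open WithBreakers B at-inj dl (λ _ → not t)
      d⊆ : ∀ {x} → x ∈ d → x ∈ dl (not t)
      d⊆ p = subst (_ ∈_) (≡sym dl-not) p
      compat : ∀ u v → adj F u v ≡ true → ∀ mu mv → at u ≡ mu → at v ≡ mv → Compat (roleOf mu (not t)) (roleOf mv (not t))
      compat u v a (just x) (just y) p q = at-adj u v x y a p q
      compat u v a (just x) nothing  p q = d⊆ (at-d u x p)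
      compat u v a nothing  (just y) p q = d⊆ (at-d v y q)
      compat u v a nothing  nothing  p q = ⊥-elim (proper u v a p q)
      break : ∀ u x j → 1 ≤ j → at u ≡ just x → (b : Breaker n) → (∃ λ w → ∃ λ a → b ≡ edge w a × adj G w a ≡ true × w ∈ d × a ∈ d) →
        Path (fixed x) (roleOf nothing (not t)) (suc (2 * j)) (verts b)
      break u x j 1≤j p .(edge w a) (w , a , refl , wa , w∈ , a∈) = edgePath j t w a 1≤j tt wa (d⊆ a∈)
        (Good₂ w∈ (at-d u x p) d-good) (Good₁ a∈ d-good) nil
      path : ∀ u v → IsEdge F u v → ∀ j → 1 ≤ j → (b : (starBroken at u v ≡ true) ⊎ (starBroken at u v ≡ false)) → ∀ mu mv → at u ≡ mu → at v ≡ mv →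
        Path (roleOf mu (not t)) (roleOf mv (not t)) (suc (2 * j)) (fx′ u v b)
      path u v e j 1≤j b (just x) (just y) p q = plainPath j (not t) tt tt
        (Good₂ (at-d u x p) (at-d v y q) d-good) (subst (λ z → Good z []) (≡sym (Boolₚ.not-involutive t)) nil)
      path u v e j 1≤j b nothing nothing p q = ⊥-elim (proper u v (proj₂ e) p q)
      path u v e j 1≤j (inj₂ nb) (just x) nothing p q =
        t≢f (∧⁺ (lt e) (∧⁺ (proj₂ e) (trans (cong (λ m → not (not (is-nothing (at u)) ∧ not (is-nothing m))) q) (cong not (Boolₚ.∧-zeroʳ _))))) nb
      path u v e j 1≤j (inj₂ nb) nothing (just y) p q =
        t≢f (∧⁺ (lt e) (∧⁺ (proj₂ e) (cong (λ m → not (not (is-nothing m) ∧ not (is-nothing (at v)))) p))) nb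
      path u v e j 1≤j (inj₁ eb) (just x) nothing p q = break u x j 1≤j p (brk u v eb) (edges′ _)
      path u v e j 1≤j (inj₁ eb) nothing (just y) p q = reversePath (s≤s z≤n) (break v y j 1≤j q (brk u v eb) (edges′ _))

-- Embeddings of the ballooning of K₁ ∇ Q

pairs-upper-suc : ∀ {n} (R : Fin (suc n) → Fin (suc n) → Bool) →
  pairs (upper R) ≡ count (λ x → R zero (suc x)) + pairs (upper (λ x y → R (suc x) (suc y)))
pairs-upper-suc R = trans (∑-suc (λ i → count (upper R i)))
  (cong₂ _+_ (count-suc (upper R zero)) (∑-cong (λ i → count-suc (upper R (suc i)))))

-- When the complement of K sits on vertices seeing both sides, these are the edges of Q that still
-- need a breaker.
kept : ∀ {N} → SimpleGraph N → (Fin N → Bool) → ℕ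
kept Q K = pairs (upper (λ x y → adj Q x y ∧ (K x ∧ K y)))

module _ {N} (Q : SimpleGraph N) (K : Fin N → Bool) where

  private
    U = ∑ (λ x → b2n (not (K x)) * deg Q x)
    inK : Fin N → Fin N → Bool
    inK x y = adj Q x y ∧ (K x ∧ K y)
    dbl : pairs inK ≡ 2 * kept Q K
    dbl = pairs-upper inK (λ x y → cong₂ _∧_ (sym Q x y) (Boolₚ.∧-comm (K x) (K y))) (λ x → cong (_∧ (K x ∧ K x)) (irrefl Q x))
    col≡ : pairs (λ x y → not (K y) ∧ adj Q x y) ≡ U
    col≡ = trans (pairs-swap (λ x y → not (K y) ∧ adj Q x y)) (trans (pairs-cong (λ y x → cong (not (K y) ∧_) (sym Q x y))) (pairs-row (λ y → not (K y)) (adj Q)))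
    total : ∑ (λ x → ∑ (λ y → b2n (inK x y) + (b2n (not (K x) ∧ adj Q x y) + b2n (not (K y) ∧ adj Q x y)))) ≡ 2 * (kept Q K + U)
    total = trans (∑∑-+ (λ x y → b2n (inK x y)) _)
      (trans (cong₂ _+_ (trans (≡sym (pairs≡∑∑ inK)) dbl)
        (trans (∑∑-+ (λ x y → b2n (not (K x) ∧ adj Q x y)) (λ x y → b2n (not (K y) ∧ adj Q x y)))
          (cong₂ _+_ (trans (≡sym (pairs≡∑∑ (λ x y → not (K x) ∧ adj Q x y))) (pairs-row (λ x → not (K x)) (adj Q)))
                     (trans (≡sym (pairs≡∑∑ (λ x y → not (K y) ∧ adj Q x y))) col≡))))
        (arith (kept Q K) U))
      where
      arith : ∀ k u → 2 * k + (u + u) ≡ 2 * (k + u)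
      arith = solve-∀
    e2 : ∑ (λ x → ∑ (λ y → b2n (adj Q x y))) ≡ 2 * edges Q
    e2 = trans (≡sym (pairs≡∑∑ (adj Q))) (dsum≡2edges Q)

  edges≤kept : edges Q ≤ kept Q K + U
  edges≤kept = *-cancelˡ-≤ 2 (≤-trans (≤-reflexive (≡sym e2)) (≤-trans (∑-mono (λ x → ∑-mono (λ y → pt (adj Q x y) (K x) (K y)))) (≤-reflexive total)))
    where
    pt : ∀ a k l → b2n a ≤ b2n (a ∧ (k ∧ l)) + (b2n (not k ∧ a) + b2n (not l ∧ a))
    pt false _ _ = z≤n
    pt true true true = s≤s z≤n
    pt true true false = s≤s z≤n
    pt true false l = s≤s z≤n

  -- The degree sum over the complement of K counts an edge twice only if both ends lie there, which
  -- independence excludes.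
  kept≤edges : (∀ x y → adj Q x y ≡ true → K x ≡ false → K y ≡ false → ⊥) → kept Q K + U ≤ edges Q
  kept≤edges ind = *-cancelˡ-≤ 2 (≤-trans (≤-reflexive (≡sym total)) (≤-trans (∑-mono (λ x → ∑-mono (λ y → pt (adj Q x y) (K x) (K y) (ind x y)))) (≤-reflexive e2)))
    where
    pt : ∀ a k l → (a ≡ true → k ≡ false → l ≡ false → ⊥) → b2n (a ∧ (k ∧ l)) + (b2n (not k ∧ a) + b2n (not l ∧ a)) ≤ b2n a
    pt false true  true  _ = z≤n
    pt false true  false _ = z≤n
    pt false false true  _ = z≤n
    pt false false false _ = z≤n
    pt true true true _ = ≤-refl
    pt true true false _ = ≤-refl
    pt true false true _ = ≤-refl
    pt true false false f = ⊥-elim (f refl refl refl)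

unhubbed : ∀ {N n} → (Fin N → Maybe (Fin n)) → Fin N → Bool
unhubbed hb x = is-nothing (hb x)

module _ {N : ℕ} (Q : SimpleGraph N) where

  cone : SimpleGraph (1 + N)
  cone = join (complete 1) Q

  cone-0s : ∀ x → adj cone zero (suc x) ≡ true
  cone-0s x = join-lr (complete 1) Q zero x

  cone-ss : ∀ x y → adj cone (suc x) (suc y) ≡ adj Q x y
  cone-ss x y = join-rr (complete 1) Q x y

  cone-sym-case : (P : Fin (1 + N) → Fin (1 + N) → Set) → (∀ u v → P u v → P v u) → (∀ x → P zero (suc x)) →
    (∀ x y → adj Q x y ≡ true → P (suc x) (suc y)) → ∀ u v → adj cone u v ≡ true → P u v
  cone-sym-case P s z ss zero    zero    e = t≢f e (irrefl cone zero)
  cone-sym-case P s z ss zero    (suc y) e = z y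
  cone-sym-case P s z ss (suc x) zero    e = s zero (suc x) (z x)
  cone-sym-case P s z ss (suc x) (suc y) e = ss x y (trans (≡sym (cone-ss x y)) e)

module Instances {N : ℕ} (Q : SimpleGraph N) (ℓ : Fin (1 + N) → Fin (1 + N) → ℕ) (valid : ValidLengths (cone Q) ℓ)
  (col : Fin N → Bool) (proper : ∀ x y → adj Q x y ≡ true → col y ≡ not (col x))
  {n : ℕ} (G : SimpleGraph n) (side : Bool → Fin n → Bool) (m h : ℕ)
  (cross : ∀ s z → side s z ≡ true → count (λ y → side (not s) y ∧ not (adj G z y)) ≤ m)
  (len : length (balloonVertices (cone Q) ℓ) ≤ h) where

  open Embed G side m h cross public

  private
    module E (g₀ : Good true []) = Balloon (cone Q) ℓ valid len g₀

  BreakerGood : Bool → List (Fin n) → Breaker n → Set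
  BreakerGood t d (hub w)    = ∀ s → Good s (w ∷ [])
  BreakerGood t d (edge w a) = adj G w a ≡ true × Good (not t) (w ∷ []) × Good (not t) (a ∷ []) × a ∈ d

  Disjoint : ∀ {M} → (Fin M → Breaker n) → Set
  Disjoint {M} br = ∀ i j x → x ∈ verts (br i) → x ∈ verts (br j) → i ≡ j

  -- The apex sits on `v₀`, which sees both sides, so no spoke needs a breaker; of the edges of Q
  -- only those avoiding the placed vertices do. Placed vertices are independent in Q because
  -- nothing is known about adjacency between their images.
  embedApex : (v₀ : Fin n) (hb : Fin N → Maybe (Fin n)) (t : Bool) (dl : Bool → List (Fin n)) (M : ℕ) (br : Fin M → Breaker n) →
    (∀ x y v → hb x ≡ just v → hb y ≡ just v → x ≡ y) →
    (∀ x v → hb x ≡ just v → adj G v₀ v ≡ true) →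
    (∀ x y → adj Q x y ≡ true → hb x ≢ nothing → hb y ≢ nothing → ⊥) →
    kept Q (unhubbed hb) ≤ M →
    Disjoint br → (∀ i x → x ∈ verts (br i) → x ≢ v₀) → (∀ i x y → x ∈ verts (br i) → hb y ≢ just x) →
    (∀ c → v₀ ∈ dl c) → (∀ c x v → hb x ≡ just v → v ∈ dl c) → (∀ c → Good c (dl c)) → (∀ i → BreakerGood t (dl (not t)) (br i)) →
    oddBalloon (cone Q) ℓ ⊆ G
  embedApex v₀ hb t dl M br hb-inj v₀-adj indep enough disj br-v₀ br-hb v₀∈ hb∈ dl-good br-good =
    embedHubs at (record { M = M ; br = br ; br-disj = disj
                         ; br-at = λ i x u p → br-at i x u p ; enough = ≤-trans (≤-reflexive cnt) enough })
      t dl col′ at-inj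
      (λ u v x y a p q → cone-sym-case Q (λ u v → ∀ x y → at u ≡ just x → at v ≡ just y → adj G x y ≡ true) (λ u v f x y p q → trans (sym G x y) (f y x q p))
        (λ { w x y refl q → v₀-adj w y q }) (λ w z a x y p q → ⊥-elim (indep w z a (λ r → jn (trans (≡sym p) r)) (λ r → jn (trans (≡sym q) r)))) u v a x y p q)
      (λ u v a → cone-sym-case Q (λ u v → at u ≡ nothing → at v ≡ nothing → col′ v ≡ not (col′ u)) (λ u v f p q → not-swap (f q p))
        (λ { w () q }) (λ w z a p q → proper w z a) u v a)
      (λ { zero .v₀ c refl → v₀∈ c ; (suc x) v c p → hb∈ c x v p })
      dl-good (λ i w e → subst (BreakerGood t (dl (not t))) e (br-good i)) (λ i w a e → subst (BreakerGood t (dl (not t))) e (br-good i))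
    where
    g₀ = Good₀ (dl-good true)
    open E g₀
    jn : ∀ {v : Fin n} {X : Set} → just v ≡ nothing → X
    jn ()
    at : Fin (1 + N) → Maybe (Fin n)
    at zero    = just v₀
    at (suc x) = hb x
    col′ : Fin (1 + N) → Bool
    col′ zero    = true
    col′ (suc x) = col x
    at-inj : ∀ u v x → at u ≡ just x → at v ≡ just x → u ≡ v
    at-inj zero    zero    x p q = refl
    at-inj zero    (suc v) x refl q = t≢f (v₀-adj v _ q) (irrefl G v₀)
    at-inj (suc u) zero    x p refl = t≢f (v₀-adj u _ p) (irrefl G v₀)
    at-inj (suc u) (suc v) x p q = cong suc (hb-inj u v x p q)
    br-at : ∀ i x u → x ∈ verts (br i) → at u ≢ just x
    br-at i x zero    p refl = br-v₀ i x p refl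
    br-at i x (suc y) p e    = br-hb i x y p e
    cnt : pairs (hubBroken at) ≡ kept Q (unhubbed hb)
    cnt = trans (pairs-upper-suc (λ u v → adj (cone Q) u v ∧ (is-nothing (at u) ∧ is-nothing (at v))))
      (cong₂ _+_ (count-none (λ x → adj (cone Q) zero (suc x) ∧ (is-nothing (at zero) ∧ is-nothing (at (suc x)))) (λ x → Boolₚ.∧-zeroʳ (adj (cone Q) zero (suc x))))
        (pairs-cong (λ x y → cong ((toℕ x <ᵇ toℕ y) ∧_) (cong (_∧ (is-nothing (hb x) ∧ is-nothing (hb y))) (cone-ss Q x y)))))

  -- The apex is free on side `true`. One whole colour class is placed, the other is free on side
  -- `false`; every edge at the placed class is parity-correct, so only the spokes to the free class
  -- need breakers.
  embedClass : (hb : Fin N → Maybe (Fin n)) (t : Bool) (dl : Bool → List (Fin n)) (M : ℕ) (br : Fin M → Breaker n) →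
    (∀ x y v → hb x ≡ just v → hb y ≡ just v → x ≡ y) →
    (∀ x y → adj Q x y ≡ true → hb x ≢ nothing → hb y ≢ nothing → ⊥) →
    (∀ x y → adj Q x y ≡ true → hb x ≡ nothing → hb y ≡ nothing → ⊥) →
    count (unhubbed hb) ≤ M →
    Disjoint br → (∀ i x y → x ∈ verts (br i) → hb y ≢ just x) →
    (∀ c x v → hb x ≡ just v → v ∈ dl c) → (∀ c → Good c (dl c)) → (∀ i → BreakerGood t (dl (not t)) (br i)) →
    oddBalloon (cone Q) ℓ ⊆ G
  embedClass hb t dl M br hb-inj indep indep′ enough disj br-hb hb∈ dl-good br-good =
    embedHubs at (record { M = M ; br = br ; br-disj = disj
                         ; br-at = λ i x u p → br-at i x u p ; enough = ≤-trans cnt enough })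
      t dl col′ at-inj
      (λ u v x y a p q → cone-sym-case Q (λ u v → ∀ x y → at u ≡ just x → at v ≡ just y → adj G x y ≡ true) (λ u v f x y p q → trans (sym G x y) (f y x q p))
        (λ { w x y () q }) (λ w z a x y p q → ⊥-elim (indep w z a (λ r → jn (trans (≡sym p) r)) (λ r → jn (trans (≡sym q) r)))) u v a x y p q)
      (λ u v a → cone-sym-case Q (λ u v → at u ≡ nothing → at v ≡ nothing → col′ v ≡ not (col′ u)) (λ u v f p q → not-swap (f q p))
        (λ w p q → refl) (λ w z a p q → ⊥-elim (indep′ w z a p q)) u v a)
      (λ { zero v c () ; (suc x) v c p → hb∈ c x v p })
      dl-good (λ i w e → subst (BreakerGood t (dl (not t))) e (br-good i)) (λ i w a e → subst (BreakerGood t (dl (not t))) e (br-good i))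
    where
    g₀ = Good₀ (dl-good true)
    open E g₀
    jn : ∀ {v : Fin n} {X : Set} → just v ≡ nothing → X
    jn ()
    at : Fin (1 + N) → Maybe (Fin n)
    at zero    = nothing
    at (suc x) = hb x
    col′ : Fin (1 + N) → Bool
    col′ zero    = true
    col′ (suc x) = false
    at-inj : ∀ u v x → at u ≡ just x → at v ≡ just x → u ≡ v
    at-inj (suc u) (suc v) x p q = cong suc (hb-inj u v x p q)
    br-at : ∀ i x u → x ∈ verts (br i) → at u ≢ just x
    br-at i x zero    p ()
    br-at i x (suc y) p e    = br-hb i x y p e
    nothing⁻ : ∀ m → is-nothing m ≡ true → m ≡ nothing
    nothing⁻ nothing _ = refl
    none : pairs (upper (λ x y → adj (cone Q) (suc x) (suc y) ∧ (is-nothing (hb x) ∧ is-nothing (hb y)))) ≡ 0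
    none = ∑-zero (λ x → count-none _ (λ y → lem x y))
      where
      lem : ∀ x y → upper (λ x y → adj (cone Q) (suc x) (suc y) ∧ (is-nothing (hb x) ∧ is-nothing (hb y))) x y ≡ false
      lem x y with bool (upper (λ x y → adj (cone Q) (suc x) (suc y) ∧ (is-nothing (hb x) ∧ is-nothing (hb y))) x y)
      ... | inj₂ e = e
      ... | inj₁ e = let a , p = ∧⁻ {adj (cone Q) (suc x) (suc y)} (proj₂ (∧⁻ {toℕ x <ᵇ toℕ y} e)) in
        ⊥-elim (indep′ x y (trans (≡sym (cone-ss Q x y)) a) (nothing⁻ (hb x) (proj₁ (∧⁻ {is-nothing (hb x)} p))) (nothing⁻ (hb y) (proj₂ (∧⁻ {is-nothing (hb x)} p))))
    cnt : pairs (hubBroken at) ≤ count (unhubbed hb)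
    cnt = ≤-trans (≤-reflexive (trans (pairs-upper-suc (λ u v → adj (cone Q) u v ∧ (is-nothing (at u) ∧ is-nothing (at v)))) (trans (cong (count (λ x → adj (cone Q) zero (suc x) ∧ (is-nothing (at zero) ∧ is-nothing (at (suc x)))) +_) none) (+-identityʳ _))))
      (count-mono (λ x e → proj₂ (∧⁻ {adj (cone Q) zero (suc x)} e)))

  -- The apex and one colour class lie on side `t`, so the spokes between them are edges inside a
  -- side; the other class lies opposite. Reserving a breaker for each of the N spokes and each edge
  -- of Q is a generous bound.
  embedOwnStar : (v₀ : Fin n) (hb : Fin N → Maybe (Fin n)) (t : Bool) (d : List (Fin n)) (M : ℕ) (w a : Fin M → Fin n) →
    (∀ x y v → hb x ≡ just v → hb y ≡ just v → x ≡ y) →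
    (∀ x v → hb x ≡ just v → adj G v₀ v ≡ true) →
    (∀ x y → adj Q x y ≡ true → hb x ≢ nothing → hb y ≢ nothing → ⊥) →
    (∀ x y → adj Q x y ≡ true → hb x ≡ nothing → hb y ≡ nothing → ⊥) →
    N + edges Q ≤ M →
    Disjoint (λ i → edge (w i) (a i)) → (∀ i x → x ∈ verts (edge (w i) (a i)) → x ≢ v₀) → (∀ i x y → x ∈ verts (edge (w i) (a i)) → hb y ≢ just x) →
    v₀ ∈ d → (∀ x v → hb x ≡ just v → v ∈ d) → (∀ i → w i ∈ d × a i ∈ d × adj G (w i) (a i) ≡ true) → Good (not t) d → Good t [] →
    oddBalloon (cone Q) ℓ ⊆ G
  embedOwnStar v₀ hb t d M w a hb-inj v₀-adj indep indep′ enough disj br-v₀ br-hb v₀∈ hb∈ wa∈ d-good nil =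
    embedStar at (record { M = M ; br = λ i → edge (w i) (a i) ; br-disj = disj ; br-at = br-at ; enough = ≤-trans cnt enough })
      t d at-inj
      (λ u v x y b p q → cone-sym-case Q (λ u v → ∀ x y → at u ≡ just x → at v ≡ just y → adj G x y ≡ true) (λ u v f x y p q → trans (sym G x y) (f y x q p))
        (λ { z x y refl q → v₀-adj z y q }) (λ z z′ b x y p q → ⊥-elim (indep z z′ b (λ r → jn (trans (≡sym p) r)) (λ r → jn (trans (≡sym q) r)))) u v b x y p q)
      (λ u v b → cone-sym-case Q (λ u v → at u ≡ nothing → at v ≡ nothing → ⊥) (λ u v f p q → f q p) (λ { z () q }) indep′ u v b)
      (λ { zero .v₀ refl → v₀∈ ; (suc x) v p → hb∈ x v p }) d-good nil
      (λ i → w i , a i , refl , proj₂ (proj₂ (wa∈ i)) , proj₁ (wa∈ i) , proj₁ (proj₂ (wa∈ i)))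
    where
    g₀ : Good true []
    g₀ = lem t nil (Good₀ d-good)
      where
      lem : ∀ t → Good t [] → Good (not t) [] → Good true []
      lem true  g _ = g
      lem false _ g = g
    open E g₀
    jn : ∀ {v : Fin n} {X : Set} → just v ≡ nothing → X
    jn ()
    at : Fin (1 + N) → Maybe (Fin n)
    at zero    = just v₀
    at (suc x) = hb x
    at-inj : ∀ u v x → at u ≡ just x → at v ≡ just x → u ≡ v
    at-inj zero    zero    x p q = refl
    at-inj zero    (suc v) x refl q = t≢f (v₀-adj v _ q) (irrefl G v₀)
    at-inj (suc u) zero    x p refl = t≢f (v₀-adj u _ p) (irrefl G v₀)
    at-inj (suc u) (suc v) x p q = cong suc (hb-inj u v x p q)
    br-at : ∀ i x u → x ∈ verts (edge (w i) (a i)) → at u ≢ just x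
    br-at i x zero    p refl = br-v₀ i x p refl
    br-at i x (suc y) p e    = br-hb i x y p e
    cnt : pairs (starBroken at) ≤ N + edges Q
    cnt = ≤-trans (≤-reflexive (pairs-upper-suc (λ u v → adj (cone Q) u v ∧ not (not (is-nothing (at u)) ∧ not (is-nothing (at v))))))
      (+-mono-≤ (count≤n _) (≤-trans (pairs-mono (λ x y e → ∧⁺ (proj₁ (∧⁻ {toℕ x <ᵇ toℕ y} e))
        (trans (≡sym (cone-ss Q x y)) (proj₁ (∧⁻ {adj (cone Q) (suc x) (suc y)} (proj₂ (∧⁻ {toℕ x <ᵇ toℕ y} e))))))) (≤-reflexive (≡sym (edges≡ Q)))))

  hubs-disjoint : ∀ {M} (g : Fin M → Fin n) → (∀ i j → g i ≡ g j → i ≡ j) → Disjoint (λ i → hub (g i))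
  hubs-disjoint g inj i j x (here p) (here q) = inj i j (trans (≡sym p) q)

  kept-all : kept Q (unhubbed {n = n} (λ _ → nothing)) ≤ edges Q
  kept-all = ≤-trans (pairs-mono (λ x y q → ∧⁺ (proj₁ (∧⁻ {toℕ x <ᵇ toℕ y} q)) (proj₁ (∧⁻ {adj Q x y} (proj₂ (∧⁻ {toℕ x <ᵇ toℕ y} q)))))) (≤-reflexive (≡sym (edges≡ Q)))

  -- One hub carries the apex, and each edge of Q gets another.
  embedManyHubs : ∀ {M} (g : Fin (suc M) → Fin n) → edges Q ≤ M → (∀ i j → g i ≡ g j → i ≡ j) → (∀ i s → Good s (g i ∷ [])) → oddBalloon (cone Q) ℓ ⊆ G
  embedManyHubs {M} g enough g-inj g-good = embedApex (g zero) (λ _ → nothing) true (λ _ → g zero ∷ []) M (λ i → hub (g (suc i)))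
      (λ x y v ()) (λ x v ()) (λ x y a p _ → p refl) (≤-trans kept-all enough) (hubs-disjoint (g ∘ suc) (λ i j p → Finₚ.suc-injective (g-inj (suc i) (suc j) p)))
      (λ { i x (here refl) p → case0 i (g-inj (suc i) zero p) }) (λ i x y p ()) (λ c → here refl) (λ c x v ()) (λ c → g-good zero c)
      (λ i s → g-good (suc i) s)
    where
    case0 : ∀ {m} {X : Set} (i : Fin m) → suc i ≡ zero → X
    case0 i ()

-- Large h-fold intersections and complete tripartite subgraphs

sumL : {V : Set} → (V → ℕ) → List V → ℕ
sumL f []       = 0
sumL f (v ∷ vs) = f v + sumL f vs

sumL-+ : {V : Set} (f g : V → ℕ) (vs : List V) → sumL (λ v → f v + g v) vs ≡ sumL f vs + sumL g vs
sumL-+ f g []       = refl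
sumL-+ f g (v ∷ vs) = trans (cong (f v + g v +_) (sumL-+ f g vs)) (arith (f v) (g v) (sumL f vs) (sumL g vs))
  where
  arith : ∀ a b c d → (a + b) + (c + d) ≡ (a + c) + (b + d)
  arith = solve-∀

sumL-cong : {V : Set} {f g : V → ℕ} (vs : List V) → (∀ v → f v ≡ g v) → sumL f vs ≡ sumL g vs
sumL-cong []       e = refl
sumL-cong (v ∷ vs) e = cong₂ _+_ (e v) (sumL-cong vs e)

sumL-≤ : {V : Set} {f : V → ℕ} {c : ℕ} (vs : List V) → (∀ v → f v ≤ c) → sumL f vs ≤ length vs * c
sumL-≤ []       h = z≤n
sumL-≤ (v ∷ vs) h = +-mono-≤ (h v) (sumL-≤ vs h)

sumL-≥ : {V : Set} {f : V → ℕ} {c : ℕ} (vs : List V) → (∀ v → v ∈ vs → c ≤ f v) → length vs * c ≤ sumL f vs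
sumL-≥ []       h = z≤n
sumL-≥ (v ∷ vs) h = +-mono-≤ (h v (here refl)) (sumL-≥ vs (λ w p → h w (there p)))

-- `μ` is an abstract additive measure because the lemma is applied twice: to ordered pairs of
-- vertices, then to vertices.
module Box {V Z : Set} (μ : (Z → Bool) → ℕ) (μ-cong : ∀ {p q : Z → Bool} → (∀ z → p z ≡ q z) → μ p ≡ μ q)
  (μ-split : ∀ (p q : Z → Bool) → μ p ≡ μ (λ z → p z ∧ q z) + μ (λ z → p z ∧ not (q z)))
  (S : V → Z → Bool) (t : ℕ) where

  inAll : List V → Z → Bool
  inAll []      z = true
  inAll (v ∷ L) z = S v z ∧ inAll L z

  inAll⁻ : ∀ {L z v} → inAll L z ≡ true → v ∈ L → S v z ≡ true
  inAll⁻ {w ∷ L} {z} e (here refl) = proj₁ (∧⁻ {S w z} e)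
  inAll⁻ {w ∷ L} {z} e (there p)   = inAll⁻ {L} (proj₂ (∧⁻ {S w z} e)) p

  μ-∧≤ : ∀ (p q : Z → Bool) → μ (λ z → p z ∧ q z) ≤ μ p
  μ-∧≤ p q = ≤-trans (m≤m+n (μ (λ z → p z ∧ q z)) (μ (λ z → p z ∧ not (q z)))) (≤-reflexive (≡sym (μ-split p q)))

  Found : List V → ℕ → (Z → Bool) → Set
  Found vs h P = Σ[ L ∈ List V ] (∀ v → v ∈ L → v ∈ vs) × Unique L × length L ≡ h × t ≤ μ (λ z → P z ∧ inAll L z)

  baseArith : ∀ S M p l → S ≤ l * p → (1 + l) * p ≤ M → S + p ≤ M
  baseArith S M p l h1 h2 = lin (0) (h1 ⊕ h2) (solve (S ∷ M ∷ p ∷ l ∷ []))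
  stepArith : ∀ p1 p2 s1 s2 h X → s1 + p1 ≤ h * p1 + X → s2 + p2 ≤ (1 + h) * p2 + X → p1 + (s1 + s2) + (p1 + p2) ≤ (1 + h) * (p1 + p2) + 2 * X
  stepArith p1 p2 s1 s2 h X h1 h2 = lin (0) (h1 ⊕ h2) (solve (p1 ∷ p2 ∷ s1 ∷ s2 ∷ h ∷ X ∷ []))

  1+l≤2^l : ∀ l → 1 + l ≤ 2 ^ l
  1+l≤2^l zero    = ≤-refl
  1+l≤2^l (suc l) = ≤-trans (s≤s (1+l≤2^l l)) (≤-trans (+-monoˡ-≤ (2 ^ l) (≤-trans (s≤s z≤n) (1+l≤2^l l))) (≤-reflexive (cong (2 ^ l +_) (≡sym (+-identityʳ _)))))

  -- If no h of the sets share measure t inside P, then up to an error each point of P lies in at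
  -- most h - 1 of them, and summing gives the bound. Induction splits P along the first set, asking
  -- for h - 1 further sets inside it and for h sets outside; the error doubles with each split.
  box : ∀ vs → Unique vs → ∀ h P → Found vs h P ⊎ sumL (λ v → μ (λ z → P z ∧ S v z)) vs + μ P ≤ h * μ P + 2 ^ length vs * t
  box vs _ zero P with t ≤? μ P
  ... | yes p = inj₁ ([] , (λ v ()) , AllPairs.[] , refl , ≤-trans p (≤-reflexive (μ-cong (λ z → ≡sym (Boolₚ.∧-identityʳ (P z))))))
  ... | no ¬p = inj₂ (baseArith _ (2 ^ length vs * t) (μ P) (length vs) (sumL-≤ vs (λ v → μ-∧≤ P (S v)))
                  (*-mono-≤ (1+l≤2^l (length vs)) (<⇒≤ (≰⇒> ¬p))))
  box [] _ (suc h) P = inj₂ (≤-trans (m≤m+n (μ P) (h * μ P)) (m≤m+n _ _))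
  box (v ∷ vs) (v∉ AllPairs.∷ u) (suc h) P with box vs u h (λ z → P z ∧ S v z)
  ... | inj₁ (L , L⊆ , uL , len , le) = inj₁ (v ∷ L , (λ { w (here e) → here e ; w (there p) → there (L⊆ w p) })
        , All.tabulate (λ p → All.lookup v∉ (L⊆ _ p)) AllPairs.∷ uL , cong suc len
        , ≤-trans le (≤-reflexive (μ-cong (λ z → Boolₚ.∧-assoc (P z) (S v z) _))))
  ... | inj₂ le₁ with box vs u (suc h) (λ z → P z ∧ not (S v z))
  ...   | inj₁ (L , L⊆ , uL , len , le) = inj₁ (L , (λ w p → there (L⊆ w p)) , uL , len
          , ≤-trans le (≤-trans (≤-reflexive (μ-cong (λ z → swap (P z) (not (S v z)) (inAll L z)))) (μ-∧≤ (λ z → P z ∧ inAll L z) (λ z → not (S v z)))))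
    where
    swap : ∀ a b c → (a ∧ b) ∧ c ≡ (a ∧ c) ∧ b
    swap true  b c = Boolₚ.∧-comm b c
    swap false b c = refl
  ...   | inj₂ le₂ = inj₂ (≤-trans (≤-reflexive (cong₂ _+_ (cong (μ (λ z → P z ∧ S v z) +_) splitΣ) (μ-split P (S v))))
          (≤-trans (stepArith (μ (λ z → P z ∧ S v z)) (μ (λ z → P z ∧ not (S v z))) s₁ s₂ h (2 ^ length vs * t) le₁ le₂)
            (≤-reflexive (cong₂ _+_ (cong (suc h *_) (≡sym (μ-split P (S v)))) (≡sym (*-assoc 2 (2 ^ length vs) t))))))
    where
    s₁ = sumL (λ w → μ (λ z → (P z ∧ S v z) ∧ S w z)) vs
    s₂ = sumL (λ w → μ (λ z → (P z ∧ not (S v z)) ∧ S w z)) vs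
    swap : ∀ a b c → (a ∧ b) ∧ c ≡ (a ∧ c) ∧ b
    swap true  b c = Boolₚ.∧-comm b c
    swap false b c = refl
    splitΣ : sumL (λ w → μ (λ z → P z ∧ S w z)) vs ≡ s₁ + s₂
    splitΣ = trans (sumL-cong vs (λ w → trans (μ-split (λ z → P z ∧ S w z) (S v))
        (cong₂ _+_ (μ-cong (λ z → swap (P z) (S w z) (S v z))) (μ-cong (λ z → swap (P z) (S w z) (not (S v z)))))))
      (sumL-+ (λ w → μ (λ z → (P z ∧ S v z) ∧ S w z)) (λ w → μ (λ z → (P z ∧ not (S v z)) ∧ S w z)) vs)

ge : ℕ → ℕ → Bool
ge x r = not (x <ᵇ r)

ge⁺ : ∀ {x r} → r ≤ x → ge x r ≡ true
ge⁺ p = cong not (<ᵇ-f⁺ p)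

ge⁻ : ∀ {x r} → ge x r ≡ true → r ≤ x
ge⁻ e = <ᵇ-f⁻ (not⁻ e)

degIn : ∀ {n} → SimpleGraph n → (Fin n → Bool) → Fin n → ℕ
degIn G P x = count (λ y → P y ∧ adj G x y)

pairs-within : ∀ {n} (G : SimpleGraph n) P → pairs (within G P) ≡ ∑ (λ x → b2n (P x) * degIn G P x)
pairs-within G P = pairs-row P (λ x y → P y ∧ adj G x y)

record Tripartite {n} (G : SimpleGraph n) (g : ℕ) : Set where
  field
    apex : Fin g → Fin n
    apex-inj : ∀ i j → apex i ≡ apex j → i ≡ j
    X Y : Fin n → Bool
    X-size : g ≤ count X
    Y-size : g ≤ count Y
    apex-X : ∀ i x → X x ≡ true → adj G (apex i) x ≡ true
    apex-Y : ∀ i y → Y y ≡ true → adj G (apex i) y ≡ true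
    X-Y : ∀ x y → X x ≡ true → Y y ≡ true → adj G x y ≡ true

-- v is rich when its neighbourhood spans many edges; constantly many rich vertices already
-- give a large complete tripartite graph.
rich : ∀ {n} → SimpleGraph n → ℕ → Fin n → Bool
rich G r v = ge (pairs (within G (adj G v))) (r * r)

private
  uniqueFrom : ∀ {n M} (f : Fin M → Fin n) → (∀ i j → f i ≡ f j → i ≡ j) → Unique (tabulate f)
  uniqueFrom f inj = Uniqueₚ.tabulate⁺ (λ {i} {j} e → inj i j e)

  tabulate-∈ : ∀ {n M} {f : Fin M → Fin n} {x} → x ∈ tabulate f → ∃ λ i → x ≡ f i
  tabulate-∈ p = Anyₚ.tabulate⁻ p

  lookup-unique : ∀ {n} (L : List (Fin n)) → Unique L → ∀ i j → lookup L i ≡ lookup L j → i ≡ j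
  lookup-unique (x ∷ L) u zero zero e = refl
  lookup-unique (x ∷ L) (x∉ AllPairs.∷ u) zero (suc j) e = ⊥-elim (All.lookup x∉ (∈-lookup j) e)
  lookup-unique (x ∷ L) (x∉ AllPairs.∷ u) (suc i) zero e = ⊥-elim (All.lookup x∉ (∈-lookup i) (≡sym e))
  lookup-unique (x ∷ L) (x∉ AllPairs.∷ u) (suc i) (suc j) e = cong suc (lookup-unique L u i j e)

  many-pairs : ∀ M r g n S X → M * (r * r) ≤ S → S + n * n ≤ g * (n * n) + X → g * (n * n) ≤ M * (r * r) → n * n ≤ X
  many-pairs M r g n S X h1 h2 h3 = lin (0) (h1 ⊕ h2 ⊕ h3) (solve (M ∷ r ∷ g ∷ n ∷ S ∷ X ∷ []))
  half-sum : ∀ A r1 M1 n → 2 * A * r1 ≤ n → 2 * A * M1 < n → 2 * (A * (r1 + M1)) < 2 * n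
  half-sum A r1 M1 n h1 h2 = lin (0) (h1 ⊕ h2) (solve (A ∷ r1 ∷ M1 ∷ n ∷ []))
  many-points : ∀ M1 r1 g n S X → M1 * r1 ≤ S → S + n ≤ g * n + X → g * n ≤ M1 * r1 → n ≤ X
  many-points M1 r1 g n S X h1 h2 h3 = lin (0) (h1 ⊕ h2 ⊕ h3) (solve (M1 ∷ r1 ∷ g ∷ n ∷ S ∷ X ∷ []))

  /-low : ∀ n K → .{{_ : NonZero K}} → K * (n / K) ≤ n
  /-low n K = ≤-trans (≤-reflexive (*-comm K (n / K))) (DivMod.m/n*n≤m n K)

  /-high : ∀ n K → .{{_ : NonZero K}} → n < K * suc (n / K)
  /-high n K = ≤-trans (s≤s (≤-reflexive (DivMod.m≡m%n+[m/n]*n n K)))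
    (≤-trans (+-monoˡ-≤ (n / K * K) (DivMod.m%n<n n K)) (≤-reflexive (*-comm (suc (n / K)) K)))

  /-high2 : ∀ n K → .{{_ : NonZero K}} → K ≤ n → n ≤ 2 * (K * (n / K))
  /-high2 n K K≤n = ≤-trans (<⇒≤ (/-high n K)) (≤-trans (*-monoʳ-≤ K (1+≤2* (n / K) (DivMod.m≥n⇒m/n>0 K≤n))) (≤-reflexive (arith K (n / K))))
    where
    1+≤2* : ∀ q → 1 ≤ q → suc q ≤ 2 * q
    1+≤2* q h = ≤-trans (+-monoˡ-≤ q h) (≤-reflexive (cong (q +_) (≡sym (+-identityʳ q))))
    arith : ∀ K q → K * (2 * q) ≡ 2 * (K * q)
    arith = solve-∀

-- As K ≤ n, a row of size n / K has size at least n/(2K); hence 2Kg such rows have total size at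
-- least g n, more than points covered fewer than g times allow.
boxPoints : ∀ {n} (Γ : Fin n → Fin n → Bool) K g .{{_ : NonZero K}} → K ≤ n →
  2 * K * g ≤ count (λ x → ge (count (Γ x)) (n / K)) → 2 ^ (2 * K * g) * g < n →
  Σ[ L ∈ List (Fin n) ] Unique L × length L ≡ g × Σ[ Y ∈ (Fin n → Bool) ] g ≤ count Y × (∀ x y → x ∈ L → Y y ≡ true → Γ x y ≡ true)
boxPoints {n} Γ K g K≤n rows big = finish (B.box xs (uniqueFrom (proj₁ picked) (proj₂ (proj₂ picked))) g (λ _ → true))
  where
  M = 2 * K * g
  r = n / K
  rowBig : Fin n → Bool
  rowBig x = ge (count (Γ x)) r
  picked = choose rowBig M rows
  xs = tabulate (proj₁ picked)
  len-xs : length xs ≡ M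
  len-xs = Listₚ.length-tabulate (proj₁ picked)
  module B = Box {Fin n} {Fin n} count count-cong count-split Γ g
  all₁ : count {n} (λ _ → true) ≡ n
  all₁ = trans (count≡∑ {n} (λ _ → true)) (trans (∑-const n 1) (*-identityʳ n))
  isBig : ∀ x → x ∈ xs → r ≤ count (Γ x)
  isBig x x∈ with tabulate-∈ {f = proj₁ picked} x∈
  ... | i , refl = ge⁻ (proj₁ (proj₂ picked) i)
  arith : ∀ g K r → g * (2 * (K * r)) ≡ 2 * K * g * r
  arith = solve-∀
  finish : B.Found xs g (λ _ → true) ⊎ sumL (λ x → count (Γ x)) xs + count {n} (λ _ → true) ≤ g * count {n} (λ _ → true) + 2 ^ length xs * g → _
  finish (inj₁ (L , _ , u , len , le)) = L , u , len , B.inAll L , le , λ x y x∈ e → B.inAll⁻ {L} {y} e x∈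
  finish (inj₂ le) = ⊥-elim (<⇒≱ big (many-points M r g n (sumL (λ x → count (Γ x)) xs) (2 ^ M * g)
      (≤-trans (≤-reflexive (cong (_* r) (≡sym len-xs))) (sumL-≥ xs isBig))
      (≤-trans (≤-reflexive (cong (sumL (λ x → count (Γ x)) xs +_) (≡sym all₁)))
        (≤-trans le (≤-reflexive (cong₂ _+_ (cong (g *_) all₁) (cong (λ l → 2 ^ l * g) len-xs)))))
      (≤-trans (*-monoʳ-≤ g (/-high2 n K K≤n)) (≤-reflexive (arith g K r)))))

-- With r = n / K ≥ n/(2K), this many sets of r² pairs have total size at least g n².
richBound : ℕ → ℕ → ℕ
richBound g K = 4 * (K * K) * g

-- `A` is the error factor of the first application of `box`, to M rich vertices. `K₁` keeps A (n /
-- K₁) at most n/2, and `M₁` is the number of rows required by the second application.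
module TripartiteBounds (g K : ℕ) where
  M = richBound g K
  A = 2 ^ M
  K₁ = 2 * A
  M₁ = 2 * K₁ * g
  threshold = K + K₁ + K₁ * M₁ + 2 ^ M₁ * g + 1

tripartite : ∀ {n} (G : SimpleGraph n) g K .{{_ : NonZero K}} → 1 ≤ g → TripartiteBounds.threshold g K ≤ n →
  richBound g K ≤ count (rich G (n / K)) → Tripartite G g
tripartite {n} G g K 1≤g big many = result
  where
  open TripartiteBounds g K
  instance
    K₁≢0 : NonZero K₁
    K₁≢0 = m*n≢0 2 A {{_}} {{m^n≢0 2 M}}
  r = n / K
  r₁ = n / K₁
  t = n * (r₁ + M₁)
  K≤n : K ≤ n
  K≤n = ≤-trans (≤-trans (m≤m+n K K₁) (≤-trans (m≤m+n _ (K₁ * M₁)) (≤-trans (m≤m+n _ (2 ^ M₁ * g)) (m≤m+n _ 1)))) big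
  K₁≤n : K₁ ≤ n
  K₁≤n = ≤-trans (≤-trans (m≤n+m K₁ K) (≤-trans (m≤m+n _ (K₁ * M₁)) (≤-trans (m≤m+n _ (2 ^ M₁ * g)) (m≤m+n _ 1)))) big
  K₁M₁<n : K₁ * M₁ < n
  K₁M₁<n = ≤-trans (≤-trans (≤-reflexive (+-comm 1 _)) (+-monoˡ-≤ 1 (≤-trans (m≤n+m (K₁ * M₁) (K + K₁)) (m≤m+n _ (2 ^ M₁ * g))))) big
  2^M₁g<n : 2 ^ M₁ * g < n
  2^M₁g<n = ≤-trans (≤-trans (≤-reflexive (+-comm 1 _)) (+-monoˡ-≤ 1 (m≤n+m (2 ^ M₁ * g) (K + K₁ + K₁ * M₁)))) big
  0<n : 0 < n
  0<n = ≤-trans (s≤s z≤n) K₁M₁<n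
  picked = choose (rich G r) M many
  vs = tabulate (proj₁ picked)
  S : Fin n → Fin n × Fin n → Bool
  S v (x , y) = adj G v x ∧ (adj G v y ∧ adj G x y)
  module B₁ = Box {Fin n} {Fin n × Fin n} (λ p → pairs (λ x y → p (x , y))) (λ e → pairs-cong (λ x y → e (x , y)))
    (λ p q → pairs-split (λ x y → p (x , y)) (λ x y → q (x , y))) S t
  len-vs : length vs ≡ M
  len-vs = Listₚ.length-tabulate (proj₁ picked)
  all² : pairs {n} {n} (λ _ _ → true) ≡ n * n
  all² = trans (∑-cong (λ i → trans (count≡∑ {n} (λ _ → true)) (trans (∑-const n 1) (*-identityʳ n)))) (∑-const n n)
  many² : g * (n * n) ≤ M * (r * r)
  many² = ≤-trans (*-monoʳ-≤ g (*-mono-≤ (/-high2 n K K≤n) (/-high2 n K K≤n))) (≤-reflexive (arith g K r))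
    where
    arith : ∀ g K r → g * (2 * (K * r) * (2 * (K * r))) ≡ 4 * (K * K) * g * (r * r)
    arith = solve-∀
  first : B₁.Found vs g (λ _ → true)
  first with B₁.box vs (uniqueFrom (proj₁ picked) (proj₂ (proj₂ picked))) g (λ _ → true)
  ... | inj₁ f = f
  ... | inj₂ le = ⊥-elim (<⇒≱ contra (many-pairs M r g n (sumL (λ v → pairs (λ x y → S v (x , y))) vs) (A * t)
      (≤-trans (≤-reflexive (cong (_* (r * r)) (≡sym len-vs))) (sumL-≥ vs (λ v v∈ → ge⁻ (isRich v v∈))))
      (≤-trans (≤-reflexive (cong (sumL (λ v → pairs (λ x y → S v (x , y))) vs +_) (≡sym all²)))
        (≤-trans le (≤-reflexive (cong₂ _+_ (cong (g *_) all²) (cong (λ l → 2 ^ l * t) len-vs))))) many²))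
    where
    isRich : ∀ v → v ∈ vs → rich G r v ≡ true
    isRich v v∈ with tabulate-∈ v∈
    ... | i , refl = proj₁ (proj₂ picked) i
    contra : A * t < n * n
    contra = ≤-trans (s≤s (≤-reflexive (arith A n (r₁ + M₁)))) (*-monoʳ-< n {{ℕ.>-nonZero 0<n}} (*-cancelˡ-< 2 _ n (half-sum A r₁ M₁ n (/-low n K₁) K₁M₁<n)))
      where
      arith : ∀ a n x → a * (n * x) ≡ n * (a * x)
      arith = solve-∀
  L₁ = proj₁ first
  uL₁ = proj₁ (proj₂ (proj₂ first))
  len₁ : length L₁ ≡ g
  len₁ = proj₁ (proj₂ (proj₂ (proj₂ first)))
  Γ : Fin n → Fin n → Bool
  Γ x y = B₁.inAll L₁ (x , y)
  Γ-big : t ≤ pairs Γ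
  Γ-big = proj₂ (proj₂ (proj₂ (proj₂ first)))
  rowBig : Fin n → Bool
  rowBig x = ge (count (Γ x)) r₁
  -- A short row has fewer than r₁ entries and a long one at most n, so n (r₁ + M₁) pairs force M₁
  -- long rows; `t` was chosen for this.
  rows : M₁ ≤ count rowBig
  rows = *-cancelˡ-≤ n {{ℕ.>-nonZero 0<n}} (+-cancelˡ-≤ (n * r₁) _ _ (≤-trans (≤-reflexive (≡sym (*-distribˡ-+ n r₁ M₁)))
    (≤-trans Γ-big (≤-trans (∑-mono pt) (≤-reflexive (trans (∑-+ (λ _ → r₁) (λ x → n * b2n (rowBig x)))
      (cong₂ _+_ (∑-const n r₁) (trans (∑-*ˡ n (λ x → b2n (rowBig x))) (cong (n *_) (≡sym (count≡∑ rowBig)))))))))))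
    where
    pt : ∀ x → count (Γ x) ≤ r₁ + n * b2n (rowBig x)
    pt x with bool (rowBig x)
    ... | inj₁ e rewrite e = ≤-trans (count≤n (Γ x)) (≤-trans (≤-reflexive (≡sym (*-identityʳ n))) (m≤n+m _ r₁))
    ... | inj₂ e = ≤-trans (<⇒≤ (<ᵇ⁻ (nf e))) (m≤m+n r₁ _)
      where
      nf : ∀ {b} → not b ≡ false → b ≡ true
      nf {true} _ = refl
  second = boxPoints Γ K₁ g K₁≤n (≤-trans rows ≤-refl) 2^M₁g<n
  L₂ = proj₁ second
  uL₂ = proj₁ (proj₂ second)
  len₂ : length L₂ ≡ g
  len₂ = proj₁ (proj₂ (proj₂ second))
  Y : Fin n → Bool
  Y = proj₁ (proj₂ (proj₂ (proj₂ second)))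
  Y-big : g ≤ count Y
  Y-big = proj₁ (proj₂ (proj₂ (proj₂ (proj₂ second))))
  y₀ = find Y (≤-trans 1≤g Y-big)
  all : ∀ {v x y} → v ∈ L₁ → x ∈ L₂ → Y y ≡ true → S v (x , y) ≡ true
  all {v} {x} {y} v∈ x∈ ye = B₁.inAll⁻ {L₁} (proj₂ (proj₂ (proj₂ (proj₂ (proj₂ second)))) x y x∈ ye) v∈
  l₁ : Fin g → Fin (length L₁)
  l₁ = subst Fin (≡sym len₁)
  l₂ : Fin g → Fin (length L₂)
  l₂ = subst Fin (≡sym len₂)
  subst-inj : ∀ {a b} (e : a ≡ b) i j → subst Fin e i ≡ subst Fin e j → i ≡ j
  subst-inj refl i j p = p
  l₁∈ : ∀ i → lookup L₁ (l₁ i) ∈ L₁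
  l₁∈ i = ∈-lookup (l₁ i)
  l₂∈ : ∀ i → lookup L₂ (l₂ i) ∈ L₂
  l₂∈ i = ∈-lookup (l₂ i)
  x₀ : Fin g
  x₀ = fromℕ< 1≤g
  result : Tripartite G g
  result = record
    { apex = λ i → lookup L₁ (l₁ i) ; apex-inj = λ i j e → subst-inj (≡sym len₁) i j (lookup-unique L₁ uL₁ _ _ e)
    ; X = memb L₂ ; Y = Y
    ; X-size = count-inj (memb L₂) g (λ i → lookup L₂ (l₂ i)) (λ i → memb⁺ (l₂∈ i)) (λ i j e → subst-inj (≡sym len₂) i j (lookup-unique L₂ uL₂ _ _ e))
    ; Y-size = Y-big
    ; apex-X = λ i x e → proj₁ (∧⁻ {adj G _ x} (all (l₁∈ i) (memb⁻ e) (proj₂ y₀)))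
    ; apex-Y = λ i y e → proj₁ (∧⁻ {adj G (lookup L₁ (l₁ i)) y} (proj₂ (∧⁻ {adj G (lookup L₁ (l₁ i)) (lookup L₂ (l₂ x₀))} (all (l₁∈ i) (l₂∈ x₀) e))))
    ; X-Y = λ x y ex ey → proj₂ (∧⁻ {adj G (lookup L₁ (l₁ x₀)) y} (proj₂ (∧⁻ {adj G (lookup L₁ (l₁ x₀)) x} (all (l₁∈ x₀) (memb⁻ ex) ey))))
    }

-- Splitting a graph of large minimum degree with few rich vertices

record Split {n} (G : SimpleGraph n) (r : ℕ) : Set where
  field
    T     : Bool → Fin n → Bool
    compl : ∀ s x → T (not s) x ≡ not (T s x)
    size  : ∀ s → 2 * count (T s) ≤ n + 2 * r
    few   : ∀ s → count (λ x → T s x ∧ ge (degIn G (T s) x) (2 * r)) ≤ 2 * r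

deg-split : ∀ {n} (G : SimpleGraph n) (T : Fin n → Bool) x → deg G x ≡ degIn G T x + degIn G (λ y → not (T y)) x
deg-split G T x = trans (count-split (adj G x) T) (cong₂ _+_ (count-cong (λ y → Boolₚ.∧-comm (adj G x y) (T y))) (count-cong (λ y → Boolₚ.∧-comm (adj G x y) (not (T y)))))

-- Markov's inequality for the degrees inside P.
few-bad : ∀ {n} (G : SimpleGraph n) P r → pairs (within G P) < r * r → count (λ x → P x ∧ ge (degIn G P x) r) ≤ r
few-bad G P r small = <⇒≤ (*-cancelʳ-< r _ r (≤-trans (s≤s le) small))
  where
  Q = λ x → P x ∧ ge (degIn G P x) r
  le : count Q * r ≤ pairs (within G P)
  le = ≤-trans (∑-P≥ Q (degIn G P) r (λ x e → ge⁻ (proj₂ (∧⁻ {P x} e))))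
    (≤-trans (∑-mono (λ x → *-monoˡ-≤ (degIn G P x) (b2n-mono (λ e → proj₁ (∧⁻ {P x} e))))) (≤-reflexive (≡sym (pairs-within G P))))

complement-size : ∀ n t f → n ≤ 2 * t → t + f ≤ n → 2 * f ≤ n
complement-size n t f h1 h2 = lin (0) (h1 ⊕ 2 ⊛ h2) (solve (n ∷ t ∷ f ∷ []))
neighbourhood-size : ∀ n t f d di df r → n ≤ 2 * d → d ≤ di + df → di ≤ r → df ≤ f → t + f ≤ n → 2 * t ≤ n + 2 * r
neighbourhood-size n t f d di df r h1 h2 h3 h4 h5 = lin (0) (h1 ⊕ 2 ⊛ h2 ⊕ 2 ⊛ h3 ⊕ 2 ⊛ h4 ⊕ 2 ⊛ h5) (solve (n ∷ t ∷ f ∷ d ∷ di ∷ df ∷ r ∷ []))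
few-missing : ∀ n f d di df r mi → n ≤ 2 * d → d ≤ di + df → di ≤ r → df + mi ≤ f → 2 * f ≤ n → mi ≤ r
few-missing n f d di df r mi h1 h2 h3 h4 h5 = *-cancelˡ-≤ 2 (lin (0) (h1 ⊕ 2 ⊛ h2 ⊕ 2 ⊛ h3 ⊕ 2 ⊛ h4 ⊕ h5) (solve (n ∷ f ∷ d ∷ di ∷ df ∷ r ∷ mi ∷ [])))
still-dense : ∀ r x y mi → 2 * r ≤ x → x ≤ y + mi → mi ≤ r → r ≤ y
still-dense r x y mi h1 h2 h3 = lin (0) (h1 ⊕ h2 ⊕ h3) (solve (r ∷ x ∷ y ∷ mi ∷ []))
typical-exists : ∀ n d c q r M b → n ≤ 2 * d → d ≤ c + q → q ≤ b + M → b ≤ r → 2 * r + 2 * M < n → 1 ≤ 2 * c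
typical-exists n d c q r M b h1 h2 h3 h4 h5 = lin (0) (h1 ⊕ 2 ⊛ h2 ⊕ 2 ⊛ h3 ⊕ 2 ⊛ h4 ⊕ h5) (solve (n ∷ d ∷ c ∷ q ∷ r ∷ M ∷ b ∷ []))

-- The parts are N(v) and its complement. N(v) is sparse as v is not rich. The complement has at
-- most n/2 vertices, and a, with degree at least n/2 and at most r neighbours in N(v), misses at
-- most r of them; so the complement is nearly contained in N(a), which is sparse as well.
splitAlong : ∀ {n} (G : SimpleGraph n) r v a → (∀ v → n ≤ 2 * deg G v) →
  pairs (within G (adj G v)) < r * r → pairs (within G (adj G a)) < r * r → degIn G (adj G v) a ≤ r → Split G r
splitAlong {n} G r v a mindeg v-poor a-poor va = record
  { T = λ { true → N ; false → Nᶜ }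
  ; compl = λ { true x → refl ; false x → ≡sym (Boolₚ.not-involutive (N x)) }
  ; size = λ { true → size-t ; false → ≤-trans size-f (m≤m+n n (2 * r)) }
  ; few = λ { true → few-t ; false → few-f }
  }
  where
  N = adj G v
  few₁ : count (λ x → N x ∧ ge (degIn G N x) r) ≤ r
  few₁ = few-bad G N r v-poor
  Nᶜ : Fin n → Bool
  Nᶜ x = not (N x)
  size-f : 2 * count Nᶜ ≤ n
  size-f = complement-size n (count N) (count Nᶜ) (mindeg v) (≤-reflexive (count-not N))
  size-t : 2 * count N ≤ n + 2 * r
  size-t = neighbourhood-size n (count N) (count Nᶜ) (deg G a) (degIn G N a) (degIn G Nᶜ a) r (mindeg a) (≤-reflexive (deg-split G N a)) va
    (count-mono (λ y e → proj₁ (∧⁻ {Nᶜ y} e))) (≤-reflexive (count-not N))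
  few-t : count (λ x → N x ∧ ge (degIn G N x) (2 * r)) ≤ 2 * r
  few-t = ≤-trans (count-mono (λ x e → ∧⁺ (proj₁ (∧⁻ {N x} e)) (ge⁺ (≤-trans (m≤m+n r (r + 0)) (ge⁻ (proj₂ (∧⁻ {N x} e)))))))
    (≤-trans few₁ (m≤m+n r (r + 0)))
  miss : count (λ y → Nᶜ y ∧ not (adj G a y)) ≤ r
  miss = few-missing n (count Nᶜ) (deg G a) (degIn G N a) (degIn G Nᶜ a) r _ (mindeg a) (≤-reflexive (deg-split G N a)) va
    (≤-reflexive (≡sym (count-split Nᶜ (adj G a)))) size-f
  few-f : count (λ x → Nᶜ x ∧ ge (degIn G Nᶜ x) (2 * r)) ≤ 2 * r
  few-f = ≤-trans (≤-reflexive (count-split _ (adj G a))) (≤-trans (+-mono-≤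
    (≤-trans (count-mono (λ b e → ∧⁺ (proj₂ (∧⁻ {Nᶜ b ∧ ge (degIn G Nᶜ b) (2 * r)} e)) (ge⁺ (lem b (ge⁻ (proj₂ (∧⁻ {Nᶜ b} (proj₁ (∧⁻ {Nᶜ b ∧ ge (degIn G Nᶜ b) (2 * r)} e)))))))))
      (few-bad G (adj G a) r a-poor))
    (≤-trans (count-mono (λ b e → ∧⁺ (proj₁ (∧⁻ {Nᶜ b} (proj₁ (∧⁻ {Nᶜ b ∧ ge (degIn G Nᶜ b) (2 * r)} e)))) (proj₂ (∧⁻ {Nᶜ b ∧ ge (degIn G Nᶜ b) (2 * r)} e)))) miss))
    (≤-reflexive (cong (r +_) (≡sym (+-identityʳ r)))))
    where
    pt : ∀ p q s → p ∧ s ≡ true → (q ∧ s) ∨ (p ∧ not q) ≡ true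
    pt true true s e rewrite e = refl
    pt true false s e = refl
    lem : ∀ b → 2 * r ≤ degIn G Nᶜ b → r ≤ degIn G (adj G a) b
    lem b h = still-dense r (degIn G Nᶜ b) (degIn G (adj G a) b) (count (λ y → Nᶜ y ∧ not (adj G a y))) h
      (≤-trans (count-mono {q = λ y → (adj G a y ∧ adj G b y) ∨ (Nᶜ y ∧ not (adj G a y))} (λ y e → pt (Nᶜ y) (adj G a y) (adj G b y) e))
        (count-∨ (λ y → adj G a y ∧ adj G b y) (λ y → Nᶜ y ∧ not (adj G a y)))) miss

split : ∀ {n} (G : SimpleGraph n) r M → (∀ v → n ≤ 2 * deg G v) → count (rich G r) ≤ M → 2 * r + 2 * M < n → Split G r
split {n} G r M mindeg few-rich big = splitAlong G r v a mindeg (nonrich v (proj₂ v₀)) (nonrich a (proj₂ a-ok)) (small (proj₁ a-ok))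
  where
  bad : Fin n → Fin n → Bool
  bad v x = ge (degIn G (adj G v) x) r
  nonrich : ∀ v → rich G r v ≡ false → pairs (within G (adj G v)) < r * r
  nonrich v e with bool (pairs (within G (adj G v)) <ᵇ r * r)
  ... | inj₁ q = <ᵇ⁻ q
  ... | inj₂ q = t≢f (cong not q) e
  v₀ : ∃ λ v → rich G r v ≡ false
  v₀ with find? (λ v → not (rich G r v))
  ... | inj₁ (v , e) = v , not⁻ e
  ... | inj₂ f = ⊥-elim (<⇒≱ (≤-trans (s≤s (≤-trans few-rich (≤-trans (m≤n+m M (2 * r + M)) (≤-reflexive (arith r M))))) big)
        (≤-reflexive (trans (≡sym (count-not (rich G r))) (trans (cong (count (rich G r) +_) (count-none (λ v → not (rich G r v)) f)) (+-identityʳ _)))))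
    where
    arith : ∀ r M → 2 * r + M + M ≡ 2 * r + 2 * M
    arith = solve-∀
  v = proj₁ v₀
  N = adj G v
  few₁ : count (λ x → N x ∧ bad v x) ≤ r
  few₁ = few-bad G N r (nonrich v (proj₂ v₀))
  -- N(v) has at least n/2 > r + M vertices, of which at most r have many neighbours in N(v) and at
  -- most M are rich.
  a₀ : ∃ λ a → N a ∧ not (bad v a ∨ rich G r a) ≡ true
  a₀ = find _ (pos _ (typical-exists n (count N) (count (λ a → N a ∧ not (bad v a ∨ rich G r a))) (count (λ a → N a ∧ (bad v a ∨ rich G r a))) r M (count (λ x → N x ∧ bad v x)) (mindeg v)
    (≤-reflexive (trans (count-split N (λ a → bad v a ∨ rich G r a)) (+-comm (count (λ a → N a ∧ (bad v a ∨ rich G r a))) _)))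
    (≤-trans (count-mono {q = λ a → (N a ∧ bad v a) ∨ rich G r a} (λ a e → pt (N a) (bad v a) (rich G r a) e)) (≤-trans (count-∨ (λ a → N a ∧ bad v a) (rich G r)) (+-monoʳ-≤ _ few-rich))) few₁ big))
    where
    pos : ∀ c → 1 ≤ 2 * c → 1 ≤ c
    pos (suc c) _ = s≤s z≤n
    pt : ∀ p q s → p ∧ (q ∨ s) ≡ true → (p ∧ q) ∨ s ≡ true
    pt true q s e = e
  a = proj₁ a₀
  or-f : ∀ {p q} → p ∨ q ≡ false → p ≡ false × q ≡ false
  or-f {false} {false} _ = refl , refl
  a-ok : bad v a ≡ false × rich G r a ≡ false
  a-ok = or-f {bad v a} (not⁻ (proj₂ (∧⁻ {N a} (proj₂ a₀))))
  small : ∀ {x k} → ge x k ≡ false → x ≤ k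
  small {x} {k} e with bool (x <ᵇ k)
  ... | inj₁ q = <⇒≤ (<ᵇ⁻ q)
  ... | inj₂ q = t≢f (cong not q) e

-- Partial placements, and the bipartition outside W

module Assign {N n} (p : Fin N → Bool) (g : Fin (count p) → Fin n) (g-inj : ∀ i j → g i ≡ g j → i ≡ j) where

  private
    at : ∀ x → (p x ≡ true) ⊎ (p x ≡ false) → Maybe (Fin n)
    at x (inj₁ e) = just (g (proj₁ (nth-surj p x e)))
    at x (inj₂ _) = nothing

    at-just : ∀ x b v → at x b ≡ just v → ∃ λ i → v ≡ g i × nth p i ≡ x
    at-just x (inj₁ e) v refl = proj₁ (nth-surj p x e) , refl , proj₂ (nth-surj p x e)

  assign : Fin N → Maybe (Fin n)
  assign x = at x (bool (p x))

  assign-just : ∀ x v → assign x ≡ just v → ∃ λ i → v ≡ g i × nth p i ≡ x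
  assign-just x = at-just x (bool (p x))

  assign-inj : ∀ x y v → assign x ≡ just v → assign y ≡ just v → x ≡ y
  assign-inj x y v e e′ with assign-just x v e | assign-just y v e′
  ... | i , q , q′ | j , k , k′ with g-inj i j (trans (≡sym q) k)
  ...   | refl = trans (≡sym q′) k′

  assign-⊤ : ∀ x → assign x ≢ nothing → p x ≡ true
  assign-⊤ x ne with bool (p x)
  ... | inj₁ e = e
  ... | inj₂ e = ⊥-elim (ne refl)

  assign-⊥ : ∀ x → assign x ≡ nothing → p x ≡ false
  assign-⊥ x e with bool (p x)
  ... | inj₂ q = q

∈-tabulate⁺ : ∀ {M n} (f : Fin M → Fin n) i → f i ∈ tabulate f
∈-tabulate⁺ f i = Anyₚ.tabulate⁺ i refl

∈-tabulate⁻ : ∀ {M n} {f : Fin M → Fin n} {x} → x ∈ tabulate f → ∃ λ i → x ≡ f i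
∈-tabulate⁻ p = Anyₚ.tabulate⁻ p

pairs-remove : ∀ {n} (G : SimpleGraph n) P L Δ → (∀ x → P x ≡ true → degIn G P x ≤ Δ) →
  pairs (within G P) ≤ pairs (within G (λ z → P z ∧ not (memb L z))) + 2 * (length L * Δ)
pairs-remove {n} G P L Δ bound = ≤-trans (≤-reflexive (pairs≡∑∑ R)) (≤-trans (∑-mono (λ x → ∑-mono (λ y → pt x y)))
  (≤-trans (≤-reflexive (trans (∑∑-+ (λ x y → b2n (R′ x y)) _) (cong₂ _+_ (≡sym (pairs≡∑∑ R′)) (trans (∑∑-+ (λ x y → b2n (memb L x ∧ R x y)) (λ x y → b2n (memb L y ∧ R x y)))
     (cong₂ _+_ (≡sym (pairs≡∑∑ (λ x y → memb L x ∧ R x y))) (≡sym (pairs≡∑∑ (λ x y → memb L y ∧ R x y))))))))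
   (+-monoʳ-≤ (pairs R′) (≤-trans (+-mono-≤ rows cols) (≤-reflexive (cong (length L * Δ +_) (≡sym (+-identityʳ _))))))))
  where
  P′ = λ z → P z ∧ not (memb L z)
  R = within G P
  R′ = within G P′
  pt : ∀ x y → b2n (R x y) ≤ b2n (R′ x y) + (b2n (memb L x ∧ R x y) + b2n (memb L y ∧ R x y))
  pt x y = lem (P x) (P y) (adj G x y) (memb L x) (memb L y)
    where
    lem : ∀ p q a s t → b2n (p ∧ (q ∧ a)) ≤ b2n ((p ∧ not s) ∧ ((q ∧ not t) ∧ a)) + (b2n (s ∧ (p ∧ (q ∧ a))) + b2n (t ∧ (p ∧ (q ∧ a))))
    lem false q a s t = z≤n
    lem true false a s t = z≤n
    lem true true false s t = z≤n
    lem true true true false false = s≤s z≤n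
    lem true true true false true = s≤s z≤n
    lem true true true true t = s≤s z≤n
  R≤ : ∀ x → count (R x) ≤ Δ
  R≤ x with bool (P x)
  ... | inj₁ e = ≤-trans (count-mono (λ y q → proj₂ (∧⁻ {P x} q))) (bound x e)
  ... | inj₂ e rewrite e = ≤-trans (≤-reflexive (count-none {n} (λ _ → false) (λ _ → refl))) z≤n
  rows : pairs (λ x y → memb L x ∧ R x y) ≤ length L * Δ
  rows = ≤-trans (≤-reflexive (pairs-row (memb L) R)) (≤-trans (∑-P≤ (memb L) (λ x → count (R x)) Δ (λ x _ → R≤ x)) (*-monoˡ-≤ Δ (count-memb L)))
  swapR : ∀ y x → (memb L y ∧ R x y) ≡ (memb L y ∧ R y x)
  swapR y x = cong (memb L y ∧_) (lem (P x) (P y) (adj G x y) (adj G y x) (sym G x y))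
    where
    lem : ∀ p q a b → a ≡ b → p ∧ (q ∧ a) ≡ q ∧ (p ∧ b)
    lem true q a .a refl = refl
    lem false true a .a refl = refl
    lem false false a .a refl = refl
  cols : pairs (λ x y → memb L y ∧ R x y) ≤ length L * Δ
  cols = ≤-trans (≤-reflexive (trans (pairs-swap (λ x y → memb L y ∧ R x y)) (pairs-cong swapR))) rows

-- Errors are measured in units of r, a small fraction of n: a vertex belongs to W when it has at
-- least c r neighbours on each side, and n exceeds L r.
module Consts (N e h : ℕ) where
  -- Of c r common neighbours at most 2r are exceptional, and the remaining (3h + 2) r exceed the
  -- greedy demand h (2 + 3r) because h < r.
  c = 3 * h + 4
  -- Own degrees are at most (c + 2) r. Without N + e disjoint edges away from a star of 1 + N
  -- vertices, at most κ r ordered pairs inside a part are adjacent.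
  κ = (4 * (N + e) + 2 * (1 + N)) * (c + 2)
  -- The same bound when there are no e disjoint edges in a part; `κ₂` then bounds the total
  -- deficit, its summand 1 absorbing terms independent of n.
  κ′ = 4 * e * (c + 2)
  κ₂ = 4 * κ′ + 1
  -- The longest list that free vertices must see: a star of 1 + N vertices and both ends of N + e
  -- edges, with a margin.
  λ₀ = 3 + 3 * N + 2 * e
  k₁ = 4 * c + 4
  k₂ = 4 * κ + 1
  -- Makes n/(4e) - r at least ((c + 1) e + c) r: enough for a vertex to keep c r neighbours after
  -- losing (c + 1) r to each of e others.
  k₃ = 4 * e * ((c + 1) * e + c + 1)
  -- (κ₂ + c + 1) r bounds the vertices missed across by a vertex of a part, and those missed by a
  -- vertex of W once |W| = |U|; λ₀ such losses must leave c r vertices of a side.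
  k₄ = 4 * (λ₀ * (κ₂ + c + 1) + c + 3)
  L = k₁ + k₂ + k₃ + k₄

private
  weaken : ∀ k L r n x → L * r < n → k + x ≤ L → k * r < n
  weaken k L r n x h1 h2 = lin (r * x) (h1 ⊕ r ⊛ h2) (solve (k ∷ L ∷ r ∷ n ∷ x ∷ []))
  missArith : ∀ n dg ds dn k mi t r → n ≤ 2 * dg → dg ≤ ds + dn → ds ≤ k → mi + dn ≤ t → 2 * t ≤ n + 2 * r → mi ≤ r + k
  missArith n dg ds dn k mi t r h1 h2 h3 h4 h5 = *-cancelˡ-≤ 2 (lin (0) (h1 ⊕ 2 ⊛ h2 ⊕ 2 ⊛ h3 ⊕ 2 ⊛ h4 ⊕ h5) (solve (n ∷ dg ∷ ds ∷ dn ∷ k ∷ mi ∷ t ∷ r ∷ [])))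
  roomy : ∀ h r x y → (3 * h + 4) * r ≤ x → x ≤ y + 2 * r → h < r → h * (2 + 3 * r) < y
  roomy h r x y h1 h2 h3 = lin (1) (h1 ⊕ h2 ⊕ 2 ⊛ h3) (solve (h ∷ r ∷ x ∷ y ∷ []))
  sizeLow : ∀ n t f r → t + f ≤ n → n ≤ t + f → 2 * f ≤ n + 2 * r → n ≤ 2 * t + 2 * r
  sizeLow n t f r _ h2 h3 = lin (0) (2 ⊛ h2 ⊕ h3) (solve (n ∷ t ∷ f ∷ r ∷ []))
  goodArith : ∀ n t r x k c l q → n ≤ 2 * t + 2 * r → t ≤ x + l * (k * r) → 4 * (q * k + c + 3) * r < n → l ≤ q → c * r ≤ x
  goodArith n t r x k c l q h1 h2 h3 h4 = *-cancelˡ-≤ 4 (lin (1 + 2 * k * q * r + 10 * r + 2 * x) (h1 ⊕ 2 ⊛ h2 ⊕ h3 ⊕ 2 ⊛ ((k * r) ⊛ h4)) (solve (n ∷ t ∷ r ∷ x ∷ k ∷ c ∷ l ∷ q ∷ [])))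
  disj : ∀ n dg a b c r → n ≤ 2 * dg → dg ≤ a + b → a < c * r → b < c * r → (4 * c + 4) * r < n → ⊥
  disj n dg a b c r h1 h2 h3 h4 h5 = 1≰0 (*-cancelˡ-≤ 5 (lin (4 * r) (h1 ⊕ 2 ⊛ h2 ⊕ 2 ⊛ h3 ⊕ 2 ⊛ h4 ⊕ h5) (solve (n ∷ dg ∷ a ∷ b ∷ c ∷ r ∷ []))))
  lowOther : ∀ n dg a b c r → n ≤ 2 * dg → dg ≤ a + b → a < c * r → (4 * c + 4) * r < n → 2 * r ≤ b
  lowOther n dg a b c r h1 h2 h3 h4 = *-cancelˡ-≤ 2 (lin (3 + 2 * c * r) (h1 ⊕ 2 ⊛ h2 ⊕ 2 ⊛ h3 ⊕ h4) (solve (n ∷ dg ∷ a ∷ b ∷ c ∷ r ∷ [])))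

module Partitioned {N : ℕ} (Q : SimpleGraph N) (ℓ : Fin (1 + N) → Fin (1 + N) → ℕ) (valid : ValidLengths (cone Q) ℓ)
  (col : Fin N → Bool) (proper : ∀ x y → adj Q x y ≡ true → col y ≡ not (col x))
  {n : ℕ} (G : SimpleGraph n) (noCopy : ¬ (oddBalloon (cone Q) ℓ ⊆ G)) (r : ℕ) (S : Split G r) (mindeg : ∀ v → n ≤ 2 * deg G v)
  (h e : ℕ) (len : length (balloonVertices (cone Q) ℓ) ≤ h) (e≡ : edges Q ≡ e) (h<r : h < r) (big : Consts.L N e h * r < n) where

  open Consts N e h
  open Split S

  big₁ : k₁ * r < n
  big₁ = weaken k₁ L r n (k₂ + k₃ + k₄) big (≤-reflexive (arith k₁ k₂ k₃ k₄))
    where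
    arith : ∀ a b c d → a + (b + c + d) ≡ a + b + c + d
    arith = solve-∀
  big₂ : k₂ * r < n
  big₂ = weaken k₂ L r n (k₁ + k₃ + k₄) big (≤-reflexive (arith k₁ k₂ k₃ k₄))
    where
    arith : ∀ a b c d → b + (a + c + d) ≡ a + b + c + d
    arith = solve-∀
  big₃ : k₃ * r < n
  big₃ = weaken k₃ L r n (k₁ + k₂ + k₄) big (≤-reflexive (arith k₁ k₂ k₃ k₄))
    where
    arith : ∀ a b c d → c + (a + b + d) ≡ a + b + c + d
    arith = solve-∀
  big₄ : k₄ * r < n
  big₄ = weaken k₄ L r n (k₁ + k₂ + k₃) big (≤-reflexive (arith k₁ k₂ k₃ k₄))
    where
    arith : ∀ a b c d → d + (a + b + c) ≡ a + b + c + d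
    arith = solve-∀

  d : Bool → Fin n → ℕ
  d s = degIn G (T s)

  missing : Bool → Fin n → ℕ
  missing s x = count (λ z → T s z ∧ not (adj G x z))

  deg≡ : ∀ s x → deg G x ≡ d s x + d (not s) x
  deg≡ s x = trans (deg-split G (T s) x) (cong (d s x +_) (count-cong (λ y → cong (_∧ adj G x y) (≡sym (compl s y)))))

  size≡ : ∀ s → count (T s) + count (T (not s)) ≡ n
  size≡ s = trans (cong (count (T s) +_) (count-cong (compl s))) (count-not (T s))

  missing+d : ∀ s x → missing s x + d s x ≡ count (T s)
  missing+d s x = trans (+-comm (missing s x) _) (≡sym (count-split (T s) (adj G x)))

  missing≤ : ∀ s x k → d s x ≤ k → missing (not s) x ≤ r + k
  missing≤ s x k p = missArith n (deg G x) (d s x) (d (not s) x) k (missing (not s) x) (count (T (not s))) r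
    (mindeg x) (≤-reflexive (deg≡ s x)) p (≤-reflexive (missing+d (not s) x)) (size (not s))

  isLow : Bool → Fin n → Bool
  isLow s x = not (ge (d s x) (2 * r))

  -- Free vertices are chosen only among the low ones: these miss at most 3r vertices of the
  -- opposite side.
  side : Bool → Fin n → Bool
  side s x = T s x ∧ isLow s x

  not-ge : ∀ {x k} → not (ge x k) ≡ true → x < k
  not-ge {x} {k} e = <ᵇ⁻ (trans (≡sym (Boolₚ.not-involutive (x <ᵇ k))) e)

  cross : ∀ s z → side s z ≡ true → count (λ y → side (not s) y ∧ not (adj G z y)) ≤ 3 * r
  cross s z e = ≤-trans (count-mono (λ y q → ∧⁺ (proj₁ (∧⁻ {T (not s) y} (proj₁ (∧⁻ {side (not s) y} q)))) (proj₂ (∧⁻ {side (not s) y} q))))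
    (≤-trans (missing≤ s z (2 * r) (<⇒≤ (not-ge (proj₂ (∧⁻ {T s z} e))))) (≤-reflexive (arith r)))
    where
    arith : ∀ r → r + 2 * r ≡ 3 * r
    arith = solve-∀

  open Instances Q ℓ valid col proper G side (3 * r) h cross len public

  mkGood : ∀ s L → c * r ≤ count (λ z → T s z ∧ allAdj L z) → Good s L
  mkGood s L p = good (roomy h r _ (count (λ z → side s z ∧ allAdj L z)) p
    (≤-trans (count-minus (λ z → T s z ∧ allAdj L z) (λ z → T s z ∧ ge (d s z) (2 * r)))
      (+-mono-≤ (count-mono (λ z q → lem (T s z) (allAdj L z) (ge (d s z) (2 * r)) q)) (few s))) h<r)
    where
    lem : ∀ t a g → (t ∧ a) ∧ not (t ∧ g) ≡ true → (t ∧ not g) ∧ a ≡ true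
    lem true a g q = ∧⁺ (proj₂ (∧⁻ {a} q)) (proj₁ (∧⁻ {a} q))

  lossList : ∀ P L → count P ≤ count (λ z → P z ∧ allAdj L z) + sumL (λ x → count (λ z → P z ∧ not (adj G x z))) L
  lossList P [] = ≤-reflexive (trans (count-cong (λ z → ≡sym (Boolₚ.∧-identityʳ (P z)))) (≡sym (+-identityʳ _)))
  lossList P (x ∷ L) = begin
    count P ≤⟨ lossList P L ⟩
    A + s ≡⟨ cong (_+ s) (count-split (λ z → P z ∧ allAdj L z) (adj G x)) ⟩
    count (λ z → (P z ∧ allAdj L z) ∧ adj G x z) + count (λ z → (P z ∧ allAdj L z) ∧ not (adj G x z)) + s
      ≤⟨ +-monoˡ-≤ s (+-mono-≤ (count-mono (λ z q → lem₁ (P z) (allAdj L z) (adj G x z) q)) (count-mono (λ z q → lem₂ (P z) (allAdj L z) (adj G x z) q))) ⟩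
    count (λ z → P z ∧ (adj G x z ∧ allAdj L z)) + count (λ z → P z ∧ not (adj G x z)) + s ≡⟨ +-assoc (count (λ z → P z ∧ (adj G x z ∧ allAdj L z))) _ s ⟩
    count (λ z → P z ∧ (adj G x z ∧ allAdj L z)) + (count (λ z → P z ∧ not (adj G x z)) + s) ∎
    where
    open ≤-Reasoning
    A = count (λ z → P z ∧ allAdj L z)
    s = sumL (λ x → count (λ z → P z ∧ not (adj G x z))) L
    lem₁ : ∀ p a b → (p ∧ a) ∧ b ≡ true → p ∧ (b ∧ a) ≡ true
    lem₁ true a b q = ∧⁺ (proj₂ (∧⁻ {a} q)) (proj₁ (∧⁻ {a} q))
    lem₂ : ∀ p a b → (p ∧ a) ∧ not b ≡ true → p ∧ not b ≡ true
    lem₂ true a b q = proj₂ (∧⁻ {a} q)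

  sumL-≤∈ : {V : Set} {f : V → ℕ} {k : ℕ} (vs : List V) → (∀ v → v ∈ vs → f v ≤ k) → sumL f vs ≤ length vs * k
  sumL-≤∈ []       h = z≤n
  sumL-≤∈ (v ∷ vs) h = +-mono-≤ (h v (here refl)) (sumL-≤∈ vs (λ w p → h w (there p)))

  sizeLower : ∀ s → n ≤ 2 * count (T s) + 2 * r
  sizeLower s = sizeLow n (count (T s)) (count (T (not s))) r (≤-reflexive (size≡ s)) (≤-reflexive (≡sym (size≡ s))) (size (not s))

  listGood : ∀ s L → length L ≤ λ₀ → (∀ x → x ∈ L → missing s x ≤ (κ₂ + c + 1) * r) → Good s L
  listGood s L len miss = mkGood s L (goodArith n (count (T s)) r _ (κ₂ + c + 1) c (length L) λ₀ (sizeLower s)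
    (≤-trans (lossList (T s) L) (+-monoʳ-≤ _ (sumL-≤∈ L miss))) (subst (λ z → 4 * z * r < n) (arith (λ₀ * (κ₂ + c + 1)) c) big₄) len)
    where
    arith : ∀ a c → a + c + 3 ≡ a + c + 3
    arith a c = refl

  -- Membership depends on the degree into `T s`, not on lying in `T s`: exceptional vertices are
  -- thereby moved to the part where they belong, and W is all that remains.
  Part : Bool → Fin n → Bool
  Part s x = not (ge (d s x) (c * r))

  W : Fin n → Bool
  W x = not (Part true x) ∧ not (Part false x)

  Part< : ∀ {s x} → Part s x ≡ true → d s x < c * r
  Part< = not-ge

  V-disjoint : ∀ s x → Part s x ≡ true → Part (not s) x ≡ true → ⊥
  V-disjoint s x p q = disj n (deg G x) (d s x) (d (not s) x) c r (mindeg x) (≤-reflexive (deg≡ s x)) (Part< {s} p) (Part< {not s} q) big₁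

  V-W : ∀ s x → Part s x ≡ true → W x ≡ true → ⊥
  V-W true  x p q = t≢f p (not⁻ (proj₁ (∧⁻ {not (Part true x)} q)))
  V-W false x p q = t≢f p (not⁻ (proj₂ (∧⁻ {not (Part true x)} q)))

  W-d : ∀ s x → W x ≡ true → c * r ≤ d s x
  W-d s x e = ge⁻ (lem s)
    where
    dn : ∀ {b} → not (not b) ≡ true → b ≡ true
    dn {true} _ = refl
    lem : ∀ s → ge (d s x) (c * r) ≡ true
    lem true  = dn (proj₁ (∧⁻ {not (Part true x)} e))
    lem false = dn (proj₂ (∧⁻ {not (Part true x)} e))

  V-missing : ∀ s x → Part s x ≡ true → missing (not s) x ≤ (c + 1) * r
  V-missing s x p = ≤-trans (missing≤ s x (c * r) (<⇒≤ (Part< {s} p))) (≤-reflexive (arith c r))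
    where
    arith : ∀ c r → r + c * r ≡ (c + 1) * r
    arith = solve-∀

  V-missing′ : ∀ s x → Part s x ≡ true → missing (not s) x ≤ (κ₂ + c + 1) * r
  V-missing′ s x p = ≤-trans (V-missing s x p) (*-monoˡ-≤ r (≤-trans (m≤n+m (c + 1) κ₂) (≤-reflexive (≡sym (+-assoc κ₂ c 1)))))

  W-good : ∀ s x → W x ≡ true → Good s (x ∷ [])
  W-good s x e = mkGood s (x ∷ []) (≤-trans (W-d s x e) (≤-reflexive (count-cong (λ z → cong (T s z ∧_) (≡sym (Boolₚ.∧-identityʳ _))))))

  Δ = (c + 2) * r

  -- A neighbour in `Part s` that lies in `T (not s)` has few neighbours in `T s`, hence at least 2r
  -- in its own `T (not s)`, and is one of the 2r exceptions there.
  V-own : ∀ s x → Part s x ≡ true → degIn G (Part s) x ≤ Δ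
  V-own s x p = begin
    count (λ y → Part s y ∧ adj G x y) ≤⟨ count-minus (λ y → Part s y ∧ adj G x y) (λ y → T (not s) y ∧ ge (d (not s) y) (2 * r)) ⟩
    count (λ y → (Part s y ∧ adj G x y) ∧ not (T (not s) y ∧ ge (d (not s) y) (2 * r))) + count (λ y → T (not s) y ∧ ge (d (not s) y) (2 * r))
      ≤⟨ +-mono-≤ (count-mono pt) (few (not s)) ⟩
    d s x + 2 * r ≤⟨ +-monoˡ-≤ (2 * r) (<⇒≤ (Part< {s} p)) ⟩
    c * r + 2 * r ≡⟨ ≡sym (*-distribʳ-+ r c 2) ⟩
    Δ ∎
    where
    open ≤-Reasoning
    pt : ∀ y → (Part s y ∧ adj G x y) ∧ not (T (not s) y ∧ ge (d (not s) y) (2 * r)) ≡ true → T s y ∧ adj G x y ≡ true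
    pt y q with ∧⁻ {Part s y ∧ adj G x y} q
    ... | q₁ , q₂ with ∧⁻ {Part s y} q₁ | bool (T s y)
    ...   | vy , a | inj₁ t = ∧⁺ t a
    ...   | vy , a | inj₂ f = t≢f (∧⁺ (trans (compl s y) (cong not f)) (ge⁺ (lowOther n (deg G y) (d s y) (d (not s) y) c r (mindeg y) (≤-reflexive (deg≡ s y)) (Part< {s} vy) big₁)))
              (not⁻ q₂)

  W≤e : count W ≤ e
  W≤e = ≮⇒≥ λ lt → let g , gW , g-inj = choose W (suc e) lt in
    noCopy (embedManyHubs g (≤-reflexive e≡) g-inj (λ i s → W-good s (g i) (gW i)))

  matching-disjoint : ∀ {P M} (m : Matching G P M) → Disjoint (λ i → edge (Matching.w m i) (Matching.a m i))
  matching-disjoint m i j x (here p) (here q) = Matching.w-inj m i j (trans (≡sym p) q)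
  matching-disjoint m i j x (here p) (there (here q)) = ⊥-elim (Matching.w≢a m i j (trans (≡sym p) q))
  matching-disjoint m i j x (there (here p)) (here q) = ⊥-elim (Matching.w≢a m j i (trans (≡sym q) p))
  matching-disjoint m i j x (there (here p)) (there (here q)) = Matching.a-inj m i j (trans (≡sym p) q)

  verts-P : ∀ {P M} (m : Matching G P M) i x → x ∈ verts (edge (Matching.w m i) (Matching.a m i)) → P x ≡ true
  verts-P m i x (here refl) = Matching.w∈ m i
  verts-P m i x (there (here refl)) = Matching.a∈ m i

  -- A vertex with many neighbours on its own side forces the own-side matchings to be small.
  starMatching : ∀ s v₀ → Part s v₀ ≡ true → count col ≤ degIn G (Part s) v₀ → pairs (within G (Part s)) ≤ κ * r
  starMatching s v₀ v₀∈ many = finish (matching? G Δ (N + e) P′ (λ z pz → ≤-trans (count-mono (λ v q → ∧⁺ (proj₁ (∧⁻ {Part s v} (proj₁ (∧⁻ {P′ v} q)))) (proj₂ (∧⁻ {P′ v} q)))) (V-own s z (proj₁ (∧⁻ {Part s z} pz)))))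
    where
    ch = choose (λ y → Part s y ∧ adj G v₀ y) (count col) many
    g = proj₁ ch
    g∈ = proj₁ (proj₂ ch)
    open Assign col g (proj₂ (proj₂ ch))
    L₀ = v₀ ∷ tabulate g
    P′ = λ z → Part s z ∧ not (memb L₀ z)
    L₀-len : length L₀ ≤ 1 + N
    L₀-len = s≤s (≤-trans (≤-reflexive (Listₚ.length-tabulate g)) (count≤n col))
    hb∈L₀ : ∀ x v → assign x ≡ just v → v ∈ L₀
    hb∈L₀ x v q with assign-just x v q
    ... | i , refl , _ = there (∈-tabulate⁺ g i)
    L₀-V : ∀ z → z ∈ L₀ → Part s z ≡ true
    L₀-V z (here refl) = v₀∈
    L₀-V z (there p) with ∈-tabulate⁻ {f = g} p
    ... | i , refl = proj₁ (∧⁻ {Part s (g i)} (g∈ i))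
    g-adj : ∀ x v → assign x ≡ just v → adj G v₀ v ≡ true
    g-adj x v q with assign-just x v q
    ... | i , refl , _ = proj₂ (∧⁻ {Part s (g i)} (g∈ i))
    finArith : ∀ k → k < N + e → 4 * (k * Δ) + 2 * (length L₀ * Δ) ≤ κ * r
    finArith k lt = ≤-trans (+-mono-≤ (*-monoʳ-≤ 4 (*-monoˡ-≤ Δ (<⇒≤ lt))) (*-monoʳ-≤ 2 (*-monoˡ-≤ Δ L₀-len))) (≤-reflexive (arith N e (c + 2) r))
      where
      arith : ∀ N e c r → 4 * ((N + e) * (c * r)) + 2 * ((1 + N) * (c * r)) ≡ (4 * (N + e) + 2 * (1 + N)) * c * r
      arith = solve-∀
    contradictory : ∀ x y → adj Q x y ≡ true → col x ≡ col y → ⊥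
    contradictory x y a q = b≢not (col x) (trans q (proper x y a))
    finish : Matching G P′ (N + e) ⊎ (∃ λ k → k < N + e × pairs (within G P′) + 2 * k ≤ 4 * (k * Δ)) → pairs (within G (Part s)) ≤ κ * r
    finish (inj₂ (k , lt , le)) = ≤-trans (pairs-remove G (Part s) L₀ Δ (V-own s))
      (≤-trans (+-monoˡ-≤ (2 * (length L₀ * Δ)) (≤-trans (m≤m+n (pairs (within G P′)) (2 * k)) le)) (finArith k lt))
    -- The colour class `col` goes on neighbours of v₀ in the same part, the other class to the
    -- opposite side; the matching edges break the remaining spokes and the edges of Q.
    finish (inj₁ m) = ⊥-elim (noCopy (embedOwnStar v₀ assign s D (N + e) w a assign-inj g-adj
      (λ x y q p₁ p₂ → contradictory x y q (trans (assign-⊤ x p₁) (≡sym (assign-⊤ y p₂))))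
      (λ x y q p₁ p₂ → contradictory x y q (trans (assign-⊥ x p₁) (≡sym (assign-⊥ y p₂))))
      (≤-reflexive (cong (N +_) e≡)) (matching-disjoint m)
      (λ i x x∈ q → t≢f (memb⁺ {L = L₀} (here q)) (out i x x∈))
      (λ i x y x∈ q → t≢f (memb⁺ (hb∈L₀ y x q)) (out i x x∈))
      (here refl) (λ x v q → ∈-++⁺ˡ (hb∈L₀ x v q))
      (λ i → ∈-++⁺ʳ L₀ (∈-++⁺ˡ (∈-tabulate⁺ w i)) , ∈-++⁺ʳ L₀ (∈-++⁺ʳ (tabulate w) (∈-tabulate⁺ a i)) , w~a i)
      (listGood (not s) D D-len (λ x x∈ → V-missing′ s x (D-V x x∈)))
      (listGood s [] z≤n (λ x ()))))
      where
      open Matching m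
      D = L₀ ++ (tabulate w ++ tabulate a)
      out : ∀ i x → x ∈ verts (edge (w i) (a i)) → memb L₀ x ≡ false
      out i x x∈ = not⁻ (proj₂ (∧⁻ {Part s x} (verts-P m i x x∈)))
      D-len : length D ≤ λ₀
      D-len = ≤-trans (≤-reflexive (trans (Listₚ.length-++ L₀) (cong (length L₀ +_) (trans (Listₚ.length-++ (tabulate w)) (cong₂ _+_ (Listₚ.length-tabulate w) (Listₚ.length-tabulate a))))))
        (≤-trans (+-monoˡ-≤ _ L₀-len) (lenArith N e))
        where
        lenArith : ∀ N e → 1 + N + ((N + e) + (N + e)) ≤ 3 + 3 * N + 2 * e
        lenArith N e = lin (2) (z≤n {0}) (solve (N ∷ e ∷ []))
      D-V : ∀ x → x ∈ D → Part s x ≡ true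
      D-V x p with ∈-++⁻ L₀ p
      ... | inj₁ q = L₀-V x q
      ... | inj₂ q with ∈-++⁻ (tabulate w) q
      ...   | inj₁ q′ with ∈-tabulate⁻ {f = w} q′
      ...     | i , refl = proj₁ (∧⁻ {Part s (w i)} (w∈ i))
      D-V x p | inj₂ q | inj₂ q′ with ∈-tabulate⁻ {f = a} q′
      ...     | i , refl = proj₁ (∧⁻ {Part s (a i)} (a∈ i))

-- Arithmetic of the edge count

private
  4ab≤ : ∀ a b → 4 * (a * b) ≤ (a + b) * (a + b)
  4ab≤ a b with ≤-total a b
  ... | inj₁ p = lem a b p
    where
    lem : ∀ a b → a ≤ b → 4 * (a * b) ≤ (a + b) * (a + b)
    lem a b p with m≤n⇒∃[o]m+o≡n p
    ... | k , refl = ≤-trans (m≤m+n _ (k * k)) (≤-reflexive (arith a k))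
      where
      arith : ∀ a k → 4 * (a * (a + k)) + k * k ≡ (a + (a + k)) * (a + (a + k))
      arith = solve-∀
  ... | inj₂ p with m≤n⇒∃[o]m+o≡n p
  ...   | k , refl = ≤-trans (m≤m+n _ (k * k)) (≤-reflexive (arith b k))
      where
      arith : ∀ a k → 4 * ((a + k) * a) + k * k ≡ (a + k + a) * (a + k + a)
      arith = solve-∀

  -- Here D is the degree sum of G, x the product of the part sizes, S the degree sum inside the
  -- parts and Z the degree sum over W. Everything is multiplied by four so that balanced products
  -- become squares.
  counting₁ : ∀ u m t D x S Z pp → 2 * (u * m) + 2 * t ≤ D → m * m ≤ 4 * t + 1 → D ≤ 2 * x + S + 2 * Z → 4 * x ≤ pp → 4 * (u * m) + m * m ≤ 1 + pp + 2 * S + 4 * Z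
  counting₁ u m t D x S Z pp h1 h2 h3 h4 = lin (0) (2 ⊛ h1 ⊕ h2 ⊕ 2 ⊛ h3 ⊕ h4) (solve (u ∷ m ∷ t ∷ D ∷ x ∷ S ∷ Z ∷ pp ∷ []))
  counting₂ : ∀ u m n w S Z pp → 4 * (u * m) + m * m ≤ 1 + pp + 2 * S + 4 * Z → n * n + 2 * u * n ≤ 4 * (u * m) + m * m + 3 * (u * u) → pp + 2 * n * w ≤ n * n + w * w → 2 * u * n + 2 * n * w ≤ 3 * (u * u) + 1 + w * w + 2 * S + 4 * Z
  counting₂ u m n w S Z pp h1 h2 h3 = lin (0) (h1 ⊕ h2 ⊕ h3) (solve (u ∷ m ∷ n ∷ w ∷ S ∷ Z ∷ pp ∷ []))
  -- Own degrees at most v = u - 1 contribute 2vn, one 2n short of what is required, and the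
  -- vertices of W make up only n of this.
  noHub : ∀ v n w S Z e r k p → 2 * (1 + v) * n + 2 * n * w ≤ 3 * ((1 + v) * (1 + v)) + 1 + w * w + 2 * S + 4 * Z → S ≤ v * p + 2 * (k * r) → p ≤ n → 4 * Z ≤ n + 2 * n * w → 3 * ((1 + v) * (1 + v)) + 1 + e * e ≤ r → w * w ≤ e * e → (4 * k + 1) * r < n → ⊥
  noHub v n w S Z e r k p h1 h2 h3 h4 h5 h6 h7 = 1≰0 (lin (0) (h1 ⊕ 2 ⊛ h2 ⊕ h4 ⊕ h5 ⊕ h6 ⊕ h7 ⊕ 2 ⊛ (v ⊛ h3)) (solve (v ∷ n ∷ w ∷ S ∷ Z ∷ e ∷ r ∷ k ∷ p ∷ [])))
  hub-degree : ∀ n e D d1 d2 r → n + 2 * (e * n) ≤ 4 * (e * D) → D ≤ d1 + d2 → 2 * d2 ≤ n + 2 * r → n ≤ 4 * e * (d1 + r)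
  hub-degree n e D d1 d2 r h1 h2 h3 = lin (0) (h1 ⊕ 4 ⊛ (e ⊛ h2) ⊕ 2 ⊛ (e ⊛ h3)) (solve (n ∷ e ∷ D ∷ d1 ∷ d2 ∷ r ∷ []))
  hub-degree-cancel : ∀ c e r x → ((c + 1) * e + c + 1) * r < x + r → ((c + 1) * e + c) * r ≤ x
  hub-degree-cancel c e r x h1 = lin (1) (h1) (solve (c ∷ e ∷ r ∷ x ∷ []))
  hub-room : ∀ c e r x y q → ((c + 1) * e + c) * r ≤ x → x ≤ y + q → q ≤ e * ((c + 1) * r) → c * r ≤ y
  hub-room c e r x y q h1 h2 h3 = lin (0) (h1 ⊕ h2 ⊕ h3) (solve (c ∷ e ∷ r ∷ x ∷ y ∷ q ∷ []))
  -- Once S is of order r, replacing Z by w n minus the total deficit Y turns the edge count into a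
  -- bound for Y.
  deficit-bound : ∀ u n w S Z e r k Y → 2 * u * n + 2 * n * w ≤ 3 * (u * u) + 1 + w * w + 2 * S + 4 * Z → S ≤ 2 * (k * r) → Z + Y ≤ w * n → 3 * (u * u) + 1 + e * e ≤ r → w * w ≤ e * e → 2 * (u * n) + 4 * Y ≤ (4 * k + 1) * r + 2 * (w * n)
  deficit-bound u n w S Z e r k Y h1 h2 h3 h4 h5 = lin (0) (h1 ⊕ 2 ⊛ h2 ⊕ 4 ⊛ h3 ⊕ h4 ⊕ h5) (solve (u ∷ n ∷ w ∷ S ∷ Z ∷ e ∷ r ∷ k ∷ Y ∷ []))
  too-few-hubs : ∀ u n w k r Y → 2 * (u * n) + 4 * Y ≤ (4 * k + 1) * r + 2 * (w * n) → w < u → (4 * k + 1) * r < n → ⊥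
  too-few-hubs u n w k r Y h1 h2 h3 = 1≰0 (*-cancelˡ-≤ 2 (lin (4 * Y + 4 * k * r + r) (h1 ⊕ 2 ⊛ h3 ⊕ 2 ⊛ (n ⊛ h2)) (solve (u ∷ n ∷ w ∷ k ∷ r ∷ Y ∷ []))))

sq-id : ∀ u m → (u + m) * (u + m) + 2 * u * (u + m) ≡ 4 * (u * m) + m * m + 3 * (u * u)
sq-id = solve-∀

sq-id₂ : ∀ p w → p * p + 2 * (p + w) * w ≡ (p + w) * (p + w) + w * w
sq-id₂ = solve-∀

-- Recognising joins with balanced complete bipartite graphs

b2n-inj : ∀ {a b} → b2n a ≡ b2n b → a ≡ b
b2n-inj {true}  {true}  _ = refl
b2n-inj {false} {false} _ = refl

bijection : ∀ {a b} (p : Fin a → Fin b) → (∀ i j → p i ≡ p j → i ≡ j) → (∀ x → ∃ λ i → p i ≡ x) → Fin a ↔ Fin b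
bijection p inj surj = mk↔ₛ′ p (proj₁ ∘ surj) (proj₂ ∘ surj) (λ k → inj _ _ (proj₂ (surj (p k))))

≅-sym : ∀ {a b} {G : SimpleGraph a} {H : SimpleGraph b} → G ≅ H → H ≅ G
≅-sym {G = G} {H} (σ , e) = mk↔ₛ′ (Inverse.from σ) (Inverse.to σ) (Inverse.strictlyInverseʳ σ) (Inverse.strictlyInverseˡ σ)
  , λ i j → trans (≡sym (cong₂ (adj H) (Inverse.strictlyInverseˡ σ i) (Inverse.strictlyInverseˡ σ j))) (≡sym (e _ _))

≅-pointwise : ∀ {a} {G H : SimpleGraph a} → (∀ i j → adj G i j ≡ adj H i j) → G ≅ H
≅-pointwise e = mk↔ₛ′ id id (λ _ → refl) (λ _ → refl) , e

pinch : ∀ {n} (G H : SimpleGraph n) → (∀ i j → adj G i j ≡ true → adj H i j ≡ true) → dsum H ≤ dsum G → ∀ i j → adj G i j ≡ adj H i j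
pinch G H le q i j = b2n-inj (∑-pinch (λ j → b2n-mono (le i j))
  (≤-reflexive (trans (≡sym (count≡∑ (adj H i))) (trans (≡sym (∑-pinch (λ i → count-mono (le i)) q i)) (count≡∑ (adj G i))))) j)

join-≅ˡ : ∀ {a a′ b} {G : SimpleGraph a} {G′ : SimpleGraph a′} (T : SimpleGraph b) → G ≅ G′ → join G T ≅ join G′ T
join-≅ˡ {a} {a′} {b} {G} {G′} T (σ , e) = mk↔ₛ′ (f (Inverse.to σ)) (f (Inverse.from σ))
    (λ k → inv (Inverse.to σ) (Inverse.from σ) (Inverse.strictlyInverseˡ σ) k (↑-cases a′ k))
    (λ k → inv (Inverse.from σ) (Inverse.to σ) (Inverse.strictlyInverseʳ σ) k (↑-cases a k))
  , λ i j → adj-eq i j (↑-cases a i) (↑-cases a j)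
  where
  f : ∀ {a a′} → (Fin a → Fin a′) → Fin (a + b) → Fin (a′ + b)
  f {a} {a′} g k = [ (λ i → g i ↑ˡ b) , (λ j → a′ ↑ʳ j) ]′ (splitAt a k)
  f-l : ∀ {a a′} (g : Fin a → Fin a′) i → f g (i ↑ˡ b) ≡ g i ↑ˡ b
  f-l {a} g i rewrite Finₚ.splitAt-↑ˡ a i b = refl
  f-r : ∀ {a a′} (g : Fin a → Fin a′) j → f g (a ↑ʳ j) ≡ a′ ↑ʳ j
  f-r {a} g j rewrite Finₚ.splitAt-↑ʳ a b j = refl
  inv : ∀ {a a′} (g : Fin a → Fin a′) (g′ : Fin a′ → Fin a) → (∀ i → g (g′ i) ≡ i) → ∀ k →
    (∃ λ i → k ≡ i ↑ˡ b) ⊎ (∃ λ j → k ≡ a′ ↑ʳ j) → f g (f g′ k) ≡ k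
  inv g g′ gg k (inj₁ (i , refl)) = trans (cong (f g) (f-l g′ i)) (trans (f-l g (g′ i)) (cong (_↑ˡ b) (gg i)))
  inv g g′ gg k (inj₂ (j , refl)) = trans (cong (f g) (f-r g′ j)) (f-r g j)
  to = Inverse.to σ
  adj-eq : ∀ i j → (∃ λ x → i ≡ x ↑ˡ b) ⊎ (∃ λ x → i ≡ a ↑ʳ x) → (∃ λ x → j ≡ x ↑ˡ b) ⊎ (∃ λ x → j ≡ a ↑ʳ x) →
    adj (join G T) i j ≡ adj (join G′ T) (f to i) (f to j)
  adj-eq i j (inj₁ (x , refl)) (inj₁ (y , refl)) = trans (join-ll G T x y) (trans (e x y) (trans (≡sym (join-ll G′ T (to x) (to y))) (≡sym (cong₂ (adj (join G′ T)) (f-l to x) (f-l to y)))))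
  adj-eq i j (inj₁ (x , refl)) (inj₂ (y , refl)) = trans (join-lr G T x y) (trans (≡sym (join-lr G′ T (to x) y)) (≡sym (cong₂ (adj (join G′ T)) (f-l to x) (f-r to y))))
  adj-eq i j (inj₂ (x , refl)) (inj₁ (y , refl)) = trans (sym (join G T) (a ↑ʳ x) (y ↑ˡ b)) (trans (join-lr G T y x) (trans (≡sym (trans (sym (join G′ T) (a′ ↑ʳ x) (to y ↑ˡ b)) (join-lr G′ T (to y) x))) (≡sym (cong₂ (adj (join G′ T)) (f-r to x) (f-l to y)))))
  adj-eq i j (inj₂ (x , refl)) (inj₂ (y , refl)) = trans (join-rr G T x y) (trans (≡sym (join-rr G′ T x y)) (≡sym (cong₂ (adj (join G′ T)) (f-r to x) (f-r to y))))

private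
  join-bound : ∀ g y z m → z ≤ m → g + 2 * z + 2 * y ≤ g + 2 * y + 2 * m
  join-bound g y z m h1 = lin (0) (2 ⊛ h1) (solve (g ∷ y ∷ z ∷ m ∷ []))
  balanced-parts : ∀ g x y t → g + 2 * y + 2 * t ≤ g + 2 * x + 2 * y → t ≤ x
  balanced-parts g x y t h1 = *-cancelˡ-≤ 2 (lin (0) (h1) (solve (g ∷ x ∷ y ∷ t ∷ [])))
  matching-large : ∀ k t D → k < t → D + 2 * k ≤ 4 * (k * 1) → 2 * t ≤ D → ⊥
  matching-large k t D h1 h2 h3 = 1≰0 (*-cancelˡ-≤ 2 (lin (0) (2 ⊛ h1 ⊕ h2 ⊕ h3) (solve (k ∷ t ∷ D ∷ []))))

module Arrange {n} (G : SimpleGraph n) (W : Fin n → Bool) {u m : ℕ} (u+m : u + m ≡ n)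
  (pW : Fin u → Fin n) (pW-inj : ∀ i j → pW i ≡ pW j → i ≡ j) (pW∈ : ∀ i → W (pW i) ≡ true) (pW-onto : ∀ x → W x ≡ true → ∃ λ i → pW i ≡ x) where

  GW = induce G pW

  Conclusion : Set
  Conclusion = dsum G ≤ dsum GW + 2 * (u * m) + 2 * turanEdges m ×
    (dsum GW + 2 * (u * m) + 2 * turanEdges m ≤ dsum G → G ≅ join GW (turan2 m))

  -- G is a subgraph of G[W] ∇ K(a , b). Reaching the bound forces a * b to be the maximal product,
  -- hence balanced parts, and no missing edge. The sizes are ordered because `turan2` puts its
  -- smaller part first.
  ordered : (A B : Fin n → Bool) → (∀ x → W x ≡ true ⊎ A x ≡ true ⊎ B x ≡ true) → (∀ x → W x ≡ true → A x ≡ true → ⊥) → (∀ x → W x ≡ true → B x ≡ true → ⊥) →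
    (∀ x → A x ≡ true → B x ≡ true → ⊥) → (∀ x y → A x ≡ true → A y ≡ true → adj G x y ≡ true → ⊥) → (∀ x y → B x ≡ true → B y ≡ true → adj G x y ≡ true → ⊥) →
    count A ≤ count B → Conclusion
  ordered A B cover WA WB AB A-ind B-ind a≤b = finish m≡
    where
    a = count A
    b = count B
    p : Fin (u + (a + b)) → Fin n
    p k = [ pW , (λ j → [ nth A , nth B ]′ (splitAt a j)) ]′ (splitAt u k)
    iW : Fin u → Fin (u + (a + b))
    iW i = i ↑ˡ (a + b)
    iA : Fin a → Fin (u + (a + b))
    iA i = u ↑ʳ (i ↑ˡ b)
    iB : Fin b → Fin (u + (a + b))
    iB i = u ↑ʳ (a ↑ʳ i)
    p-W : ∀ i → p (iW i) ≡ pW i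
    p-W i rewrite Finₚ.splitAt-↑ˡ u i (a + b) = refl
    p-A : ∀ i → p (iA i) ≡ nth A i
    p-A i rewrite Finₚ.splitAt-↑ʳ u (a + b) (i ↑ˡ b) | Finₚ.splitAt-↑ˡ a i b = refl
    p-B : ∀ i → p (iB i) ≡ nth B i
    p-B i rewrite Finₚ.splitAt-↑ʳ u (a + b) (a ↑ʳ i) | Finₚ.splitAt-↑ʳ a b i = refl
    data View : Fin (u + (a + b)) → Set where
      vW : ∀ i → View (iW i)
      vA : ∀ i → View (iA i)
      vB : ∀ i → View (iB i)
    view : ∀ k → View k
    view k with ↑-cases u k
    ... | inj₁ (i , refl) = vW i
    ... | inj₂ (j , refl) with ↑-cases a j
    ...   | inj₁ (i , refl) = vA i
    ...   | inj₂ (i , refl) = vB i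
    ∈W : ∀ i → W (p (iW i)) ≡ true
    ∈W i = trans (cong W (p-W i)) (pW∈ i)
    ∈A : ∀ i → A (p (iA i)) ≡ true
    ∈A i = trans (cong A (p-A i)) (nth-true A i)
    ∈B : ∀ i → B (p (iB i)) ≡ true
    ∈B i = trans (cong B (p-B i)) (nth-true B i)
    p-inj : ∀ k l → p k ≡ p l → k ≡ l
    p-inj k l e with view k | view l
    ... | vW i | vW j = cong iW (pW-inj i j (trans (≡sym (p-W i)) (trans e (p-W j))))
    ... | vA i | vA j = cong iA (nth-inj A i j (trans (≡sym (p-A i)) (trans e (p-A j))))
    ... | vB i | vB j = cong iB (nth-inj B i j (trans (≡sym (p-B i)) (trans e (p-B j))))
    ... | vW i | vA j = ⊥-elim (WA _ (∈W i) (trans (cong A e) (∈A j)))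
    ... | vW i | vB j = ⊥-elim (WB _ (∈W i) (trans (cong B e) (∈B j)))
    ... | vA i | vW j = ⊥-elim (WA _ (trans (cong W e) (∈W j)) (∈A i))
    ... | vA i | vB j = ⊥-elim (AB _ (∈A i) (trans (cong B e) (∈B j)))
    ... | vB i | vW j = ⊥-elim (WB _ (trans (cong W e) (∈W j)) (∈B i))
    ... | vB i | vA j = ⊥-elim (AB _ (trans (cong A e) (∈A j)) (∈B i))
    p-onto : ∀ x → ∃ λ k → p k ≡ x
    p-onto x with cover x
    ... | inj₁ wx = let i , q = pW-onto x wx in iW i , trans (p-W i) q
    ... | inj₂ (inj₁ ax) = let i , q = nth-surj A x ax in iA i , trans (p-A i) q
    ... | inj₂ (inj₂ bx) = let i , q = nth-surj B x bx in iB i , trans (p-B i) q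
    π = bijection p p-inj p-onto
    m≡ : m ≡ a + b
    m≡ = +-cancelˡ-≡ u m (a + b) (trans u+m (≡sym (↔⇒≡ π)))
    G′ = induce G p
    J = join GW (bip a b)
    G′≅G : G′ ≅ G
    G′≅G = π , λ i j → refl
    le : ∀ i j → adj G′ i j ≡ true → adj J i j ≡ true
    le i j e with view i | view j
    ... | vW x | vW y = trans (join-ll GW (bip a b) x y) (trans (≡sym (cong₂ (adj G) (p-W x) (p-W y))) e)
    ... | vW x | vA y = join-lr GW (bip a b) x (y ↑ˡ b)
    ... | vW x | vB y = join-lr GW (bip a b) x (a ↑ʳ y)
    ... | vA x | vW y = trans (sym J (iA x) (iW y)) (join-lr GW (bip a b) y (x ↑ˡ b))
    ... | vB x | vW y = trans (sym J (iB x) (iW y)) (join-lr GW (bip a b) y (a ↑ʳ x))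
    ... | vA x | vA y = ⊥-elim (A-ind _ _ (∈A x) (∈A y) e)
    ... | vB x | vB y = ⊥-elim (B-ind _ _ (∈B x) (∈B y) e)
    ... | vA x | vB y = trans (join-rr GW (bip a b) (x ↑ˡ b) (a ↑ʳ y)) (join-lr (emptyG a) (emptyG b) x y)
    ... | vB x | vA y = trans (join-rr GW (bip a b) (a ↑ʳ x) (y ↑ˡ b)) (trans (sym (bip a b) (a ↑ʳ x) (y ↑ˡ b)) (join-lr (emptyG a) (emptyG b) y x))
    dG : dsum G ≡ dsum G′
    dG = ≡sym (dsum-iso G′ G G′≅G)
    dJ : dsum J ≡ dsum GW + 2 * (a * b) + 2 * (u * (a + b))
    dJ = trans (dsum-join GW (bip a b)) (cong (λ z → dsum GW + z + 2 * (u * (a + b))) (dsum-bip a b))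
    finish : m ≡ a + b → Conclusion
    finish refl = ≤-trans (≤-reflexive dG) (≤-trans (∑-mono (λ i → count-mono (le i))) (≤-trans (≤-reflexive dJ)
        (join-bound (dsum GW) (u * (a + b)) (a * b) (turanEdges (a + b)) (proj₁ (turanEdges-upper a b a≤b)))))
      , λ q → ≅-trans {G = G} {G′} {join GW (turan2 (a + b))} (≅-sym {G = G′} {G} G′≅G) (≅-pointwise {G = G′} {join GW (turan2 (a + b))} (same q))
      where
      balanced : dsum GW + 2 * (u * (a + b)) + 2 * turanEdges (a + b) ≤ dsum G → turanEdges (a + b) ≤ a * b
      balanced q = balanced-parts (dsum GW) (a * b) (u * (a + b)) (turanEdges (a + b)) (≤-trans q (≤-trans (≤-reflexive dG) (≤-trans (∑-mono (λ i → count-mono (le i))) (≤-reflexive dJ))))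
      same : dsum GW + 2 * (u * (a + b)) + 2 * turanEdges (a + b) ≤ dsum G → ∀ i j → adj G′ i j ≡ adj (join GW (turan2 (a + b))) i j
      same q i j = trans (pinch G′ J le (≤-trans (≤-trans (≤-reflexive dJ) (join-bound (dsum GW) (u * (a + b)) (a * b) (turanEdges (a + b)) (proj₁ (turanEdges-upper a b a≤b)))) (≤-trans q (≤-reflexive dG))) i j)
          (J≡ (↑-cases u i) (↑-cases u j))
        where
        h = turan2-bip a b (proj₂ (turanEdges-upper a b a≤b) (balanced q))
        J≡ : ∀ {i j} → (∃ λ x → i ≡ x ↑ˡ (a + b)) ⊎ (∃ λ x → i ≡ u ↑ʳ x) → (∃ λ x → j ≡ x ↑ˡ (a + b)) ⊎ (∃ λ x → j ≡ u ↑ʳ x) → adj J i j ≡ adj (join GW (turan2 (a + b))) i j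
        J≡ (inj₁ (x , refl)) (inj₁ (y , refl)) = trans (join-ll GW (bip a b) x y) (≡sym (join-ll GW (turan2 (a + b)) x y))
        J≡ (inj₁ (x , refl)) (inj₂ (y , refl)) = trans (join-lr GW (bip a b) x y) (≡sym (join-lr GW (turan2 (a + b)) x y))
        J≡ (inj₂ (x , refl)) (inj₁ (y , refl)) = trans (trans (sym J (u ↑ʳ x) (y ↑ˡ (a + b))) (join-lr GW (bip a b) y x))
          (≡sym (trans (sym (join GW (turan2 (a + b))) (u ↑ʳ x) (y ↑ˡ (a + b))) (join-lr GW (turan2 (a + b)) y x)))
        J≡ (inj₂ (x , refl)) (inj₂ (y , refl)) = trans (join-rr GW (bip a b) x y) (trans (≡sym (h x y)) (≡sym (join-rr GW (turan2 (a + b)) x y)))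

  arrange : (A B : Fin n → Bool) → (∀ x → W x ≡ true ⊎ A x ≡ true ⊎ B x ≡ true) → (∀ x → W x ≡ true → A x ≡ true → ⊥) → (∀ x → W x ≡ true → B x ≡ true → ⊥) →
    (∀ x → A x ≡ true → B x ≡ true → ⊥) → (∀ x y → A x ≡ true → A y ≡ true → adj G x y ≡ true → ⊥) → (∀ x y → B x ≡ true → B y ≡ true → adj G x y ≡ true → ⊥) → Conclusion
  arrange A B cover WA WB AB A-ind B-ind with ≤-total (count A) (count B)
  ... | inj₁ p = ordered A B cover WA WB AB A-ind B-ind p
  ... | inj₂ p = ordered B A (λ x → [ inj₁ , (λ { (inj₁ q) → inj₂ (inj₂ q) ; (inj₂ q) → inj₂ (inj₁ q) }) ]′ (cover x)) WB WA (λ x p q → AB x q p) B-ind A-ind p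

-- Graphs of maximum degree one

deg≤1 : ∀ {n} (G : SimpleGraph n) → (∀ x → deg G x ≤ 1) → ∀ {x y z} → adj G x y ≡ true → adj G x z ≡ true → y ≡ z
deg≤1 G d {x} {y} {z} p q with y Fin.≟ z
... | yes e = e
... | no ne = ⊥-elim (<⇒≱ {1} {deg G x} (≤-trans (≤-reflexive (≡sym two)) (count-mono {p = λ v → (y == v) ∨ (z == v)} (λ v e → lem v e))) (d x))
  where
  two : count (λ v → (y == v) ∨ (z == v)) ≡ 2
  two = count-two _ y z ne (cong (_∨ (z == y)) (==-refl y)) (trans (cong ((y == z) ∨_) (==-refl z)) (Boolₚ.∨-zeroʳ _)) only
    where
    only : ∀ v → (y == v) ∨ (z == v) ≡ true → v ≡ y ⊎ v ≡ z
    only v e with bool (y == v)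
    ... | inj₁ q = inj₁ (≡sym (==⁻ q))
    ... | inj₂ q rewrite q = inj₂ (≡sym (==⁻ e))
  lem : ∀ v → (y == v) ∨ (z == v) ≡ true → adj G x v ≡ true
  lem v e with bool (y == v) | bool (z == v)
  ... | inj₁ q₁ | _ = subst (λ v → adj G x v ≡ true) (==⁻ q₁) p
  ... | inj₂ q₁ | inj₁ q₂ = subst (λ v → adj G x v ≡ true) (==⁻ q₂) q
  ... | inj₂ q₁ | inj₂ q₂ = t≢f e (cong₂ _∨_ q₁ q₂)

matching-adj : ∀ t i j → adj (matchingPlusK1 t) i j ≡ ((toℕ i / 2) ≡ᵇ (toℕ j / 2)) ∧ not (i == j)
matching-adj t i j = cong (_∧ not (i == j)) (trans (cong (((toℕ i / 2) ≡ᵇ (toℕ j / 2)) ∨_) (≡ᵇ-comm (toℕ j / 2) (toℕ i / 2))) (Boolₚ.∨-idem _))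
  where
  ≡ᵇ-comm : ∀ a b → (a ≡ᵇ b) ≡ (b ≡ᵇ a)
  ≡ᵇ-comm zero    zero    = refl
  ≡ᵇ-comm zero    (suc b) = refl
  ≡ᵇ-comm (suc a) zero    = refl
  ≡ᵇ-comm (suc a) (suc b) = ≡ᵇ-comm a b

matching-unique : ∀ t i j k → adj (matchingPlusK1 t) i j ≡ true → adj (matchingPlusK1 t) i k ≡ true → j ≡ k
matching-unique t i j k p q with ∧⁻ {(toℕ i / 2) ≡ᵇ (toℕ j / 2)} (trans (≡sym (matching-adj t i j)) p) | ∧⁻ {(toℕ i / 2) ≡ᵇ (toℕ k / 2)} (trans (≡sym (matching-adj t i k)) q)
... | p₁ , p₂ | q₁ , q₂ = Finₚ.toℕ-injective (three (toℕ i / 2) (half (toℕ i))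
    (subst (λ h → toℕ j ≡ 2 * h ⊎ toℕ j ≡ 1 + 2 * h) (≡sym (≡ᵇ⁻ {toℕ i / 2} p₁)) (half (toℕ j)))
    (subst (λ h → toℕ k ≡ 2 * h ⊎ toℕ k ≡ 1 + 2 * h) (≡sym (≡ᵇ⁻ {toℕ i / 2} q₁)) (half (toℕ k)))
    (λ e → ==-f⁻ {x = i} {j} (not⁻ p₂) (Finₚ.toℕ-injective e)) (λ e → ==-f⁻ {x = i} {k} (not⁻ q₂) (Finₚ.toℕ-injective e)))
  where
  three : ∀ h {I J K} → I ≡ 2 * h ⊎ I ≡ 1 + 2 * h → J ≡ 2 * h ⊎ J ≡ 1 + 2 * h → K ≡ 2 * h ⊎ K ≡ 1 + 2 * h → I ≢ J → I ≢ K → J ≡ K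
  three h i (inj₁ refl) (inj₁ refl) _ _ = refl
  three h i (inj₂ refl) (inj₂ refl) _ _ = refl
  three h (inj₁ refl) (inj₁ refl) k ne _ = ⊥-elim (ne refl)
  three h (inj₁ refl) j (inj₁ refl) _ ne = ⊥-elim (ne refl)
  three h (inj₂ refl) (inj₂ refl) k ne _ = ⊥-elim (ne refl)
  three h (inj₂ refl) j (inj₂ refl) _ ne = ⊥-elim (ne refl)

dsum-matching≥ : ∀ t → 2 * t ≤ dsum (matchingPlusK1 t)
dsum-matching≥ t = ≤-trans (count-inj (λ i → toℕ i <ᵇ 2 * t) (2 * t) Fin.inject₁
    (λ i → <ᵇ⁺ (≤-trans (s≤s (≤-reflexive (Finₚ.toℕ-inject₁ i))) (Finₚ.toℕ<n i))) (λ i j → Finₚ.inject₁-injective))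
  (≤-trans (≤-reflexive (count≡∑ (λ i → toℕ i <ᵇ 2 * t))) (∑-mono row))
  where
  M = matchingPlusK1 t
  mate : ∀ i → toℕ i < 2 * t → ∃ λ j → adj M i j ≡ true
  mate i lt with half (toℕ i)
  ... | inj₁ e = j , trans (matching-adj t i j) (∧⁺ (≡ᵇ⁺ {toℕ i / 2} (≡sym (trans (cong (_/ 2) (trans tj (cong suc e))) (half-odd (toℕ i / 2))))) (cong not (==-f⁺ (λ q → 1+n≢n (trans (≡sym tj) (cong toℕ (≡sym q)))))))
    where
    j = fromℕ< {suc (toℕ i)} (s≤s lt)
    tj : toℕ j ≡ suc (toℕ i)
    tj = Finₚ.toℕ-fromℕ< (s≤s lt)
  ... | inj₂ e = j , trans (matching-adj t i j) (∧⁺ (≡ᵇ⁺ {toℕ i / 2} (≡sym (trans (cong (_/ 2) tj) (half-even (toℕ i / 2))))) (cong not (==-f⁺ (λ q → 1+n≢n (trans (≡sym (trans e (cong suc (≡sym tj)))) (cong toℕ q))))))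
    where
    lt′ : 2 * (toℕ i / 2) < suc (2 * t)
    lt′ = ≤-trans (≤-reflexive (≡sym e)) (≤-trans (n≤1+n _) (≤-trans lt (n≤1+n _)))
    j = fromℕ< lt′
    tj : toℕ j ≡ 2 * (toℕ i / 2)
    tj = Finₚ.toℕ-fromℕ< lt′
  row : ∀ i → b2n (toℕ i <ᵇ 2 * t) ≤ deg M i
  row i with bool (toℕ i <ᵇ 2 * t)
  ... | inj₂ e rewrite e = z≤n
  ... | inj₁ e rewrite e = let j , q = mate i (<ᵇ⁻ {toℕ i} e) in count-pos (adj M i) j q

-- A listing that puts the ends of the i-th matching edge at positions 2i and 2i+1
interleave : ∀ {V : Set} {k} → (Fin k → V) → (Fin k → V) → V → ℕ → V
interleave {k = zero}  w a z i = z
interleave {k = suc k} w a z 0 = w zero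
interleave {k = suc k} w a z 1 = a zero
interleave {k = suc k} w a z (suc (suc i)) = interleave (w ∘ suc) (a ∘ suc) z i

interleave-∈ : ∀ {V : Set} {k} (w a : Fin k → V) z i → (∃ λ j → interleave w a z i ≡ w j) ⊎ (∃ λ j → interleave w a z i ≡ a j) ⊎ interleave w a z i ≡ z
interleave-∈ {k = zero}  w a z i = inj₂ (inj₂ refl)
interleave-∈ {k = suc k} w a z 0 = inj₁ (zero , refl)
interleave-∈ {k = suc k} w a z 1 = inj₂ (inj₁ (zero , refl))
interleave-∈ {k = suc k} w a z (suc (suc i)) with interleave-∈ (w ∘ suc) (a ∘ suc) z i
... | inj₁ (j , e) = inj₁ (suc j , e)
... | inj₂ (inj₁ (j , e)) = inj₂ (inj₁ (suc j , e))
... | inj₂ (inj₂ e) = inj₂ (inj₂ e)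

-- Division by two in the form that follows the recursion of `interleave`.
half↑ : ℕ → ℕ
half↑ 0 = 0
half↑ 1 = 0
half↑ (suc (suc i)) = suc (half↑ i)

half↑≡ : ∀ i → half↑ i ≡ i / 2
half↑≡ i with parity i
... | h , inj₁ refl = trans (lem h) (≡sym (half-even h))
  where
  lem : ∀ h → half↑ (2 * h) ≡ h
  lem zero = refl
  lem (suc h) rewrite +-suc h (h + 0) = cong suc (lem h)
... | h , inj₂ refl = trans (lem h) (≡sym (half-odd h))
  where
  lem : ∀ h → half↑ (1 + 2 * h) ≡ h
  lem zero = refl
  lem (suc h) rewrite +-suc h (h + 0) = cong suc (lem h)

module _ {n} (H : SimpleGraph n) (d≤1 : ∀ x → deg H x ≤ 1) where

  private
    strip : ∀ {i k} → suc (suc i) ≤ 2 * suc k → i ≤ 2 * k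
    strip {i} {k} p rewrite +-suc k (k + 0) = ℕ.s≤s⁻¹ (ℕ.s≤s⁻¹ p)

    tailM : ∀ {P k} → Matching H P (suc k) → Matching H P k
    tailM M = record { w = w ∘ suc ; a = a ∘ suc ; w∈ = w∈ ∘ suc ; a∈ = a∈ ∘ suc ; w~a = w~a ∘ suc
      ; w-inj = λ i j e → Finₚ.suc-injective (w-inj (suc i) (suc j) e) ; a-inj = λ i j e → Finₚ.suc-injective (a-inj (suc i) (suc j) e) ; w≢a = λ i j → w≢a (suc i) (suc j) }
      where open Matching M

    Outside : ∀ {P k} → Matching H P k → Fin n → Set
    Outside M z = (∀ i → Matching.w M i ≢ z) × (∀ i → Matching.a M i ≢ z)

    w₀∉ : ∀ {P k} (M : Matching H P (suc k)) z → Outside M z → ∀ i → Matching.w M zero ≢ interleave (Matching.w M ∘ suc) (Matching.a M ∘ suc) z i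
    w₀∉ M z (zw , za) i e with interleave-∈ (Matching.w M ∘ suc) (Matching.a M ∘ suc) z i
    ... | inj₁ (j , q) with Matching.w-inj M zero (suc j) (trans e q)
    ...   | ()
    w₀∉ M z (zw , za) i e | inj₂ (inj₁ (j , q)) = Matching.w≢a M zero (suc j) (trans e q)
    w₀∉ M z (zw , za) i e | inj₂ (inj₂ q) = zw zero (trans e q)

    a₀∉ : ∀ {P k} (M : Matching H P (suc k)) z → Outside M z → ∀ i → Matching.a M zero ≢ interleave (Matching.w M ∘ suc) (Matching.a M ∘ suc) z i
    a₀∉ M z (zw , za) i e with interleave-∈ (Matching.w M ∘ suc) (Matching.a M ∘ suc) z i
    ... | inj₁ (j , q) = Matching.w≢a M (suc j) zero (≡sym (trans e q))
    ... | inj₂ (inj₁ (j , q)) with Matching.a-inj M zero (suc j) (trans e q)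
    ...   | ()
    a₀∉ M z (zw , za) i e | inj₂ (inj₂ q) = za zero (trans e q)

    tailO : ∀ {P k} (M : Matching H P (suc k)) {z} → Outside M z → Outside (tailM M) z
    tailO M (zw , za) = zw ∘ suc , za ∘ suc

  list : ∀ {P k} (M : Matching H P k) → Fin n → ℕ → Fin n
  list M = interleave (Matching.w M) (Matching.a M)

  list-inj : ∀ {P} k (M : Matching H P k) z → Outside M z → ∀ i j → i ≤ 2 * k → j ≤ 2 * k → list M z i ≡ list M z j → i ≡ j
  list-inj zero    M z o zero zero _ _ _ = refl
  list-inj (suc k) M z o 0 0 _ _ _ = refl
  list-inj (suc k) M z o 1 1 _ _ _ = refl
  list-inj (suc k) M z o 0 1 _ _ e = ⊥-elim (Matching.w≢a M zero zero e)
  list-inj (suc k) M z o 1 0 _ _ e = ⊥-elim (Matching.w≢a M zero zero (≡sym e))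
  list-inj (suc k) M z o 0 (suc (suc j)) _ _ e = ⊥-elim (w₀∉ M z o j e)
  list-inj (suc k) M z o 1 (suc (suc j)) _ _ e = ⊥-elim (a₀∉ M z o j e)
  list-inj (suc k) M z o (suc (suc i)) 0 _ _ e = ⊥-elim (w₀∉ M z o i (≡sym e))
  list-inj (suc k) M z o (suc (suc i)) 1 _ _ e = ⊥-elim (a₀∉ M z o i (≡sym e))
  list-inj (suc k) M z o (suc (suc i)) (suc (suc j)) p q e = cong (λ x → suc (suc x)) (list-inj k (tailM M) z (tailO M o) i j (strip p) (strip q) e)

  private
    unadj : ∀ {x y v} → adj H x y ≡ true → y ≢ v → adj H x v ≡ false
    unadj {x} {y} {v} e ne with bool (adj H x v)
    ... | inj₂ q = q
    ... | inj₁ q = ⊥-elim (ne (deg≤1 H d≤1 e q))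

  -- Mates stand in the same block of two positions, and maximum degree one forbids every other
  -- edge.
  list-adj : ∀ {P} k (M : Matching H P k) z → Outside M z → ∀ i j → i ≤ 2 * k → j ≤ 2 * k →
    adj H (list M z i) (list M z j) ≡ (half↑ i ≡ᵇ half↑ j) ∧ not (i ≡ᵇ j)
  list-adj zero    M z o zero zero _ _ = irrefl H z
  list-adj (suc k) M z o 0 0 _ _ = irrefl H _
  list-adj (suc k) M z o 1 1 _ _ = irrefl H _
  list-adj (suc k) M z o 0 1 _ _ = Matching.w~a M zero
  list-adj (suc k) M z o 1 0 _ _ = trans (sym H _ _) (Matching.w~a M zero)
  list-adj (suc k) M z o 0 (suc (suc j)) _ _ = unadj (Matching.w~a M zero) (a₀∉ M z o j)
  list-adj (suc k) M z o 1 (suc (suc j)) _ _ = unadj (trans (sym H _ _) (Matching.w~a M zero)) (w₀∉ M z o j)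
  list-adj (suc k) M z o (suc (suc i)) 0 _ _ = trans (sym H _ _) (unadj (Matching.w~a M zero) (a₀∉ M z o i))
  list-adj (suc k) M z o (suc (suc i)) 1 _ _ = trans (sym H _ _) (unadj (trans (sym H _ _) (Matching.w~a M zero)) (w₀∉ M z o i))
  list-adj (suc k) M z o (suc (suc i)) (suc (suc j)) p q = list-adj k (tailM M) z (tailO M o) i j (strip p) (strip q)

injective⇒onto : ∀ {n} (p : Fin n → Fin n) → (∀ i j → p i ≡ p j → i ≡ j) → ∀ x → ∃ λ i → p i ≡ x
injective⇒onto {n} p inj x with find? (λ i → p i == x)
... | inj₁ (i , e) = i , ==⁻ e
... | inj₂ none = ⊥-elim (<⇒≱ {n} (≤-trans (s≤s (count-inj (λ y → not (x == y)) n p (λ i → cong not (==-f⁺ (λ e → ==-f⁻ {x = p i} {x} (none i) (≡sym e)))) inj))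
      (≤-reflexive (trans (cong (_+ count (λ y → not (x == y))) (≡sym (count-== x))) (count-not (x ==_))))) ≤-refl)

-- By the sharp case Δ = 1 of `matching?`, a degree sum of 2t already gives t disjoint edges; one
-- vertex is left over and closes the listing.
≅-matching : ∀ t (H : SimpleGraph (suc (2 * t))) → (∀ x → deg H x ≤ 1) → 2 * t ≤ dsum H → H ≅ matchingPlusK1 t
≅-matching t H d≤1 big = finish (matching? H 1 t (λ _ → true) (λ z _ → d≤1 z))
  where
  finish : Matching H (λ _ → true) t ⊎ (∃ λ k → k < t × pairs (within H (λ _ → true)) + 2 * k ≤ 4 * (k * 1)) → H ≅ matchingPlusK1 t
  finish (inj₂ (k , lt , le)) = ⊥-elim (matching-large k t (dsum H) lt le big)
  finish (inj₁ M) = ≅-sym {G = matchingPlusK1 t} {H} (bijection p p-inj (injective⇒onto p p-inj) , p-adj)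
    where
    open Matching M
    L = tabulate w ++ tabulate a
    L-len : length L ≡ 2 * t
    L-len = trans (Listₚ.length-++ (tabulate w)) (cong₂ _+_ (Listₚ.length-tabulate w) (trans (Listₚ.length-tabulate a) (≡sym (+-identityʳ t))))
    z₀ : ∃ λ z → not (memb L z) ≡ true
    z₀ = find (λ z → not (memb L z)) (+-cancelˡ-≤ (2 * t) _ _ (≤-trans (≤-reflexive (trans (+-comm (2 * t) 1) (≡sym (count-not (memb L)))))
      (+-monoˡ-≤ _ (≤-trans (count-memb L) (≤-reflexive L-len)))))
    z = proj₁ z₀
    out : (∀ i → w i ≢ z) × (∀ i → a i ≢ z)
    out = (λ i e → t≢f (memb⁺ {L = L} (subst (_∈ L) e (∈-++⁺ˡ (Anyₚ.tabulate⁺ i refl)))) (not⁻ (proj₂ z₀)))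
        , (λ i e → t≢f (memb⁺ {L = L} (subst (_∈ L) e (∈-++⁺ʳ (tabulate w) (Anyₚ.tabulate⁺ i refl)))) (not⁻ (proj₂ z₀)))
    p : Fin (suc (2 * t)) → Fin (suc (2 * t))
    p i = list H d≤1 M z (toℕ i)
    i≤ : ∀ (i : Fin (suc (2 * t))) → toℕ i ≤ 2 * t
    i≤ i = ℕ.s≤s⁻¹ (Finₚ.toℕ<n i)
    p-inj : ∀ i j → p i ≡ p j → i ≡ j
    p-inj i j e = Finₚ.toℕ-injective (list-inj H d≤1 t M z out (toℕ i) (toℕ j) (i≤ i) (i≤ j) e)
    ==≡ : ∀ i j → (toℕ i ≡ᵇ toℕ j) ≡ (i == j)
    ==≡ i j with bool (i == j)
    ... | inj₁ e = trans (≡ᵇ⁺ {toℕ i} (cong toℕ (==⁻ e))) (≡sym e)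
    ... | inj₂ e with bool (toℕ i ≡ᵇ toℕ j)
    ...   | inj₂ q = trans q (≡sym e)
    ...   | inj₁ q = ⊥-elim (==-f⁻ {x = i} {j} e (Finₚ.toℕ-injective (≡ᵇ⁻ {toℕ i} q)))
    p-adj : ∀ i j → adj (matchingPlusK1 t) i j ≡ adj H (p i) (p j)
    p-adj i j = trans (matching-adj t i j) (trans (cong₂ (λ x y → x ∧ not y) (cong₂ _≡ᵇ_ (≡sym (half↑≡ (toℕ i))) (≡sym (half↑≡ (toℕ j)))) (≡sym (==≡ i j)))
      (≡sym (list-adj H d≤1 t M z out (toℕ i) (toℕ j) (i≤ i) (i≤ j))))

-- The degree sum is at most the number 2t + 1 of vertices, and it is even.
dsum-matching : ∀ t (H : SimpleGraph (suc (2 * t))) → (∀ x → deg H x ≤ 1) → dsum H ≤ dsum (matchingPlusK1 t)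
dsum-matching t H d≤1 = ≤-trans (≤-trans (≤-reflexive (dsum≡2edges H)) (even (edges H) t
    (≤-trans (≤-reflexive (≡sym (dsum≡2edges H))) (≤-trans (∑-≤const 1 d≤1) (≤-reflexive (*-identityʳ _)))))) (dsum-matching≥ t)
  where
  even : ∀ E t → 2 * E ≤ suc (2 * t) → 2 * E ≤ 2 * t
  even E t p with m≤n⇒m<n∨m≡n p
  ... | inj₁ q = ℕ.s≤s⁻¹ q
  ... | inj₂ q = ⊥-elim (even≢odd E t q)

-- Placing one or two vertices of Q

-- Equal arguments `c₁`, `c₂` place a single vertex, so one definition serves for both an edge and a
-- path of two edges in G[W].
place₂ : ∀ {N n} → Fin N → Fin n → Fin N → Fin n → Fin N → Maybe (Fin n)
place₂ c₁ y c₂ z x = if c₁ == x then just y else (if c₂ == x then just z else nothing)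

place₂-just : ∀ {N n} (c₁ : Fin N) (y : Fin n) c₂ z x v → place₂ c₁ y c₂ z x ≡ just v → (x ≡ c₁ × v ≡ y) ⊎ (x ≡ c₂ × v ≡ z)
place₂-just c₁ y c₂ z x v e with bool (c₁ == x)
... | inj₁ q rewrite q = inj₁ (≡sym (==⁻ q) , ≡sym (Maybeₚ.just-injective e))
... | inj₂ q rewrite q with bool (c₂ == x)
...   | inj₁ q′ rewrite q′ = inj₂ (≡sym (==⁻ q′) , ≡sym (Maybeₚ.just-injective e))
...   | inj₂ q′ rewrite q′ with e
...     | ()

place₂-N : ∀ {N n} (c₁ : Fin N) (y : Fin n) c₂ z x → place₂ c₁ y c₂ z x ≢ nothing → x ≡ c₁ ⊎ x ≡ c₂
place₂-N c₁ y c₂ z x ne with bool (c₁ == x)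
... | inj₁ q = inj₁ (≡sym (==⁻ q))
... | inj₂ q rewrite q with bool (c₂ == x)
...   | inj₁ q′ = inj₂ (≡sym (==⁻ q′))
...   | inj₂ q′ rewrite q′ = ⊥-elim (ne refl)

unhubbed⁻ : ∀ {N n} (hb : Fin N → Maybe (Fin n)) x → unhubbed hb x ≡ false → hb x ≢ nothing
unhubbed⁻ hb x e q with hb x
unhubbed⁻ hb x () refl | .nothing

unhubbed-just : ∀ {N n} (hb : Fin N → Maybe (Fin n)) x v → hb x ≡ just v → unhubbed hb x ≡ false
unhubbed-just hb x v e with hb x
unhubbed-just hb x v refl | .(just v) = refl

unhubbed⁺ : ∀ {N n} (hb : Fin N → Maybe (Fin n)) x → unhubbed hb x ≡ true → hb x ≡ nothing
unhubbed⁺ hb x q with hb x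
unhubbed⁺ hb x q | nothing = refl

place₂-count : ∀ {N n} (c₁ : Fin N) (y : Fin n) c₂ z → c₁ ≢ c₂ → ∀ v →
  b2n (c₁ == v) + b2n (c₂ == v) ≤ b2n (not (unhubbed (place₂ c₁ y c₂ z) v))
place₂-count c₁ y c₂ z ne v with bool (c₁ == v)
... | inj₁ q with ==⁻ q
...   | refl rewrite ==-refl c₁ | ==-f⁺ {x = c₂} {c₁} (λ q → ne (≡sym q)) = ≤-refl
place₂-count c₁ y c₂ z ne v | inj₂ q rewrite q with bool (c₂ == v)
...   | inj₂ q′ rewrite q′ = z≤n
...   | inj₁ q′ rewrite q′ = ≤-refl

private
  defArith : ∀ u n Y k r → 2 * (u * n) + 4 * Y ≤ k * r + 2 * (u * n) → Y ≤ k * r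
  defArith u n Y k r h1 = *-cancelˡ-≤ 4 (lin (3 * k * r) (h1) (solve (u ∷ n ∷ Y ∷ k ∷ r ∷ [])))
  halfArith : ∀ u n k r X Y → 2 * (u * n) + 4 * (X + Y) ≤ k * r + 2 * ((1 + u) * n) → X ≤ Y → 8 * X ≤ k * r + 2 * n
  halfArith u n k r X Y h1 h2 = lin (0) (h1 ⊕ 4 ⊛ h2) (solve (u ∷ n ∷ k ∷ r ∷ X ∷ Y ∷ []))
  halfGood : ∀ n t r x k c X l → n ≤ 2 * t + 2 * r → t ≤ x + X → 8 * X ≤ k * r + 2 * n → 4 * ((3 + l) * (k + c + 1) + c + 3) * r < n → c * r ≤ x
  halfGood n t r x k c X l h1 h2 h3 h4 = *-cancelˡ-≤ 32 (lin (2 + 8 * c * l * r + 8 * k * l * r + 23 * k * r + 8 * l * r + 40 * r + 24 * x) (4 ⊛ h1 ⊕ 8 ⊛ h2 ⊕ h3 ⊕ 2 ⊛ h4) (solve (n ∷ t ∷ r ∷ x ∷ k ∷ c ∷ X ∷ l ∷ [])))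
  cancel-rest : ∀ G g w x y → g + x + y ≤ G → G ≤ w + y + x → g ≤ w
  cancel-rest G g w x y h1 h2 = lin (0) (h1 ⊕ h2) (solve (G ∷ g ∷ w ∷ x ∷ y ∷ []))
  add-rest : ∀ G g w x y → g + x + y ≤ G → w ≤ g → w + y + x ≤ G
  add-rest G g w x y h1 h2 = lin (0) (h1 ⊕ h2) (solve (G ∷ g ∷ w ∷ x ∷ y ∷ []))

-- From the edge count to the structure of G

module Extremal {N : ℕ} (Q : SimpleGraph N) (ℓ : Fin (1 + N) → Fin (1 + N) → ℕ) (valid : ValidLengths (cone Q) ℓ)
  (col : Fin N → Bool) (proper : ∀ x y → adj Q x y ≡ true → col y ≡ not (col x))
  {n : ℕ} (G : SimpleGraph n) (noCopy : ¬ (oddBalloon (cone Q) ℓ ⊆ G)) (r : ℕ) (S : Split G r) (mindeg : ∀ v → n ≤ 2 * deg G v)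
  (h e : ℕ) (len : length (balloonVertices (cone Q) ℓ) ≤ h) (e≡ : edges Q ≡ e) (h<r : h < r) (big : Consts.L N e h * r < n)
  (u′ m₀ : ℕ) (col≤ : count col ≤ suc u′) (u≤e : suc u′ ≤ e) (u+m : suc u′ + m₀ ≡ n) (sq : 3 * (suc u′ * suc u′) + 1 + e * e ≤ r)
  (lower : 2 * (suc u′ * m₀) + 2 * turanEdges m₀ ≤ dsum G) where

  open Consts N e h public
  open Split S public
  open Partitioned Q ℓ valid col proper G noCopy r S mindeg h e len e≡ h<r big public

  u = suc u′
  w = count W
  own : Bool → ℕ
  own s = pairs (within G (Part s))
  ΣW = ∑ (λ x → b2n (W x) * deg G x)
  p = count (Part true) + count (Part false)

  p+w : p + w ≡ n
  p+w = trans (+-assoc (count (Part true)) _ w) (trans (cong (count (Part true) +_) (≡sym rest)) (count-not (Part true)))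
    where
    rest : count (λ x → not (Part true x)) ≡ count (Part false) + w
    rest = trans (count-split (λ x → not (Part true x)) (Part false)) (cong (_+ w) (count-cong lem))
      where
      lem : ∀ x → not (Part true x) ∧ Part false x ≡ Part false x
      lem x with bool (Part true x) | bool (Part false x)
      ... | inj₂ a | _      = cong (λ b → not b ∧ Part false x) a
      ... | inj₁ a | inj₂ b = trans (cong (not (Part true x) ∧_) b) (trans (Boolₚ.∧-zeroʳ (not (Part true x))) (≡sym b))
      ... | inj₁ a | inj₁ b = ⊥-elim (V-disjoint true x a b)

  w≤e = W≤e

  -- Either all own degrees are at most u - 1, or some vertex has u ≥ `count col` neighbours in its
  -- own part and `starMatching` applies; the sum covers both.
  ownTotal : ∀ s → own s ≤ u′ * count (Part s) + κ * r
  ownTotal s with find? (λ x → Part s x ∧ ge (degIn G (Part s) x) u)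
  ... | inj₁ (x , q) = ≤-trans (starMatching s x (proj₁ (∧⁻ {Part s x} q)) (≤-trans col≤ (ge⁻ (proj₂ (∧⁻ {Part s x} q))))) (m≤n+m _ _)
  ... | inj₂ none = ≤-trans (≤-trans (≤-reflexive (pairs-within G (Part s))) (≤-trans (∑-P≤ (Part s) (degIn G (Part s)) u′ small) (≤-reflexive (*-comm _ u′)))) (m≤m+n _ _)
    where
    small : ∀ x → Part s x ≡ true → degIn G (Part s) x ≤ u′
    small x px with bool (ge (degIn G (Part s) x) u)
    ... | inj₁ q = t≢f (∧⁺ px q) (none x)
    ... | inj₂ q with bool (degIn G (Part s) x <ᵇ u)
    ...   | inj₁ q′ = ℕ.s≤s⁻¹ (<ᵇ⁻ q′)
    ...   | inj₂ q′ = t≢f (cong not q′) q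

  edgeCount : dsum G ≤ 2 * (count (Part true) * count (Part false)) + (own true + own false) + 2 * ΣW
  edgeCount = ≤-trans (≤-reflexive (pairs≡∑∑ (adj G))) (≤-trans (∑-mono (λ x → ∑-mono (λ y → pt x y))) (≤-reflexive total))
    where
    A = Part true
    B = Part false
    -- Rows and columns of W, edges inside either part, and all pairs between the parts, in both
    -- orders: together they cover every adjacent pair.
    f₁ f₂ f₃ f₄ f₅ f₆ : Fin n → Fin n → Bool
    f₁ x y = W x ∧ adj G x y
    f₂ x y = W y ∧ adj G x y
    f₃ = within G A
    f₄ = within G B
    f₅ x y = A x ∧ B y
    f₆ x y = B x ∧ A y
    pt : ∀ x y → b2n (adj G x y) ≤ (b2n (f₁ x y) + b2n (f₂ x y)) + ((b2n (f₃ x y) + b2n (f₄ x y)) + (b2n (f₅ x y) + b2n (f₆ x y)))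
    pt x y = lem (adj G x y) (A x) (B x) (A y) (B y)
      where
      lem : ∀ a i j k l → b2n a ≤ (b2n ((not i ∧ not j) ∧ a) + b2n ((not k ∧ not l) ∧ a)) + ((b2n (i ∧ (k ∧ a)) + b2n (j ∧ (l ∧ a))) + (b2n (i ∧ l) + b2n (j ∧ k)))
      lem false i j k l = z≤n
      lem true false false k l = s≤s z≤n
      lem true true  j false false = s≤s z≤n
      lem true true  j true  l = s≤s z≤n
      lem true true  false false true = s≤s z≤n
      lem true true  true  false true = s≤s z≤n
      lem true false true false false = s≤s z≤n
      lem true false true false true = s≤s z≤n
      lem true false true true false = s≤s z≤n
      lem true false true true true = s≤s z≤n
    sum∑ : (f : Fin n → Fin n → Bool) → ℕ
    sum∑ f = ∑ (λ x → ∑ (λ y → b2n (f x y)))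
    W-row : sum∑ f₁ ≡ ΣW
    W-row = trans (≡sym (pairs≡∑∑ f₁)) (pairs-row W (adj G))
    W-col : sum∑ f₂ ≡ ΣW
    W-col = trans (≡sym (pairs≡∑∑ f₂)) (trans (pairs-swap f₂) (trans (pairs-cong (λ y x → cong (W y ∧_) (sym G x y))) (pairs-row W (adj G))))
    rect : ∀ (P R : Fin n → Bool) → sum∑ (λ x y → P x ∧ R y) ≡ count P * count R
    rect P R = trans (≡sym (pairs≡∑∑ (λ x y → P x ∧ R y))) (trans (pairs-row P (λ _ → R)) (trans (∑-cong (λ x → *-comm (b2n (P x)) (count R)))
      (trans (∑-*ˡ (count R) (λ x → b2n (P x))) (trans (cong (count R *_) (≡sym (count≡∑ P))) (*-comm (count R) _)))))
    total : ∑ (λ x → ∑ (λ y → (b2n (f₁ x y) + b2n (f₂ x y)) + ((b2n (f₃ x y) + b2n (f₄ x y)) + (b2n (f₅ x y) + b2n (f₆ x y))))) ≡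
      2 * (count A * count B) + (own true + own false) + 2 * ΣW
    total = trans (trans (∑∑-+ (λ x y → b2n (f₁ x y) + b2n (f₂ x y)) _) (cong₂ _+_ (∑∑-+ (λ x y → b2n (f₁ x y)) (λ x y → b2n (f₂ x y)))
        (trans (∑∑-+ (λ x y → b2n (f₃ x y) + b2n (f₄ x y)) _) (cong₂ _+_ (∑∑-+ (λ x y → b2n (f₃ x y)) (λ x y → b2n (f₄ x y))) (∑∑-+ (λ x y → b2n (f₅ x y)) (λ x y → b2n (f₆ x y)))))))
      (trans (cong₂ _+_ (cong₂ _+_ W-row W-col) (cong₂ _+_ (cong₂ _+_ (≡sym (pairs≡∑∑ f₃)) (≡sym (pairs≡∑∑ f₄))) (cong₂ _+_ (rect A B) (rect B A))))
        (arith ΣW (own true) (own false) (count A) (count B)))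
      where
      arith : ∀ z s t a b → (z + z) + ((s + t) + (a * b + b * a)) ≡ 2 * (a * b) + (s + t) + 2 * z
      arith = solve-∀

  count₂ : 2 * u * n + 2 * n * w ≤ 3 * (u * u) + 1 + w * w + 2 * (own true + own false) + 4 * ΣW
  count₂ = counting₂ u m₀ n w (own true + own false) ΣW (p * p)
    (counting₁ u m₀ (turanEdges m₀) (dsum G) (count (Part true) * count (Part false)) (own true + own false) ΣW (p * p) lower (turanEdges-lower m₀) edgeCount (4ab≤ (count (Part true)) (count (Part false))))
    (≤-reflexive (subst (λ z → z * z + 2 * u * z ≡ 4 * (u * m₀) + m₀ * m₀ + 3 * (u * u)) u+m (sq-id u m₀)))
    (≤-reflexive (subst (λ z → p * p + 2 * z * w ≡ z * z + w * w) p+w (sq-id₂ p w)))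

  0<e : 0 < e
  0<e = ≤-trans (s≤s z≤n) u≤e

  -- W has at most e vertices, so if each had degree below n/2 + n/(4e), their joint surplus over
  -- n/2 would be at most n/4, too little by `noHub`. As each side has at most n/2 + r vertices,
  -- such a vertex has n/(4e) - r neighbours on either side.
  superhub : ∃ λ x → W x ≡ true × n + 2 * (e * n) ≤ 4 * (e * deg G x)
  superhub with find? (λ x → W x ∧ ge (4 * (e * deg G x)) (n + 2 * (e * n)))
  ... | inj₁ (x , q) = x , proj₁ (∧⁻ {W x} q) , ge⁻ (proj₂ (∧⁻ {W x} q))
  ... | inj₂ none = ⊥-elim (noHub u′ n w (own true + own false) ΣW e r κ p count₂
        (≤-trans (+-mono-≤ (ownTotal true) (ownTotal false)) (≤-reflexive (arith u′ (count (Part true)) (count (Part false)) (κ * r))))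
        (≤-trans (m≤m+n p w) (≤-reflexive p+w)) Z≤ sq (*-mono-≤ w≤e w≤e) big₂)
    where
    arith : ∀ v a b k → (v * a + k) + (v * b + k) ≡ v * (a + b) + 2 * k
    arith = solve-∀
    small : ∀ x → W x ≡ true → 4 * (e * deg G x) ≤ n + 2 * (e * n)
    small x wx with bool (4 * (e * deg G x) <ᵇ n + 2 * (e * n))
    ... | inj₁ q = <⇒≤ (<ᵇ⁻ q)
    ... | inj₂ q = t≢f (∧⁺ wx (cong not q)) (none x)
    Z≤ : 4 * ΣW ≤ n + 2 * n * w
    Z≤ = *-cancelˡ-≤ e {{ℕ.>-nonZero 0<e}} (begin
      e * (4 * ΣW) ≡⟨ a₁ e ΣW ⟩
      (4 * e) * ΣW ≡⟨ ≡sym (∑-*ˡ (4 * e) (λ x → b2n (W x) * deg G x)) ⟩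
      ∑ (λ x → (4 * e) * (b2n (W x) * deg G x)) ≡⟨ ∑-cong (λ x → a₂ e (b2n (W x)) (deg G x)) ⟩
      ∑ (λ x → b2n (W x) * (4 * (e * deg G x))) ≤⟨ ∑-P≤ W (λ x → 4 * (e * deg G x)) (n + 2 * (e * n)) small ⟩
      w * (n + 2 * (e * n)) ≡⟨ a₃ w n e ⟩
      w * n + e * (2 * n * w) ≤⟨ +-monoˡ-≤ _ (*-monoˡ-≤ n w≤e) ⟩
      e * n + e * (2 * n * w) ≡⟨ ≡sym (*-distribˡ-+ e n _) ⟩
      e * (n + 2 * n * w) ∎)
      where
      open ≤-Reasoning
      a₁ : ∀ e z → e * (4 * z) ≡ (4 * e) * z
      a₁ = solve-∀
      a₂ : ∀ e b d → (4 * e) * (b * d) ≡ b * (4 * (e * d))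
      a₂ = solve-∀
      a₃ : ∀ w n e → w * (n + 2 * (e * n)) ≡ w * n + e * (2 * n * w)
      a₃ = solve-∀

  x₀ = proj₁ superhub

  x₀-large : ∀ s → ((c + 1) * e + c) * r ≤ d s x₀
  x₀-large s = hub-degree-cancel c e r (d s x₀) (*-cancelˡ-< (4 * e) _ _ (≤-trans (s≤s (≤-reflexive (arith e ((c + 1) * e + c + 1) r)))
    (≤-trans big₃ (hub-degree n e (deg G x₀) (d s x₀) (d (not s) x₀) r (proj₂ (proj₂ superhub)) (≤-reflexive (deg≡ s x₀))
      (≤-trans (*-monoʳ-≤ 2 (count-mono (λ y q → proj₁ (∧⁻ {T (not s) y} q)))) (size (not s)))))))
    where
    arith : ∀ e k r → 4 * e * (k * r) ≡ 4 * e * k * r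
    arith = solve-∀

  -- Otherwise e disjoint edges inside a part break the edges of Q with the apex on `x₀`. For cycles
  -- of length five, far-side vertices must see `x₀` and all second ends `a i`; each of these misses
  -- at most (c + 1) r of the neighbours of `x₀`, which `x₀-large` allows for.
  ownSmall : ∀ s → own s ≤ κ′ * r
  ownSmall s = finish (x₀-large (not s)) (x₀-large s) (proj₁ (proj₂ superhub)) (matching? G Δ e (Part s) (V-own s))
    where
    finish : ∀ {x₀} → ((c + 1) * e + c) * r ≤ d (not s) x₀ → ((c + 1) * e + c) * r ≤ d s x₀ → W x₀ ≡ true →
      Matching G (Part s) e ⊎ (∃ λ k → k < e × own s + 2 * k ≤ 4 * (k * Δ)) → own s ≤ κ′ * r
    finish _ _ _ (inj₂ (k , lt , le)) = ≤-trans (≤-trans (m≤m+n (own s) (2 * k)) le)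
      (≤-trans (*-monoʳ-≤ 4 (*-monoˡ-≤ Δ (<⇒≤ lt))) (≤-reflexive (arith e (c + 2) r)))
      where
      arith : ∀ e c r → 4 * (e * (c * r)) ≡ 4 * e * c * r
      arith = solve-∀
    finish {x₀} large large′ x₀W (inj₁ m) = ⊥-elim (noCopy (embedApex x₀ (λ _ → nothing) s dl e (λ i → edge (w′ i) (a i))
        (λ x y v ()) (λ x v ()) (λ x y q p _ → p refl) (≤-trans kept-all (≤-reflexive e≡)) (matching-disjoint m)
        (λ { i x x∈ refl → V-W s x (verts-P m i x x∈) x₀W }) (λ i x y p ())
        dl-x₀ (λ c x v ()) dl-good
        (λ i → w~a i , listGood (not s) (w′ i ∷ []) (s≤s z≤n) (λ { x (here refl) → V-missing′ s x (w∈ i) ; x (there ()) })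
                     , listGood (not s) (a i ∷ []) (s≤s z≤n) (λ { x (here refl) → V-missing′ s x (a∈ i) ; x (there ()) }) , dl-a i)))
      where
      open Matching m renaming (w to w′)
      as = tabulate a
      dl : Bool → List (Fin n)
      dl c = x₀ ∷ (if c Bool.xor s then as else [])
      dl-x₀ : ∀ c → x₀ ∈ dl c
      dl-x₀ c = here refl
      dl-a : ∀ i → a i ∈ dl (not s)
      dl-a i = there (subst (λ b → a i ∈ (if b then as else [])) (≡sym (xor-not s)) (∈-tabulate⁺ a i))
        where
        xor-not : ∀ s → not s Bool.xor s ≡ true
        xor-not true = refl
        xor-not false = refl
      good-far : Good (not s) (x₀ ∷ as)
      good-far = mkGood (not s) (x₀ ∷ as) (hub-room c e r (d (not s) x₀) _ (sumL (λ x → count (λ z → (T (not s) z ∧ adj G x₀ z) ∧ not (adj G x z))) as) large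
        (≤-trans (lossList (λ z → T (not s) z ∧ adj G x₀ z) as) (+-monoˡ-≤ _ (≤-reflexive (count-cong (λ z → Boolₚ.∧-assoc (T (not s) z) (adj G x₀ z) (allAdj as z))))))
        (≤-trans (sumL-≤∈ as lossA) (≤-reflexive (cong (_* ((c + 1) * r)) (Listₚ.length-tabulate a)))))
        where
        lossA : ∀ x → x ∈ as → count (λ z → (T (not s) z ∧ adj G x₀ z) ∧ not (adj G x z)) ≤ (c + 1) * r
        lossA x x∈ with ∈-tabulate⁻ {f = a} x∈
        ... | i , refl = ≤-trans (count-mono (λ z q → ∧⁺ (proj₁ (∧⁻ {T (not s) z} (proj₁ (∧⁻ {T (not s) z ∧ adj G x₀ z} q)))) (proj₂ (∧⁻ {T (not s) z ∧ adj G x₀ z} q))))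
                          (V-missing s (a i) (a∈ i))
      dl-good : ∀ c → Good c (dl c)
      dl-good k = lem k s large′ good-far
        where
        near : ∀ k → ((c + 1) * e + c) * r ≤ d k x₀ → Good k (x₀ ∷ [])
        near k q = mkGood k (x₀ ∷ []) (≤-trans (≤-trans (*-monoˡ-≤ r (m≤n+m c ((c + 1) * e))) q)
          (≤-reflexive (count-cong (λ z → cong (T k z ∧_) (≡sym (Boolₚ.∧-identityʳ _))))))
        lem : ∀ k s → ((c + 1) * e + c) * r ≤ d s x₀ → Good (not s) (x₀ ∷ as) → Good k (x₀ ∷ (if k Bool.xor s then as else []))
        lem true  true  q g = near true q
        lem true  false q g = g
        lem false true  q g = g
        lem false false q g = near false q

  deficit : Fin n → ℕ
  deficit x = n ∸ deg G x

  Σdef = ∑ (λ x → b2n (W x) * deficit x)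

  ΣW+Σdef : ΣW + Σdef ≡ w * n
  ΣW+Σdef = trans (≡sym (∑-+ (λ x → b2n (W x) * deg G x) (λ x → b2n (W x) * deficit x)))
    (trans (∑-cong (λ x → trans (≡sym (*-distribˡ-+ (b2n (W x)) (deg G x) (deficit x))) (trans (cong (b2n (W x) *_) (m+[n∸m]≡n (count≤n (adj G x)))) (*-comm (b2n (W x)) n))))
      (trans (∑-*ˡ n (λ x → b2n (W x))) (trans (cong (n *_) (≡sym (count≡∑ W))) (*-comm n w))))

  -- Excludes w < u; for w = u it makes the total deficit of W of order r, and for w = u + 1 still
  -- about n/2 at most.
  deficits : 2 * (u * n) + 4 * Σdef ≤ κ₂ * r + 2 * (w * n)
  deficits = deficit-bound u n w (own true + own false) ΣW e r κ′ Σdef count₂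
    (≤-trans (+-mono-≤ (ownSmall true) (ownSmall false)) (≤-reflexive (cong (κ′ * r +_) (≡sym (+-identityʳ _))))) (≤-reflexive ΣW+Σdef) sq (*-mono-≤ w≤e w≤e)

  κ₂r<n : κ₂ * r < n
  κ₂r<n = ≤-trans (s≤s (*-monoˡ-≤ r (begin
    κ₂ ≤⟨ ≤-trans (m≤m+n κ₂ c) (m≤m+n (κ₂ + c) 1) ⟩
    κ₂ + c + 1 ≤⟨ m≤m+n (κ₂ + c + 1) _ ⟩
    λ₀ * (κ₂ + c + 1) ≤⟨ ≤-trans (m≤m+n _ c) (m≤m+n _ 3) ⟩
    λ₀ * (κ₂ + c + 1) + c + 3 ≤⟨ m≤m+n _ _ ⟩
    k₄ ∎))) big₄
    where open ≤-Reasoning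

  u≤w : u ≤ w
  u≤w = ≮⇒≥ (λ lt → too-few-hubs u n w κ′ r Σdef deficits lt κ₂r<n)

  missing≤deficit : ∀ s x → missing s x ≤ deficit x
  missing≤deficit s x = ≤-trans (count-mono (λ z q → proj₂ (∧⁻ {T s z} q)))
    (≤-reflexive (trans (≡sym (m+n∸m≡n (deg G x) _)) (cong (_∸ deg G x) (count-not (adj G x)))))

  deficit≤Σ : ∀ x → W x ≡ true → deficit x ≤ Σdef
  deficit≤Σ x wx = ≤-trans (≤-reflexive (trans (≡sym (+-identityʳ _)) (cong (λ b → b2n b * deficit x) (≡sym wx)))) (≤∑ (λ y → b2n (W y) * deficit y) x)

  W-missing : w ≡ u → ∀ s x → W x ≡ true → missing s x ≤ (κ₂ + c + 1) * r
  W-missing eq s x wx = ≤-trans (missing≤deficit s x) (≤-trans (deficit≤Σ x wx) (≤-trans (defArith u n Σdef κ₂ r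
    (subst (λ z → 2 * (u * n) + 4 * Σdef ≤ κ₂ * r + 2 * (z * n)) eq deficits)) (*-monoˡ-≤ r (≤-trans (m≤m+n κ₂ c) (m≤m+n _ 1)))))

  edge-verts : ∀ {s x y z} → Part s x ≡ true → Part s y ≡ true → z ∈ verts (edge x y) → Part s z ≡ true
  edge-verts p q (here refl) = p
  edge-verts p q (there (here refl)) = q

  mixed : ∀ {M} → (Fin M → Fin n) → Fin n → Fin n → Fin (suc M) → Breaker n
  mixed g x y zero    = edge x y
  mixed g x y (suc i) = hub (g i)

  mixed-disjoint : ∀ {M} (g : Fin M → Fin n) s x y → Part s x ≡ true → Part s y ≡ true → (∀ i → W (g i) ≡ true) →
    (∀ i j → g i ≡ g j → i ≡ j) → Disjoint (mixed g x y)
  mixed-disjoint g s x y px py gW inj zero    zero    z p q = refl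
  mixed-disjoint g s x y px py gW inj zero    (suc j) z p (here refl) = ⊥-elim (V-W s z (edge-verts px py p) (gW j))
  mixed-disjoint g s x y px py gW inj (suc i) zero    z (here refl) q = ⊥-elim (V-W s z (edge-verts px py q) (gW i))
  mixed-disjoint g s x y px py gW inj (suc i) (suc j) z (here p) (here q) = cong suc (inj i j (trans (≡sym p) q))

  -- The leaf y lies in `Part s` and can be demanded as a neighbour only on the opposite side, where
  -- it misses few vertices.
  withLeaf : Bool → Fin n → List (Fin n) → Bool → List (Fin n)
  withLeaf s y L k = if k Bool.xor s then y ∷ L else L

  withLeaf-⊆ : ∀ s y L k z → z ∈ L → z ∈ withLeaf s y L k
  withLeaf-⊆ s y L k z p with k Bool.xor s
  ... | true  = there p
  ... | false = p

  withLeaf-y : ∀ s y L → y ∈ withLeaf s y L (not s)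
  withLeaf-y true  y L = here refl
  withLeaf-y false y L = here refl

  withLeaf-good : w ≡ u → ∀ s y L k → Part s y ≡ true → (∀ z → z ∈ L → W z ≡ true) → suc (length L) ≤ λ₀ → Good k (withLeaf s y L k)
  withLeaf-good eq s y L k py LW len = lem k s refl
    where
    hubs : ∀ k → Good k L
    hubs k = listGood k L (≤-trans (n≤1+n _) len) (λ z p → W-missing eq k z (LW z p))
    leaf : ∀ k → k ≡ not s → Good k (y ∷ L)
    leaf k refl = listGood k (y ∷ L) len (λ { z (here refl) → V-missing′ s z py ; z (there p) → W-missing eq _ z (LW z p) })
    lem : ∀ k t → s ≡ t → Good k (if k Bool.xor t then y ∷ L else L)
    lem true  true  _ = hubs true
    lem false false _ = hubs false
    lem true  false q = leaf true (cong not (≡sym q))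
    lem false true  q = leaf false (cong not (≡sym q))

  edge-good : w ≡ u → ∀ s x y L → Part s x ≡ true → Part s y ≡ true → adj G x y ≡ true → BreakerGood s (withLeaf s y L (not s)) (edge x y)
  edge-good eq s x y L px py xy = xy , listGood (not s) (x ∷ []) (s≤s z≤n) (λ { z (here refl) → V-missing′ s z px ; z (there ()) })
    , listGood (not s) (y ∷ []) (s≤s z≤n) (λ { z (here refl) → V-missing′ s z py ; z (there ()) }) , withLeaf-y s y L

  mixed-good : w ≡ u → ∀ {M} (g : Fin M → Fin n) s x y L → Part s x ≡ true → Part s y ≡ true → adj G x y ≡ true → (∀ i → W (g i) ≡ true) →
    ∀ i → BreakerGood s (withLeaf s y L (not s)) (mixed g x y i)
  mixed-good eq g s x y L px py xy gW zero    = edge-good eq s x y L px py xy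
  mixed-good eq g s x y L px py xy gW (suc i) = λ k → W-good k (g i) (gW i)

  1≤λ₀ : ∀ {k} → k ≤ 3 → k ≤ λ₀
  1≤λ₀ p = ≤-trans p (≤-trans (m≤m+n 3 (3 * N)) (m≤m+n _ (2 * e)))

  -- With the apex on one of the e hubs, e - 1 hubs and the edge xy supply the e breakers.
  independent-apex : w ≡ u → u ≡ e → ∀ s x y → Part s x ≡ true → Part s y ≡ true → adj G x y ≡ true → ⊥
  independent-apex eq ue s x y px py xy = noCopy (embedApex (g zero) (λ _ → nothing) s (withLeaf s y (g zero ∷ [])) u (mixed (g ∘ suc) x y)
      (λ x y v ()) (λ x v ()) (λ x y a p _ → p refl) (≤-trans kept-all (≤-reflexive (trans e≡ (≡sym ue))))
      (mixed-disjoint (g ∘ suc) s x y px py (gW ∘ suc) (λ i j p → Finₚ.suc-injective (g-inj (suc i) (suc j) p)))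
      avoid₀ (λ i x y p ()) (λ k → withLeaf-⊆ s y _ k (g zero) (here refl)) (λ k x v ())
      (λ k → withLeaf-good eq s y (g zero ∷ []) k py (λ { z (here refl) → gW zero ; z (there ()) }) (1≤λ₀ (s≤s (s≤s z≤n))))
      (mixed-good eq (g ∘ suc) s x y (g zero ∷ []) px py xy (gW ∘ suc)))
    where
    ch = choose W u (≤-reflexive (≡sym eq))
    g = proj₁ ch
    gW = proj₁ (proj₂ ch)
    g-inj = proj₂ (proj₂ ch)
    case0 : ∀ {m} {X : Set} (i : Fin m) → suc i ≡ zero → X
    case0 i ()
    avoid₀ : ∀ i z → z ∈ verts (mixed (g ∘ suc) x y i) → z ≢ g zero
    avoid₀ zero z p refl = V-W s z (edge-verts px py p) (gW zero)
    avoid₀ (suc i) z (here refl) q = case0 i (g-inj (suc i) zero q)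

  -- For copies found from edges inside W: the apex on v₀, a few vertices of Q on L, and all
  -- breakers among the remaining vertices of W.
  hubsOnly : w ≡ u → ∀ v₀ (hb : Fin N → Maybe (Fin n)) (L : List (Fin n)) M → W v₀ ≡ true →
    (∀ x y v → hb x ≡ just v → hb y ≡ just v → x ≡ y) → (∀ x v → hb x ≡ just v → adj G v₀ v ≡ true) →
    (∀ x y → adj Q x y ≡ true → hb x ≢ nothing → hb y ≢ nothing → ⊥) →
    (∀ x v → hb x ≡ just v → v ∈ L) → (∀ v → v ∈ L → W v ≡ true) → length L ≤ 2 →
    kept Q (unhubbed hb) ≤ M → M ≤ count (λ z → W z ∧ not (memb (v₀ ∷ L) z)) → ⊥
  hubsOnly eq v₀ hb L M v₀W inj v₀-adj indep hb∈ LW len enough room = noCopy (embedApex v₀ hb true (λ _ → v₀ ∷ L) M (λ i → hub (g i))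
      inj v₀-adj indep enough (hubs-disjoint g g-inj)
      (λ { i z (here refl) q → t≢f (memb⁺ {L = v₀ ∷ L} (here q)) (out i) })
      (λ { i z y (here refl) q → t≢f (memb⁺ {L = v₀ ∷ L} (there (hb∈ y z q))) (out i) })
      (λ _ → here refl) (λ _ x v q → there (hb∈ x v q))
      (λ k → listGood k (v₀ ∷ L) (1≤λ₀ (s≤s len)) (λ { z (here refl) → W-missing eq k z v₀W ; z (there p) → W-missing eq k z (LW z p) }))
      (λ i k → W-good k (g i) (proj₁ (∧⁻ {W (g i)} (gW i)))))
    where
    ch = choose (λ z → W z ∧ not (memb (v₀ ∷ L) z)) M room
    g = proj₁ ch
    gW = proj₁ (proj₂ ch)
    g-inj = proj₂ (proj₂ ch)
    out : ∀ i → memb (v₀ ∷ L) (g i) ≡ false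
    out i = not⁻ (proj₂ (∧⁻ {W (g i)} (gW i)))

  room : ∀ L M → M + length L ≤ w → M ≤ count (λ z → W z ∧ not (memb L z))
  room L M p = +-cancelʳ-≤ (length L) M _ (≤-trans p (≤-trans (count-minus W (memb L)) (+-monoʳ-≤ _ (count-memb L))))

  -- The apex on x and c₀ on y settle at least two edges of Q, and the remaining e - 2 are broken by
  -- the w - 2 other hubs.
  no-W-edge : w ≡ u → u ≡ e → ∀ c₀ → 2 ≤ deg Q c₀ → ∀ x y → W x ≡ true → W y ≡ true → adj G x y ≡ true → ⊥
  no-W-edge eq ue c₀ d₂ x y xW yW xy = hubsOnly eq x hb (y ∷ []) (kept Q (unhubbed hb)) xW inj
      (λ { z v q → subst (λ v → adj G x v ≡ true) (≡sym (val z v q)) xy })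
      indep (λ z v q → here (val z v q)) (λ { v (here refl) → yW ; v (there ()) }) (s≤s z≤n) ≤-refl
      (room (x ∷ y ∷ []) _ (≤-trans (≤-trans (+-monoʳ-≤ (kept Q (unhubbed hb)) (≤-trans d₂ degs)) (≤-trans (kept≤edges Q (unhubbed hb) (λ p q a e₁ e₂ → indep p q a (unhubbed⁻ hb p e₁) (unhubbed⁻ hb q e₂)))
        (≤-reflexive e≡))) (≤-reflexive (trans (≡sym ue) (≡sym eq)))))
    where
    hb = place₂ c₀ y c₀ y
    pos : ∀ z → hb z ≢ nothing → z ≡ c₀
    pos z ne = [ id , id ]′ (place₂-N c₀ y c₀ y z ne)
    val : ∀ z v → hb z ≡ just v → v ≡ y
    val z v q = [ proj₂ , proj₂ ]′ (place₂-just c₀ y c₀ y z v q)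
    inj : ∀ p q v → hb p ≡ just v → hb q ≡ just v → p ≡ q
    inj p q v e₁ e₂ = trans ([ proj₁ , proj₁ ]′ (place₂-just c₀ y c₀ y p v e₁)) (≡sym ([ proj₁ , proj₁ ]′ (place₂-just c₀ y c₀ y q v e₂)))
    indep : ∀ p q → adj Q p q ≡ true → hb p ≢ nothing → hb q ≢ nothing → ⊥
    indep p q a e₁ e₂ with pos p e₁ | pos q e₂
    ... | refl | refl = t≢f a (irrefl Q p)
    hbc : hb c₀ ≡ just y
    hbc rewrite ==-refl c₀ = refl
    degs : deg Q c₀ ≤ ∑ (λ z → b2n (not (unhubbed hb z)) * deg Q z)
    degs = ≤-trans (≤-reflexive (≡sym (∑-== c₀ (deg Q)))) (∑-mono (λ z → *-monoˡ-≤ (deg Q z) (b2n-mono (λ q → cong not (unhubbed-just hb z y (subst (λ z → hb z ≡ just y) (==⁻ q) hbc))))))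

  -- Two neighbours of a common vertex of Q have the same colour, so they are not adjacent.
  no-W-cherry : w ≡ u → suc u ≡ e → (∀ x → deg Q x ≡ 2) → ∀ c₁ c₂ b → c₁ ≢ c₂ → adj Q b c₁ ≡ true → adj Q b c₂ ≡ true →
    ∀ x y z → W x ≡ true → W y ≡ true → W z ≡ true → y ≢ z → adj G x y ≡ true → adj G x z ≡ true → ⊥
  no-W-cherry eq ue deg2 c₁ c₂ b c≢ b₁ b₂ x y z xW yW zW y≢z xy xz = hubsOnly eq x hb (y ∷ z ∷ []) (kept Q (unhubbed hb)) xW inj
      xadj indep hb∈ (λ { v (here refl) → yW ; v (there (here refl)) → zW ; v (there (there ())) }) ≤-refl ≤-refl
      (room (x ∷ y ∷ z ∷ []) _ (ℕ.s≤s⁻¹ (≤-trans (≤-reflexive (≡sym (+-suc _ 3))) (≤-trans (≤-trans (+-monoʳ-≤ (kept Q (unhubbed hb)) degs) (≤-trans (kept≤edges Q (unhubbed hb) (λ p q a e₁ e₂ → indep p q a (unhubbed⁻ hb p e₁) (unhubbed⁻ hb q e₂)))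
        (≤-reflexive e≡))) (≤-reflexive (trans (≡sym ue) (cong suc (≡sym eq))))))))
    where
    hb = place₂ c₁ y c₂ z
    same : col c₁ ≡ col c₂
    same = trans (proper b c₁ b₁) (≡sym (proper b c₂ b₂))
    nonadj : ∀ {p q} → col p ≡ col q → adj Q p q ≡ true → ⊥
    nonadj {p} {q} s a = b≢not (col p) (trans s (proper p q a))
    inj : ∀ p q v → hb p ≡ just v → hb q ≡ just v → p ≡ q
    inj p q v e₁ e₂ with place₂-just c₁ y c₂ z p v e₁ | place₂-just c₁ y c₂ z q v e₂
    ... | inj₁ (refl , _) | inj₁ (refl , _) = refl
    ... | inj₂ (refl , _) | inj₂ (refl , _) = refl
    ... | inj₁ (_ , q₁) | inj₂ (_ , q₂) = ⊥-elim (y≢z (trans (≡sym q₁) q₂))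
    ... | inj₂ (_ , q₁) | inj₁ (_ , q₂) = ⊥-elim (y≢z (trans (≡sym q₂) q₁))
    xadj : ∀ p v → hb p ≡ just v → adj G x v ≡ true
    xadj p v e₁ with place₂-just c₁ y c₂ z p v e₁
    ... | inj₁ (_ , refl) = xy
    ... | inj₂ (_ , refl) = xz
    hb∈ : ∀ p v → hb p ≡ just v → v ∈ y ∷ z ∷ []
    hb∈ p v e₁ with place₂-just c₁ y c₂ z p v e₁
    ... | inj₁ (_ , q) = here q
    ... | inj₂ (_ , q) = there (here q)
    indep : ∀ p q → adj Q p q ≡ true → hb p ≢ nothing → hb q ≢ nothing → ⊥
    indep p q a e₁ e₂ with place₂-N c₁ y c₂ z p e₁ | place₂-N c₁ y c₂ z q e₂
    ... | inj₁ refl | inj₁ refl = nonadj refl a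
    ... | inj₂ refl | inj₂ refl = nonadj refl a
    ... | inj₁ refl | inj₂ refl = nonadj same a
    ... | inj₂ refl | inj₁ refl = nonadj (≡sym same) a
    -- Being non-adjacent, `c₁` and `c₂` settle four edges; the e - 4 others match the w - 3 hubs
    -- left, as w = e - 1.
    degs : 4 ≤ ∑ (λ v → b2n (not (unhubbed hb v)) * deg Q v)
    degs = ≤-trans (≤-reflexive (≡sym (trans (∑-+ (λ v → b2n (c₁ == v) * deg Q v) (λ v → b2n (c₂ == v) * deg Q v))
        (cong₂ _+_ (trans (∑-== c₁ (deg Q)) (deg2 c₁)) (trans (∑-== c₂ (deg Q)) (deg2 c₂))))))
      (∑-mono (λ v → ≤-trans (≤-reflexive (≡sym (*-distribʳ-+ (deg Q v) (b2n (c₁ == v)) (b2n (c₂ == v))))) (*-monoˡ-≤ (deg Q v) (place₂-count c₁ y c₂ z c≢ v))))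

  -- With one colour class on hubs, the remaining hubs are one too few for the spokes to the other
  -- class, and the edge xy supplies the missing breaker.
  independent-class : w ≡ u → u ≡ count col + count (λ x → not (col x)) ∸ 1 → 1 ≤ count (λ x → not (col x)) →
    ∀ s x y → Part s x ≡ true → Part s y ≡ true → adj G x y ≡ true → ⊥
  independent-class eq ue 1≤ s x y px py xy with count (λ x → not (col x)) in cj
  ... | suc j = noCopy (embedClass assign s (withLeaf s y (tabulate g₁)) (suc j) (mixed g₂ x y) assign-inj
      (λ p q a e₁ e₂ → contradictory p q a (trans (assign-⊤ p e₁) (≡sym (assign-⊤ q e₂))))
      (λ p q a e₁ e₂ → contradictory p q a (trans (assign-⊥ p e₁) (≡sym (assign-⊥ q e₂))))
      (≤-trans (count-mono (λ z q → cong not (assign-⊥ z (unhubbed⁺ assign z q)))) (≤-reflexive cj))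
      (mixed-disjoint g₂ s x y px py (λ i → gW (count col ↑ʳ i)) (λ i k p → Finₚ.↑ʳ-injective (count col) i k (g-inj _ _ p)))
      avoid₀ (λ k z v q → withLeaf-⊆ s y _ k v (hb∈ z v q))
      (λ k → withLeaf-good eq s y (tabulate g₁) k py LW len₁)
      (mixed-good eq g₂ s x y (tabulate g₁) px py xy (λ i → gW (count col ↑ʳ i))))
    where
    ch = choose W (count col + j) (≤-reflexive (trans (≡sym (trans ue (cong (_∸ 1) (+-suc (count col) j)))) (≡sym eq)))
    g = proj₁ ch
    gW = proj₁ (proj₂ ch)
    g-inj = proj₂ (proj₂ ch)
    g₁ : Fin (count col) → Fin n
    g₁ i = g (i ↑ˡ j)
    g₂ : Fin j → Fin n
    g₂ i = g (count col ↑ʳ i)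
    open Assign col g₁ (λ i k p → Finₚ.↑ˡ-injective j i k (g-inj _ _ p))
    contradictory : ∀ x y → adj Q x y ≡ true → col x ≡ col y → ⊥
    contradictory x y a q = b≢not (col x) (trans q (proper x y a))
    LW : ∀ z → z ∈ tabulate g₁ → W z ≡ true
    LW z p with ∈-tabulate⁻ {f = g₁} p
    ... | i , refl = gW (i ↑ˡ j)
    len₁ : suc (length (tabulate g₁)) ≤ λ₀
    len₁ = ≤-trans (s≤s (≤-trans (≤-reflexive (Listₚ.length-tabulate g₁)) (count≤n col))) (lenA N e)
      where
      lenA : ∀ N e → 1 + N ≤ 3 + 3 * N + 2 * e
      lenA N e = lin (2 + 2 * N + 2 * e) (z≤n {0}) (solve (N ∷ e ∷ []))
    hb∈ : ∀ z v → assign z ≡ just v → v ∈ tabulate g₁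
    hb∈ z v q with assign-just z v q
    ... | i , refl , _ = ∈-tabulate⁺ g₁ i
    avoid₀ : ∀ i z y′ → z ∈ verts (mixed g₂ x y i) → assign y′ ≢ just z
    avoid₀ zero z y′ p q = V-W s z (edge-verts px py p) (LW z (hb∈ y′ z q))
    avoid₀ (suc i) z y′ (here refl) q with assign-just y′ z q
    ... | k , q′ , _ = ↑ˡ≢↑ʳ k i (≡sym (g-inj _ _ q′))

  -- One of the two halves of W has a small total deficit, hence many common neighbours.
  no-extra-hub : w ≡ suc u → suc u ≡ count col + count col → count (λ x → not (col x)) ≡ count col → ⊥
  no-extra-hub eq ue cn = case (≤-total X Y)
    where
    j = count col
    ch = choose W (j + j) (≤-reflexive (trans (≡sym ue) (≡sym eq)))
    g = proj₁ ch
    gW = proj₁ (proj₂ ch)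
    g-inj = proj₂ (proj₂ ch)
    gL gR : Fin j → Fin n
    gL i = g (i ↑ˡ j)
    gR i = g (j ↑ʳ i)
    X = ∑ (λ i → deficit (gL i))
    Y = ∑ (λ i → deficit (gR i))
    gsum : X + Y ≤ Σdef
    gsum = ≤-trans (≤-reflexive (≡sym (∑-++ j (λ i → deficit (g i))))) (∑-inj g g-inj gW)
      where
      ∑-inj : ∀ {k} (g : Fin k → Fin n) → (∀ i i′ → g i ≡ g i′ → i ≡ i′) → (∀ i → W (g i) ≡ true) → ∑ (λ i → deficit (g i)) ≤ Σdef
      ∑-inj {k} g inj gW = begin
        ∑ (λ i → deficit (g i)) ≡⟨ ∑-cong (λ i → ≡sym (∑-== (g i) deficit)) ⟩
        ∑ (λ i → ∑ (λ x → b2n (g i == x) * deficit x)) ≡⟨ ∑-swap (λ i x → b2n (g i == x) * deficit x) ⟩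
        ∑ (λ x → ∑ (λ i → b2n (g i == x) * deficit x)) ≤⟨ ∑-mono row ⟩
        Σdef ∎
        where
        open ≤-Reasoning
        row : ∀ x → ∑ (λ i → b2n (g i == x) * deficit x) ≤ b2n (W x) * deficit x
        row x = ≤-trans (≤-reflexive (trans (∑-cong (λ i → *-comm (b2n (g i == x)) (deficit x))) (trans (∑-*ˡ (deficit x) (λ i → b2n (g i == x)))
            (trans (*-comm (deficit x) _) (cong (_* deficit x) (≡sym (count≡∑ (λ i → g i == x))))))))
          (*-monoˡ-≤ (deficit x) (hits x))
          where
          hits : ∀ x → count (λ i → g i == x) ≤ b2n (W x)
          hits x with find? (λ i → g i == x)
          ... | inj₂ none = ≤-trans (≤-reflexive (count-none (λ i → g i == x) none)) z≤n
          ... | inj₁ (i , q) = ≤-trans (count-≤1 (λ i → g i == x) (λ i i′ p p′ → inj i i′ (trans (==⁻ p) (≡sym (==⁻ p′)))))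
                (≤-reflexive (cong b2n (≡sym (trans (cong W (≡sym (==⁻ q))) (gW i)))))
    contradictory : ∀ x y → adj Q x y ≡ true → col x ≡ col y → ⊥
    contradictory x y a q = b≢not (col x) (trans q (proper x y a))
    -- Only the colour class on `a` needs a common neighbourhood, so `a` is the lighter half; `b`
    -- breaks the spokes to the other class.
    use : (a b : Fin j → Fin n) → (∀ i k → a i ≡ a k → i ≡ k) → (∀ i k → b i ≡ b k → i ≡ k) → (∀ i k → a i ≢ b k) → (∀ i → W (b i) ≡ true) →
      8 * ∑ (λ i → deficit (a i)) ≤ κ₂ * r + 2 * n → ⊥
    use a b a-inj b-inj a≢b bW small = noCopy (embedClass assign true (λ _ → tabulate a) j (λ i → hub (b i)) assign-inj
      (λ p q a e₁ e₂ → contradictory p q a (trans (assign-⊤ p e₁) (≡sym (assign-⊤ q e₂))))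
      (λ p q a e₁ e₂ → contradictory p q a (trans (assign-⊥ p e₁) (≡sym (assign-⊥ q e₂))))
      (≤-trans (count-mono (λ z q → cong not (assign-⊥ z (unhubbed⁺ assign z q)))) (≤-reflexive cn))
      (hubs-disjoint b b-inj) avoid₀ (λ _ → hb∈) tgood (λ i k → W-good k (b i) (bW i)))
      where
      open Assign col a a-inj
      hb∈ : ∀ z v → assign z ≡ just v → v ∈ tabulate a
      hb∈ z v q with assign-just z v q
      ... | i , refl , _ = ∈-tabulate⁺ a i
      avoid₀ : ∀ i z y′ → z ∈ verts (hub (b i)) → assign y′ ≢ just z
      avoid₀ i z y′ (here refl) q with assign-just y′ z q
      ... | k , q′ , _ = a≢b k i (≡sym q′)
      sum≤ : ∀ s {k} (f : Fin k → Fin n) → sumL (missing s) (tabulate f) ≤ ∑ (λ i → deficit (f i))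
      sum≤ s {zero}  f = ≤-reflexive (≡sym (∑-nil (λ i → deficit (f i))))
      sum≤ s {suc k} f = ≤-trans (+-mono-≤ (missing≤deficit s (f zero)) (sum≤ s (f ∘ suc))) (≤-reflexive (≡sym (∑-suc (λ i → deficit (f i)))))
      -- The lighter half misses about n/4 vertices in total, a side has about n/2.
      tgood : ∀ s → Good s (tabulate a)
      tgood s = mkGood s (tabulate a) (halfGood n (count (T s)) r _ κ₂ c (∑ (λ i → deficit (a i))) (3 * N + 2 * e) (sizeLower s)
        (≤-trans (lossList (T s) (tabulate a)) (+-monoʳ-≤ _ (sum≤ s a))) small (subst (λ z → 4 * (z * (κ₂ + c + 1) + c + 3) * r < n) (+-assoc 3 (3 * N) (2 * e)) big₄))
    bound : ∀ P R → P + R ≤ Σdef → P ≤ R → 8 * P ≤ κ₂ * r + 2 * n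
    bound P R h p = halfArith u n κ₂ r P R (≤-trans (+-monoʳ-≤ (2 * (u * n)) (*-monoʳ-≤ 4 h)) (subst (λ z → 2 * (u * n) + 4 * Σdef ≤ κ₂ * r + 2 * (z * n)) eq deficits)) p
    case : X ≤ Y ⊎ Y ≤ X → ⊥
    case (inj₁ p) = use gL gR (λ i k q → Finₚ.↑ˡ-injective j i k (g-inj _ _ q)) (λ i k q → Finₚ.↑ʳ-injective j i k (g-inj _ _ q))
      (λ i k q → ↑ˡ≢↑ʳ i k (g-inj _ _ q)) (λ i → gW (j ↑ʳ i)) (bound X Y gsum p)
    case (inj₂ p) = use gR gL (λ i k q → Finₚ.↑ʳ-injective j i k (g-inj _ _ q)) (λ i k q → Finₚ.↑ˡ-injective j i k (g-inj _ _ q))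
      (λ i k q → ↑ˡ≢↑ʳ k i (≡sym (g-inj _ _ q))) (λ i → gW (i ↑ˡ j)) (bound Y X (≤-trans (≤-reflexive (+-comm Y X)) gsum) p)

  -- Both degree sums contain the same terms outside W, so comparing them leaves an inequality
  -- between G[W] and `GU`; `special` is the extremal statement about G[W] alone, and its equality
  -- case propagates back to G.
  conclude : w ≡ u → (∀ s x y → Part s x ≡ true → Part s y ≡ true → adj G x y ≡ true → ⊥) → (GU : SimpleGraph u) →
    (∀ (pW : Fin u → Fin n) → (∀ i → W (pW i) ≡ true) → (∀ i j → pW i ≡ pW j → i ≡ j) →
      dsum (induce G pW) ≤ dsum GU × (dsum GU ≤ dsum (induce G pW) → induce G pW ≅ GU)) →
    dsum (join GU (turan2 m₀)) ≤ dsum G → G ≅ join GU (turan2 m₀)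
  conclude eq ind GU special big′ = ≅-trans {G = G} {join (induce G pW) (turan2 m₀)} {join GU (turan2 m₀)}
      (proj₂ arranged (add-rest (dsum G) (dsum GU) (dsum (induce G pW)) (2 * turanEdges m₀) (2 * (u * m₀)) D₀ (proj₁ sp)))
      (join-≅ˡ {G = induce G pW} {GU} (turan2 m₀) (proj₂ sp (cancel-rest (dsum G) (dsum GU) (dsum (induce G pW)) (2 * turanEdges m₀) (2 * (u * m₀)) D₀ (proj₁ arranged))))
    where
    cast : ∀ {a b} → a ≡ b → Fin a → Fin b
    cast refl i = i
    cast-inj : ∀ {a b} (e : a ≡ b) i j → cast e i ≡ cast e j → i ≡ j
    cast-inj refl i j q = q
    cast-onto : ∀ {a b} (e : a ≡ b) i → ∃ λ j → cast e j ≡ i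
    cast-onto refl i = i , refl
    pW : Fin u → Fin n
    pW i = nth W (cast (≡sym eq) i)
    pW-inj : ∀ i j → pW i ≡ pW j → i ≡ j
    pW-inj i j q = cast-inj (≡sym eq) i j (nth-inj W _ _ q)
    pW-onto : ∀ x → W x ≡ true → ∃ λ i → pW i ≡ x
    pW-onto x wx = let k , q = nth-surj W x wx ; i , q′ = cast-onto (≡sym eq) k in i , trans (cong (nth W) q′) q
    cover : ∀ x → W x ≡ true ⊎ Part true x ≡ true ⊎ Part false x ≡ true
    cover x with bool (Part true x) | bool (Part false x)
    ... | inj₁ p | _ = inj₂ (inj₁ p)
    ... | inj₂ p | inj₁ q = inj₂ (inj₂ q)
    ... | inj₂ p | inj₂ q = inj₁ (∧⁺ (cong not p) (cong not q))
    arranged = Arrange.arrange G W u+m pW pW-inj (λ i → nth-true W _) pW-onto (Part true) (Part false) cover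
      (λ x p q → V-W true x q p) (λ x p q → V-W false x q p) (V-disjoint true) (ind true) (ind false)
    sp = special pW (λ i → nth-true W _) pW-inj
    D₀ : dsum GU + 2 * turanEdges m₀ + 2 * (u * m₀) ≤ dsum G
    D₀ = ≤-trans (≤-reflexive (≡sym (trans (dsum-join GU (turan2 m₀)) (cong (λ z → dsum GU + z + 2 * (u * m₀)) (dsum-turan2 m₀))))) big′

  conclude-apex : u ≡ e → (GU : SimpleGraph u) →
    ((f : Fin u → Fin n) → (∀ i j → f i ≡ f j → i ≡ j) → ((∃ λ c → 2 ≤ deg Q c) → ∀ i j → adj (induce G f) i j ≡ false) →
      dsum (induce G f) ≤ dsum GU × (dsum GU ≤ dsum (induce G f) → induce G f ≅ GU)) →
    dsum (join GU (turan2 m₀)) ≤ dsum G → G ≅ join GU (turan2 m₀)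
  conclude-apex ue GU special = conclude w≡u (independent-apex w≡u ue) GU
      (λ f f∈ f-inj → special f f-inj (λ { (c , 2≤) i j → nonadj c 2≤ f f∈ i j }))
    where
    w≡u : w ≡ u
    w≡u = ≤-antisym (≤-trans w≤e (≤-reflexive (≡sym ue))) u≤w
    nonadj : ∀ c → 2 ≤ deg Q c → (f : Fin u → Fin n) → (∀ i → W (f i) ≡ true) → ∀ i j → adj G (f i) (f j) ≡ false
    nonadj c 2≤ f f∈ i j with bool (adj G (f i) (f j))
    ... | inj₂ q = q
    ... | inj₁ q = ⊥-elim (no-W-edge w≡u ue c 2≤ (f i) (f j) (f∈ i) (f∈ j) q)

  conclude-class : suc u ≡ e → (GU : SimpleGraph u) →
    ((f : Fin u → Fin n) → (∀ x → deg (induce G f) x ≤ 1) →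
      dsum (induce G f) ≤ dsum GU × (dsum GU ≤ dsum (induce G f) → induce G f ≅ GU)) →
    (∀ x → deg Q x ≡ 2) → (c₁ c₂ b : Fin N) → c₁ ≢ c₂ → adj Q b c₁ ≡ true → adj Q b c₂ ≡ true →
    u ≡ count col + count (λ x → not (col x)) ∸ 1 → 1 ≤ count (λ x → not (col x)) →
    suc u ≡ count col + count col → count (λ x → not (col x)) ≡ count col →
    dsum (join GU (turan2 m₀)) ≤ dsum G → G ≅ join GU (turan2 m₀)
  conclude-class ue GU special deg2 c₁ c₂ b c≢ b₁ b₂ ue′ 1≤c′ 2c c′≡c = conclude w≡u (independent-class w≡u ue′ 1≤c′) GU
      (λ f f∈ f-inj → special f (d≤1 f f∈ f-inj))
    where
    w≡u : w ≡ u
    -- Here e = u + 1, so w ≤ e leaves the one further value w = u + 1.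
    w≡u = [ (λ lt → ≤-antisym (ℕ.s≤s⁻¹ (≤-trans lt (≤-reflexive (≡sym ue)))) u≤w)
          , (λ eq → ⊥-elim (no-extra-hub (trans eq (≡sym ue)) 2c c′≡c)) ]′ (m≤n⇒m<n∨m≡n w≤e)
    d≤1 : (f : Fin u → Fin n) → (∀ i → W (f i) ≡ true) → (∀ i k → f i ≡ f k → i ≡ k) → ∀ x → deg (induce G f) x ≤ 1
    d≤1 f f∈ f-inj x = count-≤1 (adj (induce G f) x) λ y z p q → same y z p q (y Fin.≟ z)
      where
      same : ∀ y z → adj G (f x) (f y) ≡ true → adj G (f x) (f z) ≡ true → Dec (y ≡ z) → y ≡ z
      same y z p q (yes e) = e
      same y z p q (no ne) = ⊥-elim (no-W-cherry w≡u ue deg2 c₁ c₂ b c≢ b₁ b₂ (f x) (f y) (f z) (f∈ x) (f∈ y) (f∈ z) (λ e → ne (f-inj y z e)) p q)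

-- Trees, even cycles and their disjoint unions

record Colouring {n} (G : SimpleGraph n) : Set where
  constructor colouring
  field
    col    : Fin n → Bool
    proper : ∀ x y → adj G x y ≡ true → col y ≡ not (col x)

cycle-adj⁻ : ∀ k (i j : Fin k) → adj (cycleGraph k) i j ≡ true →
  (suc (toℕ i) ≡ toℕ j ⊎ suc (toℕ j) ≡ toℕ i) ⊎ (toℕ i ≡ 0 × suc (toℕ j) ≡ k ⊎ toℕ j ≡ 0 × suc (toℕ i) ≡ k)
cycle-adj⁻ k i j e = or₄ (proj₁ (∧⁻ {(a ∨ b) ∨ (c ∨ d)} e))
  where
  a = suc (toℕ i) ≡ᵇ toℕ j
  b = (toℕ i ≡ᵇ 0) ∧ (suc (toℕ j) ≡ᵇ k)
  c = suc (toℕ j) ≡ᵇ toℕ i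
  d = (toℕ j ≡ᵇ 0) ∧ (suc (toℕ i) ≡ᵇ k)
  or₄ : (a ∨ b) ∨ (c ∨ d) ≡ true → (suc (toℕ i) ≡ toℕ j ⊎ suc (toℕ j) ≡ toℕ i) ⊎ (toℕ i ≡ 0 × suc (toℕ j) ≡ k ⊎ toℕ j ≡ 0 × suc (toℕ i) ≡ k)
  or₄ e with bool a | bool b | bool c | bool d
  ... | inj₁ p | _ | _ | _ = inj₁ (inj₁ (≡ᵇ⁻ {suc (toℕ i)} p))
  ... | inj₂ _ | inj₁ p | _ | _ = let q , q′ = ∧⁻ {toℕ i ≡ᵇ 0} p in inj₂ (inj₁ (≡ᵇ⁻ {toℕ i} q , ≡ᵇ⁻ {suc (toℕ j)} q′))
  ... | inj₂ _ | inj₂ _ | inj₁ p | _ = inj₁ (inj₂ (≡ᵇ⁻ {suc (toℕ j)} p))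
  ... | inj₂ _ | inj₂ _ | inj₂ _ | inj₁ p = let q , q′ = ∧⁻ {toℕ j ≡ᵇ 0} p in inj₂ (inj₂ (≡ᵇ⁻ {toℕ j} q , ≡ᵇ⁻ {suc (toℕ i)} q′))
  ... | inj₂ p | inj₂ q | inj₂ r | inj₂ s = t≢f e (cong₂ _∨_ (cong₂ _∨_ p q) (cong₂ _∨_ r s))

cycle-adj⁺ : ∀ k (i j : Fin k) → i ≢ j → suc (toℕ i) ≡ toℕ j ⊎ toℕ i ≡ 0 × suc (toℕ j) ≡ k → adj (cycleGraph k) i j ≡ true
cycle-adj⁺ k i j ne h = ∧⁺ (or h) (cong not (==-f⁺ ne))
  where
  or : suc (toℕ i) ≡ toℕ j ⊎ toℕ i ≡ 0 × suc (toℕ j) ≡ k → ((suc (toℕ i) ≡ᵇ toℕ j) ∨ ((toℕ i ≡ᵇ 0) ∧ (suc (toℕ j) ≡ᵇ k))) ∨ ((suc (toℕ j) ≡ᵇ toℕ i) ∨ ((toℕ j ≡ᵇ 0) ∧ (suc (toℕ i) ≡ᵇ k))) ≡ true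
  or (inj₁ p) rewrite ≡ᵇ⁺ {suc (toℕ i)} p = refl
  or (inj₂ (p , q)) rewrite ≡ᵇ⁺ {toℕ i} p | ≡ᵇ⁺ {suc (toℕ j)} q | Boolₚ.∨-zeroʳ (suc (toℕ i) ≡ᵇ toℕ j) = refl

-- If all degrees were at least two, a path could be extended at its front until it closes a cycle.
lowVertex : ∀ {n} (G : SimpleGraph (suc n)) → Acyclic G → ∃ λ v → deg G v ≤ 1
lowVertex {n} G acyclic with find? (λ v → not (ge (deg G v) 2))
... | inj₁ (v , e) = v , small (not⁻ e)
  where
  small : ∀ {x} → ge x 2 ≡ false → x ≤ 1
  small {x} q with bool (x <ᵇ 2)
  ... | inj₁ p = ℕ.s≤s⁻¹ (<ᵇ⁻ {x} p)
  ... | inj₂ p = t≢f (cong not p) q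
... | inj₂ none = ⊥-elim (grow (suc n) 1 path₁ (s≤s (≤-trans (n≤1+n n) ≤-refl)) (s≤s z≤n) inj₁′ adj₁)
  where
  deg≥2 : ∀ v → 2 ≤ deg G v
  deg≥2 v with bool (ge (deg G v) 2)
  ... | inj₁ p = ge⁻ p
  ... | inj₂ p = t≢f (cong not p) (none v)
  close : ∀ p (path : ℕ → Fin (suc n)) → (∀ i j → i ≤ p → j ≤ p → path i ≡ path j → i ≡ j) → (∀ i → i < p → adj G (path i) (path (suc i)) ≡ true) →
    ∀ j → j ≤ p → adj G (path 0) (path j) ≡ true → path 1 ≢ path j → ⊥
  close p path inj ad zero j≤p e ne = t≢f e (irrefl G (path 0))
  close p path inj ad (suc zero) j≤p e ne = ne refl
  close p path inj ad (suc (suc j)) j≤p e ne = acyclic (3 + j) (s≤s (s≤s (s≤s z≤n))) (path ∘ toℕ ,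
      (λ {x} {y} q → Finₚ.toℕ-injective (inj (toℕ x) (toℕ y) (≤p x) (≤p y) q)) , λ x y q → edge′ x y (cycle-adj⁻ (3 + j) x y q))
    where
    ≤p : ∀ (x : Fin (3 + j)) → toℕ x ≤ p
    ≤p x = ≤-trans (ℕ.s≤s⁻¹ (Finₚ.toℕ<n x)) j≤p
    step : ∀ (x y : Fin (3 + j)) → suc (toℕ x) ≡ toℕ y → adj G (path (toℕ x)) (path (toℕ y)) ≡ true
    step x y q rewrite ≡sym q = ad (toℕ x) (≤-trans (≤-reflexive q) (≤p y))
    wrap : ∀ (x y : Fin (3 + j)) → toℕ x ≡ 0 → suc (toℕ y) ≡ 3 + j → adj G (path (toℕ x)) (path (toℕ y)) ≡ true
    wrap x y q q′ rewrite q | ℕₚ.suc-injective q′ = e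
    edge′ : ∀ x y → (suc (toℕ x) ≡ toℕ y ⊎ suc (toℕ y) ≡ toℕ x) ⊎ (toℕ x ≡ 0 × suc (toℕ y) ≡ 3 + j ⊎ toℕ y ≡ 0 × suc (toℕ x) ≡ 3 + j) →
      adj G (path (toℕ x)) (path (toℕ y)) ≡ true
    edge′ x y (inj₁ (inj₁ q)) = step x y q
    edge′ x y (inj₁ (inj₂ q)) = trans (sym G _ _) (step y x q)
    edge′ x y (inj₂ (inj₁ (q , q′))) = wrap x y q q′
    edge′ x y (inj₂ (inj₂ (q , q′))) = trans (sym G _ _) (wrap y x q q′)
  grow : ∀ fuel p (path : ℕ → Fin (suc n)) → suc n ≤ p + fuel → 1 ≤ p → (∀ i j → i ≤ p → j ≤ p → path i ≡ path j → i ≡ j) →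
    (∀ i → i < p → adj G (path i) (path (suc i)) ≡ true) → ⊥
  -- The sum p + fuel stays at least the number of vertices, so at this point the injective path has
  -- more vertices than G.
  grow zero p path le _ inj ad = <⇒≱ (s≤s (≤-trans le (≤-reflexive (+-identityʳ p)))) (Finₚ.injective⇒≤ {suc p} {f = path ∘ toℕ}
    (λ {x} {y} q → Finₚ.toℕ-injective (inj (toℕ x) (toℕ y) (ℕ.s≤s⁻¹ (Finₚ.toℕ<n x)) (ℕ.s≤s⁻¹ (Finₚ.toℕ<n y)) q)))
  grow (suc fuel) p path le 1≤p inj ad with other (adj G (path 0)) (path 1) (deg≥2 (path 0))
  ... | y , y~ , y≢ with find? {suc p} (λ j → path (toℕ j) == y)
  ...   | inj₁ (j , q) = close p path inj ad (toℕ j) (ℕ.s≤s⁻¹ (Finₚ.toℕ<n j)) (trans (cong (adj G (path 0)) (==⁻ q)) y~) (λ r → y≢ (trans (≡sym (==⁻ q)) (≡sym r)))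
  ...   | inj₂ new = grow fuel (suc p) path′ (≤-trans le (≤-reflexive (+-suc p fuel))) (s≤s z≤n) inj′ ad′
    where
    path′ : ℕ → Fin (suc n)
    path′ zero    = y
    path′ (suc i) = path i
    fresh : ∀ i → i ≤ p → path i ≢ y
    fresh i i≤p q = ==-f⁻ {x = path (toℕ (fromℕ< (s≤s i≤p)))} (new (fromℕ< (s≤s i≤p))) (trans (cong path (Finₚ.toℕ-fromℕ< (s≤s i≤p))) q)
    inj′ : ∀ i j → i ≤ suc p → j ≤ suc p → path′ i ≡ path′ j → i ≡ j
    inj′ zero zero _ _ _ = refl
    inj′ zero (suc j) _ (s≤s q) e = ⊥-elim (fresh j q (≡sym e))
    inj′ (suc i) zero (s≤s q) _ e = ⊥-elim (fresh i q e)
    inj′ (suc i) (suc j) (s≤s q) (s≤s q′) e = cong suc (inj i j q q′ e)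
    ad′ : ∀ i → i < suc p → adj G (path′ i) (path′ (suc i)) ≡ true
    ad′ zero _ = trans (sym G y (path 0)) y~
    ad′ (suc i) (s≤s q) = ad i q
  nb = find (adj G zero) (≤-trans (s≤s z≤n) (deg≥2 zero))
  path₁ : ℕ → Fin (suc n)
  path₁ zero    = zero
  path₁ (suc _) = proj₁ nb
  0≢nb : zero ≢ proj₁ nb
  0≢nb q = t≢f (trans (cong (adj G zero) q) (proj₂ nb)) (irrefl G zero)
  inj₁′ : ∀ i j → i ≤ 1 → j ≤ 1 → path₁ i ≡ path₁ j → i ≡ j
  inj₁′ zero zero _ _ _ = refl
  inj₁′ zero (suc j) _ _ e = ⊥-elim (0≢nb e)
  inj₁′ (suc i) zero _ _ e = ⊥-elim (0≢nb (≡sym e))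
  inj₁′ (suc zero) (suc zero) _ _ e = refl
  inj₁′ (suc (suc i)) _ (s≤s ()) _ _
  inj₁′ (suc zero) (suc (suc j)) _ (s≤s ()) _
  adj₁ : ∀ i → i < 1 → adj G (path₁ i) (path₁ (suc i)) ≡ true
  adj₁ zero _ = proj₂ nb
  adj₁ (suc i) (s≤s ())

acyclic-delete : ∀ {n} (G : SimpleGraph (suc n)) v → Acyclic G → Acyclic (induce G (punchIn v))
acyclic-delete G v ac k 3≤k (f , inj , hom) = ac k 3≤k (punchIn v ∘ f , (λ {x} {y} e → inj (Finₚ.punchIn-injective v _ _ e)) , hom)

extendColouring : ∀ {n} (G : SimpleGraph (suc n)) v → deg G v ≤ 1 → Colouring (induce G (punchIn v)) → Colouring G
extendColouring {n} G v d≤1 (colouring col proper) = colouring (λ x → colour x (v Fin.≟ x)) (λ x y e → ok x y (v Fin.≟ x) (v Fin.≟ y) e)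
  where
  own : (∃ λ y → adj G v y ≡ true) ⊎ (∀ y → adj G v y ≡ false) → Bool
  -- An isolated vertex may take any colour; otherwise the only neighbour decides.
  own (inj₂ _) = true
  own (inj₁ (y , e)) = not (col (punchOut {i = v} {y} (λ { refl → t≢f e (irrefl G v) })))
  colour : ∀ x → Dec (v ≡ x) → Bool
  colour x (yes _) = own (find? (adj G v))
  colour x (no ne) = col (punchOut ne)
  own-ok : ∀ b y (ne : v ≢ y) → adj G v y ≡ true → col (punchOut ne) ≡ not (own b)
  own-ok (inj₂ none) y ne e = t≢f e (none y)
  own-ok (inj₁ (z , e′)) y ne e with unique
    where
    unique : z ≡ y
    unique with z Fin.≟ y
    ... | yes q = q
    ... | no q = ⊥-elim (<⇒≱ {1} (≤-trans (≤-reflexive (≡sym (trans (∑-+ (λ w → b2n (z == w)) (λ w → b2n (y == w))) (cong₂ _+_ (trans (≡sym (count≡∑ (z ==_))) (count-== z)) (trans (≡sym (count≡∑ (y ==_))) (count-== y))))))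
          (≤-trans (∑-mono pt) (≤-reflexive (≡sym (count≡∑ (adj G v)))))) d≤1)
      where
      pt : ∀ w → b2n (z == w) + b2n (y == w) ≤ b2n (adj G v w)
      pt w with bool (z == w) | bool (y == w)
      ... | inj₁ a | inj₁ b = ⊥-elim (q (trans (==⁻ a) (≡sym (==⁻ b))))
      ... | inj₁ a | inj₂ b rewrite a | b | ≡sym (==⁻ a) | e′ = ≤-refl
      ... | inj₂ a | inj₁ b rewrite a | b | ≡sym (==⁻ b) | e = ≤-refl
      ... | inj₂ a | inj₂ b rewrite a | b = z≤n
  ... | refl = trans (cong col (Finₚ.punchOut-cong v refl)) (≡sym (Boolₚ.not-involutive _))
  ok : ∀ x y dx dy → adj G x y ≡ true → colour y dy ≡ not (colour x dx)
  ok x y (yes refl) (yes refl) e = t≢f e (irrefl G v)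
  ok x y (yes refl) (no ne) e = own-ok (find? (adj G v)) y ne e
  ok x y (no ne) (yes refl) e = ≡sym (trans (cong not (own-ok (find? (adj G v)) x ne (trans (sym G v x) e))) (Boolₚ.not-involutive _))
  ok x y (no nx) (no ny) e = proper (punchOut nx) (punchOut ny) (trans (cong₂ (adj G) (Finₚ.punchIn-punchOut nx) (Finₚ.punchIn-punchOut ny)) e)

-- Both facts come from deleting a vertex of degree at most one. The edge bound is guarded because
-- it fails for the empty graph.
forest : ∀ n (G : SimpleGraph n) → Acyclic G → Colouring G × (1 ≤ n → dsum G + 2 ≤ 2 * n)
forest zero G ac = colouring (λ ()) (λ ()) , λ ()
forest (suc n) G ac with lowVertex G ac
... | v , d≤1 with forest n (induce G (punchIn v)) (acyclic-delete G v ac)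
...   | c , le = extendColouring G v d≤1 c , λ _ → bound n G v d≤1 le
  where
  forestArith : ∀ D d n X → D + 2 ≤ 2 * (1 + n) → d ≤ 1 → X ≤ D + 2 * d → X + 2 ≤ 2 * (2 + n)
  forestArith D d n X h1 h2 h3 = lin (0) (h1 ⊕ 2 ⊛ h2 ⊕ h3) (solve (D ∷ d ∷ n ∷ X ∷ []))
  bound : ∀ n (G : SimpleGraph (suc n)) v → deg G v ≤ 1 → (1 ≤ n → dsum (induce G (punchIn v)) + 2 ≤ 2 * n) → dsum G + 2 ≤ 2 * suc n
  bound (suc n) G v d≤1 le = forestArith (dsum (induce G (punchIn v))) (deg G v) n (dsum G) (le (s≤s z≤n)) d≤1 (≤-reflexive (dsum-delete G v))
  bound zero G v d≤1 le = ≤-reflexive (cong (_+ 2) (∑-zero (λ { zero → count-none (adj G zero) (λ { zero → irrefl G zero }) })))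

connected-deg : ∀ {n} (G : SimpleGraph n) → 2 ≤ n → Connected G → ∀ x → 1 ≤ deg G x
connected-deg {n} G 2≤n con x with other {n} (λ _ → true) x (≤-trans 2≤n (≤-reflexive (≡sym (trans (count≡∑ {n} (λ _ → true)) (trans (∑-const n 1) (*-identityʳ n))))))
... | y , _ , y≢x = first (con x y)
  where
  first : Star (λ i j → adj G i j ≡ true) x y → 1 ≤ deg G x
  first ε = ⊥-elim (y≢x refl)
  first (_◅_ {j = z} e _) = count-pos (adj G x) z e

-- If all degrees were at most one, walks from `zero` would never leave `zero` and its neighbour, so
-- a third vertex could not be reached.
connected-branch : ∀ {n} (G : SimpleGraph n) → 3 ≤ n → Connected G → ∃ λ x → 2 ≤ deg G x
connected-branch {suc n} G 3≤n con with find? (λ x → ge (deg G x) 2)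
... | inj₁ (x , e) = x , ge⁻ e
... | inj₂ none = ⊥-elim (far (stay (con zero z) (inj₁ refl)))
  where
  d≤1 : ∀ x → deg G x ≤ 1
  d≤1 x with bool (deg G x <ᵇ 2)
  ... | inj₁ p = ℕ.s≤s⁻¹ (<ᵇ⁻ {deg G x} p)
  ... | inj₂ p = t≢f (cong not p) (none x)
  nb = find (adj G zero) (connected-deg G (≤-trans (n≤1+n 2) 3≤n) con zero)
  y = proj₁ nb
  L = zero ∷ y ∷ []
  out : ∃ λ z → not (memb L z) ≡ true
  out = find (λ z → not (memb L z)) (+-cancelˡ-≤ 2 _ _ (≤-trans 3≤n (≤-trans (≤-reflexive (≡sym (count-not (memb L)))) (+-monoˡ-≤ _ (count-memb L)))))
  z = proj₁ out
  stay : ∀ {u v} → Star (λ i j → adj G i j ≡ true) u v → u ≡ zero ⊎ u ≡ y → v ≡ zero ⊎ v ≡ y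
  stay ε h = h
  stay (e ◅ p) (inj₁ refl) = stay p (inj₂ (deg≤1 G d≤1 e (proj₂ nb)))
  stay (e ◅ p) (inj₂ refl) = stay p (inj₁ (deg≤1 G d≤1 e (trans (sym G y zero) (proj₂ nb))))
  far : z ≡ zero ⊎ z ≡ y → ⊥
  far (inj₁ q) = t≢f (memb⁺ {L = L} {z} (here q)) (not⁻ (proj₂ out))
  far (inj₂ q) = t≢f (memb⁺ {L = L} {z} (there (here q))) (not⁻ (proj₂ out))

tree-cases : ∀ {n} (G : SimpleGraph n) → IsTree G → IsSingleEdge G ⊎ ∃ λ x → 2 ≤ deg G x
tree-cases {suc (suc zero)} G (_ , con , _) = inj₁ (≅-pointwise {G = G} {complete 2} eq)
  where
  e01 : adj G zero (suc zero) ≡ true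
  e01 with find (adj G zero) (connected-deg G ≤-refl con zero)
  ... | zero , e = t≢f e (irrefl G zero)
  ... | suc zero , e = e
  eq : ∀ i j → adj G i j ≡ adj (complete 2) i j
  eq zero zero = irrefl G zero
  eq zero (suc zero) = e01
  eq (suc zero) zero = trans (sym G _ _) e01
  eq (suc zero) (suc zero) = irrefl G (suc zero)
tree-cases {suc (suc (suc n))} G (_ , con , _) = inj₂ (connected-branch G (s≤s (s≤s (s≤s z≤n))) con)
tree-cases {suc zero} G (s≤s () , _)
tree-cases {zero} G (() , _)

edge-deg : ∀ {n} (G : SimpleGraph n) → IsSingleEdge G → ∀ x → deg G x ≡ 1
edge-deg G iso x = trans (deg-iso G (complete 2) iso x) (lem (Inverse.to (proj₁ iso) x))
  where
  lem : ∀ y → deg (complete 2) y ≡ 1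
  lem zero       = trans (count-suc (adj (complete 2) zero)) (trans (count-suc (adj (complete 2) zero ∘ suc)) (cong suc (count-none {0} _ (λ ()))))
  lem (suc zero) = trans (count-suc (adj (complete 2) (suc zero))) (cong suc (trans (count-suc (adj (complete 2) (suc zero) ∘ suc)) (count-none {0} _ (λ ()))))

cycle-deg : ∀ t → 2 ≤ t → ∀ x → deg (cycleGraph (2 * t)) x ≡ 2
cycle-deg t 2≤t x = count-two (adj C x) (proj₁ nx) (proj₁ pv) distinct (adj-nx (proj₂ nx)) (trans (sym C x (proj₁ pv)) (adj-pv (proj₂ pv))) only
  where
  k = 2 * t
  C = cycleGraph k
  4≤k : 4 ≤ k
  4≤k = *-monoʳ-≤ 2 2≤t
  Next : Fin k → Fin k → Set
  Next x y = suc (toℕ x) ≡ toℕ y ⊎ (suc (toℕ x) ≡ k × toℕ y ≡ 0)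
  next : ∀ x → ∃ (Next x)
  next x with suc (toℕ x) <? k
  ... | yes p = fromℕ< p , inj₁ (≡sym (Finₚ.toℕ-fromℕ< p))
  ... | no ¬p = fromℕ< 0<k , inj₂ (≤-antisym (Finₚ.toℕ<n x) (≮⇒≥ ¬p) , Finₚ.toℕ-fromℕ< 0<k)
    where 0<k = ≤-trans (s≤s z≤n) 4≤k
  prev : ∀ x → ∃ λ y → Next y x
  prev x = pr (toℕ x) refl
    where
    pr : ∀ i → toℕ x ≡ i → ∃ λ y → Next y x
    pr zero e = fromℕ< {k ∸ 1} lt , inj₂ (trans (cong suc (Finₚ.toℕ-fromℕ< lt)) (m+[n∸m]≡n (≤-trans (s≤s z≤n) 4≤k)) , e)
      where lt = ≤-reflexive (m+[n∸m]≡n {1} (≤-trans (s≤s z≤n) 4≤k))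
    pr (suc i) e = fromℕ< {i} lt , inj₁ (trans (cong suc (Finₚ.toℕ-fromℕ< lt)) (≡sym e))
      where lt = ≤-trans (n≤1+n _) (≤-trans (≤-reflexive (cong suc (≡sym e))) (Finₚ.toℕ<n x))
  nx = next x
  pv = prev x
  irr : ∀ {x} → Next x x → ⊥
  irr (inj₁ q) = 1+n≢n q
  irr {x} (inj₂ (q , q′)) = <⇒≱ (≤-trans (s≤s (s≤s z≤n)) 4≤k) (≤-reflexive (≡sym (trans (cong suc (≡sym q′)) q)))
  adj-nx : ∀ {x y} → Next x y → adj C x y ≡ true
  adj-nx {x} {y} h = go h (λ { refl → irr h })
    where
    go : Next x y → x ≢ y → adj C x y ≡ true
    go (inj₁ q) ne = cycle-adj⁺ k x y ne (inj₁ q)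
    go (inj₂ (q , q′)) ne = trans (sym C x y) (cycle-adj⁺ k y x (λ r → ne (≡sym r)) (inj₂ (q′ , q)))
  adj-pv : ∀ {y} → Next y x → adj C y x ≡ true
  adj-pv = adj-nx
  unique-next : ∀ {x y z} → Next x y → Next x z → y ≡ z
  unique-next (inj₁ p) (inj₁ q) = Finₚ.toℕ-injective (trans (≡sym p) q)
  unique-next {z = z} (inj₁ p) (inj₂ (q , _)) = ⊥-elim (<⇒≱ (Finₚ.toℕ<n _) (≤-reflexive (trans (≡sym q) p)))
  unique-next (inj₂ (q , _)) (inj₁ p) = ⊥-elim (<⇒≱ (Finₚ.toℕ<n _) (≤-reflexive (trans (≡sym q) p)))
  unique-next (inj₂ (_ , p)) (inj₂ (_ , q)) = Finₚ.toℕ-injective (trans p (≡sym q))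
  unique-prev : ∀ {x y z} → Next y x → Next z x → y ≡ z
  unique-prev (inj₁ p) (inj₁ q) = Finₚ.toℕ-injective (ℕₚ.suc-injective (trans p (≡sym q)))
  unique-prev (inj₁ p) (inj₂ (_ , q)) = ⊥-elim (1+n≢0 (trans p q))
  unique-prev (inj₂ (_ , q)) (inj₁ p) = ⊥-elim (1+n≢0 (trans p q))
  unique-prev (inj₂ (p , _)) (inj₂ (q , _)) = Finₚ.toℕ-injective (ℕₚ.suc-injective (trans p (≡sym q)))
  -- Successor and predecessor coincide only in cycles of length at most two.
  two-step : ∀ {x y} → Next x y → Next y x → ⊥
  two-step (inj₁ p) (inj₁ q) = <⇒≱ (≤-reflexive p) (≤-trans (n≤1+n _) (≤-reflexive q))
  two-step (inj₁ p) (inj₂ (q , q′)) = <⇒≱ (≤-trans (n≤1+n 3) 4≤k) (≤-reflexive (≡sym (trans (cong suc (trans (cong suc (≡sym q′)) p)) q)))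
  two-step (inj₂ (q , q′)) (inj₁ p) = <⇒≱ (≤-trans (n≤1+n 3) 4≤k) (≤-reflexive (≡sym (trans (cong suc (trans (cong suc (≡sym q′)) p)) q)))
  two-step (inj₂ (q , q′)) (inj₂ (p , p′)) = <⇒≱ (≤-trans (s≤s (s≤s z≤n)) 4≤k) (≤-reflexive (≡sym (trans (cong suc (≡sym q′)) p)))
  distinct : proj₁ nx ≢ proj₁ pv
  distinct e = two-step (proj₂ nx) (subst (λ z → Next z x) (≡sym e) (proj₂ pv))
  only : ∀ z → adj C x z ≡ true → z ≡ proj₁ nx ⊎ z ≡ proj₁ pv
  only z e with cycle-adj⁻ k x z e
  ... | inj₁ (inj₁ q) = inj₁ (unique-next (inj₁ q) (proj₂ nx))
  ... | inj₁ (inj₂ q) = inj₂ (unique-prev (inj₁ q) (proj₂ pv))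
  ... | inj₂ (inj₁ (q , q′)) = inj₂ (unique-prev (inj₂ (q′ , q)) (proj₂ pv))
  ... | inj₂ (inj₂ (q , q′)) = inj₁ (unique-next (inj₂ (q′ , q)) (proj₂ nx))

cycle-colouring : ∀ t → Colouring (cycleGraph (2 * t))
cycle-colouring t = colouring (λ x → ev (toℕ x)) λ x y e → lem x y (cycle-adj⁻ (2 * t) x y e)
  where
  wrap : ∀ {i j} → i ≡ 0 → suc j ≡ 2 * t → ev j ≡ not (ev i)
  wrap {j = j} refl q = not-f (trans (cong ev q) (ev-2* t))
    where
    not-f : ∀ {b} → not b ≡ true → b ≡ false
    not-f {false} _ = refl
  lem : ∀ x y → _ → ev (toℕ y) ≡ not (ev (toℕ x))
  lem x y (inj₁ (inj₁ q)) = cong ev (≡sym q)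
  lem x y (inj₁ (inj₂ q)) = trans (≡sym (Boolₚ.not-involutive _)) (cong not (cong ev q))
  lem x y (inj₂ (inj₁ (q , q′))) = wrap q q′
  lem x y (inj₂ (inj₂ (q , q′))) = trans (≡sym (Boolₚ.not-involutive _)) (cong not (≡sym (wrap q q′)))

iso-colouring : ∀ {a b} {G : SimpleGraph a} {H : SimpleGraph b} → G ≅ H → Colouring H → Colouring G
iso-colouring (σ , e) (colouring col proper) = colouring (col ∘ Inverse.to σ) (λ x y a → proper _ _ (trans (≡sym (e x y)) a))

Comp : Set
Comp = Σ ℕ SimpleGraph

comp-colouring : (c : Comp) → IsTree (proj₂ c) ⊎ IsEvenCycle (proj₂ c) → Colouring (proj₂ c)
comp-colouring (n , G) (inj₁ (_ , _ , ac)) = proj₁ (forest n G ac)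
comp-colouring (n , G) (inj₂ (t , _ , iso)) = iso-colouring {G = G} {cycleGraph (2 * t)} iso (cycle-colouring t)

evenCycle-deg : ∀ {n} (G : SimpleGraph n) → IsEvenCycle G → ∀ x → deg G x ≡ 2
evenCycle-deg G (t , 2≤t , iso) x = trans (deg-iso G (cycleGraph (2 * t)) iso x) (cycle-deg t 2≤t _)

comp-deg : (c : Comp) → IsTree (proj₂ c) ⊎ IsEvenCycle (proj₂ c) → ∀ x → 1 ≤ deg (proj₂ c) x
comp-deg (n , G) (inj₁ (2≤n , con , _)) x = connected-deg G 2≤n con x
comp-deg (n , G) (inj₂ C) x = ≤-trans (s≤s z≤n) (≤-reflexive (≡sym (evenCycle-deg G C x)))

comp-size : (c : Comp) → IsTree (proj₂ c) ⊎ IsEvenCycle (proj₂ c) → 1 ≤ proj₁ c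
comp-size (n , G) (inj₁ (2≤n , _)) = ≤-trans (s≤s z≤n) 2≤n
comp-size (n , G) (inj₂ (t , 2≤t , iso)) = ≤-trans (≤-trans (s≤s z≤n) 2≤t) (≤-trans (m≤m+n t (t + 0)) (≤-reflexive (≡sym (↔⇒≡ (proj₁ iso)))))

comp-dsum : (c : Comp) → IsTree (proj₂ c) ⊎ IsEvenCycle (proj₂ c) → dsum (proj₂ c) ≤ 2 * proj₁ c
comp-dsum (n , G) (inj₁ (2≤n , _ , ac)) = ≤-trans (m≤m+n _ 2) (proj₂ (forest n G ac) (≤-trans (s≤s z≤n) 2≤n))
comp-dsum (n , G) (inj₂ C) = ≤-reflexive (trans (∑-cong (evenCycle-deg G C)) (trans (∑-const n 2) (*-comm n 2)))

union-colouring : ∀ {a b} (G : SimpleGraph a) (H : SimpleGraph b) → Colouring G → Colouring H → Colouring (union G H)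
union-colouring {a} {b} G H (colouring c p) (colouring c′ p′) = colouring (λ x → [ c , c′ ]′ (splitAt a x)) (λ x y e → lem (↑-cases a x) (↑-cases a y) e)
  where
  l : ∀ i → [ c , c′ ]′ (splitAt a (i ↑ˡ b)) ≡ c i
  l i rewrite Finₚ.splitAt-↑ˡ a i b = refl
  r : ∀ j → [ c , c′ ]′ (splitAt a (a ↑ʳ j)) ≡ c′ j
  r j rewrite Finₚ.splitAt-↑ʳ a b j = refl
  lem : ∀ {x y} → (∃ λ i → x ≡ i ↑ˡ b) ⊎ (∃ λ i → x ≡ a ↑ʳ i) → (∃ λ i → y ≡ i ↑ˡ b) ⊎ (∃ λ i → y ≡ a ↑ʳ i) → adj (union G H) x y ≡ true →
    [ c , c′ ]′ (splitAt a y) ≡ not ([ c , c′ ]′ (splitAt a x))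
  lem (inj₁ (i , refl)) (inj₁ (j , refl)) e = trans (l j) (trans (p i j (trans (≡sym (union-ll G H i j)) e)) (cong not (≡sym (l i))))
  lem (inj₂ (i , refl)) (inj₂ (j , refl)) e = trans (r j) (trans (p′ i j (trans (≡sym (union-rr G H i j)) e)) (cong not (≡sym (r i))))
  lem (inj₁ (i , refl)) (inj₂ (j , refl)) e = t≢f e (union-lr G H i j)
  lem (inj₂ (i , refl)) (inj₁ (j , refl)) e = t≢f e (trans (sym (union G H) (a ↑ʳ i) (j ↑ˡ b)) (union-lr G H j i))

unionList-colouring : ∀ {cs : List Comp} → All (λ c → Colouring (proj₂ c)) cs → Colouring (proj₂ (unionList cs))
unionList-colouring All.[] = colouring (λ ()) (λ ())
unionList-colouring {(a , G) ∷ cs} (p All.∷ ps) = union-colouring G (proj₂ (unionList cs)) p (unionList-colouring ps)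

unionList-deg : (Φ : ℕ → Set) {cs : List Comp} → All (λ c → ∀ x → Φ (deg (proj₂ c) x)) cs → ∀ x → Φ (deg (proj₂ (unionList cs)) x)
unionList-deg Φ {(a , G) ∷ cs} (p All.∷ ps) x with ↑-cases a x
... | inj₁ (i , refl) = subst Φ (≡sym (deg-union-l G (proj₂ (unionList cs)) i)) (p i)
... | inj₂ (j , refl) = subst Φ (≡sym (deg-union-r G (proj₂ (unionList cs)) j)) (unionList-deg Φ ps j)

unionList-dsum : ∀ {cs : List Comp} → All (λ c → dsum (proj₂ c) ≤ 2 * proj₁ c) cs → dsum (proj₂ (unionList cs)) ≤ 2 * proj₁ (unionList cs)
unionList-dsum All.[] = ≤-reflexive (dsum-empty 0)
unionList-dsum {(a , G) ∷ cs} (p All.∷ ps) = ≤-trans (≤-reflexive (dsum-union G (proj₂ (unionList cs))))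
  (≤-trans (+-mono-≤ p (unionList-dsum ps)) (≤-reflexive (≡sym (*-distribˡ-+ 2 a _))))

tree-left : ∀ D E a b → D + 2 ≤ 2 * a → E ≤ 2 * b → D + E + 2 ≤ 2 * (a + b)
tree-left D E a b h1 h2 = lin (0) (h1 ⊕ h2) (solve (D ∷ E ∷ a ∷ b ∷ []))
tree-right : ∀ D E a b → D ≤ 2 * a → E + 2 ≤ 2 * b → D + E + 2 ≤ 2 * (a + b)
tree-right D E a b h1 h2 = lin (0) (h1 ⊕ h2) (solve (D ∷ E ∷ a ∷ b ∷ []))

-- No component has more edges than vertices and a tree has one fewer, so e(Q) < |Q|; freeness needs
-- this, as the spokes must outnumber the e(Q) vertices of U.
unionList-dsum-tree : ∀ {cs : List Comp} → All (λ c → dsum (proj₂ c) ≤ 2 * proj₁ c) cs → Any (λ c → dsum (proj₂ c) + 2 ≤ 2 * proj₁ c) cs →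
  dsum (proj₂ (unionList cs)) + 2 ≤ 2 * proj₁ (unionList cs)
unionList-dsum-tree {(a , G) ∷ cs} (p All.∷ ps) (here q) = ≤-trans (≤-reflexive (cong (_+ 2) (dsum-union G (proj₂ (unionList cs)))))
  (tree-left (dsum G) (dsum (proj₂ (unionList cs))) a _ q (unionList-dsum ps))
unionList-dsum-tree {(a , G) ∷ cs} (p All.∷ ps) (there q) = ≤-trans (≤-reflexive (cong (_+ 2) (dsum-union G (proj₂ (unionList cs)))))
  (tree-right (dsum G) (dsum (proj₂ (unionList cs))) a _ p (unionList-dsum-tree ps q))

unionList-branch : ∀ {cs : List Comp} → Any (λ c → ∃ λ x → 2 ≤ deg (proj₂ c) x) cs → ∃ λ x → 2 ≤ deg (proj₂ (unionList cs)) x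
unionList-branch {(a , G) ∷ cs} (here (x , q)) = _ , ≤-trans q (≤-reflexive (≡sym (deg-union-l G (proj₂ (unionList cs)) x)))
unionList-branch {(a , G) ∷ cs} (there p) = let x , q = unionList-branch p in _ , ≤-trans q (≤-reflexive (≡sym (deg-union-r G (proj₂ (unionList cs)) x)))

someTree : ∀ {cs : List Comp} → All (λ c → IsTree (proj₂ c) ⊎ IsEvenCycle (proj₂ c)) cs → ¬ All (λ c → IsEvenCycle (proj₂ c)) cs →
  Any (λ c → dsum (proj₂ c) + 2 ≤ 2 * proj₁ c) cs
someTree All.[] ne = ⊥-elim (ne All.[])
someTree {(n , G) ∷ cs} (inj₁ (2≤n , _ , ac) All.∷ ps) ne = here (proj₂ (forest n G ac) (≤-trans (s≤s z≤n) 2≤n))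
someTree (inj₂ C All.∷ ps) ne = there (someTree ps (λ q → ne (C All.∷ q)))

someBranch : ∀ {cs : List Comp} → All (λ c → IsTree (proj₂ c) ⊎ IsEvenCycle (proj₂ c)) cs → ¬ All (λ c → IsSingleEdge (proj₂ c)) cs →
  Any (λ c → ∃ λ x → 2 ≤ deg (proj₂ c) x) cs
someBranch All.[] ne = ⊥-elim (ne All.[])
someBranch {(n , G) ∷ cs} (inj₂ C All.∷ ps) ne = here (fromℕ< (comp-size (n , G) (inj₂ C)) , ≤-reflexive (≡sym (evenCycle-deg G C _)))
someBranch {(n , G) ∷ cs} (inj₁ t All.∷ ps) ne with tree-cases G t
... | inj₂ b = here b
... | inj₁ e = there (someBranch ps (λ q → ne (e All.∷ q)))

-- Enumerating related pairs

opaque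
  unfolding ∑

  Σnth : ∀ {n} (f : Fin n → ℕ) (i : Fin (∑ f)) → ∃ λ x → ∃ λ j → Σidx f x j ≡ i
  Σnth {suc n} f i with splitAt (f zero) i in e
  ... | inj₁ j = zero , j , Finₚ.splitAt⁻¹-↑ˡ e
  ... | inj₂ k with Σnth (f ∘ suc) k
  ...   | x , j , q = suc x , j , trans (cong (f zero ↑ʳ_) q) (Finₚ.splitAt⁻¹-↑ʳ e)

pairNth : ∀ {m n} (R : Fin m → Fin n → Bool) → Fin (pairs R) → Fin m × Fin n
pairNth R i = let x , j , _ = Σnth (λ x → count (R x)) i in x , nth (R x) j

pairNth-true : ∀ {m n} (R : Fin m → Fin n → Bool) i → R (proj₁ (pairNth R i)) (proj₂ (pairNth R i)) ≡ true
pairNth-true R i = nth-true (R _) _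

pairNth-inj : ∀ {m n} (R : Fin m → Fin n → Bool) i j → pairNth R i ≡ pairNth R j → i ≡ j
pairNth-inj R i j e = lem (Σnth f i) (Σnth f j) e
  where
  f = λ x → count (R x)
  lem : (a : ∃ λ x → ∃ λ k → Σidx f x k ≡ i) (b : ∃ λ x → ∃ λ k → Σidx f x k ≡ j) →
    _≡_ {A = _ × _} (proj₁ a , nth (R (proj₁ a)) (proj₁ (proj₂ a))) (proj₁ b , nth (R (proj₁ b)) (proj₁ (proj₂ b))) → i ≡ j
  lem (x , k , p) (y , l , q) e with cong proj₁ e
  ... | refl with nth-inj (R x) k l (cong proj₂ e)
  ...   | refl = trans (≡sym p) q

-- The extremal graphs contain no copy: every odd cycle of the ballooning meets the joined part.

module Freeness {N : ℕ} (Q : SimpleGraph N) (ℓ : Fin (1 + N) → Fin (1 + N) → ℕ) (valid : ValidLengths (cone Q) ℓ)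
  {u : ℕ} (GU : SimpleGraph u) (m : ℕ) (δ : ℕ) (u<N : u < N) (u+δ : u + δ ≤ edges Q)
  (few : ∀ (i₀ : Fin u) (S : Fin N → Bool) (g : ∀ x → S x ≡ true → Fin u) → (∀ x s → adj GU i₀ (g x s) ≡ true) →
    (∀ x s y s′ → g x s ≡ g y s′ → x ≡ y) → ∑ (λ x → b2n (S x) * deg Q x) ≤ count S + δ)
  (f : BV (cone Q) ℓ → Fin (u + m)) (f-inj : Injective _≡_ _≡_ f)
  (f-adj : ∀ x y → BAdj (cone Q) ℓ x y → adj (join GU (turan2 m)) (f x) (f y) ≡ true) where

  private
    F = cone Q
    J = join GU (turan2 m)
    X = BV F ℓ

    inU : X → Bool
    inU x = [ (λ _ → true) , (λ _ → false) ]′ (splitAt u (f x))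

    idxU : ∀ x → inU x ≡ true → ∃ λ i → f x ≡ i ↑ˡ m
    idxU x e with splitAt u (f x) in q
    ... | inj₁ i = i , ≡sym (Finₚ.splitAt⁻¹-↑ˡ q)

    sd : X → Bool
    sd x = [ (λ _ → true) , side< (m / 2) ]′ (splitAt u (f x))

    outU : ∀ x → inU x ≡ false → ∃ λ j → f x ≡ u ↑ʳ j × sd x ≡ side< (m / 2) j
    outU x e with splitAt u (f x) in q
    ... | inj₂ j = j , ≡sym (Finₚ.splitAt⁻¹-↑ʳ q) , refl

    flip : ∀ x y → inU x ≡ false → inU y ≡ false → BAdj F ℓ x y → sd y ≡ not (sd x)
    flip x y ex ey a with outU x ex | outU y ey
    ... | i , fx , sx | j , fy , sy = trans sy (trans
      (lem (side< (m / 2) i) (side< (m / 2) j) (trans (≡sym (turan2-adj m i j)) (trans (≡sym (join-rr GU (turan2 m) i j)) (trans (≡sym (cong₂ (adj J) fx fy)) (f-adj x y a)))))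
      (cong not (≡sym sx)))
      where
      lem : ∀ a b → (a ∧ not b) ∨ (b ∧ not a) ≡ true → b ≡ not a
      lem true false _ = refl
      lem false true _ = refl

    -- Otherwise the cycle lies in the bipartite part: an odd number of inner vertices puts a and b
    -- on the same side, while the edge ab puts them on opposite sides.
    hit : ∀ a b (e : IsEdge F a b) → inU (inj₁ a) ≡ false → inU (inj₁ b) ≡ false → ∃ λ i → inU (inj₂ (a , b , e , i)) ≡ true
    hit a b e ea eb with find? (λ i → inU (inj₂ (a , b , e , i)))
    ... | inj₁ r = r
    ... | inj₂ none with inner e
      where
      inner : IsEdge F a b → ∃ λ j → ℓ a b ∸ 2 ≡ suc (2 * j)
      inner e with valid a b e
      ... | 5≤ , s , eq = lem s (ℓ a b) 5≤ eq
        where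
        lem : ∀ s l → 5 ≤ l → l ≡ suc (2 * s) → ∃ λ j → l ∸ 2 ≡ suc (2 * j)
        lem 0 _ (s≤s ()) refl
        lem (suc j) _ _ refl = j , cong (_∸ 1) (+-suc (suc j) (j + 0))
    ...   | k , L≡ = ⊥-elim (b≢not (sd (inj₁ a)) (trans (≡sym end) (flip (inj₁ a) (inj₁ b) ea eb (proj₂ e))))
      where
      w : ∀ i → i < ℓ a b ∸ 2 → X
      w i lt = inj₂ (a , b , e , fromℕ< lt)
      along : ∀ i lt → sd (w i lt) ≡ (if ev i then not (sd (inj₁ a)) else sd (inj₁ a))
      along zero lt = flip (inj₁ a) (w zero lt) ea (none _) (inj₁ (refl , Finₚ.toℕ-fromℕ< lt))
      along (suc i) lt = trans (flip (w i lt′) (w (suc i) lt) (none _) (none _) (refl , refl , inj₁ (trans (cong suc (Finₚ.toℕ-fromℕ< lt′)) (≡sym (Finₚ.toℕ-fromℕ< lt)))))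
          (trans (cong not (along i lt′)) (lem (ev i) (sd (inj₁ a))))
        where
        lt′ = ≤-trans (n≤1+n _) lt
        lem : ∀ c s → not (if c then not s else s) ≡ (if not c then not s else s)
        lem true s = Boolₚ.not-involutive s
        lem false s = refl
      last : 2 * k < ℓ a b ∸ 2
      last = ≤-reflexive (≡sym L≡)
      end : sd (inj₁ b) ≡ sd (inj₁ a)
      end = trans (flip (w (2 * k) last) (inj₁ b) (none _) eb (inj₂ (refl , trans (cong suc (Finₚ.toℕ-fromℕ< last)) (≡sym L≡))))
        (trans (cong not (trans (along (2 * k) last) (cong (λ c → if c then not (sd (inj₁ a)) else sd (inj₁ a)) (ev-2* k)))) (Boolₚ.not-involutive _))

    inject : ∀ M (v : Fin M → X) → (∀ i → inU (v i) ≡ true) → (∀ i j → v i ≡ v j → i ≡ j) → M ≤ u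
    inject M v vU v-inj = Finₚ.injective⇒≤ {f = λ i → proj₁ (idxU (v i) (vU i))}
      (λ {i} {j} e → v-inj i j (f-inj (trans (proj₂ (idxU (v i) (vU i))) (trans (cong (_↑ˡ m) e) (≡sym (proj₂ (idxU (v j) (vU j))))))))

    spoke : ∀ x → IsEdge F zero (suc x)
    spoke x = s≤s z≤n , cone-0s Q x

    apex∉ : inU (inj₁ zero) ≡ false → ⊥
    apex∉ e0 = <⇒≱ u<N (inject N v vU v-inj)
      where
      pick : ∀ x → (inU (inj₁ (suc x)) ≡ true) ⊎ (inU (inj₁ (suc x)) ≡ false) → Σ X λ y → inU y ≡ true × (y ≡ inj₁ (suc x) ⊎ ∃ λ i → y ≡ inj₂ (zero , suc x , spoke x , i))
      pick x (inj₁ e) = inj₁ (suc x) , e , inj₁ refl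
      pick x (inj₂ e) = let i , q = hit zero (suc x) (spoke x) e0 e in _ , q , inj₂ (i , refl)
      v : Fin N → X
      v x = proj₁ (pick x (bool _))
      vU : ∀ x → inU (v x) ≡ true
      vU x = proj₁ (proj₂ (pick x (bool _)))
      v-inj : ∀ x y → v x ≡ v y → x ≡ y
      v-inj x y e = lem (proj₂ (proj₂ (pick x (bool _)))) (proj₂ (proj₂ (pick y (bool _)))) e
        where
        lem : ∀ {a b} → (a ≡ inj₁ (suc x) ⊎ ∃ λ i → a ≡ inj₂ (zero , suc x , spoke x , i)) → (b ≡ inj₁ (suc y) ⊎ ∃ λ i → b ≡ inj₂ (zero , suc y , spoke y , i)) → a ≡ b → x ≡ y
        lem (inj₁ refl) (inj₁ refl) refl = refl
        lem (inj₁ refl) (inj₂ (_ , refl)) ()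
        lem (inj₂ (_ , refl)) (inj₁ refl) ()
        lem (inj₂ (_ , refl)) (inj₂ (_ , refl)) refl = refl

    S : Fin N → Bool
    S x = inU (inj₁ (suc x))

    R : Fin N → Fin N → Bool
    R = upper (λ x y → adj Q x y ∧ (not (S x) ∧ not (S y)))

    R-edge : ∀ x y → R x y ≡ true → IsEdge F (suc x) (suc y)
    R-edge x y e = let p , q = ∧⁻ {toℕ x <ᵇ toℕ y} e in s≤s (<ᵇ⁻ p) , trans (cone-ss Q x y) (proj₁ (∧⁻ {adj Q x y} q))

    R-hit : ∀ x y → R x y ≡ true → ∃ λ e → ∃ λ i → inU (inj₂ (suc x , suc y , e , i)) ≡ true
    R-hit x y r = let q = proj₂ (∧⁻ {adj Q x y} (proj₂ (∧⁻ {toℕ x <ᵇ toℕ y} r))) ; e = R-edge x y r in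
      e , hit (suc x) (suc y) e (not⁻ (proj₁ (∧⁻ {not (S x)} q))) (not⁻ (proj₂ (∧⁻ {not (S x)} q)))

    -- The apex, the vertices of Q sent into U, and one inner vertex for each edge of Q with no end
    -- among these are distinct members of U.
    counted : inU (inj₁ zero) ≡ true → 1 + (count S + pairs R) ≤ u
    counted e0 = inject (1 + (count S + pairs R)) v vU v-inj
      where
      hitAt : Fin (pairs R) → X
      hitAt j = let x , y = pairNth R j ; e , i , _ = R-hit x y (pairNth-true R j) in inj₂ (suc x , suc y , e , i)
      v′ : Fin (count S) ⊎ Fin (pairs R) → X
      v′ (inj₁ i) = inj₁ (suc (nth S i))
      v′ (inj₂ j) = hitAt j
      v : Fin (1 + (count S + pairs R)) → X
      v zero    = inj₁ zero
      v (suc k) = v′ (splitAt (count S) k)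
      v′U : ∀ s → inU (v′ s) ≡ true
      v′U (inj₁ i) = nth-true S i
      v′U (inj₂ j) = let x , y = pairNth R j in proj₂ (proj₂ (R-hit x y (pairNth-true R j)))
      vU : ∀ i → inU (v i) ≡ true
      vU zero = e0
      vU (suc k) = v′U (splitAt (count S) k)
      pr : X → Fin (1 + N) × Fin (1 + N)
      pr (inj₁ a) = a , a
      pr (inj₂ (a , b , _)) = a , b
      unsuc : ∀ {a b c d : Fin N} → _≡_ {A = Fin (1 + N) × Fin (1 + N)} (suc a , suc b) (suc c , suc d) → (a , b) ≡ (c , d)
      unsuc refl = refl
      v′-inj : ∀ s t → v′ s ≡ v′ t → s ≡ t
      v′-inj (inj₁ i) (inj₁ j) e = cong inj₁ (nth-inj S i j (cong proj₁ (unsuc (cong pr e))))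
      v′-inj (inj₂ i) (inj₂ j) e = cong inj₂ (pairNth-inj R i j (unsuc (cong pr e)))
      v′-0 : ∀ s → inj₁ zero ≢ v′ s
      v′-0 (inj₁ i) ()
      v′-0 (inj₂ j) ()
      v-inj : ∀ i j → v i ≡ v j → i ≡ j
      v-inj zero zero _ = refl
      v-inj zero (suc k) e = ⊥-elim (v′-0 (splitAt (count S) k) e)
      v-inj (suc k) zero e = ⊥-elim (v′-0 (splitAt (count S) k) (≡sym e))
      v-inj (suc k) (suc l) e = cong suc (trans (≡sym (Finₚ.join-splitAt (count S) (pairs R) k))
        (trans (cong (Fin.join (count S) (pairs R)) (v′-inj (splitAt (count S) k) (splitAt (count S) l) e)) (Finₚ.join-splitAt (count S) (pairs R) l)))

    freeArith : ∀ u d e k s D → u + d ≤ e → 1 + (s + k) ≤ u → e ≤ k + D → D ≤ s + d → ⊥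
    freeArith u d e k s D h1 h2 h3 h4 = 1≰0 (lin (0) (h1 ⊕ h2 ⊕ h3 ⊕ h4) (solve (u ∷ d ∷ e ∷ k ∷ s ∷ D ∷ [])))

    -- The vertices of Q in U go to neighbours of the apex inside U. `few` bounds the edges they
    -- settle by their number plus δ, so the others number at least e - |S| - δ ≥ u - |S|, and
    -- `counted` leaves room for only u - 1 - |S|.
    apex∈ : inU (inj₁ zero) ≡ true → ⊥
    apex∈ e0 = freeArith u δ (edges Q) (pairs R) (count S) (∑ (λ x → b2n (S x) * deg Q x)) u+δ (counted e0)
      (≤-trans (edges≤kept Q (λ x → not (S x))) (≤-reflexive (cong (pairs R +_) (∑-cong (λ x → cong (λ b → b2n b * deg Q x) (Boolₚ.not-involutive (S x)))))))
      (few i₀ S (λ x s → proj₁ (idxU (inj₁ (suc x)) s)) nbr inj)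
      where
      i₀ = proj₁ (idxU (inj₁ zero) e0)
      nbr : ∀ x s → adj GU i₀ (proj₁ (idxU (inj₁ (suc x)) s)) ≡ true
      nbr x s = trans (≡sym (join-ll GU (turan2 m) i₀ _)) (trans (≡sym (cong₂ (adj J) (proj₂ (idxU (inj₁ zero) e0)) (proj₂ (idxU (inj₁ (suc x)) s)))) (f-adj (inj₁ zero) (inj₁ (suc x)) (cone-0s Q x)))
      inj : ∀ x s y s′ → proj₁ (idxU (inj₁ (suc x)) s) ≡ proj₁ (idxU (inj₁ (suc y)) s′) → x ≡ y
      inj x s y s′ e with f-inj {inj₁ (suc x)} {inj₁ (suc y)} (trans (proj₂ (idxU (inj₁ (suc x)) s)) (trans (cong (_↑ˡ m) e) (≡sym (proj₂ (idxU (inj₁ (suc y)) s′)))))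
      ... | refl = refl

  contradictory : ⊥
  contradictory = [ apex∈ , apex∉ ]′ (bool (inU (inj₁ zero)))

-- On u + m₁ vertices a degree sum is at most (u + m₁)²; an excess of this size is used up by as
-- many deletions.
progressSize : ℕ → ℕ → ℕ
progressSize u m₁ = suc ((u + m₁) * (u + m₁) + m₁)

private
  step-arith : ∀ g t c u m X Y → X ≤ g + 2 * t + 2 * (u * m) → g + 2 * (t + c) + 2 * (u * (1 + m)) ≤ Y → m ≤ 2 * c → 1 ≤ u → X + (1 + (u + m)) ≤ Y
  step-arith g t c u m X Y h1 h2 h3 h4 = lin (0) (h1 ⊕ h2 ⊕ h3 ⊕ h4) (solve (g ∷ t ∷ c ∷ u ∷ m ∷ X ∷ Y ∷ []))
  delete-arith : ∀ D D1 d n x y k → D ≤ D1 + 2 * d → 2 * d ≤ n → D1 ≤ x + k → x + (1 + n) ≤ y → D + 1 ≤ y + k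
  delete-arith D D1 d n x y k h1 h2 h3 h4 = lin (0) (h1 ⊕ h2 ⊕ h3 ⊕ h4) (solve (D ∷ D1 ∷ d ∷ n ∷ x ∷ y ∷ k ∷ []))

-- Progressive deletion of vertices of low degree: every deletion gains at least one edge over
-- the extremal numbers, so for large n a graph with at least the extremal number of edges has
-- large minimum degree.

module Progressive (H : PGraph) {u : ℕ} (GU : SimpleGraph u) (1≤u : 1 ≤ u) (m₁ : ℕ)
  (core : ∀ {n} (G : SimpleGraph n) m → u + m ≡ n → m₁ ≤ m → Free H G → (∀ v → n ≤ 2 * deg G v) →
    dsum (join GU (turan2 m)) ≤ dsum G → G ≅ join GU (turan2 m)) where

  private
    D₀ : ℕ → ℕ
    D₀ m = dsum (join GU (turan2 m))

    D₀≡ : ∀ m → D₀ m ≡ dsum GU + 2 * turanEdges m + 2 * (u * m)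
    D₀≡ m = trans (dsum-join GU (turan2 m)) (cong (λ z → dsum GU + z + 2 * (u * m)) (dsum-turan2 m))

    K = (u + m₁) * (u + m₁)

    -- The extremal degree sum gains at least m + 2u > m + u, whereas deleting a vertex of degree at
    -- most half of u + m loses at most u + m: the excess drops by one or more. This uses u ≥ 1.
    step : ∀ m → D₀ m + (1 + (u + m)) ≤ D₀ (suc m)
    step m = let c , e , le = turanEdges-suc m in step-arith (dsum GU) (turanEdges m) c u m (D₀ m) (D₀ (suc m)) (≤-reflexive (D₀≡ m))
      (≤-reflexive (≡sym (trans (D₀≡ (suc m)) (cong (λ z → dsum GU + 2 * z + 2 * (u * suc m)) e)))) le 1≤u

    free-delete : ∀ {n} (G : SimpleGraph (suc n)) v → Free H G → Free H (induce G (punchIn v))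
    free-delete G v fr (f , inj , hom) = fr (punchIn v ∘ f , (λ {x} {y} e → inj (Finₚ.punchIn-injective v _ _ e)) , hom)

    low? : ∀ {n} (G : SimpleGraph (suc n)) → (∃ λ v → 2 * deg G v ≤ n) ⊎ (∀ v → suc n ≤ 2 * deg G v)
    low? {n} G with find? (λ v → 2 * deg G v <ᵇ suc n)
    ... | inj₁ (v , e) = inj₁ (v , ℕ.s≤s⁻¹ (<ᵇ⁻ {2 * deg G v} e))
    ... | inj₂ none = inj₂ (λ v → <ᵇ-f⁻ (none v))

    pred∸ : ∀ x y K j → x + 1 ≤ y + (K ∸ j) → x ≤ y + (K ∸ suc j)
    pred∸ x y K j p with K ∸ j in q
    ... | zero  = ≤-trans (≤-trans (m≤m+n x 1) p) (≤-trans (≤-reflexive (+-identityʳ y)) (m≤m+n y _))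
    ... | suc k = ≤-trans (+-cancelʳ-≤ 1 x (y + k) (≤-trans p (≤-reflexive (trans (+-suc y k) (+-comm 1 (y + k))))))
      (≤-reflexive (cong (y +_) (trans (cong ℕ.pred (≡sym q)) (pred[m∸n]≡m∸[1+n] K j))))

    mutual
      -- The excess starts at the trivial K and falls with each deletion; when no vertex has low
      -- degree, `core` removes it entirely.
      bound : ∀ j {n} (G : SimpleGraph n) → u + (j + m₁) ≡ n → Free H G → dsum G ≤ D₀ (j + m₁) + (K ∸ j)
      bound zero G refl fr = ≤-trans (∑-≤const (u + m₁) (λ v → count≤n (adj G v))) (m≤n+m K _)
      bound (suc j) G e fr with trans (≡sym (+-suc u (j + m₁))) e
      ... | refl with low? G
      ...   | inj₁ low = pred∸ (dsum G) _ K j (drop j G low fr)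
      ...   | inj₂ high with D₀ (suc j + m₁) ≤? dsum G
      ...     | yes p = ≤-trans (≤-reflexive (dsum-iso G (join GU (turan2 (suc j + m₁))) (core G (suc j + m₁) e (m≤n+m m₁ (suc j)) fr high p))) (m≤m+n _ _)
      ...     | no ¬p = ≤-trans (<⇒≤ (≰⇒> ¬p)) (m≤m+n _ _)

      drop : ∀ j (G : SimpleGraph (suc (u + (j + m₁)))) → (∃ λ v → 2 * deg G v ≤ u + (j + m₁)) → Free H G → dsum G + 1 ≤ D₀ (suc j + m₁) + (K ∸ j)
      drop j G (v , low) fr = delete-arith (dsum G) (dsum (induce G (punchIn v))) (deg G v) (u + (j + m₁)) (D₀ (j + m₁)) (D₀ (suc j + m₁)) (K ∸ j)
        (≤-reflexive (dsum-delete G v)) low (bound j (induce G (punchIn v)) refl (free-delete G v fr)) (step (j + m₁))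

  extremal : ∀ n m → u + m ≡ n → progressSize u m₁ ≤ m → Free H (join GU (turan2 m)) → UniqueExtremal n H (join GU (turan2 m))
  extremal n m e big fr₀ = e , fr₀ , λ G fr → compare G e big fr
    where
    G₀ = join GU (turan2 m)
    halve : ∀ {n} (G : SimpleGraph n) → dsum G ≤ dsum G₀ → edges G ≤ edges G₀
    halve G p = *-cancelˡ-≤ 2 (≤-trans (≤-reflexive (≡sym (dsum≡2edges G))) (≤-trans p (≤-reflexive (dsum≡2edges G₀))))
    unhalve : ∀ {n} (G : SimpleGraph n) → edges G ≡ edges G₀ → dsum G ≡ dsum G₀
    unhalve G q = trans (dsum≡2edges G) (trans (cong (2 *_) q) (≡sym (dsum≡2edges G₀)))
    small-case : ∀ {n} (G : SimpleGraph n) → dsum G < dsum G₀ → edges G ≤ edges G₀ × (edges G ≡ edges G₀ → G ≅ G₀)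
    small-case G p = halve G (<⇒≤ p) , λ q → ⊥-elim (<⇒≱ p (≤-reflexive (≡sym (unhalve G q))))
    compare : ∀ {n} (G : SimpleGraph n) → u + m ≡ n → progressSize u m₁ ≤ m → Free H G → edges G ≤ edges G₀ × (edges G ≡ edges G₀ → G ≅ G₀)
    compare G e big fr with m≤n⇒∃[o]m+o≡n big
    ... | o , refl with trans (≡sym (+-suc u (K + m₁ + o))) e
    ...   | refl with low? G
    ...     | inj₁ low = small-case G (≤-trans (≤-reflexive (+-comm 1 (dsum G))) (≤-trans (subst (λ z → dsum G + 1 ≤ D₀ (suc z) + (K ∸ (K + o))) reorder dropped)
                (≤-reflexive (trans (cong (D₀ (suc (K + m₁ + o)) +_) (m≤n⇒m∸n≡0 (m≤m+n K o))) (+-identityʳ _)))))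
      where
      reorder : K + o + m₁ ≡ K + m₁ + o
      reorder = trans (+-assoc K o m₁) (trans (cong (K +_) (+-comm o m₁)) (≡sym (+-assoc K m₁ o)))
      dropAt : ∀ z → K + o + m₁ ≡ z → (G : SimpleGraph (suc (u + z))) → (∃ λ v → 2 * deg G v ≤ u + z) → Free H G → dsum G + 1 ≤ D₀ (suc (K + o + m₁)) + (K ∸ (K + o))
      dropAt .(K + o + m₁) refl G = drop (K + o) G
      dropped = dropAt (K + m₁ + o) reorder G low fr
    ...     | inj₂ high with D₀ (suc (K + m₁ + o)) ≤? dsum G
    ...       | no ¬p = small-case G (≰⇒> ¬p)
    ...       | yes p = halve G (≤-reflexive (dsum-iso G G₀ iso)) , λ _ → iso
      where iso = core G (suc (K + m₁ + o)) e (≤-trans (≤-trans (m≤n+m m₁ K) (m≤m+n (K + m₁) o)) (n≤1+n _)) fr high p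

-- Graphs of large minimum degree

module Size (N e h : ℕ) where
  K g R M bound : ℕ
  -- The error unit is r = n / K, so that L r < n once r is positive.
  K = suc (Consts.L N e h)
  -- In a complete tripartite graph one class supplies e + 1 hubs; the other two act as sides
  -- without missing edges, where the greedy choice needs more than 2h vertices.
  g = suc e + suc (2 * h)
  -- A lower bound for r: it exceeds h and absorbs the terms of the edge count that do not grow with
  -- n.
  R = suc h + (3 * (e * e) + 1 + e * e)
  M = richBound g K
  bound = TripartiteBounds.threshold g K + (K * R + (4 * M + 1))

module Cone {N : ℕ} (Q : SimpleGraph N) (ℓ : Fin (1 + N) → Fin (1 + N) → ℕ) (valid : ValidLengths (cone Q) ℓ)
  (cl : Colouring Q) (deg≥1 : ∀ x → 1 ≤ deg Q x) (h : ℕ) (len : length (balloonVertices (cone Q) ℓ) ≤ h) where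

  open Colouring cl
  H = oddBalloon (cone Q) ℓ

  tripartite-copy : ∀ {n} (G : SimpleGraph n) e → edges Q ≤ e → Tripartite G (Size.g N e h) → H ⊆ G
  tripartite-copy {n} G e e≤ T = Instances.embedManyHubs Q ℓ valid col proper G side 0 h cross len (λ i → apex (inject≤ i (m≤m+n (suc e) _))) e≤
      (λ i j q → Finₚ.inject≤-injective _ _ i j (apex-inj _ _ q)) (λ i → good′ (inject≤ i (m≤m+n (suc e) _)))
    where
    open Tripartite T
    side : Bool → Fin n → Bool
    side true  = X
    side false = Y
    cross : ∀ s z → side s z ≡ true → count (λ y → side (not s) y ∧ not (adj G z y)) ≤ 0
    cross true z e = ≤-reflexive (count-none _ (λ y → lem y))
      where
      lem : ∀ y → Y y ∧ not (adj G z y) ≡ false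
      lem y with bool (Y y)
      ... | inj₁ q = trans (cong (λ b → Y y ∧ not b) (X-Y z y e q)) (Boolₚ.∧-zeroʳ (Y y))
      ... | inj₂ q = cong (_∧ not (adj G z y)) q
    cross false z e = ≤-reflexive (count-none _ (λ y → lem y))
      where
      lem : ∀ y → X y ∧ not (adj G z y) ≡ false
      lem y with bool (X y)
      ... | inj₁ q = trans (cong (λ b → X y ∧ not b) (trans (sym G z y) (X-Y y z q e))) (Boolₚ.∧-zeroʳ (X y))
      ... | inj₂ q = cong (_∧ not (adj G z y)) q
    size : ∀ s → Size.g N e h ≤ count (side s)
    size true  = X-size
    size false = Y-size
    apex-side : ∀ i s z → side s z ≡ true → adj G (apex i) z ≡ true
    apex-side i true  = apex-X i
    apex-side i false = apex-Y i
    good′ : ∀ i s → Embed.Good G side 0 h cross s (apex i ∷ [])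
    good′ i s = Embed.good (≤-trans (≤-trans (s≤s (≤-reflexive (*-comm h 2))) (m≤n+m _ (suc e))) (≤-trans (size s)
      (count-mono (λ z q → ∧⁺ q (trans (Boolₚ.∧-identityʳ _) (apex-side i s z q))))))

  record Setup {n} (G : SimpleGraph n) (e : ℕ) : Set where
    field
      r : ℕ
      S : Split G r
      h<r : h < r
      big : Consts.L N e h * r < n
      sq : 3 * (e * e) + 1 + e * e ≤ r

  setup : ∀ {n} (G : SimpleGraph n) e → edges Q ≤ e → Size.bound N e h ≤ n → Free H G → (∀ v → n ≤ 2 * deg G v) → Setup G e
  setup {n} G e e≤ big fr mindeg = record { r = r ; S = split G r M mindeg (<⇒≤ poor) r-small
      ; h<r = ≤-trans (m≤m+n (suc h) _) R≤r ; big = L*r<n ; sq = ≤-trans (m≤n+m _ (suc h)) R≤r }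
    where
    open Size N e h
    r = n / K
    rest≤n : K * R + (4 * M + 1) ≤ n
    rest≤n = ≤-trans (m≤n+m _ (TripartiteBounds.threshold g K)) big
    R≤r : R ≤ r
    R≤r = ≤-trans (≤-reflexive (≡sym (DivMod.m*n/n≡m R K))) (DivMod./-monoˡ-≤ K (≤-trans (≤-reflexive (*-comm R K)) (≤-trans (m≤m+n _ _) rest≤n)))
    Kr≤n : K * r ≤ n
    Kr≤n = ≤-trans (≤-reflexive (*-comm K r)) (DivMod.m/n*n≤m n K)
    L*r<n : Consts.L N e h * r < n
    L*r<n = ≤-trans (+-monoˡ-≤ (Consts.L N e h * r) (≤-trans (s≤s z≤n) R≤r)) Kr≤n
    poor : count (rich G r) < M
    poor = ≰⇒> (λ many → fr (tripartite-copy G e e≤ (tripartite G g K (s≤s z≤n) (≤-trans (m≤m+n _ _) big) many)))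
    4r<n : 4 * r < n
    4r<n = ≤-trans (s≤s (*-monoˡ-≤ r 4≤L)) L*r<n
      where
      open Consts N e h
      4≤L : 4 ≤ L
      4≤L = ≤-trans (m≤n+m 4 (4 * c)) (≤-trans (m≤m+n k₁ k₂) (≤-trans (m≤m+n _ k₃) (m≤m+n _ k₄)))
    4M<n : 4 * M < n
    4M<n = ≤-trans (≤-trans (≤-reflexive (+-comm 1 (4 * M))) (m≤n+m _ (K * R))) rest≤n
    rsmall : ∀ r M n → 4 * r < n → 4 * M < n → 2 * (2 * r + 2 * M) < 2 * n
    rsmall r M n h1 h2 = lin (1) (h1 ⊕ h2) (solve (r ∷ M ∷ n ∷ []))
    r-small : 2 * r + 2 * M < n
    r-small = *-cancelˡ-< 2 _ n (rsmall r M n 4r<n 4M<n)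

  -- Every edge has exactly one end in a class of a bipartition.
  class-degrees : (p : Fin N → Bool) → (∀ x y → adj Q x y ≡ true → p x ≡ true → p y ≡ true → ⊥) → (∀ x y → adj Q x y ≡ true → p x ≡ false → p y ≡ false → ⊥) →
    ∑ (λ x → b2n (p x) * deg Q x) ≡ edges Q
  class-degrees p ind ind′ = ≤-antisym
    (≤-trans (≤-reflexive (∑-cong (λ x → cong (λ b → b2n b * deg Q x) (≡sym (Boolₚ.not-involutive (p x))))))
      (≤-trans (m≤n+m _ (kept Q K′)) (kept≤edges Q K′ (λ x y a q q′ → ind x y a (nf q) (nf q′)))))
    (≤-trans (edges≤kept Q K′) (≤-reflexive (cong₂ _+_ none (∑-cong (λ x → cong (λ b → b2n b * deg Q x) (Boolₚ.not-involutive (p x)))))))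
    where
    K′ = λ x → not (p x)
    nf : ∀ {b} → not b ≡ false → b ≡ true
    nf {true} _ = refl
    none : kept Q K′ ≡ 0
    none = ∑-zero (λ x → count-none _ (λ y → lem x y))
      where
      lem : ∀ x y → upper (λ x y → adj Q x y ∧ (K′ x ∧ K′ y)) x y ≡ false
      lem x y with bool (upper (λ x y → adj Q x y ∧ (K′ x ∧ K′ y)) x y)
      ... | inj₂ q = q
      ... | inj₁ q = let a , b = ∧⁻ {adj Q x y} (proj₂ (∧⁻ {toℕ x <ᵇ toℕ y} q)) in ⊥-elim (ind′ x y a (not⁻ (proj₁ (∧⁻ {K′ x} b))) (not⁻ (proj₂ (∧⁻ {K′ x} b))))

  same-colour : ∀ x y → adj Q x y ≡ true → col x ≡ col y → ⊥
  same-colour x y a q = b≢not (col x) (trans q (proper x y a))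

  col-degrees : ∑ (λ x → b2n (col x) * deg Q x) ≡ edges Q
  col-degrees = class-degrees col (λ x y a p q → same-colour x y a (trans p (≡sym q))) (λ x y a p q → same-colour x y a (trans p (≡sym q)))

  col′-degrees : ∑ (λ x → b2n (not (col x)) * deg Q x) ≡ edges Q
  col′-degrees = class-degrees (not ∘ col) (λ x y a p q → same-colour x y a (trans (not⁻ p) (≡sym (not⁻ q)))) (λ x y a p q → same-colour x y a (Boolₚ.not-injective (trans p (≡sym q))))

  col≤edges : count col ≤ edges Q
  col≤edges = ≤-trans (≤-reflexive (≡sym (*-identityʳ _))) (≤-trans (∑-P≥ col (deg Q) 1 (λ x _ → deg≥1 x)) (≤-reflexive col-degrees))

  sq-mono : ∀ {u e r} → u ≤ e → 3 * (e * e) + 1 + e * e ≤ r → 3 * (u * u) + 1 + e * e ≤ r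
  sq-mono {e = e} u≤e p = ≤-trans (+-monoˡ-≤ (e * e) (+-monoˡ-≤ 1 (*-monoʳ-≤ 3 (*-mono-≤ u≤e u≤e)))) p

  lower-bound : ∀ {n u} (G : SimpleGraph n) (GU : SimpleGraph u) m → dsum (join GU (turan2 m)) ≤ dsum G → 2 * (u * m) + 2 * turanEdges m ≤ dsum G
  lower-bound {u = u} G GU m p = ≤-trans (arith (2 * (u * m)) (2 * turanEdges m) (dsum GU)) (≤-trans (≤-reflexive (≡sym (trans (dsum-join GU (turan2 m)) (cong (λ z → dsum GU + z + 2 * (u * m)) (dsum-turan2 m))))) p)
    where
    arith : ∀ x y g → x + y ≤ g + y + x
    arith x y g = lin (g) (z≤n {0}) (solve (x ∷ y ∷ g ∷ []))

  core-apex : ∀ u′ → edges Q ≡ suc u′ → (GU : SimpleGraph (suc u′)) →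
    (∀ {n} (G : SimpleGraph n) (f : Fin (suc u′) → Fin n) → (∀ i j → f i ≡ f j → i ≡ j) → ((∃ λ c → 2 ≤ deg Q c) → ∀ i j → adj (induce G f) i j ≡ false) →
      dsum (induce G f) ≤ dsum GU × (dsum GU ≤ dsum (induce G f) → induce G f ≅ GU)) →
    ∀ {n} (G : SimpleGraph n) m → suc u′ + m ≡ n → Size.bound N (suc u′) h ≤ m → Free H G → (∀ v → n ≤ 2 * deg G v) →
    dsum (join GU (turan2 m)) ≤ dsum G → G ≅ join GU (turan2 m)
  core-apex u′ e≡ GU special {n} G m u+m big fr mindeg large =
    use (setup G (suc u′) (≤-reflexive e≡) (≤-trans big (≤-trans (m≤n+m m (suc u′)) (≤-reflexive u+m))) fr mindeg)
    where
    use : Setup G (suc u′) → G ≅ join GU (turan2 m)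
    use record { r = r ; S = S ; h<r = h<r ; big = big ; sq = sq } =
      Extremal.conclude-apex Q ℓ valid col proper G fr r S mindeg h (suc u′) len e≡ h<r big
        u′ m (≤-trans col≤edges (≤-reflexive e≡)) ≤-refl u+m sq (lower-bound G GU m large) refl GU (special G) large

  -- Q is 2-regular and its colour classes have j + 1 vertices each, so e = N = 2j + 2 and |U| = 2j
  -- + 1. The given vertex of Q provides two vertices with a common neighbour.
  core-class : (∀ x → deg Q x ≡ 2) → ∀ j → count col ≡ suc j → Fin N →
    ∀ {n} (G : SimpleGraph n) m → suc (2 * j) + m ≡ n → Size.bound N (suc (suc (2 * j))) h ≤ m → Free H G → (∀ v → n ≤ 2 * deg G v) →
    dsum (join (matchingPlusK1 j) (turan2 m)) ≤ dsum G → G ≅ join (matchingPlusK1 j) (turan2 m)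
  core-class deg2 j cj b {n} G m u+m big fr mindeg large =
    use (setup G (suc (suc (2 * j))) (≤-reflexive e≡) (≤-trans big (≤-trans (m≤n+m m (suc (2 * j))) (≤-reflexive u+m))) fr mindeg)
    where
    dbl : ∀ j → 2 * suc j ≡ suc (suc (2 * j))
    dbl = solve-∀
    twice : ∀ p → ∑ (λ x → b2n (p x) * deg Q x) ≡ 2 * count p
    twice p = trans (∑-cong (λ x → trans (cong (b2n (p x) *_) (deg2 x)) (*-comm (b2n (p x)) 2))) (trans (∑-*ˡ 2 (λ x → b2n (p x))) (cong (2 *_) (≡sym (count≡∑ p))))
    e≡2c : edges Q ≡ 2 * count col
    e≡2c = trans (≡sym col-degrees) (twice col)
    c′≡c : count (λ x → not (col x)) ≡ count col
    c′≡c = *-cancelˡ-≡ _ _ 2 (trans (≡sym (twice (not ∘ col))) (trans col′-degrees e≡2c))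
    e≡ : edges Q ≡ suc (suc (2 * j))
    e≡ = trans e≡2c (trans (cong (2 *_) cj) (dbl j))
    1≤c′ : 1 ≤ count (λ x → not (col x))
    1≤c′ = ≤-trans (s≤s z≤n) (≤-reflexive (trans (≡sym cj) (≡sym c′≡c)))
    ue : suc (2 * j) ≡ count col + count (λ x → not (col x)) ∸ 1
    ue = ≡sym (trans (cong (_∸ 1) (trans (cong (count col +_) c′≡c) (cong₂ _+_ cj cj))) (arith j))
      where
      arith : ∀ j → j + suc j ≡ suc (2 * j)
      arith = solve-∀
    u≤e : suc (2 * j) ≤ suc (suc (2 * j))
    u≤e = n≤1+n _
    c₁ = find (adj Q b) (≤-trans (s≤s z≤n) (≤-reflexive (≡sym (deg2 b))))
    c₂ = other (adj Q b) (proj₁ c₁) (≤-reflexive (≡sym (deg2 b)))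
    use : Setup G (suc (suc (2 * j))) → G ≅ join (matchingPlusK1 j) (turan2 m)
    use record { r = r ; S = S ; h<r = h<r ; big = big ; sq = sq } =
      Extremal.conclude-class Q ℓ valid col proper G fr r S mindeg h (suc (suc (2 * j))) len e≡ h<r big
        (2 * j) m (≤-trans (≤-reflexive cj) (s≤s (m≤m+n j (j + 0)))) u≤e u+m (sq-mono u≤e sq) (lower-bound G (matchingPlusK1 j) m large)
        refl (matchingPlusK1 j)
        (λ f d≤1 → dsum-matching j (induce G f) d≤1 , λ q → ≅-matching j (induce G f) d≤1 (≤-trans (dsum-matching≥ j) q)) deg2 (proj₁ c₁) (proj₁ c₂) b (λ e → proj₂ (proj₂ c₂) (≡sym e)) (proj₂ c₁) (proj₁ (proj₂ c₂)) ue 1≤c′ (trans (≡sym (dbl j)) (trans (cong (suc j +_) (+-identityʳ (suc j))) (cong₂ _+_ (≡sym cj) (≡sym cj)))) c′≡c large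

-- The three cases

startSize : ℕ → ℕ → ℕ
startSize u m₁ = u + progressSize u m₁

startSize-late : ∀ N u m₁ n → N + startSize u m₁ ≤ n → progressSize u m₁ ≤ n ∸ N + 1
startSize-late N u m₁ n big = ≤-trans (m≤n+m _ u) (≤-trans (≤-trans (≤-reflexive (≡sym (m+n∸m≡n N (startSize u m₁)))) (∸-monoˡ-≤ N big)) (m≤m+n (n ∸ N) 1))

module Cases {N : ℕ} (Q : SimpleGraph N) (ℓ : Fin (1 + N) → Fin (1 + N) → ℕ) (valid : ValidLengths (cone Q) ℓ)
  (cl : Colouring Q) (deg≥1 : ∀ x → 1 ≤ deg Q x) (h : ℕ) (len : length (balloonVertices (cone Q) ℓ) ≤ h) where

  open Cone Q ℓ valid cl deg≥1 h len
  open Colouring cl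

  HasBranch : Set
  HasBranch = ∃ λ c → 2 ≤ deg Q c

  apexCase : ∀ E → edges Q ≡ E → 1 ≤ E → E < N → (GU : SimpleGraph E) →
    (∀ {n} (G : SimpleGraph n) (f : Fin E → Fin n) → (∀ i j → f i ≡ f j → i ≡ j) → (HasBranch → ∀ i j → adj (induce G f) i j ≡ false) →
      dsum (induce G f) ≤ dsum GU × (dsum GU ≤ dsum (induce G f) → induce G f ≅ GU)) →
    (∀ (i₀ : Fin E) (S : Fin N → Bool) (g : ∀ x → S x ≡ true → Fin E) → (∀ x s → adj GU i₀ (g x s) ≡ true) →
      (∀ x s y s′ → g x s ≡ g y s′ → x ≡ y) → ∑ (λ x → b2n (S x) * deg Q x) ≤ count S + 0) →
    ∀ n → startSize E (Size.bound N E h) ≤ n → UniqueExtremal n H (join GU (turan2 (n ∸ E)))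
  apexCase (suc u′) e≡ _ E<N GU special few n big =
    Progressive.extremal H GU (s≤s z≤n) (Size.bound N (suc u′) h) (λ G m u+m m₁≤m fr mindeg → core-apex u′ e≡ GU special G m u+m m₁≤m fr mindeg)
      n (n ∸ suc u′) (m+[n∸m]≡n (≤-trans (m≤m+n (suc u′) _) big)) (≤-trans (≤-reflexive (≡sym (m+n∸m≡n (suc u′) (progressSize (suc u′) (Size.bound N (suc u′) h))))) (∸-monoˡ-≤ (suc u′) big))
      (λ { (f , inj , hom) → Freeness.contradictory Q ℓ valid GU (n ∸ suc u′) 0 E<N (≤-reflexive (trans (+-identityʳ _) (≡sym e≡))) few f inj hom })

  single-edges : (∀ x → deg Q x ≡ 1) → 1 ≤ N → ∀ n → startSize (edges Q) (Size.bound N (edges Q) h) ≤ n →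
    UniqueExtremal n H (join (complete (edges Q)) (turan2 (n ∸ edges Q)))
  single-edges deg1 1≤N = apexCase (edges Q) refl (proj₁ sizes) (proj₂ sizes) (complete (edges Q)) special few
    where
    N≡2e : N ≡ 2 * edges Q
    N≡2e = trans (trans (≡sym (*-identityʳ N)) (trans (≡sym (∑-const N 1)) (∑-cong (λ x → ≡sym (deg1 x))))) (dsum≡2edges Q)
    sizes : 1 ≤ edges Q × edges Q < N
    sizes = lem (edges Q) N≡2e
      where
      lem : ∀ E → N ≡ 2 * E → 1 ≤ E × E < N
      lem zero q = ⊥-elim (1≰0 (≤-trans 1≤N (≤-reflexive q)))
      lem (suc E) q = s≤s z≤n , ≤-trans (s≤s (m≤m+n (suc E) E)) (≤-reflexive (trans (arith E) (≡sym q)))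
        where
        arith : ∀ E → suc (suc E + E) ≡ 2 * suc E
        arith = solve-∀
    special : ∀ {n} (G : SimpleGraph n) (f : Fin (edges Q) → Fin n) → (∀ i j → f i ≡ f j → i ≡ j) → (HasBranch → ∀ i j → adj (induce G f) i j ≡ false) →
      dsum (induce G f) ≤ dsum (complete (edges Q)) × (dsum (complete (edges Q)) ≤ dsum (induce G f) → induce G f ≅ complete (edges Q))
    special G f _ _ = ∑-mono (λ i → count-mono (le i)) , λ q → ≅-pointwise {G = induce G f} {complete (edges Q)} (pinch (induce G f) (complete (edges Q)) le q)
      where
      le : ∀ i j → adj G (f i) (f j) ≡ true → adj (complete (edges Q)) i j ≡ true
      le i j e = cong not (==-f⁺ {x = i} {j} (λ { refl → t≢f e (irrefl G (f i)) }))
    few : ∀ (i₀ : Fin (edges Q)) (S : Fin N → Bool) (g : ∀ x → S x ≡ true → Fin (edges Q)) → _ → _ → ∑ (λ x → b2n (S x) * deg Q x) ≤ count S + 0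
    -- All degrees are one, so edges inside U settle no more edges of Q than they use hubs.
    few i₀ S g _ _ = ≤-trans (∑-P≤ S (deg Q) 1 (λ x _ → ≤-reflexive (deg1 x))) (≤-reflexive (trans (*-identityʳ _) (≡sym (+-identityʳ _))))

  branching : HasBranch → dsum Q + 2 ≤ 2 * N → ∀ n → startSize (edges Q) (Size.bound N (edges Q) h) ≤ n →
    UniqueExtremal n H (join (emptyG (edges Q)) (turan2 (n ∸ edges Q)))
  branching (c , 2≤d) small = apexCase (edges Q) refl 1≤e e<N (emptyG (edges Q)) special few
    where
    1≤e : 1 ≤ edges Q
    1≤e = *-cancelˡ-≤ 2 (≤-trans 2≤d (≤-trans (≤∑ (deg Q) c) (≤-reflexive (dsum≡2edges Q))))
    e<N : edges Q < N
    e<N = *-cancelˡ-≤ 2 (≤-trans (≤-reflexive (trans (arith (edges Q)) (cong (_+ 2) (≡sym (dsum≡2edges Q))))) small)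
      where
      arith : ∀ e → 2 * suc e ≡ 2 * e + 2
      arith = solve-∀
    special : ∀ {n} (G : SimpleGraph n) (f : Fin (edges Q) → Fin n) → (∀ i j → f i ≡ f j → i ≡ j) → (HasBranch → ∀ i j → adj (induce G f) i j ≡ false) →
      dsum (induce G f) ≤ dsum (emptyG (edges Q)) × (dsum (emptyG (edges Q)) ≤ dsum (induce G f) → induce G f ≅ emptyG (edges Q))
    special G f _ none = ∑-mono (λ i → count-mono (λ j e → t≢f e (none (c , 2≤d) i j))) , λ _ → ≅-pointwise {G = induce G f} {emptyG (edges Q)} (none (c , 2≤d))
    few : ∀ (i₀ : Fin (edges Q)) (S : Fin N → Bool) (g : ∀ x → S x ≡ true → Fin (edges Q)) → (∀ x s → adj (emptyG (edges Q)) i₀ (g x s) ≡ true) → _ →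
      ∑ (λ x → b2n (S x) * deg Q x) ≤ count S + 0
    -- U is empty, so no vertex of Q can be sent to a neighbour of the apex inside U.
    few i₀ S g ad _ = ≤-trans (∑-P≤ S (deg Q) 1 (λ x s → t≢f (ad x s) refl)) (≤-reflexive (trans (*-identityʳ _) (≡sym (+-identityʳ _))))

  regular-colour : (∀ x → deg Q x ≡ 2) → edges Q ≡ N × 2 * count col ≡ N
  regular-colour deg2 = e≡N , trans (trans (trans (cong (2 *_) (count≡∑ col)) (≡sym (∑-*ˡ 2 (λ x → b2n (col x)))))
      (∑-cong (λ x → trans (*-comm 2 (b2n (col x))) (cong (b2n (col x) *_) (≡sym (deg2 x)))))) (trans col-degrees e≡N)
    where
    e≡N : edges Q ≡ N
    e≡N = *-cancelˡ-≡ _ _ 2 (trans (≡sym (dsum≡2edges Q)) (trans (∑-cong deg2) (trans (∑-const N 2) (*-comm N 2))))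

  even-cycles : (∀ x → deg Q x ≡ 2) → Fin N → ∀ t → suc (suc (2 * t)) ≡ N → ∀ n →
    N + startSize (suc (2 * t)) (Size.bound N (suc (suc (2 * t))) h) ≤ n →
    UniqueExtremal n H (join (matchingPlusK1 t) (turan2 (n ∸ N + 1)))
  even-cycles deg2 b t N≡ n big = Progressive.extremal H (matchingPlusK1 t) (s≤s z≤n) (Size.bound N (suc (suc (2 * t))) h) (core-class deg2 t cj b)
      n (n ∸ N + 1) u+m (startSize-late N (suc (2 * t)) (Size.bound N (suc (suc (2 * t))) h) n big)
      (λ { (f , inj , hom) → Freeness.contradictory Q ℓ valid (matchingPlusK1 t) (n ∸ N + 1) 1 (≤-reflexive N≡)
        (≤-reflexive (trans (+-comm (suc (2 * t)) 1) (trans N≡ (≡sym e≡N)))) few f inj hom })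
    where
    e≡N = proj₁ (regular-colour deg2)
    cj : count col ≡ suc t
    cj = *-cancelˡ-≡ _ _ 2 (trans (proj₂ (regular-colour deg2)) (trans (≡sym N≡) (arith t)))
      where
      arith : ∀ t → suc (suc (2 * t)) ≡ 2 * suc t
      arith = solve-∀
    u+m : suc (2 * t) + (n ∸ N + 1) ≡ n
    u+m = trans (arith (2 * t) (n ∸ N)) (trans (cong (_+ (n ∸ N)) N≡) (m+[n∸m]≡n (≤-trans (m≤m+n N _) big)))
      where
      arith : ∀ a x → suc a + (x + 1) ≡ suc (suc a) + x
      arith = solve-∀
    few : ∀ (i₀ : Fin (suc (2 * t))) (S : Fin N → Bool) (g : ∀ x → S x ≡ true → Fin (suc (2 * t))) → (∀ x s → adj (matchingPlusK1 t) i₀ (g x s) ≡ true) →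
      (∀ x s y s′ → g x s ≡ g y s′ → x ≡ y) → ∑ (λ x → b2n (S x) * deg Q x) ≤ count S + 1
    -- A vertex of U has at most one neighbour in U, so |S| ≤ 1 and 2|S| ≤ |S| + 1; this is the case
    -- δ = 1, with |U| = e - 1.
    few i₀ S g ad g-inj = ≤-trans (∑-P≤ S (deg Q) 2 (λ x _ → ≤-reflexive (deg2 x)))
      (≤-trans (≤-reflexive (arith (count S))) (+-monoʳ-≤ (count S) (count-≤1 S (λ x y sx sy → g-inj x sx y sy (matching-unique t i₀ (g x sx) (g y sy) (ad x sx) (ad y sy))))))
      where
      arith : ∀ s → s * 2 ≡ s + s
      arith = solve-∀

  half-size : (∀ x → deg Q x ≡ 2) → Fin N → suc (suc (2 * (N / 2 ∸ 1))) ≡ N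
  half-size deg2 b = lem (count col) (proj₂ (regular-colour deg2))
    where
    lem : ∀ k → 2 * k ≡ N → suc (suc (2 * (N / 2 ∸ 1))) ≡ N
    lem zero q = ⊥-elim (1≰0 (≤-trans (≤-trans (s≤s z≤n) (Finₚ.toℕ<n b)) (≤-reflexive (≡sym q))))
    lem (suc k) q = trans (cong (λ z → suc (suc (2 * (z ∸ 1)))) (trans (cong (_/ 2) (≡sym q)) (half-even (suc k)))) (trans (arith k) q)
      where
      arith : ∀ k → suc (suc (2 * k)) ≡ 2 * suc k
      arith = solve-∀

  -- The hypotheses on components enter only through degrees and edge numbers of Q, so they are kept
  -- abstract; one threshold must serve for all cases, since n₀ precedes the case distinction.
  allCases : Fin N → {Cycles Singles ¬Cycles ¬Singles : Set} → (Cycles → ∀ x → deg Q x ≡ 2) → (Singles → ∀ x → deg Q x ≡ 1) →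
    (¬Cycles → dsum Q + 2 ≤ 2 * N) → (¬Singles → HasBranch) →
    Σ[ n₀ ∈ ℕ ] (∀ n → n₀ ≤ n →
      (Cycles → UniqueExtremal n H (join (matchingPlusK1 (N / 2 ∸ 1)) (turan2 (n ∸ N + 1)))) ×
      (Singles → UniqueExtremal n H (join (complete (edges Q)) (turan2 (n ∸ edges Q)))) ×
      (¬Cycles → ¬Singles → UniqueExtremal n H (join (emptyG (edges Q)) (turan2 (n ∸ edges Q)))))
  allCases b deg2 deg1 tree branch = start₁ + start₂ , λ n big →
      (λ c → even-cycles (deg2 c) b (N / 2 ∸ 1) (half-size (deg2 c) b) n (≤-trans (m≤m+n start₁ start₂) big))
    , (λ s → single-edges (deg1 s) (≤-trans (s≤s z≤n) (Finₚ.toℕ<n b)) n (≤-trans (m≤n+m start₂ start₁) big))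
    , (λ c s → branching (branch s) (tree c) n (≤-trans (m≤n+m start₂ start₁) big))
    where
    start₁ start₂ : ℕ
    start₁ = N + startSize (suc (2 * (N / 2 ∸ 1))) (Size.bound N (suc (suc (2 * (N / 2 ∸ 1)))) h)
    start₂ = startSize (edges Q) (Size.bound N (edges Q) h)

unionList-size : ∀ {cs : List Comp} → cs ≢ [] → All (λ c → IsTree (proj₂ c) ⊎ IsEvenCycle (proj₂ c)) cs → 1 ≤ proj₁ (unionList cs)
unionList-size {[]} ne _ = ⊥-elim (ne refl)
unionList-size {c ∷ cs} _ (p All.∷ _) = ≤-trans (comp-size c p) (m≤m+n _ _)

theorem1p3 : (cs : List (Σ ℕ SimpleGraph)) → cs ≢ [] →
    All (λ c → IsTree (proj₂ c) ⊎ IsEvenCycle (proj₂ c)) cs →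
    (ℓ : Fin (1 + proj₁ (unionList cs)) → Fin (1 + proj₁ (unionList cs)) → ℕ) →
    ValidLengths (join (complete 1) (proj₂ (unionList cs))) ℓ →
    Σ[ n₀ ∈ ℕ ] (∀ n → n₀ ≤ n →
      (All (λ c → IsEvenCycle (proj₂ c)) cs →
        UniqueExtremal n (oddBalloon (join (complete 1) (proj₂ (unionList cs))) ℓ)
          (join (matchingPlusK1 (proj₁ (unionList cs) / 2 ∸ 1))
                (turan2 (n ∸ proj₁ (unionList cs) + 1))))
      × (All (λ c → IsSingleEdge (proj₂ c)) cs →
        UniqueExtremal n (oddBalloon (join (complete 1) (proj₂ (unionList cs))) ℓ)
          (join (complete (edges (proj₂ (unionList cs))))
                (turan2 (n ∸ edges (proj₂ (unionList cs))))))
      × (¬ All (λ c → IsEvenCycle (proj₂ c)) cs → ¬ All (λ c → IsSingleEdge (proj₂ c)) cs →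
        UniqueExtremal n (oddBalloon (join (complete 1) (proj₂ (unionList cs))) ℓ)
          (join (emptyG (edges (proj₂ (unionList cs))))
                (turan2 (n ∸ edges (proj₂ (unionList cs)))))))
theorem1p3 cs cs≢[] comps ℓ valid = Cases.allCases (proj₂ (unionList cs)) ℓ valid
  (unionList-colouring (All.map (λ {c} → comp-colouring c) comps)) (unionList-deg (1 ≤_) (All.map (λ {c} → comp-deg c) comps)) _ ≤-refl
  (fromℕ< (unionList-size cs≢[] comps))
  (λ cycles → unionList-deg (_≡ 2) (All.map (λ {c} → evenCycle-deg (proj₂ c)) cycles))
  (λ singles → unionList-deg (_≡ 1) (All.map (λ {c} → edge-deg (proj₂ c)) singles))
  (λ ¬cycles → unionList-dsum-tree (All.map (λ {c} → comp-dsum c) comps) (someTree comps ¬cycles))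
  (λ ¬singles → unionList-branch (someBranch comps ¬singles))
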